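{- Let $\mathcal{M}_1,\ldots,\mathcal{M}_k$ be graph matroid families and let $\mathcal{M}$ be their union, i.e., $\mathcal{M}(G)=\mathcal{M}_1(G)\cup\cdots\cup\mathcal{M}_k(G)$ (matroid union) for every graph $G$. If each of $\mathcal{M}_1,\ldots,\mathcal{M}_k$ has the Whitney property, then so does $\mathcal{M}$.
   Context: All graphs are finite and simple, with vertex sets taken from a fixed countably infinite set, and are assumed to have no isolated vertices. A graph matroid family $\mathcal{M}$ assigns to every graph $G$ a matroid $\mathcal{M}(G)$ on $E(G)$ such that (i) every graph isomorphism $\varphi:V(G)\to V(H)$ induces, via $uv\mapsto\varphi(u)\varphi(v)$, an isomorphism $\mathcal{M}(G)\to\mathcal{M}(H)$, and (ii) for every subgraph $H$ of $G$, $\mathcal{M}(H)$ is the restriction of $\mathcal{M}(G)$ to $E(H)$. The union of matroids $(E,\mathcal{I}_1),\ldots,(E,\mathcal{I}_k)$ on a common ground set is the matroid on $E$ whose independent sets are the sets $I_1\cup\cdots\cup I_k$ with $I_j\in\mathcal{I}_j$. A graph $G$ is $\mathcal{M}$-reconstructible if for every graph $H$ and every matroid isomorphism $\psi:E(G)\to E(H)$ between $\mathcal{M}(G)$ and $\mathcal{M}(H)$, there is a graph isomorphism $\varphi:V(G)\to V(H)$ with $\psi(uv)=\varphi(u)\varphi(v)$ for all $uv\in E(G)$. $\mathcal{M}$ has the Whitney property if there is a nonnegative integer $c$ such that every $c$-connected graph is $\mathcal{M}$-reconstructible. -}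

module Defs where

open import Data.Nat using (ℕ; suc; _<_; _≟_)
open import Data.Fin using (Fin)
open import Data.Fin.Properties using (any?)
open import Data.Fin.Subset as S using (Subset; ⊥; _⊆_; _∪_; ⁅_⁆; ∣_∣)
open import Data.Vec using (tabulate; lookup)
open import Data.List using (List; length)
import Data.List.Membership.Propositional as LM
open import Data.List.Relation.Unary.All using (All)
open import Data.List.Relation.Unary.Unique.Propositional using (Unique)
open import Data.Product using (Σ; ∃; _×_; _,_; proj₁)
open import Data.Sum using (_⊎_; inj₁; inj₂)
open import Relation.Binary.PropositionalEquality using (_≡_; refl)
open import Relation.Nullary using (Dec; ¬_)
open import Relation.Nullary.Decidable using (True; fromWitness; _⊎-dec_)
open import Function.Bundles using (_⤖_; _⇔_; Bijection)
open import Function.Definitions using (Injective)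

-- Graphs.  Vertices are natural numbers (the fixed countably infinite
-- vertex set).  An edge is an unordered pair {lo,hi} of distinct
-- vertices, stored with lo < hi.  A graph is a finite set of edges,
-- given as an injective enumeration Fin m → Edge; its edge set E(G)
-- is identified with Fin m.  Its vertex set is the set of endpoints of
-- edges (graphs have no isolated vertices).

record Edge : Set where
  constructor mkEdge
  field
    lo hi : ℕ
    lo<hi : lo < hi
open Edge public

record Graph : Set where
  field
    m        : ℕ
    edge     : Fin m → Edge
    edge-inj : Injective _≡_ _≡_ edge
open Graph public

joins : Edge → ℕ → ℕ → Set
joins e u v = (lo e ≡ u × hi e ≡ v) ⊎ (lo e ≡ v × hi e ≡ u)

Adj : Graph → ℕ → ℕ → Set
Adj G u v = ∃ λ i → joins (edge G i) u v

isVertex? : (G : Graph) (v : ℕ) → Dec (∃ λ i → v ≡ lo (edge G i) ⊎ v ≡ hi (edge G i))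
isVertex? G v = any? (λ i → (v ≟ lo (edge G i)) ⊎-dec (v ≟ hi (edge G i)))

-- v ∈ V(G)  (a proof-irrelevant predicate)
IsVertex : Graph → ℕ → Set
IsVertex G v = True (isVertex? G v)

V : Graph → Set
V G = Σ ℕ (IsVertex G)

loV : (G : Graph) → Fin (m G) → V G
loV G i = lo (edge G i) , fromWitness (i , inj₁ refl)

hiV : (G : Graph) → Fin (m G) → V G
hiV G i = hi (edge G i) , fromWitness (i , inj₂ refl)

GraphIso : Graph → Graph → Set
GraphIso G H = Σ (V G ⤖ V H) λ φ →
  ∀ (u v : V G) → Adj G (proj₁ u) (proj₁ v) ⇔
                  Adj H (proj₁ (Bijection.to φ u)) (proj₁ (Bijection.to φ v))

Induced : (G H : Graph) → GraphIso G H → (Fin (m G) → Fin (m H)) → Set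
Induced G H (φ , _) ψ = ∀ i →
  joins (edge H (ψ i)) (proj₁ (Bijection.to φ (loV G i)))
                       (proj₁ (Bijection.to φ (hiV G i)))

SubgraphEmb : (H G : Graph) → (Fin (m H) → Fin (m G)) → Set
SubgraphEmb H G ι = ∀ i → edge G (ι i) ≡ edge H i

IndepSystem : ℕ → Set₁
IndepSystem n = Subset n → Set

record IsMatroid {n : ℕ} (I : IndepSystem n) : Set where
  field
    indep-∅   : I ⊥
    indep-⊆   : ∀ X Y → X ⊆ Y → I Y → I X
    indep-aug : ∀ X Y → I X → I Y → ∣ X ∣ < ∣ Y ∣ →
                ∃ λ e → e S.∈ Y × e S.∉ X × I (X ∪ ⁅ e ⁆)

preimage : ∀ {n n'} → (Fin n → Fin n') → Subset n' → Subset n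
preimage ψ Y = tabulate (λ i → lookup Y (ψ i))

-- the bijection ψ : Fin n → Fin n' is a matroid isomorphism I → J:
-- X is I-independent iff ψ(X) is J-independent
-- (equivalently, for every Y, Y is J-independent iff ψ⁻¹(Y) is I-independent)
IsMatroidIso : ∀ {n n'} → IndepSystem n → IndepSystem n' → (Fin n → Fin n') → Set
IsMatroidIso I J ψ = ∀ Y → J Y ⇔ I (preimage ψ Y)

GraphIndep : Set₁
GraphIndep = (G : Graph) → IndepSystem (m G)

record GraphMatroidFamily : Set₁ where
  field
    Ind      : GraphIndep
    matroid  : ∀ G → IsMatroid (Ind G)
    iso-inv  : ∀ G H (φ : GraphIso G H) (ψ : Fin (m G) → Fin (m H)) →
               Induced G H φ ψ → IsMatroidIso (Ind G) (Ind H) ψ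
    restrict : ∀ H G (ι : Fin (m H) → Fin (m G)) → SubgraphEmb H G ι →
               ∀ (X : Subset (m H)) (Y : Subset (m G)) →
               (∀ j → j S.∈ Y ⇔ (∃ λ i → i S.∈ X × ι i ≡ j)) →
               Ind H X ⇔ Ind G Y
open GraphMatroidFamily public

UnionInd : ∀ {k} → (Fin k → GraphMatroidFamily) → GraphIndep
UnionInd {k} 𝓜 G X = Σ (Fin k → Subset (m G)) λ I →
  (∀ j → Ind (𝓜 j) G (I j)) × (∀ e → e S.∈ X ⇔ (∃ λ j → e S.∈ I j))

data Reach (G : Graph) (X : List ℕ) (u : ℕ) : ℕ → Set where
  here : Reach G X u u
  step : ∀ {w v} → Reach G X u w → Adj G w v → ¬ (v LM.∈ X) → Reach G X u v

ConnectedMinus : Graph → List ℕ → Set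
ConnectedMinus G X = ∀ u v → IsVertex G u → IsVertex G v →
  ¬ (u LM.∈ X) → ¬ (v LM.∈ X) → Reach G X u v

IsConnected : ℕ → Graph → Set
IsConnected c G =
  (∃ λ (L : List ℕ) → Unique L × length L ≡ suc c × All (IsVertex G) L) ×
  (∀ (X : List ℕ) → length X < c → ConnectedMinus G X)

Reconstructible : GraphIndep → Graph → Set
Reconstructible Ind G = ∀ (H : Graph) (ψ : Fin (m G) ⤖ Fin (m H)) →
  IsMatroidIso (Ind G) (Ind H) (Bijection.to ψ) →
  Σ (GraphIso G H) λ φ → Induced G H φ (Bijection.to ψ)

WhitneyProperty : GraphIndep → Set
WhitneyProperty Ind = ∃ λ (c : ℕ) → ∀ G → IsConnected c G → Reconstructible Ind G

{-# OPTIONS --safe #-}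
module Submission where

-- Whether a bijection of edges maps stars to stars is decidable, and if it does, it is induced by a graph isomorphism.  So only the
-- connectivity constant has to be found constructively; everything else may be argued classically.
--
-- The Whitney property with constant c implies that K_{A,B} with |A|, |B| ≥ c spans the edges inside A: otherwise two such edges
-- would be coloops of K_{A,B} that can be exchanged.  Distributing the edges of a larger K_{A,B}, the union has the same property.
--
-- If pendant edges are coloops in some M_j, the ranks of complete graphs in the union grow at every step.  Every graph is then
-- covered by few vertex sets and few loose edges, both controlled by its rank, and for a highly connected graph one vertex set is
-- all there is.  Hence M(G) ≅ M(H) implies |V(H)| ≤ |V(G)|, and the same argument for all G - v recognises the stars.
--
-- Otherwise all ranks are bounded.  Some c-connected graph Γ has degrees at most 4c and large girth (iterated ℤ₂-covers of K_{4c,4c},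
-- and Mader's theorem).  By the Whitney property M_j(Γ) is not uniform, so a small forest is dependent; the vertices whose stars it
-- spans are fewer than c and their stars have small rank.  It follows that stars in M_j are uniform flats of bounded rank ρ_j and
-- that matchings of size ρ_j + 1 are independent, so the stars of G are the large sets of rank ρ_1 + ⋯ + ρ_k in the union.

open import Data.Bool.Base using (Bool; true; false; not)
open import Data.Bool.Properties using (not-involutive; not-¬) renaming (_≟_ to _≟B_)
open import Data.Empty using (⊥; ⊥-elim)
open import Data.Fin.Base using (Fin; toℕ; fromℕ<; cast; splitAt; _↑ˡ_; _↑ʳ_) renaming (zero to fzero; suc to fsuc)
open import Data.Fin.Properties using (toℕ-injective; toℕ-fromℕ<; splitAt-↑ˡ; splitAt-↑ʳ; all?) renaming (_≟_ to _≟F_; any? to anyF?; suc-injective to fsuc-injective)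
open import Data.Fin.Subset as S using (Subset)
open import Data.Fin.Subset.Properties using (⊆⊤; ∈⊤; x∈p∪q⁻; x∈p∪q⁺; x∈⁅x⁆; x∈⁅y⁆⇒x≡y)
open import Data.List.Base using (List; []; _∷_; _++_; map; length; filter; lookup; cartesianProduct; take; drop; allFin; upTo; deduplicate)
open import Data.List.Membership.Propositional using (_∈_; _∉_; lose; find)
open import Data.List.Membership.Propositional.Properties using (∈-map⁺; ∈-map⁻; ∈-++⁺ˡ; ∈-++⁺ʳ; ∈-++⁻; ∈-cartesianProduct⁺; ∈-cartesianProduct⁻; ∈-filter⁺; ∈-filter⁻; ∈-lookup; ∈-allFin; ∈-deduplicate⁺; ∈-deduplicate⁻; ∈-upTo⁺)
open import Data.List.Properties using (length-map; length-++; map-∘; length-take; map-id; length-tabulate; take++drop≡id; length-drop; map-tabulate; tabulate-lookup; length-upTo)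
open import Data.List.Relation.Binary.Subset.Propositional using (_⊆_)
open import Data.List.Relation.Unary.All using (All; []; _∷_) renaming (all? to allL?; lookup to lookupAll; tabulate to tabulateAll)
open import Data.List.Relation.Unary.AllPairs using ([]; _∷_)
open import Data.List.Relation.Unary.Any as Any using (Any; here; there) renaming (any? to anyL?)
open import Data.List.Relation.Unary.Any.Properties using (lookup-index)
import Data.List.Relation.Unary.Unique.DecPropositional as UniqueDec
import Data.List.Relation.Unary.Unique.DecPropositional.Properties as UniqueD
open import Data.List.Relation.Unary.Unique.Propositional using (Unique)
import Data.List.Relation.Unary.Unique.Propositional.Properties as Uniqueₚ
open import Data.Maybe.Base using (Maybe; just; nothing)
open import Data.Nat.Base using (ℕ; zero; suc; _+_; _*_; _∸_; _≤_; _<_; z≤n; s≤s; _⊓_; pred; NonZero; >-nonZero)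
open import Data.Nat.Properties hiding (_≟_; ≡-irrelevant)
open import Data.Nat.Properties using () renaming (_≟_ to _≟ℕ_)
open import Data.Nat.Tactic.RingSolver using (solve-∀)
open import Data.Product.Base using (Σ; ∃; _×_; _,_; proj₁; proj₂)
open import Data.Product.Properties using () renaming (≡-dec to ×-≟)
open import Data.Sum.Base using (_⊎_; inj₁; inj₂; [_,_]′)
open import Data.Sum.Properties using (inj₁-injective; inj₂-injective) renaming (≡-dec to ⊎-≟)
open import Data.Unit.Base using (tt)
open import Data.Vec.Base as Vec using (Vec; []; _∷_; here; there; updateAt)
open import Data.Vec.Properties using (lookup∘tabulate; []=⇒lookup; lookup⇒[]=; lookup∘updateAt; lookup∘updateAt′; updateAt-updateAt-local; updateAt-id-local; ∷-injectiveʳ) renaming (≡-dec to vec-≟)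
open import Function.Base using (_∘_; id; case_of_)
open import Function.Bundles using (_⇔_; mk⇔; Equivalence; mk⤖; _⤖_; Bijection)
open import Function.Construct.Identity using (⤖-id)
open import Relation.Binary.Definitions using (DecidableEquality; tri<; tri≈; tri>)
open import Relation.Binary.PropositionalEquality using (_≡_; _≢_; refl; sym; trans; cong; cong₂; subst; subst₂; module ≡-Reasoning)
open import Relation.Nullary using (¬_; Dec; yes; no; does)
open import Relation.Nullary.Decidable using (_×-dec_; _⊎-dec_; _→-dec_; ¬?; map′; decidable-stable; toWitness; fromWitness)
open Equivalence using (to; from)

-- The constant has to be fixed before it is known which of the two cases applies, and the
-- distinction is not decidable; so the constants of both cases are added.
--
-- When ranks grow, the increments `d n` for complete graphs lie between 1 and `D` for `n ≥ 1` and
-- do not increase from `D` on; nothing else is known about them. The key is a surplus: in a flat, a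
-- vertex with enough neighbours, two of them non-adjacent, gains strictly more than the increment
-- of the complete graphs at an order larger by `q` (`ext`). Hence a flat of large minimum degree
-- can fall short in rank only because of simplicial vertices, and their neighbourhoods are cliques;
-- these give the vertex sets of the cover.
--
-- When ranks are bounded, only the star rank, not the rank `R` of large complete graphs, gets a
-- bound in terms of `c`. The girth is therefore chosen after a bound on `R`, so that sets of at
-- most `R` edges are forests, while the star rank is bounded by the number of spanned stars times
-- the maximum degree. So the final constant depends only on the number of families and on their
-- Whitney constants.

private variable
  𝒜 ℬ : Set

-- 𝒜 Farkas certificate: a linear inequality follows from another one by an identity.
lin : ∀ {x y a b} s → x ≤ y → a + y + s ≡ b + x → a ≤ b
lin {x} {y} {a} {b} s x≤y eq = +-cancelʳ-≤ y a b
  (≤-trans (m≤m+n (a + y) s) (≤-trans (≤-reflexive eq) (+-monoʳ-≤ b x≤y)))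

-- Classical reasoning behind double negation.

dne-→ : ¬ ¬ 𝒜 → (𝒜 → ¬ ℬ) → ¬ ℬ
dne-→ k f b = k (λ a → f a b)

lem : (P : Set) → ¬ ¬ Dec P
lem P k = k (no (λ p → k (yes p)))

dns-All : {P : 𝒜 → Set} → (∀ x → ¬ ¬ P x) → ∀ xs → ¬ ¬ All P xs
dns-All f []       k = k []
dns-All f (x ∷ xs) k = f x λ p → dns-All f xs λ ps → k (p ∷ ps)

dns-Fin : ∀ {n} {P : Fin n → Set} → (∀ i → ¬ ¬ P i) → ¬ ¬ (∀ i → P i)
dns-Fin {zero}  f k = k λ ()
dns-Fin {suc n} f k = f fzero λ p → dns-Fin (f ∘ fsuc) λ q →
  k λ { fzero → p ; (fsuc i) → q i }

-- Finite sums and counting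

∑ : List 𝒜 → (𝒜 → ℕ) → ℕ
∑ []       f = 0
∑ (x ∷ xs) f = f x + ∑ xs f

ind : {P : Set} → Dec P → ℕ
ind (yes _) = 1
ind (no _)  = 0

# : {P : 𝒜 → Set} → (∀ x → Dec (P x)) → List 𝒜 → ℕ
# P? xs = ∑ xs (λ x → ind (P? x))

ind≤1 : {P : Set} (d : Dec P) → ind d ≤ 1
ind≤1 (yes _) = ≤-refl
ind≤1 (no _)  = z≤n

ind-yes : {P : Set} (d : Dec P) → P → ind d ≡ 1
ind-yes (yes _) _ = refl
ind-yes (no ¬p) p = ⊥-elim (¬p p)

ind-no : {P : Set} (d : Dec P) → ¬ P → ind d ≡ 0
ind-no (yes p) ¬p = ⊥-elim (¬p p)
ind-no (no _)  _  = refl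

ind-mono : {P Q : Set} (d : Dec P) (e : Dec Q) → (P → Q) → ind d ≤ ind e
ind-mono (yes p) e f = ≤-reflexive (sym (ind-yes e (f p)))
ind-mono (no _)  e f = z≤n

∑-mono : ∀ (xs : List 𝒜) {f g : 𝒜 → ℕ} → (∀ x → x ∈ xs → f x ≤ g x) → ∑ xs f ≤ ∑ xs g
∑-mono []       h = z≤n
∑-mono (x ∷ xs) h = +-mono-≤ (h x (here refl)) (∑-mono xs (λ y y∈ → h y (there y∈)))

∑-cong : ∀ (xs : List 𝒜) {f g : 𝒜 → ℕ} → (∀ x → x ∈ xs → f x ≡ g x) → ∑ xs f ≡ ∑ xs g
∑-cong []       h = refl
∑-cong (x ∷ xs) h = cong₂ _+_ (h x (here refl)) (∑-cong xs (λ y y∈ → h y (there y∈)))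

interchange : ∀ a b c d → (a + b) + (c + d) ≡ (a + c) + (b + d)
interchange = solve-∀

∑-+ : ∀ (xs : List 𝒜) (f g : 𝒜 → ℕ) → ∑ xs (λ x → f x + g x) ≡ ∑ xs f + ∑ xs g
∑-+ []       f g = refl
∑-+ (x ∷ xs) f g = trans (cong (f x + g x +_) (∑-+ xs f g)) (interchange (f x) (g x) (∑ xs f) (∑ xs g))

∑-zero : ∀ (xs : List 𝒜) → ∑ xs (λ _ → 0) ≡ 0
∑-zero []       = refl
∑-zero (x ∷ xs) = ∑-zero xs

∑-const : ∀ (xs : List 𝒜) n → ∑ xs (λ _ → n) ≡ length xs * n
∑-const []       n = refl
∑-const (x ∷ xs) n = cong (n +_) (∑-const xs n)

∑-* : ∀ (xs : List 𝒜) n (f : 𝒜 → ℕ) → ∑ xs (λ x → n * f x) ≡ n * ∑ xs f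
∑-* []       n f = sym (*-zeroʳ n)
∑-* (x ∷ xs) n f = trans (cong (n * f x +_) (∑-* xs n f)) (sym (*-distribˡ-+ n (f x) (∑ xs f)))

∑-swap : ∀ (xs : List 𝒜) (ys : List ℬ) (f : 𝒜 → ℬ → ℕ) →
         ∑ xs (λ x → ∑ ys (f x)) ≡ ∑ ys (λ y → ∑ xs (λ x → f x y))
∑-swap []       ys f = sym (∑-zero ys)
∑-swap (x ∷ xs) ys f = trans (cong (∑ ys (f x) +_) (∑-swap xs ys f))
  (sym (∑-+ ys (f x) (λ y → ∑ xs (λ x → f x y))))

∑-++ : ∀ (xs ys : List 𝒜) (f : 𝒜 → ℕ) → ∑ (xs ++ ys) f ≡ ∑ xs f + ∑ ys f
∑-++ []       ys f = refl
∑-++ (x ∷ xs) ys f = trans (cong (f x +_) (∑-++ xs ys f)) (sym (+-assoc (f x) _ _))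

∑-∈ : ∀ {x} {xs : List 𝒜} (f : 𝒜 → ℕ) → x ∈ xs → f x ≤ ∑ xs f
∑-∈ f (here refl) = m≤m+n _ _
∑-∈ f (there x∈)  = ≤-trans (∑-∈ f x∈) (m≤n+m _ _)

length-filter≡# : ∀ {P : 𝒜 → Set} (P? : ∀ x → Dec (P x)) xs → length (filter P? xs) ≡ # P? xs
length-filter≡# P? [] = refl
length-filter≡# P? (x ∷ xs) with P? x
... | yes _ = cong suc (length-filter≡# P? xs)
... | no _  = length-filter≡# P? xs

#-mono : ∀ {P Q : 𝒜 → Set} (P? : ∀ x → Dec (P x)) (Q? : ∀ x → Dec (Q x)) xs →
         (∀ x → x ∈ xs → P x → Q x) → # P? xs ≤ # Q? xs
#-mono P? Q? xs h = ∑-mono xs (λ x x∈ → ind-mono (P? x) (Q? x) (h x x∈))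

#≤length : ∀ {P : 𝒜 → Set} (P? : ∀ x → Dec (P x)) xs → # P? xs ≤ length xs
#≤length P? []       = z≤n
#≤length P? (x ∷ xs) = +-mono-≤ (ind≤1 (P? x)) (#≤length P? xs)

ind-¬ : {P : Set} (d : Dec P) → ind d + ind (¬? d) ≡ 1
ind-¬ (yes _) = refl
ind-¬ (no _)  = refl

#-¬ : ∀ {P : 𝒜 → Set} (P? : ∀ x → Dec (P x)) xs → # P? xs + # (λ x → ¬? (P? x)) xs ≡ length xs
#-¬ P? []       = refl
#-¬ P? (x ∷ xs) = trans (interchange (ind (P? x)) _ _ _) (cong₂ _+_ (ind-¬ (P? x)) (#-¬ P? xs))

#-pos : ∀ {P : 𝒜 → Set} (P? : ∀ x → Dec (P x)) xs → 1 ≤ # P? xs → ∃ λ x → x ∈ xs × P x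
#-pos P? (x ∷ xs) h with P? x
... | yes p = x , here refl , p
... | no _  with #-pos P? xs h
...   | y , y∈ , p = y , there y∈ , p

#-∈ : ∀ {P : 𝒜 → Set} (P? : ∀ x → Dec (P x)) {x} {xs : List 𝒜} → x ∈ xs → P x → 1 ≤ # P? xs
#-∈ P? {x} {xs} x∈ p = ≤-trans (≤-reflexive (sym (ind-yes (P? x) p))) (∑-∈ (λ x → ind (P? x)) x∈)

ind-⊎ : {P Q : Set} (d : Dec P) (e : Dec Q) → ind (d ⊎-dec e) ≤ ind d + ind e
ind-⊎ (yes _) e       = s≤s z≤n
ind-⊎ (no _)  (yes _) = s≤s z≤n
ind-⊎ (no _)  (no _)  = z≤n

#-⊎ : ∀ {P Q : 𝒜 → Set} (P? : ∀ x → Dec (P x)) (Q? : ∀ x → Dec (Q x)) xs →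
      # (λ x → P? x ⊎-dec Q? x) xs ≤ # P? xs + # Q? xs
#-⊎ P? Q? xs = ≤-trans (∑-mono xs (λ x _ → ind-⊎ (P? x) (Q? x))) (≤-reflexive (∑-+ xs _ _))

∑-avg : ∀ (xs : List 𝒜) (f g : 𝒜 → ℕ) → ∑ xs f ≤ ∑ xs g → 1 ≤ length xs → ∃ λ x → x ∈ xs × f x ≤ g x
∑-avg (x ∷ xs) f g h _ with f x ≤? g x
... | yes p = x , here refl , p
... | no ¬p with xs
...   | []     = ⊥-elim (¬p (+-cancelʳ-≤ 0 (f x) (g x) h))
...   | y ∷ ys with ∑-avg (y ∷ ys) f g (≮⇒≥ λ lt → <⇒≱ (+-mono-< (≰⇒> ¬p) lt) h) (s≤s z≤n)
...     | z , z∈ , q = z , there z∈ , q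

-- Lists as finite sets

filter-∈ : ∀ {P : 𝒜 → Set} (P? : ∀ x → Dec (P x)) xs {x} → x ∈ filter P? xs → x ∈ xs × P x
filter-∈ P? xs p = ∈-filter⁻ P? {xs = xs} p

∉⇒All≢ : ∀ {x : 𝒜} {xs} → x ∉ xs → All (x ≢_) xs
∉⇒All≢ {xs = []}     h = []
∉⇒All≢ {xs = y ∷ ys} h = (λ e → h (here e)) ∷ ∉⇒All≢ (h ∘ there)

All≢⇒∉ : ∀ {x : 𝒜} {xs} → All (x ≢_) xs → x ∉ xs
All≢⇒∉ (p ∷ ps) (here e)  = p e
All≢⇒∉ (p ∷ ps) (there q) = All≢⇒∉ ps q

unique-∷ : ∀ {x : 𝒜} {xs} → x ∉ xs → Unique xs → Unique (x ∷ xs)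
unique-∷ h u = ∉⇒All≢ h ∷ u

unique-head : ∀ {x : 𝒜} {xs} → Unique (x ∷ xs) → x ∉ xs
unique-head (p ∷ _) = All≢⇒∉ p

unique-tail : ∀ {x : 𝒜} {xs} → Unique (x ∷ xs) → Unique xs
unique-tail (_ ∷ u) = u

unique-++ : ∀ {xs ys : List 𝒜} → Unique xs → Unique ys → (∀ {x} → x ∈ xs → x ∉ ys) → Unique (xs ++ ys)
unique-++ {xs = []}     u v d = v
unique-++ {xs = x ∷ xs} u v d = unique-∷ h (unique-++ (unique-tail u) v (d ∘ there))
  where h : x ∉ xs ++ _
        h q with ∈-++⁻ xs q
        ... | inj₁ r = unique-head u r
        ... | inj₂ r = d (here refl) r

unique-++⁻ : ∀ (xs : List 𝒜) {ys} → Unique (xs ++ ys) → Unique xs × Unique ys × (∀ {x} → x ∈ xs → x ∉ ys)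
unique-++⁻ []       u = [] , u , λ ()
unique-++⁻ (x ∷ xs) u with unique-++⁻ xs (unique-tail u)
... | a , b , c = unique-∷ (λ q → unique-head u (∈-++⁺ˡ q)) a , b ,
  λ { (here refl) q → unique-head u (∈-++⁺ʳ xs q) ; (there p) q → c p q }

unique-filter : ∀ {P : 𝒜 → Set} (P? : ∀ x → Dec (P x)) {xs} → Unique xs → Unique (filter P? xs)
unique-filter P? u = Uniqueₚ.filter⁺ P? u

unique-lookup : ∀ {xs : List 𝒜} → Unique xs → ∀ {i j} → lookup xs i ≡ lookup xs j → i ≡ j
unique-lookup {xs = x ∷ xs} u {fzero}  {fzero}  e = refl
unique-lookup {xs = x ∷ xs} u {fzero}  {fsuc j} e = ⊥-elim (unique-head u (subst (_∈ xs) (sym e) (∈-lookup j)))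
unique-lookup {xs = x ∷ xs} u {fsuc i} {fzero}  e = ⊥-elim (unique-head u (subst (_∈ xs) e (∈-lookup i)))
unique-lookup {xs = x ∷ xs} u {fsuc i} {fsuc j} e = cong fsuc (unique-lookup (unique-tail u) e)

split-∈ : ∀ {x : 𝒜} {ys} → x ∈ ys → ∃ λ zs → length ys ≡ suc (length zs) × (∀ {y} → y ∈ ys → y ≢ x → y ∈ zs) × zs ⊆ ys
split-∈ {ys = y ∷ ys} (here refl) = ys , refl , (λ { (here e) n → ⊥-elim (n e) ; (there p) _ → p }) , there
split-∈ {ys = y ∷ ys} (there p) with split-∈ p
... | zs , e , f , g = y ∷ zs , cong suc e , (λ { (here e) _ → here e ; (there q) n → there (f q n) }) ,
  λ { (here e) → here e ; (there q) → there (g q) }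

unique-⊆-length : ∀ {xs ys : List 𝒜} → Unique xs → xs ⊆ ys → length xs ≤ length ys
unique-⊆-length {xs = []}     u s = z≤n
unique-⊆-length {xs = x ∷ xs} u s with split-∈ (s (here refl))
... | zs , e , f , _ = subst (suc (length xs) ≤_) (sym e)
  (s≤s (unique-⊆-length (unique-tail u) (λ {y} q → f (s (there q)) (λ e → unique-head u (subst (_∈ xs) e q)))))

unique-⊆-equal : ∀ {xs ys : List 𝒜} → Unique xs → xs ⊆ ys → length ys ≤ length xs → (_≟_ : DecidableEquality 𝒜) → ys ⊆ xs
unique-⊆-equal {xs = xs} {ys} u s le _≟_ {y} y∈ with anyL? (y ≟_) xs
... | yes p = p
... | no ¬p = ⊥-elim (1+n≰n (≤-trans (unique-⊆-length (unique-∷ ¬p u) λ { (here refl) → y∈ ; (there q) → s q }) le))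

unique-map : ∀ {f : 𝒜 → ℬ} {xs} → (∀ {x y} → x ∈ xs → y ∈ xs → f x ≡ f y → x ≡ y) → Unique xs → Unique (map f xs)
unique-map {f = f} {xs = []}     inj u = []
unique-map {f = f} {xs = x ∷ xs} inj u = unique-∷ h (unique-map (λ p q → inj (there p) (there q)) (unique-tail u))
  where h : f x ∉ map f xs
        h p with ∈-map⁻ f p
        ... | y , y∈ , e = unique-head u (subst (_∈ xs) (sym (inj (here refl) (there y∈) e)) y∈)

take-⊆ : ∀ n (xs : List 𝒜) → take n xs ⊆ xs
take-⊆ (suc n) (x ∷ xs) (here e)  = here e
take-⊆ (suc n) (x ∷ xs) (there p) = there (take-⊆ n xs p)

unique-take : ∀ n {xs : List 𝒜} → Unique xs → Unique (take n xs)
unique-take zero    u = []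
unique-take (suc n) {xs = []} u = []
unique-take (suc n) {xs = x ∷ xs} u = unique-∷ (unique-head u ∘ take-⊆ n xs) (unique-take n (unique-tail u))

length-take≤ : ∀ n {xs : List 𝒜} → n ≤ length xs → length (take n xs) ≡ n
length-take≤ n {xs = xs} h = trans (length-take n xs) (m≤n⇒m⊓n≡m h)

nonempty : ∀ {xs : List 𝒜} → 1 ≤ length xs → ∃ (_∈ xs)
nonempty {xs = x ∷ _} _ = x , here refl

module DecList {A : Set} (_≟_ : DecidableEquality A) where

  _∈?_ : ∀ x (xs : List A) → Dec (x ∈ xs)
  x ∈? xs = anyL? (x ≟_) xs

  #∈≤length : ∀ {xs : List A} → Unique xs → ∀ ys → # (_∈? ys) xs ≤ length ys
  #∈≤length {xs} u ys = subst (_≤ length ys) (length-filter≡# (_∈? ys) xs)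
    (unique-⊆-length (unique-filter (_∈? ys) u) (λ p → proj₂ (filter-∈ (_∈? ys) xs p)))

  length≤#∈ : ∀ {xs ys : List A} → Unique ys → ys ⊆ xs → length ys ≤ # (_∈? ys) xs
  length≤#∈ {xs} {ys} u s = subst (length ys ≤_) (length-filter≡# (_∈? ys) xs)
    (unique-⊆-length u (λ p → ∈-filter⁺ (_∈? ys) (s p) p))

  #≡≤1 : ∀ {xs : List A} → Unique xs → ∀ x → # (λ y → y ≟ x) xs ≤ 1
  #≡≤1 {xs} u x = ≤-trans (#-mono (_≟ x) (_∈? (x ∷ [])) xs (λ y _ e → here e)) (#∈≤length u (x ∷ []))

  infixl 6 _⊖_
  _⊖_ : List A → A → List A
  xs ⊖ x = filter (λ y → ¬? (y ≟ x)) xs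

  ∈-⊖⁺ : ∀ {x y xs} → y ∈ xs → y ≢ x → y ∈ xs ⊖ x
  ∈-⊖⁺ {x} p n = ∈-filter⁺ (λ y → ¬? (y ≟ x)) p n

  ∈-⊖⁻ : ∀ {x y} xs → y ∈ xs ⊖ x → y ∈ xs × y ≢ x
  ∈-⊖⁻ {x} xs p = filter-∈ (λ y → ¬? (y ≟ x)) xs p

  length-⊖ : ∀ {x xs} → Unique xs → x ∈ xs → length xs ≡ suc (length (xs ⊖ x))
  length-⊖ {x} {xs} u p = ≤-antisym
    (unique-⊆-length {xs = xs} {x ∷ xs ⊖ x} u λ {y} q → case y ≟ x of λ { (yes e) → here e ; (no n) → there (∈-⊖⁺ q n) })
    (unique-⊆-length {xs = x ∷ xs ⊖ x} (unique-∷ (λ q → proj₂ (∈-⊖⁻ xs q) refl) (unique-filter _ u))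
      λ { (here refl) → p ; (there q) → proj₁ (∈-⊖⁻ xs q) })

-- Matroids, by their independent duplicate-free lists

record ListMatroid (E : Set) : Set₁ where
  field
    I        : List E → Set
    I-[]     : I []
    I-unique : ∀ {X} → I X → Unique X
    I-⊆      : ∀ {X Y} → Unique X → X ⊆ Y → I Y → I X
    I-aug    : ∀ {X Y} → I X → I Y → length X < length Y → ∃ λ e → e ∈ Y × I (e ∷ X)

∑-lt : ∀ {A : Set} (xs : List A) (f g : A → ℕ) → ∑ xs f < ∑ xs g → ∃ λ x → x ∈ xs × f x < g x
∑-lt (x ∷ xs) f g h with f x <? g x
... | yes p = x , here refl , p
... | no ¬p with ∑-lt xs f g (≰⇒> λ le → <⇒≱ h (+-mono-≤ (≮⇒≥ ¬p) le))
...   | y , y∈ , q = y , there y∈ , q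

#-strict : ∀ {A : Set} {P Q : A → Set} (P? : ∀ x → Dec (P x)) (Q? : ∀ x → Dec (Q x)) xs {e} →
           (∀ x → x ∈ xs → P x → Q x) → e ∈ xs → Q e → ¬ P e → # P? xs < # Q? xs
#-strict P? Q? (x ∷ xs) h (here refl) q ¬p =
  subst₂ (λ a b → a + _ < b + _) (sym (ind-no (P? x) ¬p)) (sym (ind-yes (Q? x) q))
    (s≤s (#-mono P? Q? xs (λ y y∈ → h y (there y∈))))
#-strict P? Q? (x ∷ xs) h (there e∈) q ¬p =
  +-mono-≤-< (ind-mono (P? x) (Q? x) (h x (here refl))) (#-strict P? Q? xs (λ y y∈ → h y (there y∈)) e∈ q ¬p)

module MatroidRank {E : Set} (L : ListMatroid E) (I? : ∀ X → Dec (ListMatroid.I L X)) where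
  open ListMatroid L

  -- Greedy, from the last element to the first. By `basis-max` the result is maximal inside `X`,
  -- and augmentation then makes it a longest independent list there.
  basis : List E → List E
  basis []      = []
  basis (e ∷ X) with I? (e ∷ basis X)
  ... | yes _ = e ∷ basis X
  ... | no _  = basis X

  rank : List E → ℕ
  rank X = length (basis X)

  basis-I : ∀ X → I (basis X)
  basis-I []      = I-[]
  basis-I (e ∷ X) with I? (e ∷ basis X)
  ... | yes p = p
  ... | no _  = basis-I X

  basis-⊆ : ∀ X → basis X ⊆ X
  basis-⊆ (e ∷ X) p with I? (e ∷ basis X)
  basis-⊆ (e ∷ X) (here q)  | yes _ = here q
  basis-⊆ (e ∷ X) (there q) | yes _ = there (basis-⊆ X q)
  basis-⊆ (e ∷ X) p         | no _  = there (basis-⊆ X p)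

  basis-max : ∀ X {f} → f ∈ X → ¬ I (f ∷ basis X)
  basis-max (e ∷ X) p i with I? (e ∷ basis X)
  basis-max (e ∷ X) (here refl) i | yes _ = unique-head (I-unique i) (here refl)
  basis-max (e ∷ X) (there p) i   | yes _ = basis-max X p (I-⊆
    (unique-∷ (λ q → unique-head (I-unique i) (there q)) (unique-tail (unique-tail (I-unique i))))
    (λ { (here q) → here q ; (there q) → there (there q) }) i)
  basis-max (e ∷ X) (here refl) i | no ¬p = ¬p i
  basis-max (e ∷ X) (there p) i   | no _  = basis-max X p i

  rank-max : ∀ {X B} → I B → B ⊆ X → length B ≤ rank X
  rank-max {X} {B} i s = ≮⇒≥ λ lt → case I-aug (basis-I X) i lt of λ { (e , e∈ , j) → basis-max X (s e∈) j }

  rank≤length : ∀ X → rank X ≤ length X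
  rank≤length X = unique-⊆-length (I-unique (basis-I X)) (basis-⊆ X)

  rank-full : ∀ X → length X ≤ rank X → I X
  rank-full X le = subst I (eq X le) (basis-I X)
    where eq : ∀ X → length X ≤ rank X → basis X ≡ X
          eq []      _  = refl
          eq (e ∷ X) le with I? (e ∷ basis X)
          ... | yes _ = cong (e ∷_) (eq X (≤-pred le))
          ... | no _  = ⊥-elim (1+n≰n (≤-trans le (rank≤length X)))

  rank-indep : ∀ {X} → I X → rank X ≡ length X
  rank-indep {X} i = ≤-antisym (rank≤length X) (rank-max i id)

  -- The number `n` is fuel: every augmentation from `basis X` makes `B` longer by one, until its
  -- length reaches the rank.
  extend : ∀ n {B X} → I B → B ⊆ X → rank X ≤ n + length B →
           ∃ λ B′ → I B′ × B ⊆ B′ × B′ ⊆ X × rank X ≤ length B′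
  extend zero i s le = _ , i , id , s , le
  extend (suc n) {B} {X} i s le with length B <? rank X
  ... | no ¬lt = _ , i , id , s , ≮⇒≥ ¬lt
  ... | yes lt with I-aug i (basis-I X) lt
  ...   | e , e∈ , j with extend n {e ∷ B} {X} j
                          (λ { (here refl) → basis-⊆ X e∈ ; (there q) → s q })
                          (≤-trans le (≤-reflexive (sym (+-suc n (length B)))))
  ...     | B′ , k , a , b , c = B′ , k , (a ∘ there) , b , c

  rank-step : ∀ e X → rank (e ∷ X) ≤ suc (rank X)
  rank-step e X with I? (e ∷ basis X)
  ... | yes _ = ≤-refl
  ... | no _  = n≤1+n _

  rank-mono : ∀ {X Y} → X ⊆ Y → rank X ≤ rank Y
  rank-mono {X} s = rank-max (basis-I X) (s ∘ basis-⊆ X)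

  -- Submodularity as diminishing returns. Extend `basis X` to a basis `B` of `Y`. If `e` raises the
  -- rank of `Y`, then augmenting `B` from a basis of `e ∷ Y` can only add `e` itself, so `e` is
  -- also independent of `basis X`.
  rank-dim : ∀ {X Y} e → X ⊆ Y → rank (e ∷ Y) + rank X ≤ rank (e ∷ X) + rank Y
  rank-dim {X} {Y} e s with rank (e ∷ Y) ≤? rank Y
  ... | yes le = ≤-trans (+-mono-≤ le (rank-mono {X} {e ∷ X} there)) (≤-reflexive (+-comm (rank Y) _))
  ... | no ¬le with extend (rank Y) (basis-I X) (s ∘ basis-⊆ X) (m≤m+n _ _)
  ...   | B , i , a , b , c with I-aug i (basis-I (e ∷ Y))
                                   (≤-<-trans (rank-max i b) (≰⇒> ¬le))
  ...     | f , f∈ , j with basis-⊆ (e ∷ Y) f∈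
  ...       | there f∈Y = ⊥-elim (1+n≰n (≤-trans (rank-max j (λ { (here refl) → f∈Y ; (there q) → b q })) c))
  ...       | here refl = ≤-trans (+-monoˡ-≤ (rank X) (rank-step e Y))
              (≤-trans (≤-reflexive (cong suc (+-comm (rank Y) (rank X)))) (+-monoˡ-≤ (rank Y)
                (rank-max {e ∷ X} {e ∷ basis X}
                  (I-⊆ (unique-∷ (λ q → unique-head (I-unique j) (a q)) (I-unique (basis-I X)))
                       (λ { (here q) → here q ; (there q) → there (a q) }) j)
                  (λ { (here q) → here q ; (there q) → there (basis-⊆ X q) }))))

  -- By `rank-dim` the unit gained by `e` over `X` is also gained over the subset `B`.
  coloop : ∀ {X B} e → ¬ (rank (e ∷ X) ≤ rank X) → I B → B ⊆ X → I (e ∷ B)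
  coloop {X} {B} e h i s = rank-full (e ∷ B) (+-cancelʳ-≤ (rank X) _ _
    (≤-trans (≤-trans (≤-reflexive (trans (cong (λ z → suc (z + rank X)) (sym (rank-indep i))) (cong suc (+-comm (rank B) (rank X)))))
      (+-monoˡ-≤ (rank B) (≰⇒> h))) (rank-dim e s)))

module Union {E : Set} (_≟_ : DecidableEquality E) {k : ℕ} (L : Fin (suc k) → ListMatroid E) where
  open ListMatroid
  open DecList _≟_

  I∪ : List E → Set
  I∪ X = Unique X × Σ (Fin (suc k) → List E) λ B → (∀ j → I (L j) (B j)) × (∀ {e} → e ∈ X → ∃ λ j → e ∈ B j)

  class : (E → Fin (suc k)) → List E → Fin (suc k) → List E
  class f X j = filter (λ e → f e ≟F j) X

  ∑-class : ∀ f X → ∑ (allFin (suc k)) (λ j → length (class f X j)) ≡ length X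
  ∑-class f X = begin
    ∑ (allFin (suc k)) (λ j → length (class f X j)) ≡⟨ ∑-cong (allFin _) (λ j _ → length-filter≡# (λ e → f e ≟F j) X) ⟩
    ∑ (allFin (suc k)) (λ j → # (λ e → f e ≟F j) X) ≡⟨ ∑-swap (allFin (suc k)) X (λ j e → ind (f e ≟F j)) ⟩
    ∑ X (λ e → # (λ j → f e ≟F j) (allFin (suc k))) ≡⟨ ∑-cong X (λ e _ → one (f e)) ⟩
    ∑ X (λ _ → 1)                                    ≡⟨ ∑-const X 1 ⟩
    length X * 1                                     ≡⟨ *-identityʳ _ ⟩
    length X ∎
    where
      open ≡-Reasoning
      open DecList {A = Fin (suc k)} _≟F_ using () renaming (#≡≤1 to #≡≤1F)
      one : ∀ i → # (λ j → i ≟F j) (allFin (suc k)) ≡ 1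
      one i = ≤-antisym
        (≤-trans (#-mono (i ≟F_) (_≟F i) (allFin _) (λ _ _ → sym)) (#≡≤1F (Uniqueₚ.allFin⁺ (suc k)) i))
        (#-∈ (i ≟F_) (∈-allFin i) refl)
        where import Data.List.Relation.Unary.Unique.Propositional.Properties as Uniqueₚ

  -- A cover of X by independent sets is made disjoint by sending each element to the first set containing it.
  colour : ∀ {X} → I∪ X → Σ (E → Fin (suc k)) λ f → ∀ j → I (L j) (class f X j)
  colour {X} (u , B , i , c) = f , λ j → I-⊆ (L j) (unique-filter _ u) (λ p → sub j p) (i j)
    where
      f : E → Fin (suc k)
      f e with anyF? (λ j → e ∈? B j)
      ... | yes (j , _) = j
      ... | no _        = fzero
      f-∈ : ∀ {e} → e ∈ X → e ∈ B (f e)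
      f-∈ {e} p with anyF? (λ j → e ∈? B j)
      ... | yes (_ , q) = q
      ... | no ¬q       = ⊥-elim (¬q (c p))
      sub : ∀ j {e} → e ∈ class f X j → e ∈ B j
      sub j {e} p with filter-∈ (λ e → f e ≟F j) X p
      ... | q , eq = subst (λ j → e ∈ B j) eq (f-∈ q)

  -- Some colour class of `Y` is longer than the class of `X` of the same colour `j`, so it augments
  -- that class by some `e`. If `e` is new to `X`, this finishes. Otherwise `e` had another colour
  -- in `X`, and recolouring it with `j` makes `f` agree with `g` at one more element. The fuel `n`
  -- bounds the elements of `X` without such agreement.
  augment : ∀ n {X Y} → Unique X → Unique Y → length X < length Y → (f g : E → Fin (suc k)) →
            (∀ j → I (L j) (class f X j)) → (∀ j → I (L j) (class g Y j)) →
            length X ≤ n + # (λ e → (e ∈? Y) ×-dec (f e ≟F g e)) X → ∃ λ e → e ∈ Y × I∪ (e ∷ X)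
  augment n {X} {Y} uX uY lt f g iX iY le
    with ∑-lt (allFin (suc k)) (λ j → length (class f X j)) (λ j → length (class g Y j))
              (subst₂ _<_ (sym (∑-class f X)) (sym (∑-class g Y)) lt)
  ... | j , _ , lt′ with I-aug (L j) (iX j) (iY j) lt′
  ...   | e , e∈ , ij with filter-∈ (λ e → g e ≟F j) Y e∈
  ...     | e∈Y , ge with e ∈? X
  ...       | no e∉ = e , e∈Y , unique-∷ e∉ uX , B , iB , cB
    where
      B : Fin (suc k) → List E
      B i with i ≟F j
      ... | yes _ = e ∷ class f X j
      ... | no _  = class f X i
      iB : ∀ i → I (L i) (B i)
      iB i with i ≟F j
      ... | yes refl = ij
      ... | no _     = iX i
      ∈B : ∀ {x} i → x ∈ class f X i → x ∈ B i
      ∈B i p with i ≟F j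
      ... | yes refl = there p
      ... | no _     = p
      e∈B : e ∈ B j
      e∈B with j ≟F j
      ... | yes _ = here refl
      ... | no ¬p = ⊥-elim (¬p refl)
      cB : ∀ {x} → x ∈ e ∷ X → ∃ λ i → x ∈ B i
      cB (here refl)   = j , e∈B
      cB {x} (there p) = f x , ∈B (f x) (∈-filter⁺ (λ y → f y ≟F f x) p refl)
  ...       | yes e∈X = go n le
    where
      f′ : E → Fin (suc k)
      f′ x with x ≟ e
      ... | yes _ = j
      ... | no _  = f x
      f′e : f′ e ≡ j
      f′e with e ≟ e
      ... | yes _ = refl
      ... | no ¬p = ⊥-elim (¬p refl)
      f′≢ : ∀ {x} → x ≢ e → f′ x ≡ f x
      f′≢ {x} h with x ≟ e
      ... | yes p = ⊥-elim (h p)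
      ... | no _  = refl
      e∉j : f e ≢ j
      e∉j p = unique-head (I-unique (L j) ij) (∈-filter⁺ (λ y → f y ≟F j) e∈X p)
      iX′ : ∀ i → I (L i) (class f′ X i)
      iX′ i with i ≟F j
      ... | yes refl = I-⊆ (L j) (unique-filter _ uX) s ij
        where s : class f′ X j ⊆ e ∷ class f X j
              s {x} p with filter-∈ (λ y → f′ y ≟F j) X p | x ≟ e
              ... | q , eq | yes r = here r
              ... | q , eq | no r  = there (∈-filter⁺ (λ y → f y ≟F j) q (trans (sym (f′≢ r)) eq))
      ... | no i≢j = I-⊆ (L i) (unique-filter _ uX) s (iX i)
        where s : class f′ X i ⊆ class f X i
              s {x} p with filter-∈ (λ y → f′ y ≟F i) X p
              ... | q , eq = ∈-filter⁺ (λ y → f y ≟F i) q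
                (trans (sym (f′≢ λ { refl → i≢j (trans (sym eq) f′e) })) eq)
      more : # (λ x → (x ∈? Y) ×-dec (f x ≟F g x)) X < # (λ x → (x ∈? Y) ×-dec (f′ x ≟F g x)) X
      more = #-strict (λ x → (x ∈? Y) ×-dec (f x ≟F g x)) (λ x → (x ∈? Y) ×-dec (f′ x ≟F g x)) X
        (λ x _ → λ { (a , b) → a , trans (f′≢ λ { refl → e∉j (trans b ge) }) b })
        e∈X (e∈Y , trans f′e (sym ge)) (λ { (_ , b) → e∉j (trans b ge) })
      go : ∀ n → length X ≤ n + # (λ e → (e ∈? Y) ×-dec (f e ≟F g e)) X → ∃ λ e → e ∈ Y × I∪ (e ∷ X)
      go zero    le = ⊥-elim (1+n≰n (≤-trans more (≤-trans (#≤length _ X) le)))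
      go (suc n) le = augment n uX uY lt f′ g iX′ iY
        (≤-trans le (≤-trans (≤-reflexive (sym (+-suc n _))) (+-monoʳ-≤ n more)))

  ∪-matroid : ListMatroid E
  ∪-matroid = record
    { I        = I∪
    ; I-[]     = [] , (λ _ → []) , (λ j → I-[] (L j)) , λ ()
    ; I-unique = proj₁
    ; I-⊆      = λ { u s (_ , B , i , c) → u , B , i , (c ∘ s) }
    ; I-aug    = λ {X} {Y} iX iY lt → augment (length X) (proj₁ iX) (proj₁ iY) lt
                   (proj₁ (colour iX)) (proj₁ (colour iY)) (proj₂ (colour iX)) (proj₂ (colour iY)) (m≤m+n _ _)
    }

-- Rank functions on the pairs of a finite vertex set that are invariant under transpositions

module Transposition {V : Set} (_≟_ : DecidableEquality V) where

  sw : V → V → V → V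
  sw a b x with x ≟ a
  ... | yes _ = b
  ... | no _ with x ≟ b
  ...   | yes _ = a
  ...   | no _  = x

  sw-l : ∀ a b → sw a b a ≡ b
  sw-l a b with a ≟ a
  ... | yes _ = refl
  ... | no h  = ⊥-elim (h refl)

  sw-r : ∀ a b → sw a b b ≡ a
  sw-r a b with b ≟ a
  ... | yes e = e
  ... | no _ with b ≟ b
  ...   | yes _ = refl
  ...   | no h  = ⊥-elim (h refl)

  sw-other : ∀ {a b x} → x ≢ a → x ≢ b → sw a b x ≡ x
  sw-other {a} {b} {x} p q with x ≟ a
  ... | yes e = ⊥-elim (p e)
  ... | no _ with x ≟ b
  ...   | yes e = ⊥-elim (q e)
  ...   | no _  = refl

  sw-invol : ∀ a b x → sw a b (sw a b x) ≡ x
  sw-invol a b x with x ≟ a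
  ... | yes refl = sw-r x b
  ... | no p with x ≟ b
  ...   | yes refl = sw-l a x
  ...   | no q     = sw-other p q

  sw-inj : ∀ a b {x y} → sw a b x ≡ sw a b y → x ≡ y
  sw-inj a b {x} {y} e = trans (sym (sw-invol a b x)) (trans (cong (sw a b) e) (sw-invol a b y))

mapP : ∀ {A : Set} → (A → A) → A × A → A × A
mapP π (a , b) = π a , π b

abstract
  K : List 𝒜 → List (𝒜 × 𝒜)
  K U = cartesianProduct U U

  K⁺ : ∀ {U : List 𝒜} {x y} → x ∈ U → y ∈ U → (x , y) ∈ K U
  K⁺ = ∈-cartesianProduct⁺

  K⁻ : ∀ {U : List 𝒜} {x y} → (x , y) ∈ K U → x ∈ U × y ∈ U
  K⁻ {U = U} = ∈-cartesianProduct⁻ U U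

abstract
  star : 𝒜 → List 𝒜 → List (𝒜 × 𝒜)
  star v S = map (v ,_) S

  star-[] : ∀ {v : 𝒜} → star v [] ≡ []
  star-[] = refl

  star-∷ : ∀ {v s : 𝒜} {S} → star v (s ∷ S) ≡ (v , s) ∷ star v S
  star-∷ = refl

  length-star : ∀ (v : 𝒜) S → length (star v S) ≡ length S
  length-star v S = length-map (v ,_) S

  star⁻ : ∀ {v : 𝒜} {S x y} → (x , y) ∈ star v S → x ≡ v × y ∈ S
  star⁻ {v = v} p with ∈-map⁻ (v ,_) p
  ... | s , s∈ , refl = refl , s∈

  star⁺ : ∀ {v : 𝒜} {S y} → y ∈ S → (v , y) ∈ star v S
  star⁺ {v = v} = ∈-map⁺ (v ,_)

abstract
  Bi : List 𝒜 → List 𝒜 → List (𝒜 × 𝒜)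
  Bi X Y = cartesianProduct X Y

  Bi⁺ : ∀ {X Y : List 𝒜} {x y} → x ∈ X → y ∈ Y → (x , y) ∈ Bi X Y
  Bi⁺ = ∈-cartesianProduct⁺

  Bi⁻ : ∀ {X Y : List 𝒜} {x y} → (x , y) ∈ Bi X Y → x ∈ X × y ∈ Y
  Bi⁻ {X = X} {Y} = ∈-cartesianProduct⁻ X Y

-- Pairs are ordered and may be loops, so that products of vertex lists can serve directly as
-- complete and complete bipartite graphs. `r-flip` makes the orientation irrelevant and `r-loop`
-- gives loops rank zero; `r-dim` is submodularity for one new element.
record SymRank (V : Set) : Set where
  field
    _≟_         : DecidableEquality V
    pool        : List V
    pool-unique : Unique pool
    pool-all    : ∀ x → x ∈ pool
    r           : List (V × V) → ℕ
    r-[]        : r [] ≡ 0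
    r-step      : ∀ e X → r (e ∷ X) ≤ suc (r X)
    r-mono      : ∀ {X Y} → X ⊆ Y → r X ≤ r Y
    r-dim       : ∀ {X Y} e → X ⊆ Y → r (e ∷ Y) + r X ≤ r (e ∷ X) + r Y
    r-loop      : ∀ u X → r ((u , u) ∷ X) ≤ r X
    r-flip      : ∀ {u v X} → (u , v) ∈ X → r ((v , u) ∷ X) ≤ r X
    r-swap      : ∀ a b X → r (map (mapP (Transposition.sw _≟_ a b)) X) ≤ r X

module SymRankTheory {V : Set} (S : SymRank V) where
  open SymRank S public
  open Transposition _≟_ public
  open DecList _≟_ public

  P : Set
  P = V × V

  swP : V → V → P → P
  swP a b = mapP (sw a b)

  swP-invol : ∀ a b X → map (swP a b) (map (swP a b) X) ≡ X
  swP-invol a b []            = refl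
  swP-invol a b ((x , y) ∷ X) = cong₂ _∷_ (cong₂ _,_ (sw-invol a b x) (sw-invol a b y)) (swP-invol a b X)

  swap-≡ : ∀ a b X → r (map (swP a b) X) ≡ r X
  swap-≡ a b X = ≤-antisym (r-swap a b X)
    (subst (λ Y → r Y ≤ r (map (swP a b) X)) (swP-invol a b X) (r-swap a b (map (swP a b) X)))

  Cl : List P → P → Set
  Cl X e = r (e ∷ X) ≤ r X

  Cl? : ∀ X e → Dec (Cl X e)
  Cl? X e = r (e ∷ X) ≤? r X

  cl-mono : ∀ {X Y e} → X ⊆ Y → Cl X e → Cl Y e
  cl-mono {X} {Y} {e} s h = +-cancelʳ-≤ (r X) _ _
    (≤-trans (r-dim e s) (≤-trans (+-monoˡ-≤ (r Y) h) (≤-reflexive (+-comm (r X) (r Y)))))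

  cl-∈ : ∀ {X e} → e ∈ X → Cl X e
  cl-∈ e∈ = r-mono λ { (here refl) → e∈ ; (there q) → q }

  cl-flip : ∀ {X u v} → Cl X (u , v) → Cl X (v , u)
  cl-flip {X} {u} {v} h = ≤-trans (r-mono {(v , u) ∷ X} {(v , u) ∷ (u , v) ∷ X}
    (λ { (here p) → here p ; (there p) → there (there p) })) (≤-trans (r-flip {X = (u , v) ∷ X} (here refl)) h)

  cl-++ : ∀ A {X} → (∀ {e} → e ∈ A → Cl X e) → r (A ++ X) ≤ r X
  cl-++ []      h = ≤-refl
  cl-++ (e ∷ A) {X} h = ≤-trans (cl-mono {X} {A ++ X} (∈-++⁺ʳ A) (h (here refl))) (cl-++ A (h ∘ there))

  cl-trans : ∀ {X Y e} → (∀ {f} → f ∈ Y → Cl X f) → Cl Y e → Cl X e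
  cl-trans {X} {Y} {e} h c = ≤-trans (r-mono {e ∷ X} {e ∷ Y ++ X} (λ { (here p) → here p ; (there p) → there (∈-++⁺ʳ Y p) }))
    (≤-trans (cl-mono {Y} {Y ++ X} ∈-++⁺ˡ c) (cl-++ Y h))

  span-≤ : ∀ {X Y} → (∀ {f} → f ∈ Y → Cl X f) → r Y ≤ r X
  span-≤ {X} {Y} h = ≤-trans (r-mono {Y} {Y ++ X} ∈-++⁺ˡ) (cl-++ Y h)

  r-dim* : ∀ A {X Y} → X ⊆ Y → r (A ++ Y) + r X ≤ r (A ++ X) + r Y
  r-dim* []      {X} {Y} s = ≤-reflexive (+-comm (r Y) (r X))
  r-dim* (e ∷ A) {X} {Y} s = +-cancelʳ-≤ (r (A ++ X) + r (A ++ Y)) _ _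
    (lin 0 (+-mono-≤ (r-dim e (++⁺ A s)) (r-dim* A s)) (id′ (r (e ∷ A ++ Y)) (r X) (r (A ++ X)) (r (A ++ Y)) (r (e ∷ A ++ X)) (r Y)))
    where
      ++⁺ : ∀ A {X Y} → X ⊆ Y → A ++ X ⊆ A ++ Y
      ++⁺ A s p with ∈-++⁻ A p
      ... | inj₁ q = ∈-++⁺ˡ q
      ... | inj₂ q = ∈-++⁺ʳ A (s q)
      id′ : ∀ a b c d e f → a + b + (c + d) + (e + d + (c + f)) + 0 ≡ e + f + (c + d) + (a + c + (d + b))
      id′ = solve-∀

  r-≤-length : ∀ A X → r (A ++ X) ≤ length A + r X
  r-≤-length []      X = ≤-refl
  r-≤-length (e ∷ A) X = ≤-trans (r-step e (A ++ X)) (s≤s (r-≤-length A X))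

  r-≤-len : ∀ A → r A ≤ length A
  r-≤-len A = subst₂ _≤_ (cong r (++-[] A)) (trans (cong (length A +_) r-[]) (+-identityʳ _)) (r-≤-length A [])
    where ++-[] : ∀ (A : List P) → A ++ [] ≡ A
          ++-[] []      = refl
          ++-[] (x ∷ A) = cong (x ∷_) (++-[] A)

  cl-swap : ∀ a b {X e} → Cl X e → Cl (map (swP a b) X) (swP a b e)
  cl-swap a b {X} {e} h = ≤-trans (r-swap a b (e ∷ X)) (≤-trans h (≤-reflexive (sym (swap-≡ a b X))))

  cl-swap-fix : ∀ a b {X e} → (∀ {f} → f ∈ X → swP a b f ∈ X) → Cl X e → Cl X (swP a b e)
  cl-swap-fix a b {X} s h = cl-mono (λ p → case ∈-map⁻ (swP a b) p of λ { (f , f∈ , refl) → s f∈ }) (cl-swap a b h)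

  Off : List P → V → Set
  Off X a = ∀ {u v} → (u , v) ∈ X → u ≢ a × v ≢ a

  off-fix : ∀ {a b X} → Off X a → Off X b → ∀ {f} → f ∈ X → swP a b f ∈ X
  off-fix {a} {b} {X} p q {u , v} f∈ = subst (_∈ X)
    (cong₂ _,_ (sym (sw-other (proj₁ (p f∈)) (proj₁ (q f∈)))) (sym (sw-other (proj₂ (p f∈)) (proj₂ (q f∈))))) f∈

  -- The form in which symmetry is used almost everywhere: the transposition of `a` and `b` fixes
  -- both `X` and `x` and carries one pair to the other.
  cl-move : ∀ {a b x X} → (∀ {f} → f ∈ X → swP a b f ∈ X) → x ≢ a → x ≢ b → Cl X (x , a) → Cl X (x , b)
  cl-move {a} {b} {x} {X} s p q h = subst (Cl X) (cong₂ _,_ (sw-other p q) (sw-l a b)) (cl-swap-fix a b s h)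

  K-mono : ∀ {U U′ : List V} → U ⊆ U′ → K U ⊆ K U′
  K-mono s {x , y} p = K⁺ (s (proj₁ (K⁻ p))) (s (proj₂ (K⁻ p)))

  -- After the tails have been matched, one more transposition moves the image of the head of `U` to
  -- the head of `U′`; neither lies in the tail, so the tail stays in place.
  permute : ∀ {U U′} → Unique U → Unique U′ → length U ≡ length U′ →
    Σ (V → V) λ π → (∀ X → r (map (mapP π) X) ≡ r X) × (∀ {x y} → π x ≡ π y → x ≡ y) × map π U ≡ U′
  permute {[]} {[]} _ _ _ = id , (λ X → cong r (map-id X)) , id , refl
  permute {u ∷ U} {u′ ∷ U′} a b e with permute (unique-tail a) (unique-tail b) (cong pred e)
  ... | π , inv , inj , eq = (sw (π u) u′ ∘ π)
    , (λ X → trans (cong r (map-∘ {g = swP (π u) u′} {f = mapP π} X)) (trans (swap-≡ (π u) u′ _) (inv X)))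
    , (inj ∘ sw-inj (π u) u′)
    , cong₂ _∷_ (sw-l (π u) u′) (trans (map-∘ U) (trans (cong (map (sw (π u) u′)) eq) (fix U′ πu∉ (unique-head b))))
    where
      πu∉ : π u ∉ U′
      πu∉ p with ∈-map⁻ π (subst (π u ∈_) (sym eq) p)
      ... | x , x∈ , q = unique-head a (subst (_∈ U) (sym (inj q)) x∈)
      fix : ∀ {a b} W → a ∉ W → b ∉ W → map (sw a b) W ≡ W
      fix []      p q = refl
      fix (w ∷ W) p q = cong₂ _∷_ (sw-other (λ e → p (here (sym e))) (λ e → q (here (sym e)))) (fix W (p ∘ there) (q ∘ there))

  rK-≤ : ∀ {U U′} → Unique U → Unique U′ → length U ≡ length U′ → r (K U′) ≤ r (K U)
  rK-≤ {U} {U′} a b e with permute a b e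
  ... | π , inv , _ , refl = ≤-trans (r-mono s) (≤-reflexive (inv (K U)))
    where s : K (map π U) ⊆ map (mapP π) (K U)
          s {x , y} p with ∈-map⁻ π (proj₁ (K⁻ p)) | ∈-map⁻ π (proj₂ (K⁻ p))
          ... | x′ , x∈ , refl | y′ , y∈ , refl = ∈-map⁺ (mapP π) (K⁺ x∈ y∈)

  -- The rank of the complete graph on `n` vertices, for `n` up to the size of the pool; by `rK` it
  -- does not matter which vertices are taken.
  ρ : ℕ → ℕ
  ρ n = r (K (take n pool))

  length≤pool : ∀ {U} → Unique U → length U ≤ length pool
  length≤pool u = unique-⊆-length u (λ {x} _ → pool-all x)

  rK : ∀ {U} → Unique U → r (K U) ≡ ρ (length U)
  rK {U} u = ≤-antisym (rK-≤ (unique-take (length U) pool-unique) u e) (rK-≤ u (unique-take (length U) pool-unique) (sym e))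
    where e = length-take≤ (length U) {pool} (length≤pool u)

  ρ-mono : ∀ {m n} → m ≤ n → ρ m ≤ ρ n
  ρ-mono {m} {n} h = r-mono (K-mono (s h pool))
    where s : ∀ {m n} → m ≤ n → (xs : List V) → take m xs ⊆ take n xs
          s (s≤s h) (x ∷ xs) (here p)  = here p
          s (s≤s h) (x ∷ xs) (there p) = there (s h xs p)

  d : ℕ → ℕ
  d n = ρ (suc n) ∸ ρ n

  ρ-suc : ∀ n → ρ (suc n) ≡ ρ n + d n
  ρ-suc n = sym (m+[n∸m]≡n (ρ-mono (n≤1+n n)))

  K-∷ : ∀ {v U X} → (∀ {u} → u ∈ U → Cl X (v , u)) → K U ⊆ X → ∀ {e} → e ∈ K (v ∷ U) → Cl X e
  K-∷ {v} {U} {X} h s {x , y} p with K⁻ {U = v ∷ U} p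
  ... | here refl , here refl = r-loop v X
  ... | here refl , there q   = h q
  ... | there q , here refl   = cl-flip (h q)
  ... | there q , there q′    = cl-∈ (s (K⁺ q q′))

  -- Add the edges at `v` one at a time. As long as none is spanned by the earlier ones, each gains
  -- a unit. Once one is spanned, symmetry shows that all edges from `v` to `U` are, so the clique
  -- on `v ∷ U` is spanned and the gain is the full increment.
  star-gain : ∀ {v U} T → Unique (v ∷ U) → Unique T → T ⊆ U → ρ (length U) + (length T ⊓ d (length U)) ≤ r (star v T ++ K U)
  star-gain {v} {U} [] u _ _ rewrite star-[] {v = v} = ≤-reflexive (trans (+-identityʳ _) (sym (rK (unique-tail u))))
  star-gain {v} {U} (t ∷ T) u uT s rewrite star-∷ {v = v} {t} {T} with Cl? (star v T ++ K U) (v , t)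
  ... | no ¬c = ≤-trans (≤-trans (+-monoʳ-≤ (ρ (length U)) (sm (length T) (d (length U)))) (≤-reflexive (+-suc _ _)))
                  (≤-trans (s≤s (star-gain T u (unique-tail uT) (s ∘ there))) (≰⇒> ¬c))
    where sm : ∀ a b → suc a ⊓ b ≤ suc (a ⊓ b)
          sm a zero    = z≤n
          sm a (suc b) = s≤s (⊓-monoʳ-≤ a (n≤1+n b))
  ... | yes c = ≤-trans (+-monoʳ-≤ (ρ (length U)) (m⊓n≤n (suc (length T)) (d (length U))))
                  (≤-trans (≤-reflexive (trans (sym (ρ-suc (length U))) (sym (rK u))))
                    (≤-trans (span-≤ {X} (K-∷ h (∈-++⁺ʳ (star v T)))) (r-mono there)))
    where
      X = star v T ++ K U
      v∉ : ∀ {x} → x ∈ U → v ≢ x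
      v∉ p refl = unique-head u p
      h : ∀ {x} → x ∈ U → Cl X (v , x)
      h {x} p with x ∈? T
      ... | yes q = cl-∈ (∈-++⁺ˡ (star⁺ q))
      ... | no q = cl-move {t} {x} fix (v∉ (s (here refl))) (v∉ p) c
        where
          inU : ∀ {y} → y ∈ U → sw t x y ∈ U
          inU {y} y∈ with y ≟ t
          ... | yes _ = p
          ... | no _ with y ≟ x
          ...   | yes _ = s (here refl)
          ...   | no _  = y∈
          fix : ∀ {f} → f ∈ X → swP t x f ∈ X
          fix {a , b} f∈ with ∈-++⁻ (star v T) f∈
          ... | inj₂ k = ∈-++⁺ʳ (star v T) (K⁺ (inU (proj₁ (K⁻ k))) (inU (proj₂ (K⁻ k))))
          ... | inj₁ k with star⁻ k
          ...   | refl , b∈ = ∈-++⁺ˡ (subst (_∈ star v T)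
                  (cong₂ _,_ (sym (sw-other (v∉ (s (here refl))) (v∉ p)))
                             (sym (sw-other (λ e → unique-head uT (subst (_∈ T) e b∈)) (λ e → q (subst (_∈ T) e b∈)))))
                  (star⁺ b∈))

  -- By submodularity the star gains at least as much over `X` as over the larger `K U`.
  gain : ∀ {v U X} T → Unique (v ∷ U) → Unique T → T ⊆ U → X ⊆ K U → r X + (length T ⊓ d (length U)) ≤ r (star v T ++ X)
  gain {v} {U} {X} T u uT s w = lin 0 (+-mono-≤ (star-gain T u uT s) (r-dim* (star v T) w))
    (eq (r X) (length T ⊓ d (length U)) (r (star v T ++ K U)) (r (star v T ++ X)) (ρ (length U)) (r (K U)) (rK (unique-tail u)))
    where
      eq′ : ∀ a b c e k → a + b + (c + (e + k)) + 0 ≡ e + (k + b + (c + a))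
      eq′ = solve-∀
      eq : ∀ a b c e k k′ → k′ ≡ k → a + b + (c + (e + k′)) + 0 ≡ e + (k + b + (c + a))
      eq a b c e k k′ refl = eq′ a b c e k

  d≤ : ∀ n → suc n ≤ length pool → d n ≤ n
  d≤ n h = +-cancelˡ-≤ (ρ n) _ _ (≤-trans (≤-reflexive (sym (ρ-suc n))) (main (take (suc n) pool) (unique-take (suc n) pool-unique) (length-take≤ (suc n) {pool} h)))
    where
      main : ∀ W → Unique W → length W ≡ suc n → ρ (suc n) ≤ ρ n + n
      main (v ∷ U) u e = ≤-trans (≤-reflexive (trans (cong ρ (sym e)) (sym (rK u))))
        (≤-trans (span-≤ {star v U ++ K U} (K-∷ (λ p → cl-∈ (∈-++⁺ˡ (star⁺ p))) (∈-++⁺ʳ (star v U))))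
          (≤-trans (r-≤-length (star v U) (K U))
            (≤-reflexive (trans (cong₂ _+_ (trans (length-star v U) (cong pred e)) (trans (rK (unique-tail u)) (cong ρ (cong pred e)))) (+-comm n (ρ n))))))

  fresh : ∀ k U → length U + k ≤ length pool → ∃ λ T → Unique T × length T ≡ k × (∀ {x} → x ∈ T → x ∉ U)
  fresh k U h = take k T , unique-take k uT , length-take≤ k le , λ p → proj₂ (filter-∈ _ pool (take-⊆ k T p))
    where
      T = filter (λ x → ¬? (x ∈? U)) pool
      uT = unique-filter (λ x → ¬? (x ∈? U)) pool-unique
      le : k ≤ length T
      le = +-cancelˡ-≤ (length U) _ _ (≤-trans h (≤-trans (unique-⊆-length pool-unique s) (≤-reflexive (length-++ U))))
        where s : pool ⊆ U ++ T
              s {x} p with x ∈? U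
              ... | yes q = ∈-++⁺ˡ q
              ... | no q  = ∈-++⁺ʳ U (∈-filter⁺ (λ x → ¬? (x ∈? U)) p q)

-- Growth of the rank when complete bipartite graphs span and pendant edges are coloops

module Constants (q : ℕ) where

  D : ℕ
  D = q + q

  abstract
    -- Origins: `m` makes the dominating set `A` so small that `10 * (D + 1) * length A` is at most
    -- the order of the graph. `β₂` is the minimum degree that this dominating set needs. `c₁`
    -- bounds the rank defect per class of a `Family`. `κ` pays, for each part beyond the first, for
    -- its boundary and for the defect. `β`, the minimum degree of a core, is large enough that
    -- small parts are a minority in the final count. `χ` has the factor `D` for graphs all of whose
    -- edges are loose. In `C₀`, the term with `4` makes loose vertices cheap and the others exceed
    -- what large parts can cost.
    m β₂ c₁ κ β χ C₀ : ℕ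
    m  = 20 * suc D
    β₂ = D + D * m * m
    c₁ = suc β₂ + D * q
    κ  = β₂ + (c₁ + c₁)
    β  = 8 * κ
    χ  = β * D
    C₀ = suc (8 * κ + 16 * (χ * (D * κ)) + 4 * (χ * D))

    m≡ : m ≡ 20 * suc D
    m≡ = refl

    β₂≡ : β₂ ≡ D + D * m * m
    β₂≡ = refl

    c₁≡ : c₁ ≡ suc β₂ + D * q
    c₁≡ = refl

    κ≡ : κ ≡ β₂ + (c₁ + c₁)
    κ≡ = refl

    β≡ : β ≡ 8 * κ
    β≡ = refl

    χ≡ : χ ≡ β * D
    χ≡ = refl

    C₀≡ : C₀ ≡ suc (8 * κ + 16 * (χ * (D * κ)) + 4 * (χ * D))
    C₀≡ = refl

-- `leaf` bounds the increments of the ranks of complete graphs from below, `bip` bounds them from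
-- above.
record Growing {V : Set} (S : SymRank V) : Set where
  open SymRankTheory S
  field
    q    : ℕ
    2≤q  : 2 ≤ q
    bip  : ∀ {A B u w} → Unique (A ++ B) → q ≤ length A → q ≤ length B → u ∈ A → w ∈ A → Cl (Bi A B) (u , w)
    leaf : ∀ {U X u v} → X ⊆ K U → v ∉ U → u ∈ U → r X < r ((v , u) ∷ X)

module GrowingTheory {V : Set} (S : SymRank V) (Gr : Growing S) where
  open SymRankTheory S public
  open Growing Gr public
  open Constants q public

  -- Two cliques on `v ∷ U` and `w ∷ U` contain every pair on `w ∷ v ∷ U` except `wv`, and `wv` is
  -- spanned by the complete bipartite graph with side `take q U`; `D ≤ n` leaves `q` vertices for
  -- each side. So these cliques span the next larger one, and submodularity compares the
  -- increments.
  d-step : ∀ n → D ≤ n → 2 + n ≤ length pool → d (suc n) ≤ d n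
  d-step n D≤n h = main (take (2 + n) pool) (unique-take (2 + n) pool-unique) (length-take≤ (2 + n) {pool} h)
    where
    main : ∀ W → Unique W → length W ≡ 2 + n → d (suc n) ≤ d n
    main (w ∷ v ∷ U) uW e = +-cancelʳ-≤ (ρ (suc n) + ρ n) _ _
      (≤-trans (≤-reflexive (id₁ (d (suc n)) (ρ (suc n)) (ρ n)))
      (≤-trans (≤-reflexive (cong (_+ ρ n) (sym (ρ-suc (suc n)))))
      (≤-trans big (≤-reflexive (trans (cong (_+ ρ (suc n)) (ρ-suc n)) (id₂ (ρ n) (d n) (ρ (suc n))))))))
      where
      id₁ : ∀ a b c → a + (b + c) ≡ b + a + c
      id₁ = solve-∀
      id₂ : ∀ a b c → a + b + c ≡ b + (c + a)
      id₂ = solve-∀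
      eU : length U ≡ n
      eU = cong (pred ∘ pred) e
      uvU = unique-tail uW
      uU = unique-tail uvU
      uwU : Unique (w ∷ U)
      uwU = unique-∷ (unique-head uW ∘ there) uU
      X = star w U ++ K (v ∷ U)
      A = w ∷ v ∷ drop q U
      B = take q U
      d∈ : ∀ {x} → x ∈ drop q U → x ∈ U
      d∈ p = subst (_ ∈_) (take++drop≡id q U) (∈-++⁺ʳ (take q U) p)
      uBd : Unique (take q U ++ drop q U)
      uBd = subst Unique (sym (take++drop≡id q U)) uU
      uAB : Unique (A ++ B)
      uAB with unique-++⁻ (take q U) uBd
      ... | a , b , c = unique-∷ (λ p → unique-head uW (inA p)) (unique-∷ (λ p → unique-head uvU (inB p))
              (unique-++ b a (λ p p′ → c p′ p)))
        where
        inB : ∀ {x} → x ∈ drop q U ++ B → x ∈ U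
        inB p with ∈-++⁻ (drop q U) p
        ... | inj₁ t = d∈ t
        ... | inj₂ t = take-⊆ q U t
        inA : ∀ {x} → x ∈ v ∷ drop q U ++ B → x ∈ v ∷ U
        inA (here p)  = here p
        inA (there p) = there (inB p)
      lB : q ≤ length B
      lB = ≤-reflexive (sym (length-take≤ q {U} (≤-trans (m≤m+n q q) (≤-trans D≤n (≤-reflexive (sym eU))))))
      lA : q ≤ length A
      lA = ≤-trans (≤-trans (+-cancelʳ-≤ q q (n ∸ q) (≤-trans D≤n (≤-reflexive (sym (m∸n+n≡m (≤-trans (m≤m+n q q) D≤n))))))
             (≤-reflexive (trans (cong (_∸ q) (sym eU)) (sym (length-drop q U))))) (m≤n+m _ 2)
      ab : ∀ {e} → e ∈ Bi A B → Cl X e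
      ab {a , b} p with Bi⁻ {X = A} {B} p
      ... | here refl , b∈         = cl-∈ (∈-++⁺ˡ (star⁺ (take-⊆ q U b∈)))
      ... | there (here refl) , b∈ = cl-∈ (∈-++⁺ʳ (star w U) (K⁺ (here refl) (there (take-⊆ q U b∈))))
      ... | there (there t) , b∈   = cl-∈ (∈-++⁺ʳ (star w U) (K⁺ (there (d∈ t)) (there (take-⊆ q U b∈))))
      wv : Cl X (w , v)
      wv = cl-trans ab (bip uAB lA lB (here refl) (there (here refl)))
      spans : ρ (2 + n) ≤ r X
      spans = ≤-trans (≤-reflexive (trans (cong ρ (sym e)) (sym (rK uW))))
        (span-≤ (K-∷ (λ { (here refl) → wv ; (there p) → cl-∈ (∈-++⁺ˡ (star⁺ p)) }) (∈-++⁺ʳ (star w U))))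
      big : ρ (2 + n) + ρ n ≤ ρ (suc n) + ρ (suc n)
      big = ≤-trans (+-mono-≤ spans (≤-reflexive (trans (cong ρ (sym eU)) (sym (rK uU)))))
        (≤-trans (r-dim* (star w U) {K U} {K (v ∷ U)} (K-mono there))
          (+-mono-≤
            (≤-trans (r-mono {star w U ++ K U} {K (w ∷ U)} s) (≤-reflexive (trans (rK uwU) (cong (ρ ∘ suc) eU))))
            (≤-reflexive (trans (rK uvU) (cong (ρ ∘ suc) eU)))))
        where
        s : star w U ++ K U ⊆ K (w ∷ U)
        s {x , y} p with ∈-++⁻ (star w U) p
        ... | inj₂ t = K-mono there t
        ... | inj₁ t with star⁻ t
        ...   | refl , y∈ = K⁺ (here refl) (there y∈)

  d-anti : ∀ n k → D ≤ n → suc (k + n) ≤ length pool → d (k + n) ≤ d n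
  d-anti n zero    _ _ = ≤-refl
  d-anti n (suc k) h l = ≤-trans (d-step (k + n) (≤-trans h (m≤n+m n k)) l) (d-anti n k h (≤-trans (n≤1+n _) l))

  -- Up to order `D` a new vertex has at most `D` edges; from there on the increments do not grow.
  d≤D : ∀ n → suc n ≤ length pool → d n ≤ D
  d≤D n h with n ≤? D
  ... | yes p = ≤-trans (d≤ n h) p
  ... | no ¬p = subst (λ m → d m ≤ D) (m∸n+n≡m D≤n)
      (≤-trans (d-anti D (n ∸ D) ≤-refl (subst (λ m → suc m ≤ length pool) (sym (m∸n+n≡m D≤n)) h))
        (d≤ D (≤-trans (s≤s D≤n) h)))
    where D≤n = <⇒≤ (≰⇒> ¬p)

  d-pos : ∀ n → 1 ≤ n → suc n ≤ length pool → 1 ≤ d n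
  d-pos n 1≤n h = +-cancelˡ-≤ (ρ n) _ _ (≤-trans (≤-reflexive (+-comm (ρ n) 1))
      (≤-trans (main (take (suc n) pool) (unique-take (suc n) pool-unique) (length-take≤ (suc n) {pool} h)) (≤-reflexive (ρ-suc n))))
    where
    main : ∀ W → Unique W → length W ≡ suc n → suc (ρ n) ≤ ρ (suc n)
    main (v ∷ [])     u e = ⊥-elim (1+n≰n (≤-trans 1≤n (≤-reflexive (sym (cong pred e)))))
    main (v ∷ x ∷ U) u e = ≤-trans (s≤s (≤-reflexive (trans (cong ρ (sym (cong pred e))) (sym (rK (unique-tail u))))))
      (≤-trans (leaf {x ∷ U} {K (x ∷ U)} id (unique-head u) (here refl))
        (≤-trans (r-mono {(v , x) ∷ K (x ∷ U)} {K (v ∷ x ∷ U)} (λ { (here refl) → K⁺ (here refl) (there (here refl)) ; (there p) → K-mono there p }))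
          (≤-reflexive (trans (rK u) (cong ρ e)))))

  ρ-lower : ∀ m k → 1 ≤ m → k + m ≤ length pool → k + ρ m ≤ ρ (k + m)
  ρ-lower m zero    _ _ = ≤-refl
  ρ-lower m (suc k) p h = ≤-trans (s≤s (ρ-lower m k p (≤-trans (n≤1+n _) h)))
    (≤-trans (≤-reflexive (+-comm 1 _)) (≤-trans (+-monoʳ-≤ _ (d-pos (k + m) (≤-trans p (m≤n+m m k)) h)) (≤-reflexive (sym (ρ-suc (k + m))))))

  ρ-upper : ∀ m k → k + m ≤ length pool → ρ (k + m) ≤ ρ m + D * k
  ρ-upper m zero    _ = m≤m+n _ _
  ρ-upper m (suc k) h = ≤-trans (≤-reflexive (ρ-suc (k + m)))
    (≤-trans (+-mono-≤ (ρ-upper m k (≤-trans (n≤1+n _) h)) (d≤D (k + m) h))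
      (≤-reflexive (id₁ (ρ m) D k)))
    where id₁ : ∀ a b c → a + b * c + b ≡ a + b * suc c
          id₁ = solve-∀

  ρ-0 : ρ 0 ≡ 0
  ρ-0 = ≤-antisym (≤-trans (r-mono {Y = []} λ { {x , y} p → ⊥-elim (case proj₁ (K⁻ p) of λ ()) }) (≤-reflexive r-[])) z≤n

  stars : List V → List V → List P → List P
  stars []      T X = X
  stars (z ∷ Z) T X = star z T ++ stars Z T X

  stars-∈ : ∀ {z t} Z T X → z ∈ Z → t ∈ T → (z , t) ∈ stars Z T X
  stars-∈ (z ∷ Z) T X (here refl) q = ∈-++⁺ˡ (star⁺ q)
  stars-∈ (z ∷ Z) T X (there p)   q = ∈-++⁺ʳ (star z T) (stars-∈ Z T X p q)

  stars-⊇ : ∀ Z T {X} → X ⊆ stars Z T X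
  stars-⊇ []      T p = p
  stars-⊇ (z ∷ Z) T p = ∈-++⁺ʳ (star z T) (stars-⊇ Z T p)

  stars-⊆K : ∀ Z {T U X} → T ⊆ U → X ⊆ K U → stars Z T X ⊆ K (Z ++ U)
  stars-⊆K []      t x = x
  stars-⊆K (z ∷ Z) {T} t x {a , b} p with ∈-++⁻ (star z T) p
  ... | inj₂ y = K-mono there (stars-⊆K Z t x y)
  ... | inj₁ y with star⁻ y
  ...   | refl , b∈ = K⁺ (here refl) (there (∈-++⁺ʳ Z (t b∈)))

  -- q copies of v would all have the same small gain, but with bip they span (u , w).
  ext : ∀ {v U X u w} T → Unique (v ∷ U) → Unique T → T ⊆ U → X ⊆ K U → D ≤ length T → u ∈ T → w ∈ T →
        ¬ Cl X (u , w) → length U + suc q ≤ length pool → r X + suc (d (length U + q)) ≤ r (star v T ++ X)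
  ext {v} {U} {X} {u} {w} T uv uT T⊆ X⊆ D≤T u∈ w∈ ¬c cap
    with fresh q (v ∷ U) (≤-trans (≤-reflexive (sym (+-suc (length U) q))) cap)
  ... | Z , uZ , lZ , off = ≤-trans (≤-reflexive (+-suc (r X) d′)) (*-cancelˡ-< q (r X + d′) R final)
    where
    d′ = d (length U + q)
    R = r (star v T ++ X)
    Y = (u , w) ∷ X
    Y⊆ : Y ⊆ K U
    Y⊆ (here refl) = K⁺ (T⊆ u∈) (T⊆ w∈)
    Y⊆ (there p)   = X⊆ p
    v∉ : ∀ {x} → x ∈ U → x ≢ v
    v∉ p refl = unique-head uv p
    copy : ∀ {z} → z ∈ Z → r (star z T ++ X) ≤ R
    copy {z} z∈ = ≤-trans (r-mono s) (r-swap v z (star v T ++ X))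
      where
      z∉ : ∀ {x} → x ∈ U → x ≢ z
      z∉ p refl = off z∈ (there p)
      s : star z T ++ X ⊆ map (swP v z) (star v T ++ X)
      s {a , b} p with ∈-++⁻ (star z T) p
      ... | inj₁ y with star⁻ y
      ...   | refl , b∈ = subst (_∈ map (swP v z) (star v T ++ X)) (cong₂ _,_ (sw-l v z) (sw-other (v∉ (T⊆ b∈)) (z∉ (T⊆ b∈))))
                            (∈-map⁺ (swP v z) (∈-++⁺ˡ (star⁺ b∈)))
      s {a , b} p | inj₂ y = subst (_∈ map (swP v z) (star v T ++ X))
          (cong₂ _,_ (sw-other (v∉ a∈) (z∉ a∈)) (sw-other (v∉ b∈) (z∉ b∈))) (∈-map⁺ (swP v z) (∈-++⁺ʳ (star v T) y))
        where a∈ = proj₁ (K⁻ (X⊆ y))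
              b∈ = proj₂ (K⁻ (X⊆ y))
    upper : ∀ Z′ → Z′ ⊆ Z → r (stars Z′ T X) + length Z′ * r X ≤ r X + length Z′ * R
    upper []       _ = ≤-refl
    upper (z ∷ Z′) h = lin 0 (+-mono-≤ (upper Z′ (h ∘ there)) (+-mono-≤ (r-dim* (star z T) (stars-⊇ Z′ T {X})) (copy (h (here refl)))))
      (eq (r (star z T ++ stars Z′ T X)) (r X) (length Z′) (r (stars Z′ T X)) R (r (star z T ++ X)))
      where eq : ∀ a b c e f g → a + suc c * b + (b + c * f + (g + e + f)) + 0 ≡ b + suc c * f + (e + c * b + (a + b + g))
            eq = solve-∀
    -- The lower bound starts from `Y`, which has one unit of rank more than `X`. As the stars span
    -- `(u , w)` anyway, this unit has to be contained in the gains of the `q` copies.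
    lower : ∀ Z′ → Z′ ⊆ Z → Unique Z′ → length Z′ ≤ q → r Y + length Z′ * d′ ≤ r (stars Z′ T Y)
    lower []       _ _ _ = ≤-reflexive (+-identityʳ _)
    lower (z ∷ Z′) h u l = ≤-trans (≤-trans (≤-reflexive (eq (r Y) d′ (length Z′)))
        (+-mono-≤ (lower Z′ (h ∘ there) (unique-tail u) (≤-trans (n≤1+n _) l)) d′≤))
        (gain T uz uT (∈-++⁺ʳ Z′ ∘ T⊆) (stars-⊆K Z′ T⊆ Y⊆))
      where
      eq : ∀ a b c → a + suc c * b ≡ a + c * b + b
      eq = solve-∀
      uz : Unique (z ∷ Z′ ++ U)
      uz = unique-++ u (unique-tail uv) (λ p p′ → off (h p) (there p′))
      lU : length (Z′ ++ U) ≡ length Z′ + length U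
      lU = length-++ Z′
      d′≤d : d′ ≤ d (length (Z′ ++ U))
      d′≤d = subst₂ _≤_ (cong d e₁) (cong d (sym lU)) (d-anti (length Z′ + length U) (q ∸ length Z′)
               (≤-trans D≤T (≤-trans (unique-⊆-length uT T⊆) (m≤n+m _ _)))
               (subst (λ m → suc m ≤ length pool) (sym e₁) (≤-trans (≤-reflexive (sym (+-suc (length U) q))) cap)))
        where e₁ : q ∸ length Z′ + (length Z′ + length U) ≡ length U + q
              e₁ = trans (sym (+-assoc (q ∸ length Z′) _ _)) (trans (cong (_+ length U) (m∸n+n≡m (≤-trans (n≤1+n _) l))) (+-comm q (length U)))
      d′≤ : d′ ≤ length T ⊓ d (length (Z′ ++ U))
      d′≤ = ⊓-glb (≤-trans (d≤D _ (≤-trans (≤-reflexive (sym (+-suc (length U) q))) cap)) D≤T) d′≤d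
    spanned : r (stars Z T Y) ≤ r (stars Z T X)
    spanned = ≤-trans (r-mono (s Z)) (cl-trans ab (bip (unique-++ uT uZ (λ p p′ → off p′ (there (T⊆ p))))
                  (≤-trans (m≤m+n q q) D≤T) (≤-reflexive (sym lZ)) u∈ w∈))
      where
      ab : ∀ {e} → e ∈ Bi T Z → Cl (stars Z T X) e
      ab {a , b} p = cl-flip (cl-∈ (stars-∈ Z T X (proj₂ (Bi⁻ p)) (proj₁ (Bi⁻ p))))
      s : ∀ Z → stars Z T Y ⊆ (u , w) ∷ stars Z T X
      s []      p = p
      s (z ∷ Z) p with ∈-++⁻ (star z T) p
      ... | inj₁ y = there (∈-++⁺ˡ y)
      ... | inj₂ y with s Z y
      ...   | here e = here e
      ...   | there t = there (∈-++⁺ʳ (star z T) t)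
    final : suc (q * (r X + d′)) ≤ q * R
    final = lin 0 (+-mono-≤ (+-mono-≤ (subst (λ m → r (stars Z T X) + m * r X ≤ r X + m * R) lZ (upper Z id))
                              (subst (λ m → r Y + m * d′ ≤ r (stars Z T Y)) lZ (lower Z id uZ (≤-reflexive lZ))))
                            (+-mono-≤ spanned (≰⇒> ¬c)))
      (eq q (r X) d′ R (r (stars Z T X)) (r Y) (r (stars Z T Y)))
      where eq : ∀ q a b c e f g → suc (q * (a + b)) + (a + q * c + g + (e + f)) + 0 ≡ q * c + (e + q * a + (f + q * b) + (g + suc a))
            eq = solve-∀

-- Independent and dominating sets

#-filter : ∀ {A : Set} {P Q : A → Set} (P? : ∀ x → Dec (P x)) (Q? : ∀ x → Dec (Q x)) xs →
           # Q? (filter P? xs) ≡ # (λ x → P? x ×-dec Q? x) xs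
#-filter P? Q? [] = refl
#-filter P? Q? (x ∷ xs) with P? x
... | no _  = #-filter P? Q? xs
... | yes p with Q? x
...   | yes _ = cong suc (#-filter P? Q? xs)
...   | no _  = #-filter P? Q? xs

#-⊆ : ∀ {A : Set} {P Q : A → Set} (P? : ∀ x → Dec (P x)) (Q? : ∀ x → Dec (Q x)) {xs ys} → Unique xs →
      (∀ {x} → x ∈ xs → P x → x ∈ ys × Q x) → # P? xs ≤ # Q? ys
#-⊆ P? Q? {xs} {ys} u h = subst₂ _≤_ (length-filter≡# P? xs) (length-filter≡# Q? ys)
  (unique-⊆-length (unique-filter P? u) λ p → let (a , b) = filter-∈ P? xs p ; (c , e) = h a b in ∈-filter⁺ Q? c e)

#-cases : ∀ {A : Set} {P Q R : A → Set} (P? : ∀ x → Dec (P x)) (Q? : ∀ x → Dec (Q x)) (R? : ∀ x → Dec (R x)) xs →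
          (∀ x → x ∈ xs → P x → Q x ⊎ R x) → # P? xs ≤ # Q? xs + # R? xs
#-cases P? Q? R? xs h = ≤-trans (#-mono P? (λ x → Q? x ⊎-dec R? x) xs h) (#-⊎ Q? R? xs)

module SparseSets {V : Set} (_≟_ : DecidableEquality V) where
  open DecList _≟_

  -- The digraph x ↦ f x , g x has average in-degree at most 2, so it is 4-degenerate.
  independent : ∀ n (f g : V → V) X → length X ≤ n → Unique X → (∀ {x} → x ∈ X → f x ≢ x × g x ≢ x) →
    ∃ λ B → Unique B × B ⊆ X × length X ≤ 5 * length B × (∀ {b b′} → b ∈ B → b′ ∈ B → f b ≢ b′ × g b ≢ b′)
  independent n f g [] _ _ _ = [] , [] , (λ ()) , z≤n , λ ()
  independent (suc n) f g X@(x₀ ∷ X₀) le u nf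
    with ∑-avg X (λ x → # (λ y → f y ≟ x) X + # (λ y → g y ≟ x) X) (λ _ → 2) total (s≤s z≤n)
    where
    one : (k : V → V) → ∑ X (λ x → # (λ y → k y ≟ x) X) ≤ ∑ X (λ _ → 1)
    one k = ≤-trans (≤-reflexive (∑-swap X X (λ x y → ind (k y ≟ x)))) (∑-mono X (λ y _ →
      ≤-trans (#-mono (λ x → k y ≟ x) (_≟ k y) X (λ _ _ → sym)) (#≡≤1 u (k y))))
    total : ∑ X (λ x → # (λ y → f y ≟ x) X + # (λ y → g y ≟ x) X) ≤ ∑ X (λ _ → 2)
    total = ≤-trans (≤-reflexive (∑-+ X (λ x → # (λ y → f y ≟ x) X) (λ x → # (λ y → g y ≟ x) X))) (≤-trans (+-mono-≤ (one f) (one g)) (≤-reflexive (sym (∑-+ X (λ _ → 1) (λ _ → 1)))))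
  ... | x , x∈ , deg = x ∷ B , unique-∷ (λ p → proj₂ (mem p) (inj₁ refl)) uB
      , (λ { (here refl) → x∈ ; (there p) → proj₁ (mem p) })
      , ≤-trans size (≤-trans (+-monoˡ-≤ 5 lB) (≤-reflexive (five (length B))))
      , λ { (here refl) (here refl) → nf x∈
          ; (here refl) (there p) → (λ e → proj₂ (mem p) (inj₂ (inj₁ (sym e)))) , (λ e → proj₂ (mem p) (inj₂ (inj₂ (inj₁ (sym e)))))
          ; (there p) (here refl) → (λ e → proj₂ (mem p) (inj₂ (inj₂ (inj₂ (inj₁ e))))) , (λ e → proj₂ (mem p) (inj₂ (inj₂ (inj₂ (inj₂ e)))))
          ; (there p) (there p′) → iB p p′ }
    where
    Bad : V → Set
    Bad y = y ≡ x ⊎ y ≡ f x ⊎ y ≡ g x ⊎ f y ≡ x ⊎ g y ≡ x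
    bad? : ∀ y → Dec (Bad y)
    bad? y = (y ≟ x) ⊎-dec ((y ≟ f x) ⊎-dec ((y ≟ g x) ⊎-dec ((f y ≟ x) ⊎-dec (g y ≟ x))))
    X′ = filter (λ y → ¬? (bad? y)) X
    five : ∀ b → 5 * b + 5 ≡ 5 * suc b
    five = solve-∀
    -- One for `x`, two for its out-neighbours, and two for its in-neighbours by the choice of `x`
    -- through averaging; this is the factor 5 of the statement.
    #bad : # bad? X ≤ 5
    #bad = ≤-trans (#-⊎ (_≟ x) _ X) (+-mono-≤ (#≡≤1 u x)
      (≤-trans (#-⊎ (_≟ f x) _ X) (+-mono-≤ (#≡≤1 u (f x))
      (≤-trans (#-⊎ (_≟ g x) _ X) (+-mono-≤ (#≡≤1 u (g x))
      (≤-trans (#-⊎ (λ y → f y ≟ x) (λ y → g y ≟ x) X) deg))))))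
    size : length X ≤ length X′ + 5
    size = ≤-trans (≤-reflexive (trans (sym (#-¬ bad? X)) (+-comm (# bad? X) _)))
      (+-mono-≤ (≤-reflexive (sym (length-filter≡# (λ y → ¬? (bad? y)) X))) #bad)
    smaller : length X′ ≤ n
    smaller = ≤-pred (≤-trans (unique-⊆-length (unique-∷ (λ p → proj₂ (filter-∈ (λ y → ¬? (bad? y)) X p) (inj₁ refl)) (unique-filter (λ y → ¬? (bad? y)) u))
      (λ { (here refl) → x∈ ; (there p) → proj₁ (filter-∈ (λ y → ¬? (bad? y)) X p) })) le)
    rec = independent n f g X′ smaller (unique-filter (λ y → ¬? (bad? y)) u) (λ p → nf (proj₁ (filter-∈ (λ y → ¬? (bad? y)) X p)))
    B = proj₁ rec
    uB = proj₁ (proj₂ rec)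
    lB = proj₁ (proj₂ (proj₂ (proj₂ rec)))
    iB = proj₂ (proj₂ (proj₂ (proj₂ rec)))
    mem : ∀ {y} → y ∈ B → y ∈ X × ¬ Bad y
    mem p = filter-∈ (λ y → ¬? (bad? y)) X (proj₁ (proj₂ (proj₂ rec)) p)

  module _ {Adj : V → V → Set} (adj? : ∀ x y → Dec (Adj x y)) (adj-sym : ∀ {x y} → Adj x y → Adj y x)
           (s₀ m : ℕ) (1≤s₀ : 1 ≤ s₀) (1≤m : 1 ≤ m) where

    deg : V → List V → ℕ
    deg v W = # (adj? v) W

    h : ℕ
    h = s₀ * m

    -- Greedily add a vertex with many deficient neighbours.
    dominating : ∀ {U} → Unique U → (∀ {v} → v ∈ U → s₀ + h * m ≤ deg v U) →
      ∃ λ A → Unique A × A ⊆ U × length A * m ≤ 2 * length U × (∀ {v} → v ∈ U → v ∉ A → s₀ ≤ deg v A)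
    dominating {U} u big = grow (length U) [] [] (λ ()) (m≤m+n _ _)
        (≤-reflexive (trans (∑-const U s₀) (*-comm (length U) s₀)))
      where
      n = length U
      -- The total missing degree, at most `s₀ * n` at the start. A vertex with `h` deficient
      -- neighbours lowers it by at least `h`, so the invariant bounds `length A * h`.
      dfc : List V → ℕ
      dfc A = ∑ U (λ v → s₀ ∸ deg v A)
      grow : ∀ k A → Unique A → A ⊆ U → n ≤ k + length A → length A * h + dfc A ≤ s₀ * n →
        ∃ λ A → Unique A × A ⊆ U × length A * m ≤ 2 * n × (∀ {v} → v ∈ U → v ∉ A → s₀ ≤ deg v A)
      grow k A uA A⊆ fuel inv with length (filter (λ v → deg v A <? s₀) U) * m ≤? n
      -- All deficient vertices join `A`. The greedy part, by the invariant, and the deficient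
      -- vertices, by `few`, each have at most `n / m` elements, whence the factor 2.
      ... | yes few = A ++ E , unique-++ uA (unique-filter _ (unique-filter _ u)) (λ p p′ → proj₂ (filter-∈ (λ v → ¬? (v ∈? A)) Df p′) p)
            , (λ p → [ A⊆ , (λ p′ → proj₁ (filter-∈ (λ v → deg v A <? s₀) U (proj₁ (filter-∈ (λ v → ¬? (v ∈? A)) Df p′)))) ]′ (∈-++⁻ A p))
            , bound , good
        where
        Df = filter (λ v → deg v A <? s₀) U
        E = filter (λ v → ¬? (v ∈? A)) Df
        Am≤ : length A * m ≤ n
        Am≤ = *-cancelˡ-≤ s₀ {{>-nonZero 1≤s₀}} (≤-trans (≤-reflexive (eq (length A) s₀ m)) (≤-trans (m≤m+n _ _) inv))
          where eq : ∀ a b c → b * (a * c) ≡ a * (b * c)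
                eq = solve-∀
        bound : length (A ++ E) * m ≤ 2 * n
        bound = ≤-trans (≤-reflexive (trans (cong (_* m) (length-++ A)) (*-distribʳ-+ m (length A) (length E))))
          (≤-trans (+-mono-≤ Am≤ (≤-trans (*-monoˡ-≤ m (≤-trans (≤-reflexive (length-filter≡# _ Df)) (#≤length _ Df))) few))
            (≤-reflexive (cong (n +_) (sym (+-identityʳ n)))))
        good : ∀ {v} → v ∈ U → v ∉ A ++ E → s₀ ≤ deg v (A ++ E)
        good {v} v∈ v∉ with deg v A <? s₀
        ... | yes lt = ⊥-elim (v∉ (∈-++⁺ʳ A (∈-filter⁺ (λ v → ¬? (v ∈? A)) (∈-filter⁺ (λ v → deg v A <? s₀) v∈ lt) (v∉ ∘ ∈-++⁺ˡ))))
        ... | no ¬lt = ≤-trans (≮⇒≥ ¬lt) (≤-trans (m≤m+n _ _) (≤-reflexive (sym (∑-++ A E _))))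
      -- Each deficient vertex has at least `h * m` neighbours outside `A`. With more than `n / m`
      -- deficient vertices, some vertex outside `A` therefore has at least `h` deficient
      -- neighbours.
      ... | no many with anyL? (λ x → h ≤? deg x (filter (λ v → deg v A <? s₀) U)) (filter (λ v → ¬? (v ∈? A)) U)
      ...   | no none = ⊥-elim (1+n≰n (≤-trans (+-monoˡ-≤ (n * h) (*-mono-≤ 1≤s₀ 1≤m)) (≤-trans (*-monoˡ-≤ h (≰⇒> many)) (≤-trans (≤-reflexive (eq (length Df) m h)) count))))
        where
        Df = filter (λ v → deg v A <? s₀) U
        U′ = filter (λ v → ¬? (v ∈? A)) U
        eq : ∀ a b c → a * b * c ≡ a * (c * b)
        eq = solve-∀
        each : ∀ v → v ∈ Df → h * m ≤ deg v U′
        each v v∈ = +-cancelˡ-≤ s₀ _ _ (≤-trans (big v∈U) (≤-trans split (≤-trans (+-monoˡ-≤ _ (<⇒≤ lt)) ≤-refl)))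
          where
          v∈U = proj₁ (filter-∈ (λ v → deg v A <? s₀) U v∈)
          lt = proj₂ (filter-∈ (λ v → deg v A <? s₀) U v∈)
          split : deg v U ≤ deg v A + deg v U′
          split = ≤-trans (#-⊆ (adj? v) (adj? v) {ys = A ++ U′} u λ {x} x∈ a → (case x ∈? A of λ
            { (yes p) → ∈-++⁺ˡ p ; (no p) → ∈-++⁺ʳ A (∈-filter⁺ (λ v → ¬? (v ∈? A)) x∈ p) }) , a) (≤-reflexive (∑-++ A U′ _))
        count : length Df * (h * m) ≤ n * h
        count = ≤-trans (≤-reflexive (sym (∑-const Df (h * m))))
          (≤-trans (∑-mono Df each)
          (≤-trans (≤-reflexive (∑-swap Df U′ (λ v x → ind (adj? v x))))
          (≤-trans (∑-mono U′ (λ x x∈ → ≤-trans (#-mono (λ v → adj? v x) (adj? x) Df (λ _ _ → adj-sym))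
                     (<⇒≤ (≰⇒> λ le → none (lose x∈ le)))))
          (≤-trans (≤-reflexive (∑-const U′ h)) (*-monoˡ-≤ h (≤-trans (≤-reflexive (length-filter≡# _ U)) (#≤length _ U)))))))
      ...   | yes some with find some
      ...     | x , x∈ , hx = next k fuel
        where
        Df = filter (λ v → deg v A <? s₀) U
        x∈U = proj₁ (filter-∈ (λ v → ¬? (v ∈? A)) U x∈)
        x∉A = proj₂ (filter-∈ (λ v → ¬? (v ∈? A)) U x∈)
        uA′ : Unique (x ∷ A)
        uA′ = unique-∷ x∉A uA
        A′⊆ : x ∷ A ⊆ U
        A′⊆ (here refl) = x∈U
        A′⊆ (there p)   = A⊆ p
        point : ∀ v → s₀ ∸ deg v (x ∷ A) + ind ((deg v A <? s₀) ×-dec adj? x v) ≤ s₀ ∸ deg v A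
        point v with deg v A <? s₀ | adj? x v | adj? v x
        ... | no _   | _     | yes _ = ≤-trans (≤-reflexive (+-identityʳ _)) (∸-monoʳ-≤ s₀ (n≤1+n (deg v A)))
        ... | no _   | _     | no _  = ≤-reflexive (+-identityʳ _)
        ... | yes _  | no _  | yes _ = ≤-trans (≤-reflexive (+-identityʳ _)) (∸-monoʳ-≤ s₀ (n≤1+n (deg v A)))
        ... | yes _  | no _  | no _  = ≤-reflexive (+-identityʳ _)
        ... | yes lt | yes a | no ¬b = ⊥-elim (¬b (adj-sym a))
        ... | yes lt | yes a | yes _ = ≤-reflexive (trans (+-comm (s₀ ∸ suc (deg v A)) 1) (suc-∸ lt))
          where suc-∸ : ∀ {a b} → a < b → suc (b ∸ suc a) ≡ b ∸ a
                suc-∸ {zero}  {suc b} _       = refl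
                suc-∸ {suc a} {suc b} (s≤s p) = suc-∸ p
        less : dfc (x ∷ A) + h ≤ dfc A
        less = ≤-trans (+-monoʳ-≤ (dfc (x ∷ A)) (≤-trans hx (≤-reflexive (#-filter (λ v → deg v A <? s₀) (adj? x) U))))
          (≤-trans (≤-reflexive (sym (∑-+ U _ _))) (∑-mono U (λ v _ → point v)))
        inv′ : length (x ∷ A) * h + dfc (x ∷ A) ≤ s₀ * n
        inv′ = ≤-trans (lin 0 less (eq h (length A) (dfc (x ∷ A)) (dfc A))) inv
          where eq : ∀ a b c e → suc b * a + c + e + 0 ≡ b * a + e + (c + a)
                eq = solve-∀
        next : ∀ k → n ≤ k + length A →
          ∃ λ A → Unique A × A ⊆ U × length A * m ≤ 2 * n × (∀ {v} → v ∈ U → v ∉ A → s₀ ≤ deg v A)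
        next zero    f = ⊥-elim (1+n≰n (≤-trans (unique-⊆-length uA′ A′⊆) f))
        next (suc k) f = grow k (x ∷ A) uA′ A′⊆ (≤-trans f (≤-reflexive (sym (+-suc k (length A))))) inv′

-- Graphs closed under the closure operator

record FlatGraph {V : Set} (S : SymRank V) : Set₁ where
  open SymRankTheory S
  field
    Adj     : V → V → Set
    adj?    : ∀ x y → Dec (Adj x y)
    adj-sym : ∀ {x y} → Adj x y → Adj y x
    adj-irr : ∀ {x} → ¬ Adj x x
    closed  : ∀ {X u w} → (∀ {x y} → (x , y) ∈ X → Adj x y) → u ≢ w → Cl X (u , w) → Adj u w

module FlatGraphTheory {V : Set} (S : SymRank V) (Gr : Growing S) (Fl : FlatGraph S) where
  open GrowingTheory S Gr
  open FlatGraph Fl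

  abstract
    Y : List V → List P
    Y U = filter (λ e → adj? (proj₁ e) (proj₂ e)) (K U)

    Y⁺ : ∀ {U x y} → x ∈ U → y ∈ U → Adj x y → (x , y) ∈ Y U
    Y⁺ p q a = ∈-filter⁺ (λ e → adj? (proj₁ e) (proj₂ e)) (K⁺ p q) a

    Y⁻ : ∀ {U x y} → (x , y) ∈ Y U → x ∈ U × y ∈ U × Adj x y
    Y⁻ {U} p with filter-∈ (λ e → adj? (proj₁ e) (proj₂ e)) (K U) p
    ... | k , a = proj₁ (K⁻ k) , proj₂ (K⁻ k) , a

  Y⊆K : ∀ {U} → Y U ⊆ K U
  Y⊆K {U} {x , y} p = K⁺ (proj₁ (Y⁻ p)) (proj₁ (proj₂ (Y⁻ p)))

  Y-mono : ∀ {U U′} → U ⊆ U′ → Y U ⊆ Y U′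
  Y-mono s {x , y} p with Y⁻ p
  ... | a , b , c = Y⁺ (s a) (s b) c

  Y-≤ρ : ∀ {U} → Unique U → r (Y U) ≤ ρ (length U)
  Y-≤ρ u = ≤-trans (r-mono Y⊆K) (≤-reflexive (rK u))

  deg′ : V → List V → ℕ
  deg′ v W = # (adj? v) W

  nbrs : V → List V → List V
  nbrs v W = filter (adj? v) W

  nbrs-len : ∀ v W → length (nbrs v W) ≡ deg′ v W
  nbrs-len v W = length-filter≡# (adj? v) W

  star+Y : ∀ {x W U} → W ⊆ U → star x (nbrs x W) ++ Y U ⊆ Y (x ∷ U)
  star+Y {x} {W} {U} s {a , b} p with ∈-++⁻ (star x (nbrs x W)) p
  ... | inj₂ k = Y-mono there k
  ... | inj₁ k with star⁻ k
  ...   | refl , b∈ with filter-∈ (adj? x) W b∈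
  ...     | b∈W , ad = Y⁺ (here refl) (there (s b∈W)) ad

  -- `D` neighbours are enough for the full increment, because no increment exceeds `D`.
  add-vertex : ∀ {x U W} → Unique (x ∷ U) → Unique W → W ⊆ U → D ≤ deg′ x W → r (Y U) + d (length U) ≤ r (Y (x ∷ U))
  add-vertex {x} {U} {W} u uW s le = ≤-trans (+-monoʳ-≤ (r (Y U)) (⊓-glb (≤-trans dU (≤-trans le (≤-reflexive (sym (nbrs-len x W))))) ≤-refl))
    (≤-trans (gain (nbrs x W) u (unique-filter (adj? x) uW) (λ p → s (proj₁ (filter-∈ (adj? x) W p))) Y⊆K) (r-mono (star+Y s)))
    where dU : d (length U) ≤ D
          dU = d≤D (length U) (length≤pool u)

  build : ∀ Q {W} → Unique (Q ++ W) → Unique W → (∀ {x} → x ∈ Q → D ≤ deg′ x W) →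
          r (Y W) + ρ (length Q + length W) ≤ r (Y (Q ++ W)) + ρ (length W)
  build []      u uW h = ≤-refl
  build (x ∷ Q) {W} u uW h = lin 0 (+-mono-≤ (build Q (unique-tail u) uW (h ∘ there)) (add-vertex u uW (∈-++⁺ʳ Q) (h (here refl))))
      (trans (cong (λ z → r (Y W) + z + (r (Y (Q ++ W)) + ρ (length W) + r (Y (x ∷ Q ++ W))) + 0) (trans (ρ-suc (length Q + length W)) (cong (λ z → ρ (length Q + length W) + d z) (sym (length-++ Q)))))
        (eq (r (Y W)) (ρ (length Q + length W)) (r (Y (Q ++ W))) (ρ (length W)) (d (length (Q ++ W))) (r (Y (x ∷ Q ++ W)))))
    where eq : ∀ a b c e f g → a + (b + f) + (c + e + g) + 0 ≡ g + e + (a + b + (c + f))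
          eq = solve-∀

  -- As `build`, but every vertex of `Q` sees two non-adjacent vertices of `W`. Flatness makes that
  -- pair unspanned, so `ext` applies: the price is a shift of the orders by `q`, the reward one
  -- unit for each vertex of `Q`.
  build⁺ : ∀ Q {W} → Unique (Q ++ W) → Unique W → length (Q ++ W) + q ≤ length pool →
           (∀ {x} → x ∈ Q → D ≤ deg′ x W × ∃ λ u → ∃ λ w → u ∈ W × w ∈ W × Adj x u × Adj x w × u ≢ w × ¬ Adj u w) →
           r (Y W) + ρ (length Q + length W + q) + length Q ≤ r (Y (Q ++ W)) + ρ (length W + q)
  build⁺ []      u uW cap h = ≤-reflexive (+-identityʳ _)
  build⁺ (x ∷ Q) {W} uQ uW cap h with h (here refl)
  ... | le , u , w , u∈ , w∈ , au , aw , u≢w , ¬uw =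
    lin 0 (+-mono-≤ (build⁺ Q (unique-tail uQ) uW (≤-trans (n≤1+n _) cap) (h ∘ there)) step)
      (trans (cong (λ z → r (Y W) + z + suc (length Q) + (r (Y (Q ++ W)) + ρ (length W + q) + r (Y (x ∷ Q ++ W))) + 0) (trans (ρ-suc (length Q + length W + q)) (cong (λ z → ρ (length Q + length W + q) + d (z + q)) (sym (length-++ Q)))))
        (eq (r (Y W)) (ρ (length Q + length W + q)) (d (length (Q ++ W) + q)) (length Q) (r (Y (Q ++ W))) (ρ (length W + q)) (r (Y (x ∷ Q ++ W)))))
    where
    eq : ∀ a b c e f g k → a + (b + c) + suc e + (f + g + k) + 0 ≡ k + g + (a + b + e + (f + suc c))
    eq = solve-∀
    step : r (Y (Q ++ W)) + suc (d (length (Q ++ W) + q)) ≤ r (Y (x ∷ Q ++ W))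
    step = ≤-trans (ext (nbrs x W) uQ (unique-filter (adj? x) uW) (λ p → ∈-++⁺ʳ Q (proj₁ (filter-∈ (adj? x) W p))) Y⊆K
        (≤-trans le (≤-reflexive (sym (nbrs-len x W)))) (∈-filter⁺ (adj? x) u∈ au) (∈-filter⁺ (adj? x) w∈ aw)
        (λ c → ¬uw (closed (λ p → proj₂ (proj₂ (Y⁻ p))) u≢w c)) (≤-trans (≤-reflexive (+-suc (length (Q ++ W)) q)) cap))
      (r-mono (star+Y (∈-++⁺ʳ Q)))

  -- The non-simplicial vertices: two neighbours in `U` are distinct and non-adjacent.
  NS : List V → V → Set
  NS U v = ∃ λ x → x ∈ U × ∃ λ y → y ∈ U × (Adj v x × Adj v y × x ≢ y × ¬ Adj x y)

  NS? : ∀ U v → Dec (NS U v)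
  NS? U v = map′ (λ a → let (x , p , b) = find a ; (y , q , c) = find b in x , p , y , q , c)
                 (λ { (x , p , y , q , c) → lose p (lose q c) })
    (anyL? (λ x → anyL? (λ y → adj? v x ×-dec adj? v y ×-dec ¬? (x ≟ y) ×-dec ¬? (adj? x y)) U) U)

  simplicial : ∀ {U v x y} → ¬ NS U v → x ∈ U → y ∈ U → Adj v x → Adj v y → x ≢ y → Adj x y
  simplicial {x = x} {y} h p q a b n with adj? x y
  ... | yes e = e
  ... | no ¬e = ⊥-elim (h (x , p , y , q , a , b , n , ¬e))

  1≤q : 1 ≤ q
  1≤q = ≤-trans (s≤s z≤n) 2≤q

  1≤D : 1 ≤ D
  1≤D = ≤-trans 1≤q (m≤m+n q q)

  D≤β₂ : D ≤ β₂
  D≤β₂ = ≤-trans (m≤m+n D _) (≤-reflexive (sym β₂≡))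

  -- Build the graph from a small dominating set `A`, adding last an independent fifth `B` of the
  -- non-simplicial vertices, which gains a surplus unit for each vertex outside `A`. Ten times this
  -- surplus is at least twice the number of non-simplicial vertices, while `A` costs at most the
  -- order of the graph; the difference is the number of non-simplicial minus the number of
  -- simplicial vertices.
  terminal : ∀ {U} → Unique U → length U + q ≤ length pool → (∀ {v} → v ∈ U → β₂ ≤ deg′ v U) →
    10 * ρ (length U) + # (NS? U) U ≤ 10 * r (Y U) + # (λ v → ¬? (NS? U v)) U + 10 * (D * q)
  terminal {U} u cap big with SparseSets.dominating _≟_ adj? adj-sym D m 1≤D (subst (1 ≤_) (sym m≡) (s≤s z≤n)) u (λ p → ≤-trans (≤-reflexive (sym β₂≡)) (big p))
  ... | A , uA , A⊆ , lA , dom = concl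
    where
    nsL = filter (NS? U) U
    -- Two non-adjacent neighbours of a non-simplicial vertex; the default `v` never occurs on
    -- `nsL`. `B` avoids these neighbours, so they are already present when `B` is added.
    f g : V → V
    f v with NS? U v
    ... | yes (x , _) = x
    ... | no _ = v
    g v with NS? U v
    ... | yes (_ , _ , y , _) = y
    ... | no _ = v
    fg : ∀ {v} → v ∈ nsL → f v ∈ U × g v ∈ U × Adj v (f v) × Adj v (g v) × f v ≢ g v × ¬ Adj (f v) (g v)
    fg {v} p with NS? U v
    ... | yes (x , x∈ , y , y∈ , a , b , n , e) = x∈ , y∈ , a , b , n , e
    ... | no ¬ns = ⊥-elim (¬ns (proj₂ (filter-∈ (NS? U) U p)))
    ind-set = SparseSets.independent _≟_ (length nsL) f g nsL ≤-refl (unique-filter (NS? U) u)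
      (λ {x} p → let (_ , _ , a , b , _) = fg p in (λ e → adj-irr (subst (Adj x) e a)) , (λ e → adj-irr (subst (Adj x) e b)))
    B = proj₁ ind-set
    uB = proj₁ (proj₂ ind-set)
    B⊆ = proj₁ (proj₂ (proj₂ ind-set))
    lB = proj₁ (proj₂ (proj₂ (proj₂ ind-set)))
    iB = proj₂ (proj₂ (proj₂ (proj₂ ind-set)))
    R? : ∀ x → Dec (¬ (x ∈ A) × ¬ (x ∈ B))
    R? x = ¬? (x ∈? A) ×-dec ¬? (x ∈? B)
    R = filter R? U
    B′ = filter (λ x → ¬? (x ∈? A)) B
    W = R ++ A
    R∈ : ∀ {x} → x ∈ R → x ∈ U × ¬ (x ∈ A) × ¬ (x ∈ B)
    R∈ p = filter-∈ R? U p
    B′∈ : ∀ {x} → x ∈ B′ → x ∈ B × ¬ (x ∈ A)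
    B′∈ p = filter-∈ (λ x → ¬? (x ∈? A)) B p
    uW : Unique W
    uW = unique-++ (unique-filter R? u) uA (λ p p′ → proj₁ (proj₂ (R∈ p)) p′)
    uBW : Unique (B′ ++ W)
    uBW = unique-++ (unique-filter (λ x → ¬? (x ∈? A)) uB) uW λ p p′ → case ∈-++⁻ R p′ of λ
      { (inj₁ t) → proj₂ (proj₂ (R∈ t)) (proj₁ (B′∈ p)) ; (inj₂ t) → proj₂ (B′∈ p) t }
    B∈U : ∀ {x} → x ∈ B → x ∈ U
    B∈U p = proj₁ (filter-∈ (NS? U) U (B⊆ p))
    BW⊆ : B′ ++ W ⊆ U
    BW⊆ p = [ (λ t → B∈U (proj₁ (B′∈ t))) , (λ t → [ (λ s → proj₁ (R∈ s)) , A⊆ ]′ (∈-++⁻ R t)) ]′ (∈-++⁻ B′ p)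
    inW : ∀ {x} → x ∈ U → ¬ (x ∈ B) → x ∈ W
    inW {x} p n = case x ∈? A of λ { (yes a) → ∈-++⁺ʳ R a ; (no a) → ∈-++⁺ˡ (∈-filter⁺ R? p (a , n)) }
    ⊆BW : U ⊆ B′ ++ W
    ⊆BW {x} p = case x ∈? B of λ { (no b) → ∈-++⁺ʳ B′ (inW p b) ; (yes b) → case x ∈? A of λ
      { (yes a) → ∈-++⁺ʳ B′ (∈-++⁺ʳ R a) ; (no a) → ∈-++⁺ˡ (∈-filter⁺ (λ x → ¬? (x ∈? A)) b a) } }
    n = length U
    n≤ : n ≤ length B′ + length W
    n≤ = ≤-trans (unique-⊆-length u ⊆BW) (≤-reflexive (length-++ B′))
    cap′ : length (B′ ++ W) + q ≤ length pool
    cap′ = ≤-trans (+-monoˡ-≤ q (unique-⊆-length uBW BW⊆)) cap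
    step₁ = build R {A} uW uA (λ p → dom (proj₁ (R∈ p)) (proj₁ (proj₂ (R∈ p))))
    step₂ = build⁺ B′ {W} uBW uW cap′ λ {x} p →
      let (x∈B , x∉A) = B′∈ p ; (a , b , c , e , n , k) = fg (B⊆ x∈B) in
      ≤-trans (dom (B∈U x∈B) x∉A) (≤-trans (m≤n+m _ _) (≤-reflexive (sym (∑-++ R A _)))) ,
      f x , g x , inW a (λ t → proj₁ (iB x∈B t) refl) , inW b (λ t → proj₂ (iB x∈B t) refl) , c , e , n , k
    W≤ : length W + q ≤ length pool
    W≤ = ≤-trans (+-monoˡ-≤ q (≤-trans (m≤n+m (length W) (length B′)) (≤-reflexive (sym (length-++ B′))))) cap′
    main : ρ n + length B′ ≤ r (Y U) + D * length A + D * q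
    main = lin 0 (+-mono-≤ (+-mono-≤ (+-mono-≤ step₁ step₂) (+-mono-≤ (r-mono (Y-mono BW⊆)) (ρ-mono (≤-trans n≤ (m≤m+n _ q)))))
                   (+-mono-≤ (≤-trans (≤-trans (≤-reflexive (cong ρ (+-comm (length W) q))) (ρ-upper (length W) q (≤-trans (≤-reflexive (+-comm q _)) W≤))) (≤-reflexive (cong (λ z → ρ z + D * q) (length-++ R))))
                     (+-mono-≤ ρA (z≤n {r (Y A)}))))
      (eq (ρ n) (length B′) (r (Y U)) (D * length A) (D * q) (r (Y A)) (ρ (length R + length A)) (r (Y W)) (ρ (length A))
          (ρ (length B′ + length W + q)) (r (Y (B′ ++ W))) (ρ (length W + q)))
      where
      ρA : ρ (length A) ≤ D * length A
      ρA = ≤-trans (≤-reflexive (cong ρ (sym (+-identityʳ (length A))))) (≤-trans (ρ-upper 0 (length A) (≤-trans (≤-reflexive (+-identityʳ _)) (length≤pool uA)))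
             (≤-reflexive (cong (_+ D * length A) ρ-0)))
      eq : ∀ a b c e f g h i j k l o → a + b + ((i + j + (l + o) + (c + k) + ((h + f) + (e + g)))) + 0
           ≡ c + e + f + (g + h + (i + k + b) + (l + a) + (o + (j + 0)))
      eq = solve-∀
    concl : 10 * ρ n + # (NS? U) U ≤ 10 * r (Y U) + # (λ v → ¬? (NS? U v)) U + 10 * (D * q)
    concl = lin 0 (+-mono-≤ (+-mono-≤ (*-monoʳ-≤ 10 main) (*-monoʳ-≤ 10 B≤)) (+-mono-≤ (*-monoʳ-≤ 2 (≤-trans (≤-reflexive (sym (length-filter≡# (NS? U) U))) lB)) (+-mono-≤ lA′ (≤-reflexive (sym (#-¬ (NS? U) U))))))
      (eq (ρ n) (# (NS? U) U) (r (Y U)) (# (λ v → ¬? (NS? U v)) U) (D * q) (length B′) D (length A) (length B) n)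
      where
      B≤ : length B ≤ length B′ + length A
      B≤ = ≤-trans (unique-⊆-length uB (λ {x} p → case x ∈? A of λ { (yes a) → ∈-++⁺ʳ B′ a ; (no a) → ∈-++⁺ˡ (∈-filter⁺ (λ x → ¬? (x ∈? A)) p a) }))
        (≤-reflexive (length-++ B′))
      lA′ : 10 * (suc D * length A) ≤ n
      lA′ = *-cancelˡ-≤ 2 (≤-trans (≤-reflexive (trans (eq₂ (length A) D) (cong (length A *_) (sym m≡)))) lA)
        where eq₂ : ∀ a b → 2 * (10 * (suc b * a)) ≡ a * (20 * suc b)
              eq₂ = solve-∀
      eq : ∀ a b c e f g h i j k → 10 * a + b + (10 * (c + h * i + f) + 10 * (g + i) + (2 * (5 * j) + (k + (b + e)))) + 0
           ≡ 10 * c + e + 10 * f + (10 * (a + g) + 10 * j + (2 * b + (10 * (suc h * i) + k)))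
      eq = solve-∀

  -- Vertex sets (the classes of lab) with small boundaries; suc l bounds the defect of the rank.
  record Family (U : List V) : Set where
    field
      l      : ℕ
      lab    : V → Maybe (Fin (suc l))
      ∂      : Fin (suc l) → List V
      inhab  : ∀ i → ∃ λ x → x ∈ U × lab x ≡ just i
      ∂-size : ∀ i → length (∂ i) ≤ β₂
      ∂-nbr  : ∀ {x y i} → x ∈ U → y ∈ U → lab x ≡ just i → Adj x y → lab y ≡ just i ⊎ y ∈ ∂ i
      apart  : ∀ {x y i j} → x ∈ U → y ∈ U → lab x ≡ just i → lab y ≡ just j → Adj x y → i ≡ j
      defect : ρ (length U) ≤ r (Y U) + c₁ * suc l
      -- One part alone gives no allowance `κ` for the defect. So either the rank is full, or a
      -- vertex away from the class and its boundary permits splitting off a second part.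
      single : l ≡ 0 → ((∀ {x} → x ∈ U → (∃ λ i → lab x ≡ just i ⊎ x ∈ ∂ i)) × ρ (length U) ≤ r (Y U))
                       ⊎ (∃ λ x → x ∈ U × lab x ≡ nothing × (∀ i → x ∉ ∂ i))

  -- Each vertex that is picked discards itself and at most `β₂` neighbours.
  maximal : ∀ n Sx → length Sx ≤ n → Unique Sx → (∀ {x} → x ∈ Sx → deg′ x Sx ≤ β₂) →
    ∃ λ ws → Unique ws × ws ⊆ Sx × (∀ {a b} → a ∈ ws → b ∈ ws → ¬ Adj a b) × length Sx ≤ suc β₂ * length ws
  maximal n [] _ _ _ = [] , [] , (λ ()) , (λ ()) , z≤n
  maximal (suc n) Sx@(w ∷ Sx₀) (s≤s le) u small = w ∷ ws , unique-∷ (λ p → proj₂ (mem p) (inj₁ refl)) (proj₁ (proj₂ rec))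
      , (λ { (here refl) → here refl ; (there p) → proj₁ (mem p) })
      , (λ { (here refl) (here refl) → adj-irr ; (here refl) (there p) a → proj₂ (mem p) (inj₂ a)
           ; (there p) (here refl) a → proj₂ (mem p) (inj₂ (adj-sym a)) ; (there p) (there p′) → proj₁ (proj₂ (proj₂ (proj₂ rec))) p p′ })
      , ≤-trans size (≤-trans (+-monoˡ-≤ (suc β₂) (proj₂ (proj₂ (proj₂ (proj₂ rec))))) (≤-reflexive (eq (suc β₂) (length ws))))
    where
    bad? : ∀ y → Dec (y ≡ w ⊎ Adj w y)
    bad? y = (y ≟ w) ⊎-dec adj? w y
    Sx′ = filter (λ y → ¬? (bad? y)) Sx
    lt : length Sx′ ≤ n
    lt = ≤-pred (≤-trans (unique-⊆-length {xs = w ∷ Sx′} {ys = Sx} (unique-∷ (λ p → proj₂ (filter-∈ (λ y → ¬? (bad? y)) Sx p) (inj₁ refl)) (unique-filter (λ y → ¬? (bad? y)) u))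
      (λ { (here refl) → here refl ; (there p) → proj₁ (filter-∈ (λ y → ¬? (bad? y)) Sx p) })) (s≤s le))
    rec = maximal n Sx′ lt (unique-filter (λ y → ¬? (bad? y)) u) (λ {x} p →
      let x∈ = proj₁ (filter-∈ (λ y → ¬? (bad? y)) Sx p) in
      ≤-trans (#-⊆ (adj? x) (adj? x) (unique-filter (λ y → ¬? (bad? y)) u) (λ t a → proj₁ (filter-∈ (λ y → ¬? (bad? y)) Sx t) , a)) (small x∈))
    ws = proj₁ rec
    mem : ∀ {y} → y ∈ ws → y ∈ Sx × ¬ (y ≡ w ⊎ Adj w y)
    mem p = filter-∈ (λ y → ¬? (bad? y)) Sx (proj₁ (proj₂ (proj₂ rec)) p)
    size : length Sx ≤ length Sx′ + suc β₂
    size = ≤-trans (≤-reflexive (trans (sym (#-¬ bad? Sx)) (+-comm (# bad? Sx) _)))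
      (+-mono-≤ (≤-reflexive (sym (length-filter≡# (λ y → ¬? (bad? y)) Sx)))
        (≤-trans (#-⊎ (_≟ w) (adj? w) Sx) (+-mono-≤ (#≡≤1 u w) (small (here refl)))))
    eq : ∀ a b → a * b + a ≡ a * suc b
    eq = solve-∀

  -- Forces the existence of a simplicial vertex in `terminal-family`.
  10Dq<β₂ : 10 * (D * q) < β₂
  10Dq<β₂ = ≤-trans (+-mono-≤ 1≤D (≤-trans (≤-reflexive (eq D q)) (≤-trans (*-monoʳ-≤ D (*-mono-≤ 10≤m q≤m)) (≤-reflexive (sym (*-assoc D m m))))))
      (≤-reflexive (sym β₂≡))
    where
    eq : ∀ a b → 10 * (a * b) ≡ a * (10 * b)
    eq = solve-∀
    10≤m : 10 ≤ m
    10≤m = ≤-trans (lin (20 * D + 10) (z≤n {0}) (eq₂ D)) (≤-reflexive (sym m≡))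
      where eq₂ : ∀ d → 10 + 0 + (20 * d + 10) ≡ 20 * suc d + 0
            eq₂ = solve-∀
    q≤m : q ≤ m
    q≤m = ≤-trans (lin (39 * q + 20) (z≤n {0}) (eq₂ q)) (≤-reflexive (sym m≡))
      where eq₂ : ∀ q → q + 0 + (39 * q + 20) ≡ 20 * suc (q + q) + 0
            eq₂ = solve-∀

  -- The classes are single vertices, an independent set of simplicial vertices whose boundaries are
  -- their neighbourhoods. There are at most `suc β₂` simplicial vertices per class, so `terminal`
  -- bounds the defect by `c₁` per class.
  terminal-family : ∀ {U} → Unique U → 1 ≤ length U → length U + q ≤ length pool → (∀ {v} → v ∈ U → β₂ ≤ deg′ v U) →
    (∀ {v} → v ∈ U → ¬ NS U v → deg′ v U ≤ β₂) → Family U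
  terminal-family {U} u 1≤n cap big small with maximal (length Sx) Sx ≤-refl uSx
      (λ {x} p → let (x∈ , s) = filter-∈ (λ v → ¬? (NS? U v)) U p in
        ≤-trans (#-⊆ (adj? x) (adj? x) uSx (λ t a → proj₁ (filter-∈ (λ v → ¬? (NS? U v)) U t) , a)) (small x∈ s))
    where
    Sx = filter (λ v → ¬? (NS? U v)) U
    uSx = unique-filter (λ v → ¬? (NS? U v)) u
  -- Without simplicial vertices, `terminal` would exceed the rank of the complete graph unless the
  -- order is at most `10 * (D * q)`, which is below the minimum degree.
  ... | [] , _ , _ , _ , lS = ⊥-elim (<⇒≱ (≤-trans 10Dq<β₂ (≤-trans (big v∈) (#≤length (adj? v) U))) n≤)
    where
    v = proj₁ (nonempty {xs = U} 1≤n)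
    v∈ = proj₂ (nonempty {xs = U} 1≤n)
    none : # (λ v → ¬? (NS? U v)) U ≡ 0
    none = n≤0⇒n≡0 (≤-trans (≤-reflexive (sym (length-filter≡# (λ v → ¬? (NS? U v)) U))) (≤-trans lS (≤-reflexive (*-zeroʳ (suc β₂)))))
    n≤ : length U ≤ 10 * (D * q)
    n≤ = lin 0 (+-mono-≤ (terminal u cap big) (+-mono-≤ (*-monoʳ-≤ 10 (Y-≤ρ u)) (≤-reflexive (sym (trans (sym (cong (# (NS? U) U +_) none)) (#-¬ (NS? U) U))))))
      (trans (cong (λ z → length U + (10 * r (Y U) + z + 10 * (D * q) + (10 * ρ (length U) + (# (NS? U) U + 0))) + 0) none)
        (eq (length U) (r (Y U)) (D * q) (ρ (length U)) (# (NS? U) U)))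
      where eq : ∀ a b c e f → a + (10 * b + 0 + 10 * c + (10 * e + (f + 0))) + 0 ≡ 10 * c + (10 * e + f + (10 * b + a))
            eq = solve-∀
  ... | w₀ ∷ ws₀ , uws , ws⊆ , na , lS = record
    { l = length ws₀ ; lab = lab ; ∂ = ∂
    ; inhab = λ i → lookup ws i , ws∈U (∈-lookup i) , lab-lookup i
    ; ∂-size = λ i → ≤-trans (≤-reflexive (nbrs-len (lookup ws i) U)) (small (ws∈U (∈-lookup i)) (ws-s (∈-lookup i)))
    ; ∂-nbr = λ {x} {y} {i} x∈ y∈ e a → inj₂ (∈-filter⁺ (adj? (lookup ws i)) y∈ (subst (λ z → Adj z y) (sym (lab⁻ e)) a))
    ; apart = λ {x} {y} {i} {j} _ _ e e′ a → ⊥-elim (na (subst (_∈ ws) (lab⁻ e) (∈-lookup i)) (subst (_∈ ws) (lab⁻ e′) (∈-lookup j)) a)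
    ; defect = defect
    ; single = single }
    where
    Sx = filter (λ v → ¬? (NS? U v)) U
    ws = w₀ ∷ ws₀
    ws∈U : ∀ {x} → x ∈ ws → x ∈ U
    ws∈U p = proj₁ (filter-∈ (λ v → ¬? (NS? U v)) U (ws⊆ p))
    ws-s : ∀ {x} → x ∈ ws → ¬ NS U x
    ws-s p = proj₂ (filter-∈ (λ v → ¬? (NS? U v)) U (ws⊆ p))
    lab : V → Maybe (Fin (suc (length ws₀)))
    lab x with anyF? (λ i → lookup ws i ≟ x)
    ... | yes (i , _) = just i
    ... | no _ = nothing
    lab⁻ : ∀ {x i} → lab x ≡ just i → lookup ws i ≡ x
    lab⁻ {x} e with anyF? (λ i → lookup ws i ≟ x)
    lab⁻ refl | yes (i , p) = p
    lab-lookup : ∀ i → lab (lookup ws i) ≡ just i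
    lab-lookup i with anyF? (λ j → lookup ws j ≟ lookup ws i)
    ... | yes (j , p) = cong just (unique-lookup uws p)
    ... | no ¬p = ⊥-elim (¬p (i , refl))
    lab-no : ∀ {x} → x ∉ ws → lab x ≡ nothing
    lab-no {x} n with anyF? (λ i → lookup ws i ≟ x)
    ... | yes (i , p) = ⊥-elim (n (subst (_∈ ws) p (∈-lookup i)))
    ... | no _ = refl
    ∂ : Fin (suc (length ws₀)) → List V
    ∂ i = nbrs (lookup ws i) U
    defect : ρ (length U) ≤ r (Y U) + c₁ * suc (length ws₀)
    defect = *-cancelˡ-≤ 10 (lin (# (NS? U) U + 9 * (suc β₂ * suc (length ws₀)) + 10 * (D * q * length ws₀))
      (+-mono-≤ (terminal u cap big) (≤-trans (≤-reflexive (sym (length-filter≡# (λ v → ¬? (NS? U v)) U))) lS))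
      (trans (eq (ρ (length U)) (# (NS? U) U) (r (Y U)) (# (λ v → ¬? (NS? U v)) U) (D * q) (suc β₂) (length ws₀))
        (cong (λ z → 10 * (r (Y U) + z * suc (length ws₀)) + (10 * ρ (length U) + # (NS? U) U + # (λ v → ¬? (NS? U v)) U)) (sym c₁≡))))
      where eq : ∀ a b c e f g h → 10 * a + (10 * c + e + 10 * f + g * suc h) + (b + 9 * (g * suc h) + 10 * (f * h)) ≡ 10 * (c + (g + f) * suc h) + (10 * a + b + e)
            eq = solve-∀
    single : length ws₀ ≡ 0 → ((∀ {x} → x ∈ U → (∃ λ i → lab x ≡ just i ⊎ x ∈ ∂ i)) × ρ (length U) ≤ r (Y U))
                       ⊎ (∃ λ x → x ∈ U × lab x ≡ nothing × (∀ i → x ∉ ∂ i))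
    single e with anyL? (λ x → ¬? (x ∈? ws) ×-dec ¬? (adj? w₀ x)) U
    ... | yes a = let (x , x∈ , n , na′) = find a in inj₂ (x , x∈ , lab-no n , λ i p → na′ (subst (λ z → Adj z x) (only i) (proj₂ (filter-∈ (adj? (lookup ws i)) U p))))
      where only : ∀ i → lookup ws i ≡ w₀
            only i = go ws₀ e i
              where go : ∀ zs → length zs ≡ 0 → ∀ (i : Fin (suc (length zs))) → lookup (w₀ ∷ zs) i ≡ w₀
                    go [] _ fzero = refl
    -- Every vertex is `w₀` or one of its neighbours. As `w₀` is simplicial, the graph is complete.
    ... | no none = inj₁ ((λ {x} x∈ → cov x∈) , complete)
      where
      cov′ : ∀ {x} → x ∈ U → x ∈ ws ⊎ Adj w₀ x
      cov′ {x} x∈ with x ∈? ws | adj? w₀ x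
      ... | yes p | _ = inj₁ p
      ... | no _ | yes a = inj₂ a
      ... | no n | no a = ⊥-elim (none (lose x∈ (n , a)))
      cov : ∀ {x} → x ∈ U → ∃ λ i → lab x ≡ just i ⊎ x ∈ ∂ i
      cov {x} x∈ with cov′ x∈
      ... | inj₂ a = fzero , inj₂ (∈-filter⁺ (adj? w₀) x∈ a)
      ... | inj₁ p = let i = Any.index p in i , inj₁ (trans (cong lab (lookup-index p)) (lab-lookup i))
      ws-one : ∀ {x} → x ∈ ws → x ≡ w₀
      ws-one {x} p = go ws₀ e p
        where go : ∀ zs → length zs ≡ 0 → x ∈ w₀ ∷ zs → x ≡ w₀
              go [] _ (here p) = p
      all-adj : ∀ {x y} → x ∈ U → y ∈ U → x ≢ y → Adj x y
      all-adj {x} {y} x∈ y∈ n with cov′ x∈ | cov′ y∈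
      ... | inj₁ p | inj₁ p′ = ⊥-elim (n (trans (ws-one p) (sym (ws-one p′))))
      ... | inj₁ p | inj₂ a = subst (λ z → Adj z y) (sym (ws-one p)) a
      ... | inj₂ a | inj₁ p = adj-sym (subst (λ z → Adj z x) (sym (ws-one p)) a)
      ... | inj₂ a | inj₂ b = simplicial (ws-s (here refl)) x∈ y∈ a b n
      complete : ρ (length U) ≤ r (Y U)
      complete = ≤-trans (≤-reflexive (sym (rK u))) (span-≤ λ { {x , y} p → case x ≟ y of λ
        { (yes refl) → r-loop x (Y U) ; (no n) → cl-∈ (Y⁺ (proj₁ (K⁻ p)) (proj₂ (K⁻ p)) (all-adj (proj₁ (K⁻ p)) (proj₂ (K⁻ p)) n)) } })

  isJust? : ∀ {A : Set} (x : Maybe A) → Dec (∃ λ a → x ≡ just a)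
  isJust? (just a) = yes (a , refl)
  isJust? nothing  = no λ ()

  -- A simplicial vertex of large degree can be put back at no cost: it gains at least the increment
  -- of the complete graphs, so the defect does not grow. If it takes the label of a neighbour `z`,
  -- its other neighbours are neighbours of `z` and so lie in the class or its boundary.
  extend-family : ∀ {U v} → Unique U → v ∈ U → ¬ NS U v → β₂ < deg′ v U → Family (U ⊖ v) → Family U
  extend-family {U} {v} u v∈ sv big F = record
    { l = l ; lab = lab′ ; ∂ = ∂
    ; inhab = λ i → let (x , x∈ , e) = inhab i in x , in⁻ x∈ , trans (lab-≢ (ne x∈)) e
    ; ∂-size = ∂-size ; ∂-nbr = ∂-nbr′ ; apart = apart′ ; defect = defect′ ; single = single′ }
    where
    open Family F
    U′ = U ⊖ v
    uU′ : Unique U′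
    uU′ = unique-filter (λ y → ¬? (y ≟ v)) u
    in⁻ : ∀ {x} → x ∈ U′ → x ∈ U
    in⁻ p = proj₁ (∈-⊖⁻ U p)
    ne : ∀ {x} → x ∈ U′ → x ≢ v
    ne p = proj₂ (∈-⊖⁻ U p)
    seek = anyL? (λ y → adj? v y ×-dec isJust? (lab y)) U′
    new : Dec (Any (λ y → Adj v y × (∃ λ i → lab y ≡ just i)) U′) → Maybe (Fin (suc l))
    new (yes a) = just (proj₁ (proj₂ (proj₂ (proj₂ (find a)))))
    new (no _)  = nothing
    lab′ : V → Maybe (Fin (suc l))
    lab′ x with x ≟ v
    ... | yes _ = new seek
    ... | no _  = lab x
    lab-≢ : ∀ {x} → x ≢ v → lab′ x ≡ lab x
    lab-≢ {x} n with x ≟ v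
    ... | yes e = ⊥-elim (n e)
    ... | no _  = refl
    lab-v : lab′ v ≡ new seek
    lab-v with v ≟ v
    ... | yes _ = refl
    ... | no n  = ⊥-elim (n refl)
    -- all labelled neighbours of v carry one label, because they form a clique
    same : ∀ {x y i j} → x ∈ U′ → y ∈ U′ → lab x ≡ just i → lab y ≡ just j → Adj v x → Adj v y → i ≡ j
    same {x} {y} x∈ y∈ e e′ a b with x ≟ y
    ... | yes refl = just-inj (trans (sym e) e′)
      where just-inj : ∀ {A : Set} {a b : A} → just a ≡ just b → a ≡ b
            just-inj refl = refl
    ... | no n = apart x∈ y∈ e e′ (simplicial sv (in⁻ x∈) (in⁻ y∈) a b n)
    new-just : ∀ {i} → new seek ≡ just i → ∃ λ y → y ∈ U′ × Adj v y × lab y ≡ just i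
    new-just e with seek
    new-just refl | yes a = let (y , y∈ , ad , i , e) = find a in y , y∈ , ad , e
    new-from : ∀ {y i} → y ∈ U′ → Adj v y → lab y ≡ just i → new seek ≡ just i
    new-from y∈ a e with seek
    ... | yes s = let (z , z∈ , b , j , e′) = find s in cong just (same z∈ y∈ e′ e b a)
    ... | no n = ⊥-elim (n (lose y∈ (a , _ , e)))
    ∂-nbr′ : ∀ {x y i} → x ∈ U → y ∈ U → lab′ x ≡ just i → Adj x y → lab′ y ≡ just i ⊎ y ∈ ∂ i
    ∂-nbr′ {x} {y} {i} x∈ y∈ e a = go (x ≟ v) (y ≟ v)
      where
      go : Dec (x ≡ v) → Dec (y ≡ v) → lab′ y ≡ just i ⊎ y ∈ ∂ i
      go (yes refl) (yes refl) = ⊥-elim (adj-irr a)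
      go (yes refl) (no n) with new-just (trans (sym lab-v) e)
      ... | z , z∈ , b , ez with z ≟ y
      ...   | yes refl = inj₁ (trans (lab-≢ n) ez)
      ...   | no n′ = [ (λ t → inj₁ (trans (lab-≢ n) t)) , inj₂ ]′
                (∂-nbr z∈ (∈-⊖⁺ y∈ n) ez (simplicial sv (in⁻ z∈) y∈ b a n′))
      go (no n) (yes refl) = inj₁ (trans lab-v (new-from (∈-⊖⁺ x∈ n) (adj-sym a) (trans (sym (lab-≢ n)) e)))
      go (no n) (no n′) = [ (λ t → inj₁ (trans (lab-≢ n′) t)) , inj₂ ]′ (∂-nbr (∈-⊖⁺ x∈ n) (∈-⊖⁺ y∈ n′) (trans (sym (lab-≢ n)) e) a)
    apart′ : ∀ {x y i j} → x ∈ U → y ∈ U → lab′ x ≡ just i → lab′ y ≡ just j → Adj x y → i ≡ j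
    apart′ {x} {y} {i} {j} x∈ y∈ e e′ a = go (x ≟ v) (y ≟ v)
      where
      go : Dec (x ≡ v) → Dec (y ≡ v) → i ≡ j
      go (yes refl) (yes refl) = ⊥-elim (adj-irr a)
      go (yes refl) (no n) with new-just (trans (sym lab-v) e)
      ... | z , z∈ , b , ez = same z∈ (∈-⊖⁺ y∈ n) ez (trans (sym (lab-≢ n)) e′) b a
      go (no n) (yes refl) with new-just (trans (sym lab-v) e′)
      ... | z , z∈ , b , ez = same (∈-⊖⁺ x∈ n) z∈ (trans (sym (lab-≢ n)) e) ez (adj-sym a) b
      go (no n) (no n′) = apart (∈-⊖⁺ x∈ n) (∈-⊖⁺ y∈ n′) (trans (sym (lab-≢ n)) e) (trans (sym (lab-≢ n′)) e′) a
    deg-U′ : deg′ v U ≤ deg′ v U′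
    deg-U′ = #-⊆ (adj? v) (adj? v) u (λ x∈ a → ∈-⊖⁺ x∈ (λ { refl → adj-irr a }) , a)
    uvU′ : Unique (v ∷ U′)
    uvU′ = unique-∷ (λ p → ne p refl) uU′
    rise : r (Y U′) + ρ (length U) ≤ ρ (length U′) + r (Y U)
    rise = lin 0 (≤-trans (add-vertex uvU′ uU′ id (≤-trans D≤β₂ (≤-trans (<⇒≤ big) deg-U′))) (r-mono (Y-mono {v ∷ U′} {U} λ { (here refl) → v∈ ; (there p) → in⁻ p })))
      (trans (cong (λ z → r (Y U′) + z + r (Y U) + 0) (trans (cong ρ (length-⊖ u v∈)) (ρ-suc (length U′)))) (eq (r (Y U′)) (ρ (length U′)) (d (length U′)) (r (Y U))))
      where eq : ∀ a b c e → a + (b + c) + e + 0 ≡ b + e + (a + c)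
            eq = solve-∀
    defect′ : ρ (length U) ≤ r (Y U) + c₁ * suc l
    defect′ = lin 0 (+-mono-≤ rise defect) (eq (ρ (length U)) (ρ (length U′)) (r (Y U)) (r (Y U′)) (c₁ * suc l))
      where eq : ∀ a b c e f → a + (b + c + (e + f)) + 0 ≡ c + f + (e + a + b)
            eq = solve-∀
    single′ : l ≡ 0 → ((∀ {x} → x ∈ U → (∃ λ i → lab′ x ≡ just i ⊎ x ∈ ∂ i)) × ρ (length U) ≤ r (Y U))
                       ⊎ (∃ λ x → x ∈ U × lab′ x ≡ nothing × (∀ i → x ∉ ∂ i))
    single′ l0 with single l0
    ... | inj₂ (x , x∈ , e , n) = inj₂ (x , in⁻ x∈ , trans (lab-≢ (ne x∈)) e , n)
    ... | inj₁ (cov , full) = inj₁ ((λ {x} x∈ → cov′ x∈) , lin 0 (+-mono-≤ rise full) (eq (ρ (length U)) (ρ (length U′)) (r (Y U)) (r (Y U′))))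
      where
      eq : ∀ a b c e → a + (b + c + e) + 0 ≡ c + (e + a + b)
      eq = solve-∀
      one : ∀ {l} → l ≡ 0 → (i j : Fin (suc l)) → i ≡ j
      one refl fzero fzero = refl
      -- More than `β₂` neighbours cannot all lie in the boundary of the only class, so one of them
      -- is labelled.
      vlab : ∃ λ i → new seek ≡ just i
      vlab with seek
      ... | yes a = _ , refl
      ... | no none = ⊥-elim (<⇒≱ big (≤-trans deg-U′ (≤-trans (≤-reflexive (sym (nbrs-len v U′)))
              (≤-trans (unique-⊆-length {ys = ∂ fzero} (unique-filter (adj? v) uU′) sub) (∂-size fzero)))))
        where
        sub : nbrs v U′ ⊆ ∂ fzero
        sub {y} p with filter-∈ (adj? v) U′ p
        ... | y∈ , a with cov y∈
        ...   | i , inj₁ e = ⊥-elim (none (lose y∈ (a , i , e)))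
        ...   | i , inj₂ t = subst (λ k → y ∈ ∂ k) (one l0 i fzero) t
      cov′ : ∀ {x} → x ∈ U → ∃ λ i → lab′ x ≡ just i ⊎ x ∈ ∂ i
      cov′ {x} x∈ = go (x ≟ v)
        where
        go : Dec (x ≡ v) → ∃ λ i → lab′ x ≡ just i ⊎ x ∈ ∂ i
        go (yes refl) = proj₁ vlab , inj₁ (trans lab-v (proj₂ vlab))
        go (no n) with cov (∈-⊖⁺ x∈ n)
        ... | i , inj₁ e = i , inj₁ (trans (lab-≢ n) e)
        ... | i , inj₂ t = i , inj₂ t

  -- Simplicial vertices of degree above `β₂` are stripped off one by one; without any, the terminal
  -- case applies.
  family : ∀ n {U} → length U ≤ n → Unique U → 1 ≤ length U → length U + q ≤ length pool → (∀ {v} → v ∈ U → β₂ ≤ deg′ v U) → Family U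
  family zero le u 1≤n _ _ = ⊥-elim (1+n≰n (≤-trans 1≤n le))
  family (suc n) {U} le u 1≤n cap big with anyL? (λ v → ¬? (NS? U v) ×-dec (β₂ <? deg′ v U)) U
  ... | no none = terminal-family u 1≤n cap big (λ {v} v∈ s → ≮⇒≥ λ lt → none (lose v∈ (s , lt)))
  ... | yes a with find a
  ...   | v , v∈ , sv , lt = extend-family u v∈ sv lt (family n
            (≤-pred (≤-trans (≤-reflexive (sym (length-⊖ u v∈))) le)) (unique-filter (λ y → ¬? (y ≟ v)) u) 1≤
            (≤-trans (+-monoˡ-≤ q (≤-trans (n≤1+n _) (≤-reflexive (sym (length-⊖ u v∈))))) cap) big′)
    where
    U′ = U ⊖ v
    uU′ = unique-filter (λ y → ¬? (y ≟ v)) u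
    1≤ : 1 ≤ length U′
    1≤ = ≤-trans (≤-trans (s≤s z≤n) lt) (≤-trans (#-⊆ (adj? v) (adj? v) u (λ x∈ a → ∈-⊖⁺ x∈ (λ { refl → adj-irr a }) , a)) (#≤length (adj? v) U′))
    -- If `x` is a neighbour of the simplicial `v`, all other neighbours of `v` are neighbours of
    -- `x`, so at least `β₂` of them remain.
    big′ : ∀ {x} → x ∈ U′ → β₂ ≤ deg′ x U′
    big′ {x} x∈ with adj? v x
    ... | no ¬a = ≤-trans (big (proj₁ (∈-⊖⁻ U x∈))) (#-⊆ (adj? x) (adj? x) u (λ { y∈ a → ∈-⊖⁺ y∈ (λ { refl → ¬a (adj-sym a) }) , a }))
    ... | yes a = ≤-pred (≤-trans lt (≤-trans (#-⊆ (adj? v) (λ y → (y ≟ x) ⊎-dec adj? x y) {ys = U′} u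
          (λ {y} y∈ b → ∈-⊖⁺ y∈ (λ { refl → adj-irr b }) , (case y ≟ x of λ
             { (yes e) → inj₁ e ; (no n) → inj₂ (simplicial sv (proj₁ (∈-⊖⁻ U x∈)) y∈ a b (n ∘ sym)) })))
          (≤-trans (#-⊎ (_≟ x) (adj? x) U′) (+-monoˡ-≤ _ (#≡≤1 uU′ x)))))

-- Covering a graph by vertex sets and loose edges.

is? : ∀ {n} (x : Maybe (Fin n)) i → Dec (x ≡ just i)
is? nothing  i = no λ ()
is? (just j) i with j ≟F i
... | yes refl = yes refl
... | no n     = no λ { refl → n refl }

size : ∀ {A : Set} → List (List A) → ℕ
size Vs = ∑ Vs length

In : ∀ {V : Set} → V × V → List V → Set
In e W = proj₁ e ∈ W × proj₂ e ∈ W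

module Parts {V : Set} (S : SymRank V) (Gr : Growing S) where
  open GrowingTheory S Gr public

  -- Every vertex is worth at least one unit of rank, so giving up `c` vertices pays for a defect of
  -- `c`.
  ρ-∸ : ∀ {x} n c → n ≤ length pool → ρ n ≤ x + c → ρ (n ∸ c) ≤ x
  ρ-∸ {x} n c le h with suc c ≤? n
  ... | no ¬p = subst (λ z → ρ z ≤ x) (sym (m≤n⇒m∸n≡0 (≤-pred (≰⇒> ¬p)))) (≤-trans (≤-reflexive ρ-0) z≤n)
  ... | yes p = +-cancelˡ-≤ c _ _ (≤-trans (ρ-lower (n ∸ c) c (m<n⇒0<n∸m p) (≤-trans (≤-reflexive eq) le))
          (≤-trans (≤-reflexive (cong ρ eq)) (≤-trans h (≤-reflexive (+-comm x c)))))
    where eq : c + (n ∸ c) ≡ n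
          eq = m+[n∸m]≡n (<⇒≤ p)

  IsPart : List V → List V → Set
  IsPart U W = Unique W × W ⊆ U × suc β ≤ length W

  β₂≤κ : β₂ ≤ κ
  β₂≤κ = ≤-trans (m≤m+n β₂ _) (≤-reflexive (sym κ≡))

  κ≤β : κ ≤ β
  κ≤β = ≤-trans (m≤n*m κ 8) (≤-reflexive (sym β≡))

  module _ (Fl : FlatGraph S) where
    open FlatGraph Fl
    open FlatGraphTheory S Gr Fl

    -- Unless `U` itself is the only part, the parts are some classes with their boundaries and the
    -- complement of these classes. Each contains a vertex with all its neighbours, so it has more
    -- than `β` elements. Overlaps cost `β₂` per further part, and with `l ≥ 1` further parts the
    -- defect `c₁ * suc l` is at most `2 * c₁ * l`; this is why `κ` is `β₂ + (c₁ + c₁)`.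
    core-parts : ∀ {U} → Unique U → 1 ≤ length U → length U + q ≤ length pool → (∀ {v} → v ∈ U → β ≤ deg′ v U) →
      ∃ λ Vs → (∀ {W} → W ∈ Vs → IsPart U W) × (∀ {e} → In e U → Adj (proj₁ e) (proj₂ e) → Any (In e) Vs)
             × ρ (size Vs ∸ κ * (length Vs ∸ 1)) ≤ r (Y U)
    core-parts {U} u 1≤n cap big with family (length U) ≤-refl u 1≤n cap (λ p → ≤-trans (≤-trans β₂≤κ κ≤β) (big p))
    ... | F = go (Family.l F) refl
      where
      open Family F
      n = length U
      a : Fin (suc l) → ℕ
      a i = # (λ x → is? (lab x) i) U
      W? : ∀ i x → Dec (lab x ≡ just i ⊎ x ∈ ∂ i)
      W? i x = is? (lab x) i ⊎-dec (x ∈? ∂ i)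
      Wi : Fin (suc l) → List V
      Wi i = filter (W? i) U
      large : ∀ {x W} → x ∈ U → x ∈ W → (∀ {y} → y ∈ U → Adj x y → y ∈ W) → suc β ≤ length W
      large {x} {W} x∈ x∈W h = ≤-trans (s≤s (≤-trans (big x∈) (≤-reflexive (sym (nbrs-len x U)))))
        (unique-⊆-length {xs = x ∷ nbrs x U} (unique-∷ (λ p → adj-irr (proj₂ (filter-∈ (adj? x) U p))) (unique-filter (adj? x) u))
          (λ { (here refl) → x∈W ; (there p) → let (y∈ , ad) = filter-∈ (adj? x) U p in h y∈ ad }))
      Wi-part : ∀ i → IsPart U (Wi i)
      Wi-part i = unique-filter (W? i) u , (λ p → proj₁ (filter-∈ (W? i) U p)) ,
        (let (x , x∈ , e) = inhab i in large x∈ (∈-filter⁺ (W? i) x∈ (inj₁ e)) (λ y∈ ad → ∈-filter⁺ (W? i) y∈ (∂-nbr x∈ y∈ e ad)))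
      Wi-len : ∀ i → length (Wi i) ≤ a i + β₂
      Wi-len i = ≤-trans (≤-reflexive (length-filter≡# (W? i) U)) (≤-trans (#-⊎ (λ x → is? (lab x) i) (_∈? ∂ i) U)
        (+-monoʳ-≤ (a i) (≤-trans (#∈≤length u (∂ i)) (∂-size i))))
      Wi-in : ∀ {x y i} → x ∈ U → y ∈ U → lab x ≡ just i → Adj x y → x ∈ Wi i × y ∈ Wi i
      Wi-in {i = i} x∈ y∈ e ad = ∈-filter⁺ (W? i) x∈ (inj₁ e) , ∈-filter⁺ (W? i) y∈ (∂-nbr x∈ y∈ e ad)
      capn : n ≤ length pool
      capn = length≤pool u
      Goal : Set
      Goal = ∃ λ Vs → (∀ {W} → W ∈ Vs → IsPart U W) × (∀ {e} → In e U → Adj (proj₁ e) (proj₂ e) → Any (In e) Vs)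
             × ρ (size Vs ∸ κ * (length Vs ∸ 1)) ≤ r (Y U)
      go : ∀ k → l ≡ k → Goal
      go zero l0 with single l0
      ... | inj₁ (_ , full) = U ∷ [] , (λ { (here refl) → u , id , (let (x , x∈ , _) = inhab fzero in large x∈ x∈ (λ y∈ _ → y∈)) })
            , (λ p _ → here p) , ≤-trans (≤-reflexive (cong ρ (trans (cong (n + 0 ∸_) (*-zeroʳ κ)) (+-identityʳ n)))) full
      ... | inj₂ (x₀ , x₀∈ , e₀ , n₀) = Wi fzero ∷ V0 ∷ [] , (λ { (here refl) → Wi-part fzero ; (there (here refl)) → V0-part }) , cover , bound
        where
        none? : ∀ x → Dec (¬ (lab x ≡ just fzero))
        none? x = ¬? (is? (lab x) fzero)
        V0 = filter none? U
        one : ∀ {k} → k ≡ 0 → (i : Fin (suc k)) → i ≡ fzero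
        one refl fzero = refl
        V0-part : IsPart U V0
        V0-part = unique-filter none? u , (λ p → proj₁ (filter-∈ none? U p)) , large x₀∈
          (∈-filter⁺ none? x₀∈ (λ e → case trans (sym e₀) e of λ ()))
          (λ {y} y∈ ad → ∈-filter⁺ none? y∈ λ e → [ (λ t → case trans (sym e₀) t of λ ()) , n₀ fzero ]′ (∂-nbr y∈ x₀∈ e (adj-sym ad)))
        cover : ∀ {e} → In e U → Adj (proj₁ e) (proj₂ e) → Any (In e) (Wi fzero ∷ V0 ∷ [])
        cover {x , y} (x∈ , y∈) ad with is? (lab x) fzero | is? (lab y) fzero
        ... | yes e | _     = here (Wi-in x∈ y∈ e ad)
        ... | no _  | yes e = here (let (p , q) = Wi-in y∈ x∈ e (adj-sym ad) in q , p)
        ... | no p  | no q  = there (here (∈-filter⁺ none? x∈ p , ∈-filter⁺ none? y∈ q))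
        sz : length (Wi fzero) + (length V0 + 0) ≤ n + β₂
        sz = lin 0 (+-mono-≤ (Wi-len fzero) (≤-reflexive (trans (cong (_+ a fzero) (length-filter≡# none? U)) (trans (+-comm _ (a fzero)) (#-¬ (λ x → is? (lab x) fzero) U)))))
          (eq (length (Wi fzero)) (length V0) (a fzero) β₂ n)
          where eq : ∀ a b c e f → a + (b + 0) + (c + e + f) + 0 ≡ f + e + (a + (b + c))
                eq = solve-∀
        bound : ρ (length (Wi fzero) + (length V0 + 0) ∸ κ * 1) ≤ r (Y U)
        bound = ≤-trans (ρ-mono le) (ρ-∸ n c₁ capn (≤-trans defect (≤-reflexive (cong (r (Y U) +_) (trans (cong (λ z → c₁ * suc z) l0) (*-identityʳ c₁))))))
          where le : length (Wi fzero) + (length V0 + 0) ∸ κ * 1 ≤ n ∸ c₁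
                le = ≤-trans (∸-mono sz (≤-trans (+-monoʳ-≤ β₂ (m≤m+n c₁ c₁)) (≤-reflexive (trans (sym κ≡) (sym (*-identityʳ κ))))))
                  (≤-reflexive (trans (cong (_∸ (β₂ + c₁)) (+-comm n β₂)) ([m+n]∸[m+o]≡n∸o β₂ n c₁)))
      go (suc k) lk = V0 ∷ map Wi (filter pos? (allFin (suc l))) , (λ { (here refl) → V0-part ; (there p) → case ∈-map⁻ Wi p of λ { (i , _ , refl) → Wi-part i } })
                    , cover , bound
        where
        pos? : ∀ (i : Fin (suc l)) → Dec (i ≢ fzero)
        pos? i = ¬? (i ≟F fzero)
        Is : List (Fin (suc l))
        Is = filter pos? (allFin (suc l))
        uIs : Unique Is
        uIs = unique-filter pos? (Uniqueₚ.allFin⁺ (suc l))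
        Pos : V → Set
        Pos x = ∃ λ i → lab x ≡ just i × i ≢ fzero
        Pos? : ∀ x → Dec (Pos x)
        Pos? x = anyF? (λ i → is? (lab x) i ×-dec pos? i)
        V0 = filter (λ x → ¬? (Pos? x)) U
        lIs : length Is ≡ l
        lIs = suc-injective (trans (sym (length-⊖F (Uniqueₚ.allFin⁺ (suc l)) (∈-allFin fzero))) (length-tabulate id))
          where open DecList {A = Fin (suc l)} _≟F_ using () renaming (length-⊖ to length-⊖F)
        V0-part : IsPart U V0
        V0-part = unique-filter (λ x → ¬? (Pos? x)) u , (λ p → proj₁ (filter-∈ (λ x → ¬? (Pos? x)) U p)) ,
          (let (x , x∈ , e) = inhab fzero in large x∈
            (∈-filter⁺ (λ x → ¬? (Pos? x)) x∈ λ { (i , e′ , n) → n (just-inj (trans (sym e′) e)) })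
            (λ y∈ ad → ∈-filter⁺ (λ x → ¬? (Pos? x)) y∈ λ { (i , e′ , n) → n (sym (apart x∈ y∈ e e′ ad)) }))
          where just-inj : ∀ {A : Set} {a b : A} → just a ≡ just b → a ≡ b
                just-inj refl = refl
        cover : ∀ {e} → In e U → Adj (proj₁ e) (proj₂ e) → Any (In e) (V0 ∷ map Wi Is)
        cover {x , y} (x∈ , y∈) ad with Pos? x | Pos? y
        ... | yes (i , e , n) | _ = there (lose (∈-map⁺ Wi (∈-filter⁺ pos? (∈-allFin i) n)) (Wi-in x∈ y∈ e ad))
        ... | no _ | yes (i , e , n) = there (lose (∈-map⁺ Wi (∈-filter⁺ pos? (∈-allFin i) n)) (let (p , q) = Wi-in y∈ x∈ e (adj-sym ad) in q , p))
        ... | no p | no q = here (∈-filter⁺ (λ x → ¬? (Pos? x)) x∈ p , ∈-filter⁺ (λ x → ¬? (Pos? x)) y∈ q)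
        sum-map : ∀ is → size (map Wi is) ≡ ∑ is (length ∘ Wi)
        sum-map []       = refl
        sum-map (i ∷ is) = cong (length (Wi i) +_) (sum-map is)
        labels : ∑ Is a ≤ # Pos? U
        labels = ≤-trans (≤-reflexive (∑-swap Is U (λ i x → ind (is? (lab x) i)))) (∑-mono U λ x _ → each x (Pos? x))
          where
          each : ∀ x (dx : Dec (Pos x)) → # (λ i → is? (lab x) i) Is ≤ ind dx
          each x (yes (i , e , n)) = ≤-trans (#-mono (λ j → is? (lab x) j) (λ j → j ≟F i) Is (λ j _ e′ → just-inj (trans (sym e′) e))) (#≡≤1F uIs i)
            where open DecList {A = Fin (suc l)} _≟F_ using () renaming (#≡≤1 to #≡≤1F)
                  just-inj : ∀ {A : Set} {a b : A} → just a ≡ just b → a ≡ b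
                  just-inj refl = refl
          each x (no ¬p) = ≮⇒≥ λ lt → let (i , i∈ , e) = #-pos (λ i → is? (lab x) i) Is lt in ¬p (i , e , proj₂ (filter-∈ pos? (allFin (suc l)) i∈))
        sz : length V0 + size (map Wi Is) ≤ n + β₂ * l
        sz = lin 0 (+-mono-≤ (≤-trans (≤-reflexive (sum-map Is)) (≤-trans (∑-mono Is (λ i _ → Wi-len i)) (≤-reflexive (trans (∑-+ Is a (λ _ → β₂)) (cong (∑ Is a +_) (trans (∑-const Is β₂) (trans (cong (_* β₂) lIs) (*-comm l β₂))))))))
                     (+-mono-≤ labels (≤-reflexive (trans (cong (_+ # Pos? U) (length-filter≡# (λ x → ¬? (Pos? x)) U)) (trans (+-comm _ (# Pos? U)) (#-¬ Pos? U))))))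
          (eq (length V0) (size (map Wi Is)) n (β₂ * l) (∑ Is a) (# Pos? U))
          where eq : ∀ a b c e f g → a + b + (f + e + (g + c)) + 0 ≡ c + e + (b + (f + (a + g)))
                eq = solve-∀
        bound : ρ (length V0 + size (map Wi Is) ∸ κ * length (map Wi Is)) ≤ r (Y U)
        bound = ≤-trans (ρ-mono le) (ρ-∸ n (c₁ * suc l) capn defect)
          where
          κl : β₂ * l + c₁ * suc l ≤ κ * length (map Wi Is)
          κl = ≤-trans (subst (λ z → β₂ * z + c₁ * suc z ≤ κ * z) (sym lk) (≤-trans (lin (c₁ * k) (z≤n {0}) (eq β₂ c₁ k)) (≤-reflexive (cong (_* suc k) (sym κ≡)))))
                 (≤-reflexive (cong (κ *_) (sym (trans (length-map Wi Is) lIs))))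
            where eq : ∀ b c k → b * suc k + c * suc (suc k) + 0 + c * k ≡ (b + (c + c)) * suc k + 0
                  eq = solve-∀
          le : length V0 + size (map Wi Is) ∸ κ * length (map Wi Is) ≤ n ∸ c₁ * suc l
          le = ≤-trans (∸-mono sz κl) (≤-reflexive (trans (cong (_∸ (β₂ * l + c₁ * suc l)) (+-comm n (β₂ * l))) ([m+n]∸[m+o]≡n∸o (β₂ * l) n (c₁ * suc l))))

  module Decompose {Ix : Set} (e : Ix → P)
    (noloop : ∀ i → proj₁ (e i) ≢ proj₂ (e i))
    (simple : ∀ {i j} → e i ≡ e j ⊎ e i ≡ (proj₂ (e j) , proj₁ (e j)) → i ≡ j) where

    in? : ∀ U i → Dec (In (e i) U)
    in? U i = (proj₁ (e i) ∈? U) ×-dec (proj₂ (e i) ∈? U)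

    inc? : ∀ v i → Dec (proj₁ (e i) ≡ v ⊎ proj₂ (e i) ≡ v)
    inc? v i = (proj₁ (e i) ≟ v) ⊎-dec (proj₂ (e i) ≟ v)

    other : V → Ix → V
    other v i with proj₁ (e i) ≟ v
    ... | yes _ = proj₂ (e i)
    ... | no _  = proj₁ (e i)

    other-spec : ∀ {v i} → proj₁ (e i) ≡ v ⊎ proj₂ (e i) ≡ v → e i ≡ (v , other v i) ⊎ e i ≡ (other v i , v)
    other-spec {v} {i} h with proj₁ (e i) ≟ v
    ... | yes p = inj₁ (cong (_, proj₂ (e i)) p)
    other-spec {v} {i} (inj₁ p) | no n = ⊥-elim (n p)
    other-spec {v} {i} (inj₂ p) | no n = inj₂ (cong (proj₁ (e i) ,_) p)

    other-≢ : ∀ {v i} → proj₁ (e i) ≡ v ⊎ proj₂ (e i) ≡ v → other v i ≢ v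
    other-≢ {v} {i} h eq with other-spec {v} {i} h
    ... | inj₁ p = noloop i (trans (cong proj₁ p) (trans (sym eq) (sym (cong proj₂ p))))
    ... | inj₂ p = noloop i (trans (cong proj₁ p) (trans eq (sym (cong proj₂ p))))

    other-inj : ∀ {v i j} → proj₁ (e i) ≡ v ⊎ proj₂ (e i) ≡ v → proj₁ (e j) ≡ v ⊎ proj₂ (e j) ≡ v → other v i ≡ other v j → i ≡ j
    other-inj {v} {i} {j} hi hj eq with other-spec {v} {i} hi | other-spec {v} {j} hj
    ... | inj₁ p | inj₁ p′ = simple (inj₁ (trans p (trans (cong (v ,_) eq) (sym p′))))
    ... | inj₂ p | inj₂ p′ = simple (inj₁ (trans p (trans (cong (_, v) eq) (sym p′))))
    ... | inj₁ p | inj₂ p′ = simple (inj₂ (trans p (trans (cong (v ,_) eq) (sym (cong₂ _,_ (cong proj₂ p′) (cong proj₁ p′))))))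
    ... | inj₂ p | inj₁ p′ = simple (inj₂ (trans p (trans (cong (_, v) eq) (sym (cong₂ _,_ (cong proj₂ p′) (cong proj₁ p′))))))

    module _ {L : List Ix} (uL : Unique L) where

      Z : List V → List P
      Z U = map e (filter (in? U) L)

      Z⁻ : ∀ {U f} → f ∈ Z U → ∃ λ i → i ∈ L × In (e i) U × f ≡ e i
      Z⁻ {U} p with ∈-map⁻ e p
      ... | i , q , eq = let (a , b) = filter-∈ (in? U) L q in i , a , b , eq

      Z⁺ : ∀ {U i} → i ∈ L → In (e i) U → e i ∈ Z U
      Z⁺ {U} p h = ∈-map⁺ e (∈-filter⁺ (in? U) p h)

      Z⊆K : ∀ {U} → Z U ⊆ K U
      Z⊆K p with Z⁻ p
      ... | i , _ , (a , b) , refl = K⁺ a b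

      -- `Vs` are the parts and `F` the loose edges; `p` counts the deleted vertices that lost
      -- edges, each of which lowers the rank. The allowance `κ` for each part beyond the first
      -- covers overlaps and defects.
      Dec′ : List V → Set
      Dec′ U = Σ (List (List V)) λ Vs → Σ (List Ix) λ F → Σ ℕ λ p →
        (∀ {i} → i ∈ L → In (e i) U → i ∈ F ⊎ Any (In (e i)) Vs)
        × length F ≤ β * p × (∀ {W} → W ∈ Vs → IsPart U W)
        × ρ (size Vs ∸ κ * (length Vs ∸ 1)) + p ≤ r (Z U)

      -- Vertices on fewer than `β` edges are deleted and their edges become loose. A deletion that
      -- loses an edge lowers the rank, because a pendant edge is a coloop. The core that remains
      -- has degrees at least `β`, and `core-parts` applies to the closure of its edges.
      decomposition : ∀ n U → length U ≤ n → Unique U → length U + q ≤ length pool → Dec′ U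
      decomposition n [] _ _ _ = [] , [] , 0 , (λ _ ()) , z≤n , (λ ()) ,
        ≤-trans (≤-reflexive (trans (+-identityʳ _) (trans (cong ρ (0∸n≡0 (κ * 0))) ρ-0))) z≤n
      decomposition (suc n) U@(_ ∷ _) le u cap with anyL? (λ v → # (λ i → in? U i ×-dec inc? v i) L <? β) U
      ... | yes a with find a
      ...   | v , v∈ , few = add (decomposition n U′ (≤-pred (≤-trans (≤-reflexive (sym (length-⊖ u v∈))) le)) (unique-filter (λ y → ¬? (y ≟ v)) u)
                (≤-trans (+-monoˡ-≤ q (≤-trans (n≤1+n _) (≤-reflexive (sym (length-⊖ u v∈))))) cap))
        where
        U′ = U ⊖ v
        Lv = filter (λ i → in? U i ×-dec inc? v i) L
        Z′⊆ : Z U′ ⊆ Z U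
        Z′⊆ p with Z⁻ {U′} p
        ... | i , i∈ , (x , y) , refl = Z⁺ i∈ (proj₁ (∈-⊖⁻ U x) , proj₁ (∈-⊖⁻ U y))
        cov : ∀ {F Vs} → (∀ {i} → i ∈ L → In (e i) U′ → i ∈ F ⊎ Any (In (e i)) Vs) →
              ∀ {i} → i ∈ L → In (e i) U → i ∈ Lv ++ F ⊎ Any (In (e i)) Vs
        cov c {i} i∈ (x , y) with inc? v i
        ... | yes iv = inj₁ (∈-++⁺ˡ (∈-filter⁺ (λ i → in? U i ×-dec inc? v i) i∈ ((x , y) , iv)))
        ... | no niv = [ (λ t → inj₁ (∈-++⁺ʳ Lv t)) , inj₂ ]′ (c i∈ (∈-⊖⁺ x (niv ∘ inj₁) , ∈-⊖⁺ y (niv ∘ inj₂)))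
        part : ∀ {W} → IsPart U′ W → IsPart U W
        part (a , b , c) = a , (λ p → proj₁ (∈-⊖⁻ U (b p))) , c
        few′ : length Lv ≤ β
        few′ = ≤-trans (≤-reflexive (length-filter≡# (λ i → in? U i ×-dec inc? v i) L)) (<⇒≤ few)
        rise : ∀ {i} → i ∈ Lv → suc (r (Z U′)) ≤ r (Z U)
        rise {i} i∈ with filter-∈ (λ i → in? U i ×-dec inc? v i) L i∈
        ... | i∈L , inU , iv = ≤-trans (leaf {U′} {Z U′} {other v i} {v} (Z⊆K {U′}) (λ t → proj₂ (∈-⊖⁻ U t) refl) (∈-⊖⁺ o∈ (other-≢ {v} {i} iv)))
              (≤-trans (r-mono {(v , other v i) ∷ Z U′} {(v , other v i) ∷ Z U} λ { (here t) → here t ; (there t) → there (Z′⊆ t) }) cl)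
          where
          o∈ : other v i ∈ U
          o∈ with other-spec {v} {i} iv
          ... | inj₁ t = subst (_∈ U) (cong proj₂ t) (proj₂ inU)
          ... | inj₂ t = subst (_∈ U) (cong proj₁ t) (proj₁ inU)
          cl : Cl (Z U) (v , other v i)
          cl with other-spec {v} {i} iv
          ... | inj₁ t = cl-∈ (subst (_∈ Z U) t (Z⁺ i∈L inU))
          ... | inj₂ t = cl-flip (cl-∈ (subst (_∈ Z U) t (Z⁺ i∈L inU)))
        add : Dec′ U′ → Dec′ U
        add (Vs , F , p , c , lF , pt , rk) with Lv in eq
        ... | [] = Vs , F , p , (λ {i} i∈ iU → subst (λ z → i ∈ z ++ F ⊎ Any (In (e i)) Vs) eq (cov c i∈ iU)) , lF , (part ∘ pt) , ≤-trans rk (r-mono Z′⊆)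
        ... | i₀ ∷ Lv₀ = Vs , (i₀ ∷ Lv₀) ++ F , suc p , (λ {i} i∈ iU → subst (λ z → i ∈ z ++ F ⊎ Any (In (e i)) Vs) eq (cov c i∈ iU))
              , ≤-trans (≤-reflexive (length-++ (i₀ ∷ Lv₀))) (≤-trans (+-mono-≤ (subst (λ z → length z ≤ β) eq few′) lF) (≤-reflexive (sym (*-suc β p))))
              , (part ∘ pt) , ≤-trans (≤-reflexive (+-suc _ p)) (≤-trans (s≤s rk) (rise (subst (i₀ ∈_) (sym eq) (here refl))))
      decomposition (suc n) U@(_ ∷ _) le u cap | no none = finish (core-parts Fl u (s≤s z≤n) cap big)
        where
        Fl : FlatGraph S
        Fl = record
          { Adj = λ x y → x ≢ y × Cl (Z U) (x , y)
          ; adj? = λ x y → ¬? (x ≟ y) ×-dec Cl? (Z U) (x , y)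
          ; adj-sym = λ { (n , c) → (n ∘ sym) , cl-flip c }
          ; adj-irr = λ { (n , _) → n refl }
          ; closed = λ h n c → n , cl-trans (λ { {x , y} t → proj₂ (h t) }) c }
        open FlatGraph Fl
        open FlatGraphTheory S Gr Fl
        adj-e : ∀ {i} → i ∈ L → In (e i) U → Adj (proj₁ (e i)) (proj₂ (e i))
        adj-e {i} i∈ iU = noloop i , cl-∈ (Z⁺ i∈ iU)
        big : ∀ {v} → v ∈ U → β ≤ deg′ v U
        big {v} v∈ = ≤-trans (≮⇒≥ λ lt → none (lose v∈ lt)) (≤-trans (≤-reflexive (sym (length-filter≡# (λ i → in? U i ×-dec inc? v i) L)))
            (≤-trans (≤-reflexive (sym (length-map (other v) Lv))) (≤-trans (unique-⊆-length {ys = nbrs v U} (unique-map inj (unique-filter (λ i → in? U i ×-dec inc? v i) uL)) sub) (≤-reflexive (nbrs-len v U)))))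
          where
          Lv = filter (λ i → in? U i ×-dec inc? v i) L
          inj : ∀ {i j} → i ∈ Lv → j ∈ Lv → other v i ≡ other v j → i ≡ j
          inj {i} {j} p p′ = other-inj {v} {i} {j} (proj₂ (proj₂ (filter-∈ (λ i → in? U i ×-dec inc? v i) L p))) (proj₂ (proj₂ (filter-∈ (λ i → in? U i ×-dec inc? v i) L p′)))
          sub : map (other v) Lv ⊆ nbrs v U
          sub p with ∈-map⁻ (other v) p
          ... | i , i∈ , refl with filter-∈ (λ i → in? U i ×-dec inc? v i) L i∈
          ...   | i∈L , iU , iv with other-spec {v} {i} iv
          ...     | inj₁ t = ∈-filter⁺ (adj? v) (subst (_∈ U) (cong proj₂ t) (proj₂ iU)) (subst₂ Adj (cong proj₁ t) (cong proj₂ t) (adj-e i∈L iU))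
          ...     | inj₂ t = ∈-filter⁺ (adj? v) (subst (_∈ U) (cong proj₁ t) (proj₁ iU)) (adj-sym (subst₂ Adj (cong proj₁ t) (cong proj₂ t) (adj-e i∈L iU)))
        finish : (∃ λ Vs → (∀ {W} → W ∈ Vs → IsPart U W) × (∀ {e} → In e U → Adj (proj₁ e) (proj₂ e) → Any (In e) Vs)
             × ρ (size Vs ∸ κ * (length Vs ∸ 1)) ≤ r (Y U)) → Dec′ U
        finish (Vs , pt , cv , rk) = Vs , [] , 0 , (λ i∈ iU → inj₂ (cv iU (adj-e i∈ iU))) , z≤n , pt ,
          ≤-trans (≤-reflexive (+-identityʳ _)) (≤-trans rk (span-≤ (λ { {x , y} t → proj₂ (proj₂ (proj₂ (Y⁻ t))) })))

      abstract
        decompose : ∀ n U → length U ≤ n → Unique U → length U + q ≤ length pool → Dec′ U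
        decompose = decomposition

#-one : ∀ {A : Set} {Q : A → Set} (Q? : ∀ x → Dec (Q x)) xs → # Q? xs ≤ 1 →
        ∀ {x y} → x ∈ xs → y ∈ xs → Q x → Q y → x ≡ y
#-one Q? (z ∷ xs) le (here refl) (here refl) a b = refl
#-one Q? (z ∷ xs) le (here refl) (there q) a b =
  ⊥-elim (1+n≰n (≤-trans (+-mono-≤ (≤-reflexive (sym (ind-yes (Q? z) a))) (#-∈ Q? q b)) le))
#-one Q? (z ∷ xs) le (there p) (here refl) a b =
  ⊥-elim (1+n≰n (≤-trans (+-mono-≤ (≤-reflexive (sym (ind-yes (Q? z) b))) (#-∈ Q? p a)) le))
#-one Q? (z ∷ xs) le (there p) (there q) a b = #-one Q? xs (≤-trans (m≤n+m _ _) le) p q a b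

-- Covers of highly connected graphs.

module Covers {V : Set} (S : SymRank V) (Gr : Growing S) where
  open Parts S Gr public

  1≤D : 1 ≤ D
  1≤D = ≤-trans (≤-trans (s≤s z≤n) 2≤q) (m≤m+n q q)

  1≤κ : 1 ≤ κ
  1≤κ = ≤-trans (≤-trans (≤-trans (s≤s z≤n) (≤-reflexive (sym c₁≡))) (≤-trans (m≤m+n c₁ c₁) (m≤n+m (c₁ + c₁) β₂))) (≤-reflexive (sym κ≡))

  1≤χ : 1 ≤ χ
  1≤χ = ≤-trans (*-mono-≤ (≤-trans 1≤κ κ≤β) 1≤D) (≤-reflexive (sym χ≡))

  module HighlyConnected {Ix : Set} (e : Ix → P)
    (noloop : ∀ i → proj₁ (e i) ≢ proj₂ (e i))
    (simple : ∀ {i j} → e i ≡ e j ⊎ e i ≡ (proj₂ (e j) , proj₁ (e j)) → i ≡ j) where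
    open Decompose e noloop simple public

    Boundary : List Ix → List V → V → Set
    Boundary L W v = v ∈ W × Any (λ i → (proj₁ (e i) ≡ v ⊎ proj₂ (e i) ≡ v) × ¬ In (e i) W) L

    boundary? : ∀ L W v → Dec (Boundary L W v)
    boundary? L W v = (v ∈? W) ×-dec anyL? (λ i → inc? v i ×-dec ¬? (in? W i)) L

    -- `separ` is vertex connectivity: the boundary of `W` separates a vertex in the interior of `W`
    -- from any vertex outside.
    record HC (C : ℕ) (L : List Ix) (VG : List V) : Set where
      field
        uL     : Unique L
        uV     : Unique VG
        inV    : ∀ {i} → i ∈ L → In (e i) VG
        degree : ∀ {v} → v ∈ VG → C ≤ # (inc? v) L
        separ  : ∀ W {v₀ u₀} → v₀ ∈ VG → v₀ ∈ W → ¬ Boundary L W v₀ → u₀ ∈ VG → u₀ ∉ W → C ≤ # (boundary? L W) VG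

    module _ {C L VG} (hc : HC C L VG) (C₀≤C : C₀ ≤ C) (1≤N : 1 ≤ length VG) where
      open HC hc

      N : ℕ
      N = length VG

      -- A count of multiplicities. If no part contains all vertices, then uncovered vertices, small
      -- parts and the boundaries of large parts each force overlaps or many loose edges. The weight
      -- inequality limits the overlap `T` to `κ * l` and the loose edges to a fixed multiple of
      -- `l`, which is too little for `C ≥ C₀`.
      one-part : ∀ Ws F p → (∀ {i} → i ∈ L → i ∈ F ⊎ Any (In (e i)) Ws) → (∀ {W} → W ∈ Ws → IsPart VG W) →
        length F ≤ χ * p → D * size Ws + p + D * κ ≤ D * N + D * κ * length Ws →
        ∃ λ W → Ws ≡ W ∷ [] × p ≡ 0 × VG ⊆ W
      one-part Ws F p cov part lF bal with anyL? (λ W → allL? (_∈? W) VG) Ws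
      ... | yes a with find a
      ...   | W , W∈ , al = W , single Ws W∈ L′0 , p0 , lookupAll al
        where
        big : ∀ {W} Ws → (∀ {W} → W ∈ Ws → suc β ≤ length W) → W ∈ Ws → length W + suc β * (length Ws ∸ 1) ≤ size Ws
        big (W ∷ Ws) h (here refl) = +-monoʳ-≤ (length W) (all Ws (h ∘ there))
          where all : ∀ Ws → (∀ {W} → W ∈ Ws → suc β ≤ length W) → suc β * length Ws ≤ size Ws
                all []       h = ≤-reflexive (*-zeroʳ (suc β))
                all (W ∷ Ws) h = ≤-trans (≤-reflexive (*-suc (suc β) (length Ws))) (+-mono-≤ (h (here refl)) (all Ws (h ∘ there)))
        big {W} (W′ ∷ Ws@(_ ∷ Ws′)) h (there q) = ≤-trans (lin 0 (big Ws (h ∘ there) q)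
            (eq (length W) (suc β) (length Ws′) (size Ws))) (+-monoˡ-≤ (size Ws) (h (here refl)))
          where eq : ∀ a b c s → a + b * suc c + s + 0 ≡ b + s + (a + b * c)
                eq = solve-∀
        L′ = length Ws ∸ 1
        lWs : length Ws ≡ suc L′
        lWs = sym (trans (+-comm 1 L′) (m∸n+n≡m (ne W∈)))
          where ne : ∀ {Ws} → W ∈ Ws → 1 ≤ length Ws
                ne (here _)  = s≤s z≤n
                ne (there _) = s≤s z≤n
        -- One part already uses all `N` vertices. Each further part has more than `β = 8 * κ`
        -- vertices, but the inequality credits only `κ` for it.
        key : D * L′ + p ≤ 0
        key = lin (D * 7 * κ * L′) (+-mono-≤ bal (*-monoʳ-≤ D (≤-trans (+-monoˡ-≤ (suc β * L′) (unique-⊆-length uV (lookupAll al))) (big Ws (λ q → proj₂ (proj₂ (part q))) W∈))))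
          (trans (cong (λ z → D * L′ + p + (D * N + D * κ * z + D * size Ws) + D * 7 * κ * L′) lWs) (trans (eq D L′ p N κ (size Ws))
            (cong (λ z → D * size Ws + p + D * κ + D * (N + suc z * L′)) (sym β≡))))
          where eq : ∀ d l p n k s → d * l + p + (d * n + d * k * suc l + d * s) + d * 7 * k * l ≡ 0 + (d * s + p + d * k + d * (n + suc (8 * k) * l))
                eq = solve-∀
        p0 : p ≡ 0
        p0 = n≤0⇒n≡0 (≤-trans (m≤n+m p (D * L′)) key)
        L′0 : L′ ≡ 0
        L′0 = n≤0⇒n≡0 (≤-trans (≤-trans (≤-reflexive (sym (*-identityˡ L′))) (*-monoˡ-≤ L′ 1≤D)) (≤-trans (m≤m+n _ p) key))
        single : ∀ Ws → W ∈ Ws → length Ws ∸ 1 ≡ 0 → Ws ≡ W ∷ []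
        single (W ∷ []) (here refl) _ = refl
      one-part Ws F p cov part lF bal | no none = ⊥-elim contra
        where
        l = length Ws
        mult : V → ℕ
        mult v = # (v ∈?_) Ws
        degF : V → ℕ
        degF v = # (inc? v) F
        -- `T` is the total overlap, `n₀` the number of uncovered vertices, and `nh` the number of
        -- vertices on at least `C / 2` loose edges.
        T n₀ nh : ℕ
        T  = ∑ VG (λ v → mult v ∸ 1)
        n₀ = # (λ v → mult v ≟ℕ 0) VG
        nh = # (λ v → C ≤? 2 * degF v) VG
        small? : ∀ W → Dec (2 * length W ≤ C)
        small? W = 2 * length W ≤? C
        Ls = # small? Ws
        Ll = # (λ W → ¬? (small? W)) Ws

        ∑mult : ∑ VG mult ≡ size Ws
        ∑mult = trans (∑-swap VG Ws (λ v W → ind (v ∈? W))) (∑-cong Ws (λ W W∈ → ≤-antisym (#∈≤length uV W)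
          (length≤#∈ (proj₁ (part W∈)) (proj₁ (proj₂ (part W∈))))))

        ∑degF : ∑ VG degF ≤ 2 * length F
        ∑degF = ≤-trans (≤-reflexive (∑-swap VG F (λ v i → ind (inc? v i)))) (≤-trans (∑-mono F (λ i _ →
            ≤-trans (#-⊎ (λ v → proj₁ (e i) ≟ v) (λ v → proj₂ (e i) ≟ v) VG) (+-mono-≤ (one (proj₁ (e i))) (one (proj₂ (e i))))))
            (≤-reflexive (trans (∑-const F 2) (*-comm (length F) 2))))
          where one : ∀ x → # (λ v → x ≟ v) VG ≤ 1
                one x = ≤-trans (#-mono (x ≟_) (_≟ x) VG (λ _ _ → sym)) (#≡≤1 uV x)

        balance : size Ws + n₀ ≡ N + T
        balance = trans (cong (_+ n₀) (sym ∑mult)) (trans (sym (∑-+ VG mult (λ v → ind (mult v ≟ℕ 0))))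
          (trans (∑-cong VG (λ v _ → pt (mult v))) (trans (∑-+ VG (λ _ → 1) (λ v → mult v ∸ 1)) (cong (_+ T) (trans (∑-const VG 1) (*-identityʳ N))))))
          where pt : ∀ m → m + ind (m ≟ℕ 0) ≡ 1 + (m ∸ 1)
                pt zero    = refl
                pt (suc m) = +-identityʳ (suc m)

        n₀-bound : C * n₀ ≤ 2 * length F
        n₀-bound = ≤-trans (≤-reflexive (sym (∑-* VG C (λ v → ind (mult v ≟ℕ 0))))) (≤-trans (∑-mono VG pt) ∑degF)
          where
          pt : ∀ v → v ∈ VG → C * ind (mult v ≟ℕ 0) ≤ degF v
          pt v v∈ with mult v ≟ℕ 0
          ... | no _ = ≤-trans (≤-reflexive (*-zeroʳ C)) z≤n
          ... | yes m0 = ≤-trans (≤-reflexive (*-identityʳ C)) (≤-trans (degree v∈) (#-⊆ (inc? v) (inc? v) uL (λ i∈ iv → inF i∈ iv (cov i∈) , iv)))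
            where
            inF : ∀ {i} → i ∈ L → proj₁ (e i) ≡ v ⊎ proj₂ (e i) ≡ v → i ∈ F ⊎ Any (In (e i)) Ws → i ∈ F
            inF _ _ (inj₁ t) = t
            inF {i} _ iv (inj₂ a) with find a
            ... | W , W∈ , x , y = ⊥-elim (1+n≰n (≤-trans (#-∈ (v ∈?_) W∈ ([ (λ { refl → x }) , (λ { refl → y }) ]′ iv)) (≤-reflexive m0)))

        nh-bound : C * nh ≤ 4 * length F
        nh-bound = ≤-trans (≤-reflexive (sym (∑-* VG C (λ v → ind (C ≤? 2 * degF v))))) (≤-trans (∑-mono VG (λ v _ → pt v))
            (≤-trans (≤-reflexive (∑-* VG 2 degF)) (≤-trans (*-monoʳ-≤ 2 ∑degF) (≤-reflexive (sym (*-assoc 2 2 (length F)))))))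
          where
          pt : ∀ v → C * ind (C ≤? 2 * degF v) ≤ 2 * degF v
          pt v with C ≤? 2 * degF v
          ... | yes le = ≤-trans (≤-reflexive (*-identityʳ C)) le
          ... | no _   = ≤-trans (≤-reflexive (*-zeroʳ C)) z≤n

        -- an edge at v leaving the only part that contains v is loose
        loose : ∀ {v W i} → mult v ≤ 1 → W ∈ Ws → v ∈ W → i ∈ L → proj₁ (e i) ≡ v ⊎ proj₂ (e i) ≡ v → ¬ In (e i) W → i ∈ F
        loose {v} {W} {i} m1 W∈ v∈ i∈ iv out with cov i∈
        ... | inj₁ t = t
        ... | inj₂ a with find a
        ...   | W′ , W′∈ , x , y with #-one (v ∈?_) Ws m1 W∈ W′∈ v∈ ([ (λ { refl → x }) , (λ { refl → y }) ]′ iv)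
        ...     | refl = ⊥-elim (out (x , y))

        twice : ∀ {a m} → a ≤ m → 2 ≤ m → a ≤ 2 * (m ∸ 1)
        twice {a} {suc (suc m)} le _ = ≤-trans le (lin m (z≤n {0}) (eq m))
          where eq : ∀ m → suc (suc m) + 0 + m ≡ 2 * suc m + 0
                eq = solve-∀
        twice {m = suc zero} _ (s≤s ())

        -- A vertex of a small part that lies in no other part has at most `C / 2` edges inside it,
        -- so at least `C / 2` of its edges are loose.
        small-bound : suc β * Ls ≤ 2 * T + nh
        small-bound = ≤-trans (≤-reflexive (sym (∑-* Ws (suc β) (λ W → ind (small? W))))) (≤-trans (∑-mono Ws perW)
            (≤-trans (≤-reflexive (∑-swap Ws VG (λ W v → ind (small? W ×-dec (v ∈? W))))) (≤-trans (∑-mono VG (λ v _ → perV v))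
            (≤-reflexive (trans (∑-+ VG (λ v → 2 * (mult v ∸ 1)) (λ v → ind (C ≤? 2 * degF v))) (cong (_+ nh) (∑-* VG 2 (λ v → mult v ∸ 1))))))))
          where
          perW : ∀ W → W ∈ Ws → suc β * ind (small? W) ≤ # (λ v → small? W ×-dec (v ∈? W)) VG
          perW W W∈ with small? W
          ... | no _ = ≤-trans (≤-reflexive (*-zeroʳ (suc β))) z≤n
          ... | yes s = ≤-trans (≤-reflexive (*-identityʳ (suc β))) (≤-trans (proj₂ (proj₂ (part W∈)))
                (≤-trans (length≤#∈ (proj₁ (part W∈)) (proj₁ (proj₂ (part W∈)))) (#-mono (_∈? W) (λ v → yes s ×-dec (v ∈? W)) VG (λ v _ t → s , t))))
          perV : ∀ v → # (λ W → small? W ×-dec (v ∈? W)) Ws ≤ 2 * (mult v ∸ 1) + ind (C ≤? 2 * degF v)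
          perV v with 2 ≤? mult v
          ... | yes 2≤ = ≤-trans (twice (#-mono (λ W → small? W ×-dec (v ∈? W)) (v ∈?_) Ws (λ _ _ → proj₂)) 2≤) (m≤m+n _ _)
          ... | no ¬2 with C ≤? 2 * degF v
          ...   | yes _ = ≤-trans (≤-trans (#-mono (λ W → small? W ×-dec (v ∈? W)) (v ∈?_) Ws (λ _ _ → proj₂)) (≤-pred (≰⇒> ¬2))) (m≤n+m 1 _)
          ...   | no ¬h = ≤-trans (≮⇒≥ λ lt → let (W , W∈ , s , v∈) = #-pos (λ W → small? W ×-dec (v ∈? W)) Ws lt in ¬h (heavy W∈ s v∈)) z≤n
            where
            heavy : ∀ {W} → W ∈ Ws → 2 * length W ≤ C → v ∈ W → C ≤ 2 * degF v
            heavy {W} W∈ s v∈ = lin 0 (+-mono-≤ (*-monoʳ-≤ 2 split) s) (eq C (degF v) (length W))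
              where
              eq : ∀ c d w → c + (2 * (d + w) + c) + 0 ≡ 2 * d + (2 * c + 2 * w)
              eq = solve-∀
              inside : # (λ i → inc? v i ×-dec in? W i) L ≤ length W
              inside = ≤-trans (≤-reflexive (trans (sym (length-filter≡# (λ i → inc? v i ×-dec in? W i) L)) (sym (length-map (other v) Li))))
                (unique-⊆-length (unique-map (λ {i} {j} p q → other-inj {v} {i} {j} (proj₁ (proj₂ (filter-∈ (λ i → inc? v i ×-dec in? W i) L p))) (proj₁ (proj₂ (filter-∈ (λ i → inc? v i ×-dec in? W i) L q))))
                   (unique-filter (λ i → inc? v i ×-dec in? W i) uL)) sub)
                where
                Li = filter (λ i → inc? v i ×-dec in? W i) L
                sub : map (other v) Li ⊆ W
                sub t with ∈-map⁻ (other v) t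
                ... | i , i∈ , refl with filter-∈ (λ i → inc? v i ×-dec in? W i) L i∈
                ...   | _ , iv , x , y with other-spec {v} {i} iv
                ...     | inj₁ q = subst (_∈ W) (cong proj₂ q) y
                ...     | inj₂ q = subst (_∈ W) (cong proj₁ q) x
              split : C ≤ degF v + length W
              split = ≤-trans (degree (proj₁ (proj₂ (part W∈)) v∈)) (≤-trans (≤-trans (#-⊆ (inc? v) (inc? v) {ys = F ++ filter (λ i → inc? v i ×-dec in? W i) L} uL
                  (λ {i} i∈ iv → (case in? W i of λ { (yes t) → ∈-++⁺ʳ F (∈-filter⁺ (λ i → inc? v i ×-dec in? W i) i∈ (iv , t))
                                                     ; (no t) → ∈-++⁺ˡ (loose (≤-pred (≰⇒> ¬2)) W∈ v∈ i∈ iv t) }) , iv))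
                  (≤-reflexive (∑-++ F _ _)))
                (+-monoʳ-≤ (degF v) (≤-trans (#≤length (inc? v) (filter (λ i → inc? v i ×-dec in? W i) L)) (≤-trans (≤-reflexive (length-filter≡# (λ i → inc? v i ×-dec in? W i) L)) inside))))

        -- Either `W` has an interior vertex and connectivity supplies `C` boundary vertices, or all
        -- of its more than `C / 2` vertices are on the boundary.
        bd-large : ∀ {W} → W ∈ Ws → ¬ (2 * length W ≤ C) → C ≤ 2 * # (boundary? L W) VG
        bd-large {W} W∈ ns with anyL? (λ v → (v ∈? W) ×-dec ¬? (boundary? L W v)) VG
        ... | yes a = let (v₀ , v₀∈ , v₀W , nb) = find a ; (u₀ , u₀∈ , u₀∉) = outside in
              ≤-trans (separ W v₀∈ v₀W nb u₀∈ u₀∉) (m≤m+n _ _)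
          where
          outside : ∃ λ u → u ∈ VG × u ∉ W
          outside with anyL? (λ u → ¬? (u ∈? W)) VG
          ... | yes t = find t
          ... | no t = ⊥-elim (none (lose W∈ (tabulateAll λ {u} u∈ → decidable-stable (u ∈? W) (λ n → t (lose u∈ n)))))
        ... | no all-bd = ≤-trans (<⇒≤ (≰⇒> ns)) (*-monoʳ-≤ 2 (≤-trans (length≤#∈ (proj₁ (part W∈)) (proj₁ (proj₂ (part W∈))))
              (#-mono (_∈? W) (boundary? L W) VG (λ v v∈ t → decidable-stable (boundary? L W v) (λ n → all-bd (lose v∈ (t , n)))))))

        -- A boundary vertex of a part lies in a second part or on a loose edge, and it is charged
        -- accordingly.
        large-bound : C * Ll ≤ 4 * T + 4 * length F
        large-bound = ≤-trans (≤-reflexive (sym (∑-* Ws C (λ W → ind (¬? (small? W)))))) (≤-trans (∑-mono Ws perW)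
            (≤-trans (≤-reflexive (∑-* Ws 2 _)) (≤-trans (*-monoʳ-≤ 2 (≤-trans (≤-reflexive (∑-swap Ws VG (λ W v → ind (¬? (small? W) ×-dec boundary? L W v))))
              (≤-trans (∑-mono VG (λ v _ → perV v)) (≤-trans (≤-reflexive (trans (∑-+ VG (λ v → 2 * (mult v ∸ 1)) degF) (cong (_+ ∑ VG degF) (∑-* VG 2 (λ v → mult v ∸ 1))))) (+-monoʳ-≤ (2 * T) ∑degF)))))
              (≤-reflexive (eq T (length F))))))
          where
          eq : ∀ t f → 2 * (2 * t + 2 * f) ≡ 4 * t + 4 * f
          eq = solve-∀
          perW : ∀ W → W ∈ Ws → C * ind (¬? (small? W)) ≤ 2 * # (λ v → ¬? (small? W) ×-dec boundary? L W v) VG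
          perW W W∈ with small? W
          ... | yes _ = ≤-trans (≤-reflexive (*-zeroʳ C)) z≤n
          ... | no ns = ≤-trans (≤-reflexive (*-identityʳ C)) (≤-trans (bd-large W∈ ns)
                (*-monoʳ-≤ 2 (#-mono (boundary? L W) (λ v → ¬? (no ns) ×-dec boundary? L W v) VG (λ v _ t → ns , t))))
          perV : ∀ v → # (λ W → ¬? (small? W) ×-dec boundary? L W v) Ws ≤ 2 * (mult v ∸ 1) + degF v
          perV v with 2 ≤? mult v
          ... | yes 2≤ = ≤-trans (twice (#-mono (λ W → ¬? (small? W) ×-dec boundary? L W v) (v ∈?_) Ws (λ _ _ t → proj₁ (proj₂ t))) 2≤) (m≤m+n _ _)
          ... | no ¬2 with 1 ≤? degF v
          ...   | yes 1≤ = ≤-trans (≤-trans (#-mono (λ W → ¬? (small? W) ×-dec boundary? L W v) (v ∈?_) Ws (λ _ _ t → proj₁ (proj₂ t))) (≤-pred (≰⇒> ¬2))) (≤-trans 1≤ (m≤n+m _ _))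
          ...   | no ¬1 = ≤-trans (≮⇒≥ λ lt → let (W , W∈ , _ , v∈ , bd) = #-pos (λ W → ¬? (small? W) ×-dec boundary? L W v) Ws lt ; (i , i∈ , iv , out) = find bd in
                    ¬1 (#-∈ (inc? v) (loose (≤-pred (≰⇒> ¬2)) W∈ v∈ i∈ iv out) iv)) z≤n

        Ls+Ll : Ls + Ll ≡ l
        Ls+Ll = #-¬ small? Ws

        4χD≤C : 4 * (χ * D) ≤ C
        4χD≤C = ≤-trans (≤-trans (m≤n+m _ (suc (8 * κ + 16 * (χ * (D * κ))))) (≤-reflexive (sym C₀≡))) C₀≤C

        2Dn₀≤p : 2 * (D * n₀) ≤ p
        2Dn₀≤p = *-cancelˡ-≤ (2 * χ) {{>-nonZero (*-mono-≤ (s≤s (z≤n {1})) 1≤χ)}}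
          (≤-trans (≤-reflexive (eq χ D n₀)) (≤-trans (*-monoˡ-≤ n₀ 4χD≤C) (≤-trans n₀-bound (≤-trans (*-monoʳ-≤ 2 lF) (≤-reflexive (sym (*-assoc 2 χ p)))))))
          where eq : ∀ x d n → 2 * x * (2 * (d * n)) ≡ 4 * (x * d) * n
                eq = solve-∀

        -- The weight inequality is doubled; one of the two copies of `p` pays for the uncovered
        -- vertices.
        main : 2 * (D * T) + p + 2 * (D * κ) ≤ 2 * (D * κ * l)
        main = lin 0 (+-mono-≤ (*-monoʳ-≤ 2 bal) (+-mono-≤ 2Dn₀≤p (*-monoʳ-≤ (2 * D) (≤-reflexive (sym balance)))))
          (eq D T p κ l n₀ N (size Ws))
          where eq : ∀ d t p k l n m s → 2 * (d * t) + p + 2 * (d * k) + (2 * (d * m + d * k * l) + (p + 2 * d * (s + n))) + 0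
                     ≡ 2 * (d * k * l) + (2 * (d * s + p + d * k) + (2 * (d * n) + 2 * d * (m + t)))
                eq = solve-∀

        2D-nonZero : NonZero (2 * D)
        2D-nonZero = >-nonZero (*-mono-≤ (s≤s (z≤n {1})) 1≤D)

        T≤ : T ≤ κ * l
        T≤ = *-cancelˡ-≤ (2 * D) {{2D-nonZero}} (≤-trans (≤-reflexive (*-assoc 2 D T)) (≤-trans (≤-trans (m≤m+n _ p) (m≤m+n _ _)) (≤-trans main (≤-reflexive (eq D κ l)))))
          where eq : ∀ d k l → 2 * (d * k * l) ≡ 2 * d * (k * l)
                eq = solve-∀

        p≤ : p ≤ 2 * (D * κ * l)
        p≤ = ≤-trans (≤-trans (m≤n+m p (2 * (D * T))) (m≤m+n _ _)) main

        nh≤ : nh ≤ 2 * (κ * l)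
        nh≤ = *-cancelˡ-≤ (4 * (χ * D)) {{>-nonZero (*-mono-≤ (s≤s (z≤n {3})) (*-mono-≤ 1≤χ 1≤D))}}
          (≤-trans (*-monoˡ-≤ nh 4χD≤C) (≤-trans nh-bound (≤-trans (*-monoʳ-≤ 4 (≤-trans lF (*-monoʳ-≤ χ p≤))) (≤-reflexive (eq χ D κ l)))))
          where eq : ∀ x d k l → 4 * (x * (2 * (d * k * l))) ≡ 4 * (x * d) * (2 * (k * l))
                eq = solve-∀

        l≤2Ll : l ≤ 2 * Ll
        l≤2Ll = lin 0 (+-mono-≤ 2Ls≤l (*-monoʳ-≤ 2 (≤-reflexive (sym Ls+Ll)))) (eq l Ls Ll)
          where
          eq : ∀ l a b → l + (l + 2 * (a + b)) + 0 ≡ 2 * b + (2 * a + 2 * l)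
          eq = solve-∀
          -- `T` and `nh` contribute `2 * κ * l` each to `small-bound`; the factor 8 in `β` leaves
          -- small parts at most half of all parts.
          2Ls≤l : 2 * Ls ≤ l
          2Ls≤l = *-cancelˡ-≤ (4 * κ) {{>-nonZero (*-mono-≤ (s≤s (z≤n {3})) 1≤κ)}}
            (≤-trans (lin Ls (z≤n {0}) (eq₁ κ Ls)) (≤-trans (≤-trans (≤-reflexive (cong (λ z → suc z * Ls) (sym β≡))) small-bound) (≤-trans (+-mono-≤ (*-monoʳ-≤ 2 T≤) nh≤) (≤-reflexive (eq₂ κ l)))))
            where eq₁ : ∀ k s → 4 * k * (2 * s) + 0 + s ≡ suc (8 * k) * s + 0
                  eq₁ = solve-∀
                  eq₂ : ∀ k l → 2 * (k * l) + 2 * (k * l) ≡ 4 * k * l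
                  eq₂ = solve-∀

        -- As `l ≤ 2 * Ll`, overlaps and loose edges allow only `8 * κ + 16 * (χ * (D * κ))` per
        -- large part, less than the `C` that each of them demands.
        Ll0 : Ll ≡ 0
        Ll0 with Ll in eqL
        ... | zero = refl
        ... | suc k = ⊥-elim (1+n≰n (≤-trans (≤-trans (≤-reflexive refl) (*-monoˡ-≤ (suc k) C₀≤′)) (≤-trans (subst (λ z → C * z ≤ 4 * T + 4 * length F) eqL large-bound)
            (≤-trans (+-mono-≤ (*-monoʳ-≤ 4 T≤) (*-monoʳ-≤ 4 (≤-trans lF (*-monoʳ-≤ χ p≤))))
            (≤-trans (≤-reflexive (eq₁ χ D κ l)) (≤-trans (*-monoʳ-≤ (4 * κ + 8 * (χ * (D * κ))) (subst (λ z → l ≤ 2 * z) eqL l≤2Ll)) (≤-trans (≤-reflexive (eq₂ χ D κ (suc k))) (m≤n+m _ k)))))))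
            )
          where
          C₀≤′ : suc (8 * κ + 16 * (χ * (D * κ))) ≤ C
          C₀≤′ = ≤-trans (≤-trans (m≤m+n _ (4 * (χ * D))) (≤-reflexive (sym C₀≡))) C₀≤C
          eq₁ : ∀ x d k l → 4 * (k * l) + 4 * (x * (2 * (d * k * l))) ≡ (4 * k + 8 * (x * (d * k))) * l
          eq₁ = solve-∀
          eq₂ : ∀ x d k s → (4 * k + 8 * (x * (d * k))) * (2 * s) ≡ (8 * k + 16 * (x * (d * k))) * s
          eq₂ = solve-∀

        contra : ⊥
        contra = 1+n≰n (≤-trans (*-mono-≤ (s≤s (z≤n {1})) (*-mono-≤ 1≤D 1≤κ)) (≤-trans (m≤n+m _ (2 * (D * T) + p)) (≤-trans main
          (≤-trans (*-monoʳ-≤ 2 (*-monoʳ-≤ (D * κ) (≤-trans l≤2Ll (≤-reflexive (cong (2 *_) Ll0))))) (≤-reflexive (eq D κ))))))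
          where eq : ∀ d k → 2 * (d * k * 0) ≡ 0
                eq = solve-∀

      abstract
        cover-one : ∀ Ws F p → (∀ {i} → i ∈ L → i ∈ F ⊎ Any (In (e i)) Ws) → (∀ {W} → W ∈ Ws → IsPart VG W) →
          length F ≤ χ * p → D * size Ws + p + D * κ ≤ D * N + D * κ * length Ws →
          ∃ λ W → Ws ≡ W ∷ [] × p ≡ 0 × VG ⊆ W
        cover-one = one-part

-- Recognition of the stars when ranks grow.

module Recognition {V : Set} (S : SymRank V) (Gr : Growing S) {Ix : Set} (eG eH : Ix → V × V)
  (nlG : ∀ i → proj₁ (eG i) ≢ proj₂ (eG i)) (nlH : ∀ i → proj₁ (eH i) ≢ proj₂ (eH i))
  (spG : ∀ {i j} → eG i ≡ eG j ⊎ eG i ≡ (proj₂ (eG j) , proj₁ (eG j)) → i ≡ j)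
  (spH : ∀ {i j} → eH i ≡ eH j ⊎ eH i ≡ (proj₂ (eH j) , proj₁ (eH j)) → i ≡ j)
  (same : ∀ L → SymRank.r S (map eG L) ≡ SymRank.r S (map eH L)) where
  open Covers S Gr
  module G = HighlyConnected eG nlG spG
  module H = HighlyConnected eH nlH spH
  open G.HC

  ρ-inv : ∀ {m a} → 1 ≤ a → suc a ≤ length pool → ρ m ≤ ρ a → m ≤ a
  ρ-inv {m} {a} 1≤a le h with m ≤? a
  ... | yes p = p
  ... | no ¬p = ⊥-elim (1+n≰n (≤-trans (ρ-lower a 1 1≤a le) (≤-trans (ρ-mono (≰⇒> ¬p)) h)))

  ρ≤D* : ∀ n → n ≤ length pool → ρ n ≤ D * n
  ρ≤D* n le = ≤-trans (≤-reflexive (cong ρ (sym (+-identityʳ n)))) (≤-trans (ρ-upper 0 n (≤-trans (≤-reflexive (+-identityʳ n)) le))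
    (≤-reflexive (cong (_+ D * n) ρ-0)))

  -- Rank is traded for vertices at the rate `D`: with `t` the argument of `ρ`, the rank grows by at
  -- most `D * (a ∸ t)` from `t` to `a` vertices, and this leaves room for `p`.
  balanced : ∀ {x} (Vs : List (List V)) p a → 1 ≤ a → suc a ≤ length pool → ρ (size Vs ∸ κ * (length Vs ∸ 1)) + p ≤ x → x ≤ ρ a →
    D * size Vs + p ≤ D * a + D * κ * (length Vs ∸ 1)
  balanced Vs p a 1≤a le h h′ = lin 0 (+-mono-≤ (*-monoʳ-≤ D (m≤n+m∸n (size Vs) (κ * (length Vs ∸ 1)))) Dm)
      (eq D (size Vs) p a κ (length Vs ∸ 1) t)
    where
    t = size Vs ∸ κ * (length Vs ∸ 1)
    t≤a : t ≤ a
    t≤a = ρ-inv 1≤a le (≤-trans (m≤m+n (ρ t) p) (≤-trans h h′))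
    e : a ∸ t + t ≡ a
    e = m∸n+n≡m t≤a
    Dm : D * t + p ≤ D * a
    Dm = ≤-trans (+-monoʳ-≤ (D * t) (+-cancelˡ-≤ (ρ t) _ _ (≤-trans h (≤-trans h′ (≤-trans (≤-reflexive (cong ρ (sym e)))
        (ρ-upper t (a ∸ t) (≤-trans (≤-reflexive e) (≤-trans (n≤1+n a) le))))))))
      (≤-reflexive (trans (sym (*-distribˡ-+ D t (a ∸ t))) (cong (D *_) (trans (+-comm t _) e))))
    eq : ∀ d s p a k l t → d * s + p + (d * (k * l + t) + d * a) + 0 ≡ d * a + d * k * l + (d * s + (d * t + p))
    eq = solve-∀

  -- For decompositions without parts: there `a` itself can take the place of `p` in the weight
  -- inequality.
  room : ∀ a → 2 * κ ≤ a → a + D * κ ≤ D * a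
  room a le = subst₂ (λ d x → x + d * κ ≤ d * x) (m+[n∸m]≡n (≤-trans 2≤q (m≤m+n q q))) (m+[n∸m]≡n le)
      (lin (x + d′ * κ + d′ * x) (z≤n {0}) (eq d′ κ x))
    where
    d′ = D ∸ 2
    x = a ∸ 2 * κ
    eq : ∀ d k x → (2 * k + x) + (2 + d) * k + 0 + (x + d * k + d * x) ≡ (2 + d) * (2 * k + x) + 0
    eq = solve-∀

  2κ≤β : 2 * κ ≤ β
  2κ≤β = ≤-trans (*-monoˡ-≤ κ (m≤m+n 2 6)) (≤-reflexive (sym β≡))

  β≤χ : β ≤ χ
  β≤χ = ≤-trans (≤-trans (≤-reflexive (sym (*-identityʳ β))) (*-monoʳ-≤ β 1≤D)) (≤-reflexive (sym χ≡))

  loose-χ : ∀ {f p a} → f ≤ β * p → p ≤ D * a → f ≤ χ * a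
  loose-χ {a = a} h h′ = ≤-trans h (≤-trans (*-monoʳ-≤ β h′) (≤-reflexive (trans (sym (*-assoc β D a)) (cong (_* a) (sym χ≡)))))

  module _ {C L VG} (hc : G.HC C L VG) (C₀≤C : C₀ ≤ C) (1≤N : 1 ≤ length VG) (cap : length VG + suc q ≤ length pool) where

    private
      N = length VG
      cap′ : N + q ≤ length pool
      cap′ = ≤-trans (+-monoʳ-≤ N (n≤1+n q)) cap
      sucN : suc N ≤ length pool
      sucN = ≤-trans (≤-trans (≤-reflexive (+-comm 1 N)) (+-monoʳ-≤ N (s≤s z≤n))) cap
      2κ≤N : 2 * κ ≤ N
      2κ≤N = ≤-trans (≤-trans (≤-trans (*-monoˡ-≤ κ (m≤m+n 2 6)) (≤-trans (≤-trans (m≤m+n _ _) (≤-trans (m≤m+n _ _) (n≤1+n _))) (≤-reflexive (sym C₀≡)))) C₀≤C)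
        (≤-trans (degree hc v∈) (≤-trans (≤-reflexive (trans (sym (length-filter≡# (G.inc? v) L)) (sym (length-map (G.other v) Lv))))
          (unique-⊆-length (unique-map (λ {i} {j} p p′ → G.other-inj {v} {i} {j} (proj₂ (filter-∈ (G.inc? v) L p)) (proj₂ (filter-∈ (G.inc? v) L p′))) (unique-filter (G.inc? v) (uL hc))) sub)))
        where
        v = proj₁ (nonempty {xs = VG} 1≤N)
        v∈ = proj₂ (nonempty {xs = VG} 1≤N)
        Lv = filter (G.inc? v) L
        sub : map (G.other v) Lv ⊆ VG
        sub p with ∈-map⁻ (G.other v) p
        ... | i , i∈ , refl with filter-∈ (G.inc? v) L i∈
        ...   | i∈L , iv with G.other-spec {v} {i} iv
        ...     | inj₁ t = subst (_∈ VG) (cong proj₂ t) (proj₂ (inV hc i∈L))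
        ...     | inj₂ t = subst (_∈ VG) (cong proj₁ t) (proj₁ (inV hc i∈L))

    G-rank : r (map eG L) ≤ ρ N
    G-rank = ≤-trans (r-mono (λ p → case ∈-map⁻ eG p of λ { (i , i∈ , refl) → K⁺ (proj₁ (inV hc i∈)) (proj₂ (inV hc i∈)) })) (≤-reflexive (rK (uV hc)))

    -- From `p ≤ D * N` there are at most `β * (D * N) = χ * N` loose edges, so the empty cover
    -- would be admissible with `N` in place of `p`.
    no-parts : ∀ F p → (∀ {i} → i ∈ L → i ∈ F ⊎ Any (In (eG i)) []) → length F ≤ β * p → p ≤ ρ N → ⊥
    no-parts F p cov lF pr = case G.cover-one hc C₀≤C 1≤N [] F N cov (λ ()) (loose-χ lF (≤-trans pr (ρ≤D* N (≤-trans (n≤1+n N) sucN))))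
        (≤-trans (≤-reflexive (cong (λ z → z + N + D * κ) (*-zeroʳ D))) (≤-trans (room N 2κ≤N) (m≤m+n _ _)))
      of λ { (_ , () , _) }

    -- By `cover-one` the decomposition of `G` has a single part, which contains all vertices; its
    -- rank bound is that of the complete graph.
    rigid : ρ N ≤ r (map eG L)
    rigid = one (G.decompose (uL hc) N VG ≤-refl (uV hc) cap′)
      where
      top : r (G.Z (uL hc) VG) ≤ ρ N
      top = ≤-trans (r-mono (G.Z⊆K (uL hc) {VG})) (≤-reflexive (rK (uV hc)))
      eq : ∀ d s p k n l → d * s + p + d * k + (d * n + d * k * l) + 0 ≡ d * n + d * k * suc l + (d * s + p)
      eq = solve-∀
      conclude : ∀ {Vs p} → ρ (size Vs ∸ κ * (length Vs ∸ 1)) + p ≤ r (G.Z (uL hc) VG) → (∃ λ W → Vs ≡ W ∷ [] × p ≡ 0 × VG ⊆ W) → ρ N ≤ r (map eG L)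
      conclude rk (W , refl , refl , VG⊆) = ≤-trans (ρ-mono (≤-trans (unique-⊆-length (uV hc) VG⊆) (≤-reflexive (sym (trans (cong (length W + 0 ∸_) (*-zeroʳ κ)) (+-identityʳ (length W)))))))
          (≤-trans (m≤m+n _ 0) (≤-trans rk (r-mono (λ p → case G.Z⁻ (uL hc) {VG} p of λ { (i , i∈ , _ , refl) → ∈-map⁺ eG i∈ }))))
      one : G.Dec′ (uL hc) VG → ρ N ≤ r (map eG L)
      one ([] , F , p , cov , lF , _ , rk) = ⊥-elim (no-parts F p (λ i∈ → cov i∈ (inV hc i∈)) lF (≤-trans (≤-trans (m≤n+m p _) rk) top))
      one (Vs@(_ ∷ Vs₀) , F , p , cov , lF , pt , rk) = conclude {Vs} rk (G.cover-one hc C₀≤C 1≤N Vs F p (λ i∈ → cov i∈ (inV hc i∈)) pt (≤-trans lF (*-monoˡ-≤ p β≤χ))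
          (lin 0 (balanced Vs p N 1≤N sucN rk top) (eq D (size Vs) p κ N (length Vs₀))))

    -- The edges of `H` inside one part `V₁` have rank at most `ρ (length V₁)`, in `G` as well as in
    -- `H`, and are decomposed again as edges of `G`. The weight inequalities of the parts add up.
    -- The last component makes a single part in `G` without loss imply at most one part in `H`.
    refine : ∀ {UH} Vs → suc (length UH) ≤ length pool → (∀ {W} → W ∈ Vs → IsPart UH W) →
      Σ (List (List V)) λ Ws → Σ (List Ix) λ F → Σ ℕ λ p →
        (∀ {i} → i ∈ L → Any (In (eH i)) Vs → i ∈ F ⊎ Any (In (eG i)) Ws) × (∀ {W} → W ∈ Ws → IsPart VG W)
        × length F ≤ χ * p × D * size Ws + p + D * κ * length Vs ≤ D * size Vs + D * κ * length Ws × length Vs ≤ length Ws + p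
    refine [] _ _ = [] , [] , 0 , (λ _ ()) , (λ ()) , z≤n , ≤-reflexive (cong (_+ D * κ * 0) (+-identityʳ _)) , z≤n
    refine {UH} (V₁ ∷ Vs) sz pt with refine Vs sz (pt ∘ there) | G.decompose uL₁ N VG ≤-refl (uV hc) cap′
      where
      L₁ = filter (H.in? V₁) L
      uL₁ = unique-filter (H.in? V₁) (uL hc)
    ... | Ws , F , p , cov , pts , lF , bal , cnt | Ws₁ , F₁ , p₁ , cov₁ , lF₁ , pt₁ , rk = go Ws₁ cov₁ pt₁ rk
      where
      L₁ = filter (H.in? V₁) L
      uL₁ = unique-filter (H.in? V₁) (uL hc)
      a = length V₁
      big : suc β ≤ a
      big = proj₂ (proj₂ (pt (here refl)))
      1≤a : 1 ≤ a
      1≤a = ≤-trans (s≤s z≤n) big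
      a≤ : suc a ≤ length pool
      a≤ = ≤-trans (s≤s (unique-⊆-length (proj₁ (pt (here refl))) (proj₁ (proj₂ (pt (here refl)))))) sz
      up : r (G.Z uL₁ VG) ≤ ρ a
      up = ≤-trans (r-mono (λ t → case G.Z⁻ uL₁ {VG} t of λ { (i , i∈ , _ , refl) → ∈-map⁺ eG i∈ })) (≤-trans (≤-reflexive (same L₁))
        (≤-trans (r-mono (λ t → case ∈-map⁻ eH t of λ { (i , i∈ , refl) → let (x , y) = proj₂ (filter-∈ (H.in? V₁) L i∈) in K⁺ x y }))
          (≤-reflexive (rK (proj₁ (pt (here refl)))))))
      covers : ∀ Ws₁ → (∀ {i} → i ∈ L₁ → In (eG i) VG → i ∈ F₁ ⊎ Any (In (eG i)) Ws₁) →
               ∀ {i} → i ∈ L → Any (In (eH i)) (V₁ ∷ Vs) → i ∈ F₁ ++ F ⊎ Any (In (eG i)) (Ws₁ ++ Ws)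
      covers Ws₁ c {i} i∈ (here t) with c (∈-filter⁺ (H.in? V₁) i∈ t) (inV hc i∈)
      ... | inj₁ s = inj₁ (∈-++⁺ˡ s)
      ... | inj₂ s = let (W , W∈ , h) = find s in inj₂ (lose (∈-++⁺ˡ W∈) h)
      covers Ws₁ c {i} i∈ (there t) with cov i∈ t
      ... | inj₁ s = inj₁ (∈-++⁺ʳ F₁ s)
      ... | inj₂ s = let (W , W∈ , h) = find s in inj₂ (lose (∈-++⁺ʳ Ws₁ W∈) h)
      parts : ∀ Ws₁ → (∀ {W} → W ∈ Ws₁ → IsPart VG W) → ∀ {W} → W ∈ Ws₁ ++ Ws → IsPart VG W
      parts Ws₁ h t = [ h , pts ]′ (∈-++⁻ Ws₁ t)
      Goal = Σ (List (List V)) λ Ws → Σ (List Ix) λ F → Σ ℕ λ p →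
        (∀ {i} → i ∈ L → Any (In (eH i)) (V₁ ∷ Vs) → i ∈ F ⊎ Any (In (eG i)) Ws) × (∀ {W} → W ∈ Ws → IsPart VG W)
        × length F ≤ χ * p × D * size Ws + p + D * κ * suc (length Vs) ≤ D * (a + size Vs) + D * κ * length Ws × suc (length Vs) ≤ length Ws + p
      finish : ∀ Ws₁ p′ → (∀ {i} → i ∈ L₁ → In (eG i) VG → i ∈ F₁ ⊎ Any (In (eG i)) Ws₁) → (∀ {W} → W ∈ Ws₁ → IsPart VG W) →
               length F₁ ≤ χ * p′ → D * size Ws₁ + p′ + D * κ ≤ D * a + D * κ * length Ws₁ → 1 ≤ length Ws₁ + p′ → Goal
      finish Ws₁ p′ c h l b k = Ws₁ ++ Ws , F₁ ++ F , p′ + p , covers Ws₁ c , parts Ws₁ h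
        , ≤-trans (≤-reflexive (length-++ F₁)) (≤-trans (+-mono-≤ l lF) (≤-reflexive (sym (*-distribˡ-+ χ p′ p))))
        , lin 0 (+-mono-≤ b bal) (trans (cong (λ x → D * x + (p′ + p) + D * κ * suc (length Vs) + (D * a + D * κ * length Ws₁ + (D * size Vs + D * κ * length Ws)) + 0) (∑-++ Ws₁ Ws length))
            (trans (eq D (size Ws₁) (size Ws) p′ p κ (length Vs) a (length Ws₁) (length Ws) (size Vs)) (cong (λ z → D * (a + size Vs) + D * κ * z + (D * size Ws₁ + p′ + D * κ + (D * size Ws + p + D * κ * length Vs))) (sym (length-++ Ws₁)))))
        , ≤-trans (+-mono-≤ k cnt) (≤-reflexive (trans (interchange (length Ws₁) p′ (length Ws) p) (cong (_+ (p′ + p)) (sym (length-++ Ws₁)))))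
        where eq : ∀ d s₁ s p′ p k v a l₁ l sv → d * (s₁ + s) + (p′ + p) + d * k * suc v + (d * a + d * k * l₁ + (d * sv + d * k * l)) + 0
                   ≡ d * (a + sv) + d * k * (l₁ + l) + (d * s₁ + p′ + d * k + (d * s + p + d * k * v))
              eq = solve-∀
      go : ∀ Ws₁ → (∀ {i} → i ∈ L₁ → In (eG i) VG → i ∈ F₁ ⊎ Any (In (eG i)) Ws₁) → (∀ {W} → W ∈ Ws₁ → IsPart VG W) →
           ρ (size Ws₁ ∸ κ * (length Ws₁ ∸ 1)) + p₁ ≤ r (G.Z uL₁ VG) → Goal
      go [] c h rk′ = finish [] a c h (loose-χ lF₁ (≤-trans (≤-trans (m≤n+m p₁ _) rk′) (≤-trans up (ρ≤D* a (≤-trans (n≤1+n a) a≤)))))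
        (≤-trans (≤-reflexive (cong (λ z → z + a + D * κ) (*-zeroʳ D))) (≤-trans (room a (≤-trans 2κ≤β (≤-trans (n≤1+n β) big))) (m≤m+n _ _))) 1≤a
      go Ws₁@(_ ∷ Ws₂) c h rk′ = finish Ws₁ p₁ c h (≤-trans lF₁ (*-monoˡ-≤ p₁ β≤χ))
        (lin 0 (balanced Ws₁ p₁ a 1≤a a≤ rk′ up) (eq D (size Ws₁) p₁ κ a (length Ws₂))) (s≤s z≤n)
        where eq : ∀ d s p k n l → d * s + p + d * k + (d * n + d * k * l) + 0 ≡ d * n + d * k * suc l + (d * s + p)
              eq = solve-∀

    -- Decomposing `H` and refining the result gives a cover of `G` of admissible weight, hence a
    -- single part with `p + p′ = 0`. Read backwards, `H` has one part and no loose edges, and the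
    -- order of that part is bounded through its rank.
    few-vertices : ∀ UH → Unique UH → (∀ {i} → i ∈ L → In (eH i) UH) → length UH + suc q ≤ length pool →
      ∃ λ V₀ → length V₀ ≤ N × (∀ {i} → i ∈ L → In (eH i) V₀)
    few-vertices UH uUH inH capH = decomposed (H.decompose (uL hc) (length UH) UH ≤-refl uUH (≤-trans (+-monoʳ-≤ (length UH) (n≤1+n q)) capH))
     where
     decomposed : H.Dec′ (uL hc) UH → ∃ λ V₀ → length V₀ ≤ N × (∀ {i} → i ∈ L → In (eH i) V₀)
     decomposed (Vs , F , p , cov , lF , pt , rk) = go Vs cov pt rk
      where
      sucH : suc (length UH) ≤ length pool
      sucH = ≤-trans (≤-trans (≤-reflexive (+-comm 1 (length UH))) (+-monoʳ-≤ (length UH) (s≤s z≤n))) capH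
      up : r (H.Z (uL hc) UH) ≤ ρ N
      up = ≤-trans (r-mono (λ t → case H.Z⁻ (uL hc) {UH} t of λ { (i , i∈ , _ , refl) → ∈-map⁺ eH i∈ })) (≤-trans (≤-reflexive (sym (same L))) G-rank)
      go : ∀ Vs → (∀ {i} → i ∈ L → In (eH i) UH → i ∈ F ⊎ Any (In (eH i)) Vs) → (∀ {W} → W ∈ Vs → IsPart UH W) →
           ρ (size Vs ∸ κ * (length Vs ∸ 1)) + p ≤ r (H.Z (uL hc) UH) → ∃ λ V₀ → length V₀ ≤ N × (∀ {i} → i ∈ L → In (eH i) V₀)
      go [] c h rk′ = ⊥-elim (no-parts F p (λ i∈ → [ inj₁ , (λ ()) ]′ (c i∈ (inH i∈))) lF (≤-trans (≤-trans (m≤n+m p _) rk′) up))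
      go (V₀ ∷ Vs₀) c h rk′ = one V₀ Vs₀ c rk′ (refine {UH} (V₀ ∷ Vs₀) sucH h)
        where
        one : ∀ V₀ Vs₀ → (∀ {i} → i ∈ L → In (eH i) UH → i ∈ F ⊎ Any (In (eH i)) (V₀ ∷ Vs₀)) → ρ (size (V₀ ∷ Vs₀) ∸ κ * length Vs₀) + p ≤ r (H.Z (uL hc) UH) →
          (Σ (List (List V)) λ Ws → Σ (List Ix) λ F → Σ ℕ λ p →
            (∀ {i} → i ∈ L → Any (In (eH i)) (V₀ ∷ Vs₀) → i ∈ F ⊎ Any (In (eG i)) Ws) × (∀ {W} → W ∈ Ws → IsPart VG W)
            × length F ≤ χ * p × D * size Ws + p + D * κ * suc (length Vs₀) ≤ D * size (V₀ ∷ Vs₀) + D * κ * length Ws × suc (length Vs₀) ≤ length Ws + p) →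
          ∃ λ V₀ → length V₀ ≤ N × (∀ {i} → i ∈ L → In (eH i) V₀)
        one V₀ Vs₀ c rk′ (Ws , F′ , p′ , cov′ , pts , lF′ , bal , cnt) = conclude (G.cover-one hc C₀≤C 1≤N Ws (F ++ F′) (p + p′)
              (λ i∈ → [ (λ t → inj₁ (∈-++⁺ˡ t)) , (λ t → [ (λ s → inj₁ (∈-++⁺ʳ F s)) , inj₂ ]′ (cov′ i∈ t)) ]′ (c i∈ (inH i∈))) pts
              (≤-trans (≤-reflexive (length-++ F)) (≤-trans (+-mono-≤ (≤-trans lF (*-monoˡ-≤ p β≤χ)) lF′) (≤-reflexive (sym (*-distribˡ-+ χ p p′)))))
              (lin 0 (+-mono-≤ (balanced (V₀ ∷ Vs₀) p N 1≤N sucN rk′ up) bal) (eq D (size Ws) p p′ κ N (length Ws) (size (V₀ ∷ Vs₀)) (length Vs₀))))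
          where
          eq : ∀ d w p p′ k n l s v → d * w + (p + p′) + d * k + (d * n + d * k * v + (d * s + d * k * l)) + 0
             ≡ d * n + d * k * l + (d * s + p + (d * w + p′ + d * k * suc v))
          eq = solve-∀
          conclude : (∃ λ W → Ws ≡ W ∷ [] × p + p′ ≡ 0 × VG ⊆ W) → ∃ λ V₀ → length V₀ ≤ N × (∀ {i} → i ∈ L → In (eH i) V₀)
          conclude (W , eW , pp , _) = V₀ , ρ-inv 1≤N sucN (≤-trans (ρ-mono (≤-reflexive (sym e₁))) (≤-trans (m≤m+n _ p) (≤-trans rk′ up))) , inV₀
            where
            Vs₀[] : Vs₀ ≡ []
            Vs₀[] = empty Vs₀ (≤-pred (≤-trans cnt (≤-reflexive (cong₂ _+_ (cong length eW) (m+n≡0⇒n≡0 p pp)))))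
              where empty : ∀ (xs : List (List V)) → length xs ≤ 0 → xs ≡ []
                    empty [] _ = refl
            F[] : ∀ {i} → i ∉ F
            F[] = none F (≤-trans lF (≤-reflexive (trans (cong (β *_) (m+n≡0⇒m≡0 p pp)) (*-zeroʳ β))))
              where none : ∀ (xs : List Ix) → length xs ≤ 0 → ∀ {i} → i ∉ xs
                    none [] _ ()
            e₁ : size (V₀ ∷ Vs₀) ∸ κ * length Vs₀ ≡ length V₀
            e₁ = trans (cong (λ z → size (V₀ ∷ z) ∸ κ * length z) Vs₀[]) (trans (cong (length V₀ + 0 ∸_) (*-zeroʳ κ)) (+-identityʳ _))
            inV₀ : ∀ {i} → i ∈ L → In (eH i) V₀
            inV₀ {i} i∈ = case c i∈ (inH i∈) of λ
              { (inj₁ t) → ⊥-elim (F[] t) ; (inj₂ (here t)) → t ; (inj₂ (there t)) → case subst (Any (In (eH i))) Vs₀[] t of λ () }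

  pair≤1 : ∀ {L x v} → Unique L → x ≢ v → # (λ i → G.inc? x i ×-dec G.inc? v i) L ≤ 1
  pair≤1 {L} {x} {v} u n = ≤-trans (≤-reflexive (trans (sym (length-filter≡# (λ i → G.inc? x i ×-dec G.inc? v i) L)) (sym (length-map (G.other v) L′))))
      (unique-⊆-length {ys = x ∷ []} (unique-map (λ {i} {j} p p′ → G.other-inj {v} {i} {j} (proj₂ (mem p)) (proj₂ (mem p′))) (unique-filter (λ i → G.inc? x i ×-dec G.inc? v i) u)) sub)
    where
    L′ = filter (λ i → G.inc? x i ×-dec G.inc? v i) L
    mem : ∀ {i} → i ∈ L′ → (proj₁ (eG i) ≡ x ⊎ proj₂ (eG i) ≡ x) × (proj₁ (eG i) ≡ v ⊎ proj₂ (eG i) ≡ v)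
    mem p = proj₂ (filter-∈ (λ i → G.inc? x i ×-dec G.inc? v i) L p)
    sub : map (G.other v) L′ ⊆ x ∷ []
    sub p with ∈-map⁻ (G.other v) p
    ... | i , i∈ , refl with mem i∈
    ...   | ix , iv with G.other-spec {v} {i} iv
    ...     | inj₁ t = here ([ (λ e → ⊥-elim (n (trans (sym e) (cong proj₁ t)))) , (λ e → trans (sym (cong proj₂ t)) e) ]′ ix)
    ...     | inj₂ t = here ([ (λ e → trans (sym (cong proj₁ t)) e) , (λ e → ⊥-elim (n (trans (sym e) (cong proj₂ t)))) ]′ ix)

  -- Apart from `v`, every boundary vertex of `v ∷ W` in `G` is one of `W` in the graph without `v`;
  -- so the deletion costs at most one boundary vertex, and one edge at any other vertex.
  delete : ∀ {C L VG v} → G.HC (suc C) L VG → v ∈ VG → G.HC C (filter (λ i → ¬? (G.inc? v i)) L) (VG ⊖ v)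
  delete {C} {L} {VG} {v} hc v∈ = record
    { uL = unique-filter out? (uL hc)
    ; uV = unique-filter (λ y → ¬? (y ≟ v)) (uV hc)
    ; inV = λ p → let (i∈ , n) = filter-∈ out? L p in ∈-⊖⁺ (proj₁ (inV hc i∈)) (n ∘ inj₁) , ∈-⊖⁺ (proj₂ (inV hc i∈)) (n ∘ inj₂)
    ; degree = λ {x} p → let (x∈ , n) = ∈-⊖⁻ VG p in ≤-pred (≤-trans (degree hc x∈)
        (≤-trans (#-cases (G.inc? x) (λ i → G.inc? x i ×-dec G.inc? v i) (λ i → out? i ×-dec G.inc? x i) L
            (λ i _ ix → case G.inc? v i of λ { (yes iv) → inj₁ (ix , iv) ; (no iv) → inj₂ (iv , ix) }))
          (+-mono-≤ (pair≤1 (uL hc) n) (≤-reflexive (sym (#-filter out? (G.inc? x) L))))))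
    ; separ = sep }
    where
    out? : ∀ i → Dec (¬ (proj₁ (eG i) ≡ v ⊎ proj₂ (eG i) ≡ v))
    out? i = ¬? (G.inc? v i)
    L′ = filter out? L
    back : ∀ {W x} → x ≢ v → G.Boundary L (v ∷ W) x → G.Boundary L′ W x
    back n (here e , _) = ⊥-elim (n e)
    back {W} {x} n (there x∈ , a) with find a
    ... | i , i∈ , ix , nin = x∈ , lose (∈-filter⁺ out? i∈ ni) (ix , λ { (p , p′) → nin (there p , there p′) })
      where
      ni : ¬ (proj₁ (eG i) ≡ v ⊎ proj₂ (eG i) ≡ v)
      ni = clash ix
        where
        clash : proj₁ (eG i) ≡ x ⊎ proj₂ (eG i) ≡ x → ¬ (proj₁ (eG i) ≡ v ⊎ proj₂ (eG i) ≡ v)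
        clash (inj₁ e) (inj₁ e′) = n (trans (sym e) e′)
        clash (inj₂ e) (inj₂ e′) = n (trans (sym e) e′)
        clash (inj₁ e) (inj₂ e′) = nin (there (subst (_∈ W) (sym e) x∈) , here e′)
        clash (inj₂ e) (inj₁ e′) = nin (here e′ , there (subst (_∈ W) (sym e) x∈))
    sep : ∀ W {v₀ u₀} → v₀ ∈ VG ⊖ v → v₀ ∈ W → ¬ G.Boundary L′ W v₀ → u₀ ∈ VG ⊖ v → u₀ ∉ W → C ≤ # (G.boundary? L′ W) (VG ⊖ v)
    sep W {v₀} {u₀} p v₀W nb p′ u₀∉ = let (v₀∈ , n) = ∈-⊖⁻ VG p ; (u₀∈ , n′) = ∈-⊖⁻ VG p′ in
      ≤-pred (≤-trans (separ hc (v ∷ W) v₀∈ (there v₀W) (λ b → nb (back n b)) u₀∈ (λ { (here e) → n′ e ; (there t) → u₀∉ t }))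
        (≤-trans (#-cases (G.boundary? L (v ∷ W)) (_≟ v) (λ x → ¬? (x ≟ v) ×-dec G.boundary? L′ W x) VG
            (λ x _ b → case x ≟ v of λ { (yes e) → inj₁ e ; (no m) → inj₂ (m , back m b) }))
          (+-mono-≤ (#≡≤1 (uV hc) v) (≤-reflexive (sym (#-filter (λ y → ¬? (y ≟ v)) (G.boundary? L′ W) VG))))))

  module _ {L VG VH} (hc : G.HC (suc C₀) L VG) (cap : length VG + suc q ≤ length pool) (capH : length VH + suc q ≤ length pool)
    (uVH : Unique VH) (inH : ∀ {i} → i ∈ L → In (eH i) VH) (isoH : ∀ {w} → w ∈ VH → ∃ λ i → i ∈ L × (proj₁ (eH i) ≡ w ⊎ proj₂ (eH i) ≡ w))
    (2≤N : 2 ≤ length VG) where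

    private
      N = length VG

      hc₀ : G.HC C₀ L VG
      hc₀ = record { uL = uL hc ; uV = uV hc ; inV = inV hc ; degree = λ p → ≤-trans (n≤1+n C₀) (degree hc p)
                   ; separ = λ W a b c x y → ≤-trans (n≤1+n C₀) (separ hc W a b c x y) }

      VH≤N : length VH ≤ N
      VH≤N = let (V₀ , le , h) = few-vertices hc₀ ≤-refl (≤-trans (n≤1+n 1) 2≤N) cap VH uVH inH capH in
        ≤-trans (unique-⊆-length uVH (λ w∈ → let (i , i∈ , x) = isoH w∈ in [ (λ e → subst (_∈ V₀) e (proj₁ (h i∈))) , (λ e → subst (_∈ V₀) e (proj₂ (h i∈))) ]′ x)) le

      N≤VH : N ≤ length VH
      N≤VH = ρ-inv 1≤H (≤-trans (≤-trans (≤-reflexive (+-comm 1 (length VH))) (+-monoʳ-≤ (length VH) (s≤s z≤n))) capH)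
        (≤-trans (rigid hc₀ ≤-refl (≤-trans (n≤1+n 1) 2≤N) cap) (≤-trans (≤-reflexive (same L)) (≤-trans (r-mono (λ p → case ∈-map⁻ eH p of λ { (i , i∈ , refl) → K⁺ (proj₁ (inH i∈)) (proj₂ (inH i∈)) })) (≤-reflexive (rK uVH)))))
        where
        v∈ = proj₂ (nonempty {xs = VG} (≤-trans (n≤1+n 1) 2≤N))
        1≤H : 1 ≤ length VH
        1≤H with #-pos (G.inc? _) L (≤-trans (s≤s z≤n) (degree hc v∈))
        ... | i , i∈ , _ = ne (proj₁ (inH i∈))
          where ne : ∀ {x} {xs : List V} → x ∈ xs → 1 ≤ length xs
                ne (here _)  = s≤s z≤n
                ne (there _) = s≤s z≤n

      module At {v} (v∈ : v ∈ VG) where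
        Lv = filter (λ i → ¬? (G.inc? v i)) L
        hcv : G.HC C₀ Lv (VG ⊖ v)
        hcv = delete hc v∈
        N≡ : N ≡ suc (length (VG ⊖ v))
        N≡ = length-⊖ (uV hc) v∈
        1≤ : 1 ≤ length (VG ⊖ v)
        1≤ = ≤-pred (≤-trans 2≤N (≤-reflexive N≡))
        capv : length (VG ⊖ v) + suc q ≤ length pool
        capv = ≤-trans (+-monoˡ-≤ (suc q) (≤-trans (n≤1+n _) (≤-reflexive (sym N≡)))) cap
        Lv⊆ : Lv ⊆ L
        Lv⊆ p = proj₁ (filter-∈ (λ i → ¬? (G.inc? v i)) L p)
        -- The graph without `v` is still highly connected, so in `H` its edges lie on fewer than
        -- `N` vertices. All edges of `H` at a vertex `w` outside come from edges at `v`.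
        image : ∃ λ w → w ∈ VH × (∀ {i} → i ∈ L → proj₁ (eH i) ≡ w ⊎ proj₂ (eH i) ≡ w → proj₁ (eG i) ≡ v ⊎ proj₂ (eG i) ≡ v)
        image with few-vertices hcv ≤-refl 1≤ capv VH uVH (inH ∘ Lv⊆) capH
        ... | V₀ , le , h with anyL? (λ w → ¬? (w ∈? V₀)) VH
        ...   | no none = ⊥-elim (1+n≰n (≤-trans (≤-reflexive (sym N≡)) (≤-trans N≤VH (≤-trans (unique-⊆-length uVH (λ {w} w∈ → decidable-stable (w ∈? V₀) (λ n → none (lose w∈ n)))) le))))
        ...   | yes a with find a
        ...     | w , w∈ , w∉ = w , w∈ , λ {i} i∈ iw → decidable-stable (G.inc? v i) (λ n →
                  let (x , y) = h (∈-filter⁺ (λ i → ¬? (G.inc? v i)) i∈ n) in w∉ ([ (λ e → subst (_∈ V₀) e x) , (λ e → subst (_∈ V₀) e y) ]′ iw))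

      φ : V → V
      φ v with v ∈? VG
      ... | yes p = proj₁ (At.image p)
      ... | no _  = v

      φ-spec : ∀ {v} → v ∈ VG → φ v ∈ VH × (∀ {i} → i ∈ L → proj₁ (eH i) ≡ φ v ⊎ proj₂ (eH i) ≡ φ v → proj₁ (eG i) ≡ v ⊎ proj₂ (eG i) ≡ v)
      φ-spec {v} v∈ with v ∈? VG
      ... | yes p = proj₂ (At.image p)
      ... | no n  = ⊥-elim (n v∈)

      -- Two preimages would share all edges coming from `w = φ v`, so there is at most one, and
      -- some edge `j` at `v` avoids `w`. With `j` added as a pendant edge, the rigid graph without
      -- `v` has rank above that of the complete graph on `N - 1` vertices; but in `H` all these
      -- edges avoid `w` and lie on `N - 1` vertices.
      φ-inj : ∀ {v v′} → v ∈ VG → v′ ∈ VG → φ v ≡ φ v′ → v ≡ v′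
      φ-inj {v} {v′} v∈ v′∈ eq with v ≟ v′
      ... | yes p = p
      ... | no n = ⊥-elim (1+n≰n (≤-trans (s≤s (rigid hcv ≤-refl 1≤ capv)) (≤-trans (leaf {VG ⊖ v} {map eG Lv} {G.other v j} {v} X⊆ (λ t → proj₂ (∈-⊖⁻ VG t) refl) o∈)
            (≤-trans up (≤-trans (≤-reflexive (same L′)) (≤-trans (r-mono down) (≤-reflexive (trans (rK (unique-filter (λ y → ¬? (y ≟ w)) uVH)) (cong ρ lw)))))))))
        where
        open At v∈
        w = φ v
        both : ∀ {i} → i ∈ L → proj₁ (eH i) ≡ w ⊎ proj₂ (eH i) ≡ w → (proj₁ (eG i) ≡ v ⊎ proj₂ (eG i) ≡ v) × (proj₁ (eG i) ≡ v′ ⊎ proj₂ (eG i) ≡ v′)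
        both i∈ iw = proj₂ (φ-spec v∈) i∈ iw , proj₂ (φ-spec v′∈) i∈ (subst (λ z → _ ≡ z ⊎ _ ≡ z) eq iw)
        L′ = filter (λ i → ¬? (H.inc? w i)) L
        extra : ∃ λ j → j ∈ L × (proj₁ (eG j) ≡ v ⊎ proj₂ (eG j) ≡ v) × ¬ (proj₁ (eH j) ≡ w ⊎ proj₂ (eH j) ≡ w)
        extra with anyL? (λ i → G.inc? v i ×-dec ¬? (H.inc? w i)) L
        ... | yes a = find a
        ... | no none = ⊥-elim (1+n≰n (≤-trans (≤-trans (s≤s 1≤C₀) (degree hc v∈)) (≤-trans (#-mono (G.inc? v) (λ i → G.inc? v i ×-dec G.inc? v′ i) L
              (λ i i∈ iv → iv , proj₂ (both i∈ (decidable-stable (H.inc? w i) (λ m → none (lose i∈ (iv , m))))))) (pair≤1 (uL hc) n))))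
          where 1≤C₀ : 1 ≤ C₀
                1≤C₀ = subst (1 ≤_) (sym C₀≡) (s≤s z≤n)
        j = proj₁ extra
        j∈ = proj₁ (proj₂ extra)
        jv = proj₁ (proj₂ (proj₂ extra))
        jw = proj₂ (proj₂ (proj₂ extra))
        X⊆ : map eG Lv ⊆ K (VG ⊖ v)
        X⊆ p with ∈-map⁻ eG p
        ... | i , i∈ , refl = K⁺ (proj₁ (inV hcv i∈)) (proj₂ (inV hcv i∈))
        o∈ : G.other v j ∈ VG ⊖ v
        o∈ = ∈-⊖⁺ (case G.other-spec {v} {j} jv of λ { (inj₁ t) → subst (_∈ VG) (cong proj₂ t) (proj₂ (inV hc j∈)) ; (inj₂ t) → subst (_∈ VG) (cong proj₁ t) (proj₁ (inV hc j∈)) }) (G.other-≢ {v} {j} jv)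
        ej : eG j ∈ map eG L′
        ej = ∈-map⁺ eG (∈-filter⁺ (λ i → ¬? (H.inc? w i)) j∈ jw)
        up : r ((v , G.other v j) ∷ map eG Lv) ≤ r (map eG L′)
        up = ≤-trans (r-mono {(v , G.other v j) ∷ map eG Lv} {(v , G.other v j) ∷ map eG L′} λ { (here t) → here t ; (there t) → there (sub t) })
            (case G.other-spec {v} {j} jv of λ { (inj₁ t) → cl-∈ (subst (_∈ map eG L′) t ej) ; (inj₂ t) → cl-flip (cl-∈ (subst (_∈ map eG L′) t ej)) })
          where sub : map eG Lv ⊆ map eG L′
                sub p with ∈-map⁻ eG p
                ... | i , i∈ , refl = let (a , b) = filter-∈ (λ i → ¬? (G.inc? v i)) L i∈ in ∈-map⁺ eG (∈-filter⁺ (λ i → ¬? (H.inc? w i)) a (λ iw → b (proj₁ (both a iw))))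
        down : map eH L′ ⊆ K (VH ⊖ w)
        down p with ∈-map⁻ eH p
        ... | i , i∈ , refl = let (a , b) = filter-∈ (λ i → ¬? (H.inc? w i)) L i∈ ; (x , y) = inH a in K⁺ (∈-⊖⁺ x (b ∘ inj₁)) (∈-⊖⁺ y (b ∘ inj₂))
        lw : length (VH ⊖ w) ≡ length (VG ⊖ v)
        lw = suc-injective (trans (sym (length-⊖ uVH (proj₁ (φ-spec v∈)))) (trans (≤-antisym VH≤N N≤VH) N≡))

      φ-onto : VH ⊆ map φ VG
      φ-onto = unique-⊆-equal (unique-map φ-inj (uV hc)) (λ p → case ∈-map⁻ φ p of λ { (v , v∈ , refl) → proj₁ (φ-spec v∈) })
        (≤-trans VH≤N (≤-reflexive (sym (length-map φ VG)))) _≟_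

    stars-to-stars : ∀ {v} → v ∈ VG → ∃ λ w → ∀ {i} → i ∈ L →
      (proj₁ (eG i) ≡ v ⊎ proj₂ (eG i) ≡ v → proj₁ (eH i) ≡ w ⊎ proj₂ (eH i) ≡ w) ×
      (proj₁ (eH i) ≡ w ⊎ proj₂ (eH i) ≡ w → proj₁ (eG i) ≡ v ⊎ proj₂ (eG i) ≡ v)
    stars-to-stars {v} v∈ = φ v , λ {i} i∈ → forth i∈ , proj₂ (φ-spec v∈) i∈
      where
      -- As `φ` is onto, the ends of `i` in `H` are `φ a` and `φ b` with `a ≢ b`. Then `a` and `b`
      -- are the ends of `i` in `G`, so `v` is one of them.
      forth : ∀ {i} → i ∈ L → proj₁ (eG i) ≡ v ⊎ proj₂ (eG i) ≡ v → proj₁ (eH i) ≡ φ v ⊎ proj₂ (eH i) ≡ φ v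
      forth {i} i∈ iv with ∈-map⁻ φ (φ-onto (proj₁ (inH i∈))) | ∈-map⁻ φ (φ-onto (proj₂ (inH i∈)))
      ... | a , a∈ , ea | b , b∈ , eb = ends iv (proj₂ (φ-spec a∈) i∈ (inj₁ ea)) (proj₂ (φ-spec b∈) i∈ (inj₂ eb))
        where
        a≢b : a ≢ b
        a≢b refl = nlH i (trans ea (sym eb))
        ends : proj₁ (eG i) ≡ v ⊎ proj₂ (eG i) ≡ v → proj₁ (eG i) ≡ a ⊎ proj₂ (eG i) ≡ a → proj₁ (eG i) ≡ b ⊎ proj₂ (eG i) ≡ b → proj₁ (eH i) ≡ φ v ⊎ proj₂ (eH i) ≡ φ v
        ends _ (inj₁ x) (inj₁ y) = ⊥-elim (a≢b (trans (sym x) y))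
        ends _ (inj₂ x) (inj₂ y) = ⊥-elim (a≢b (trans (sym x) y))
        ends (inj₁ z) (inj₁ x) (inj₂ y) = inj₁ (trans ea (cong φ (trans (sym x) z)))
        ends (inj₁ z) (inj₂ x) (inj₁ y) = inj₂ (trans eb (cong φ (trans (sym y) z)))
        ends (inj₂ z) (inj₁ x) (inj₂ y) = inj₂ (trans eb (cong φ (trans (sym y) z)))
        ends (inj₂ z) (inj₂ x) (inj₁ y) = inj₁ (trans ea (cong φ (trans (sym x) z)))

-- Finite graphs of bounded degree and large girth

record FinGraph : Set₁ where
  field
    Pt E       : Set
    _≟V_      : DecidableEquality Pt
    _≟_       : DecidableEquality E
    vs        : List Pt
    vs-unique : Unique vs
    vs-all    : ∀ v → v ∈ vs
    es        : List E
    es-unique : Unique es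
    es-all    : ∀ e → e ∈ es
    src tgt   : E → Pt
    noloop    : ∀ e → src e ≢ tgt e

  Inc : E → Pt → Set
  Inc e v = src e ≡ v ⊎ tgt e ≡ v

  field
    simple : ∀ {e f u v} → u ≢ v → Inc e u → Inc e v → Inc f u → Inc f v → e ≡ f

  inc? : ∀ e v → Dec (Inc e v)
  inc? e v = (src e ≟V v) ⊎-dec (tgt e ≟V v)

  opposite : ∀ {e v} → Inc e v → ∃ λ w → w ≢ v × Inc e w × (∀ {z} → Inc e z → z ≡ v ⊎ z ≡ w)
  opposite {e} (inj₁ refl) = tgt e , (noloop e ∘ sym) , inj₂ refl , [ inj₁ ∘ sym , inj₂ ∘ sym ]′
  opposite {e} (inj₂ refl) = src e , noloop e , inj₁ refl , [ inj₂ ∘ sym , inj₁ ∘ sym ]′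

  -- Takes the place of cycles: a minimal non-empty leafless set is a cycle, so `Girth>` bounds the
  -- girth without any talk of paths.
  Leafless : List E → Set
  Leafless Y = ∀ {e v} → e ∈ Y → Inc e v → ∃ λ f → f ∈ Y × f ≢ e × Inc f v

  Girth> : ℕ → Set
  Girth> g = ∀ {Y} → Unique Y → 1 ≤ length Y → Leafless Y → g < length Y

  degree : Pt → ℕ
  degree v = # (λ e → inc? e v) es

  private
    open DecList _≟_

    Leaf : List E → Pt → E → Set
    Leaf Y w e = Inc e w × All (λ f → f ≡ e ⊎ ¬ Inc f w) Y

    leaf? : ∀ Y w e → Dec (Leaf Y w e)
    leaf? Y w e = inc? e w ×-dec allL? (λ f → (f ≟ e) ⊎-dec ¬? (inc? f w)) Y

    second : ∀ {Y w e} → Inc e w → ¬ Leaf Y w e → ∃ λ f → f ∈ Y × f ≢ e × Inc f w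
    second {Y} {w} {e} i n with anyL? (λ f → ¬? (f ≟ e) ×-dec inc? f w) Y
    ... | yes a = find a
    ... | no ¬a = ⊥-elim (n (i , tabulateAll λ {f} f∈ → case f ≟ e of λ
            { (yes p) → inj₁ p ; (no p) → inj₂ λ t → ¬a (lose f∈ (p , t)) }))

  has-leaf : ∀ {Y} → ¬ Leafless Y → ∃ λ e → ∃ λ v → e ∈ Y × Inc e v × (∀ {f} → f ∈ Y → f ≢ e → ¬ Inc f v)
  has-leaf {Y} n with anyL? (λ e → leaf? Y (src e) e ⊎-dec leaf? Y (tgt e) e) Y
  ... | no none = ⊥-elim (n λ {e} e∈ i → second i (λ l → none (lose e∈ (at i l))))
    where at : ∀ {e v} → Inc e v → Leaf Y v e → Leaf Y (src e) e ⊎ Leaf Y (tgt e) e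
          at (inj₁ refl) l = inj₁ l
          at (inj₂ refl) l = inj₂ l
  ... | yes a with find a
  ...   | e , e∈ , inj₁ (i , l) = e , src e , e∈ , i , λ f∈ f≢ t → [ f≢ , (λ n → n t) ]′ (lookupAll l f∈)
  ...   | e , e∈ , inj₂ (i , l) = e , tgt e , e∈ , i , λ f∈ f≢ t → [ f≢ , (λ n → n t) ]′ (lookupAll l f∈)

  -- A leaf can occur only at `w`. Removing its edge moves the only possible leaf to the other end
  -- `w′`, where another edge is guaranteed, so the set never becomes empty.
  trim : ∀ n Y w → length Y ≤ n → Unique Y → 1 ≤ length Y →
         (∀ {e v} → e ∈ Y → Inc e v → v ≢ w → ∃ λ f → f ∈ Y × f ≢ e × Inc f v) →
         ∃ λ Y′ → Unique Y′ × 1 ≤ length Y′ × Y′ ⊆ Y × Leafless Y′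
  trim zero    Y w le u ne h = ⊥-elim (1+n≰n (≤-trans ne le))
  trim (suc n) Y w le u ne h with anyL? (leaf? Y w) Y
  ... | no none = Y , u , ne , id , λ {e} {v} e∈ i → case v ≟V w of λ
        { (yes refl) → second i (λ l → none (lose e∈ l)) ; (no v≢w) → h e∈ i v≢w }
  ... | yes a with find a
  ...   | e , e∈ , i , l with opposite i
  ...     | w′ , w′≢w , i′ , ends with trim n (Y ⊖ e) w′
                (≤-pred (≤-trans (≤-reflexive (sym (length-⊖ u e∈))) le)) (unique-filter _ u) ne′ h′
    where
    ne′ : 1 ≤ length (Y ⊖ e)
    ne′ = let (f , f∈ , f≢ , _) = h e∈ i′ w′≢w in unique-⊆-length {xs = f ∷ []} ([] ∷ []) λ { (here refl) → ∈-⊖⁺ f∈ f≢ }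
    h′ : ∀ {d v} → d ∈ Y ⊖ e → Inc d v → v ≢ w′ → ∃ λ f → f ∈ Y ⊖ e × f ≢ d × Inc f v
    h′ {d} {v} d∈ t v≢ with h (proj₁ (∈-⊖⁻ Y d∈)) t v≢w
      where v≢w : v ≢ w
            v≢w refl = [ proj₂ (∈-⊖⁻ Y d∈) , (λ n → n t) ]′ (lookupAll l (proj₁ (∈-⊖⁻ Y d∈)))
    ... | f , f∈ , f≢ , s = f , ∈-⊖⁺ f∈ f≢e , f≢ , s
      where f≢e : f ≢ e
            f≢e refl with ends s
            ... | inj₁ refl = [ proj₂ (∈-⊖⁻ Y d∈) , (λ n → n t) ]′ (lookupAll l (proj₁ (∈-⊖⁻ Y d∈)))
            ... | inj₂ p    = v≢ p
  ...       | Y′ , u′ , ne″ , s , lf = Y′ , u′ , ne″ , (λ p → proj₁ (∈-⊖⁻ Y (s p))) , lf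

vecs : ∀ m → List (Vec Bool m)
vecs zero    = [] ∷ []
vecs (suc m) = map (true ∷_) (vecs m) ++ map (false ∷_) (vecs m)

vecs-all : ∀ {m} (x : Vec Bool m) → x ∈ vecs m
vecs-all []          = here refl
vecs-all (true ∷ x)  = ∈-++⁺ˡ (∈-map⁺ (true ∷_) (vecs-all x))
vecs-all (false ∷ x) = ∈-++⁺ʳ (map (true ∷_) (vecs _)) (∈-map⁺ (false ∷_) (vecs-all x))

vecs-unique : ∀ m → Unique (vecs m)
vecs-unique zero    = [] ∷ []
vecs-unique (suc m) = unique-++ (unique-map (λ _ _ → ∷-injectiveʳ) (vecs-unique m)) (unique-map (λ _ _ → ∷-injectiveʳ) (vecs-unique m))
  λ p q → case ∈-map⁻ (true ∷_) p of λ { (_ , _ , refl) → case ∈-map⁻ (false ∷_) q of λ { (_ , _ , ()) } }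

length-× : ∀ {A B : Set} (xs : List A) (ys : List B) → length (cartesianProduct xs ys) ≡ length xs * length ys
length-× []       ys = refl
length-× (x ∷ xs) ys = trans (length-++ (map (x ,_) ys)) (cong₂ _+_ (length-map (x ,_) ys) (length-× xs ys))

-- The covering graph in which traversing the edge i flips the i-th bit: an edge of a subgraph with no other lift of the same edge
-- is a bridge, so a leafless subgraph has more edges than its projection.

module Cover (Γ : FinGraph) where
  open FinGraph Γ

  Bits : Set
  Bits = Vec Bool (length es)

  code : E → Fin (length es)
  code e = Any.index (es-all e)

  code-inj : ∀ {e f} → code e ≡ code f → e ≡ f
  code-inj {e} {f} p = trans (lookup-index (es-all e)) (trans (cong (lookup es) p) (sym (lookup-index (es-all f))))

  flip : E → Bits → Bits
  flip e x = updateAt x (code e) not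

  flip-inj : ∀ e {x y} → flip e x ≡ flip e y → x ≡ y
  flip-inj e {x} {y} p = trans (sym (invol x)) (trans (cong (flip e) p) (invol y))
    where invol : ∀ x → flip e (flip e x) ≡ x
          invol x = trans (updateAt-updateAt-local (code e) {h = id} x (not-involutive _)) (updateAt-id-local (code e) x refl)

  bit : E → Bits → Bool
  bit e x = Vec.lookup x (code e)

  bit-flip : ∀ e x → bit e (flip e x) ≢ bit e x
  bit-flip e x p = not-¬ {bit e x} refl (trans (sym p) (lookup∘updateAt (code e) x))

  bit-other : ∀ {e f} x → e ≢ f → bit e (flip f x) ≡ bit e x
  bit-other {e} {f} x n = lookup∘updateAt′ (code e) (code f) (n ∘ code-inj) x

  src′ tgt′ : E × Bits → Pt × Bits
  src′ (e , x) = src e , x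
  tgt′ (e , x) = tgt e , flip e x

  Inc′ : E × Bits → Pt × Bits → Set
  Inc′ e v = src′ e ≡ v ⊎ tgt′ e ≡ v

  down : ∀ {e v} → Inc′ e v → Inc (proj₁ e) (proj₁ v)
  down (inj₁ p) = inj₁ (cong proj₁ p)
  down (inj₂ p) = inj₂ (cong proj₁ p)

  up : ∀ {e} x {v} → Inc e v → ∃ λ y → Inc′ (e , x) (v , y)
  up {e} x (inj₁ refl) = x , inj₁ refl
  up {e} x (inj₂ refl) = flip e x , inj₂ refl

  lift-unique : ∀ {e f v} → Inc′ e v → Inc′ f v → proj₁ e ≡ proj₁ f → e ≡ f
  lift-unique (inj₁ refl) (inj₁ refl) refl = refl
  lift-unique {e , x} (inj₁ refl) (inj₂ p) refl = ⊥-elim (noloop e (sym (cong proj₁ p)))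
  lift-unique {e , x} (inj₂ refl) (inj₁ p) refl = ⊥-elim (noloop e (cong proj₁ p))
  lift-unique {e , x} {_ , y} (inj₂ refl) (inj₂ p) refl = cong (e ,_) (sym (flip-inj e (cong proj₂ p)))

  apart : ∀ {e u v} → u ≢ v → Inc′ e u → Inc′ e v → proj₁ u ≢ proj₁ v
  apart n (inj₁ refl) (inj₁ refl) _ = n refl
  apart {e , _} n (inj₁ refl) (inj₂ refl) p = noloop e p
  apart {e , _} n (inj₂ refl) (inj₁ refl) p = noloop e (sym p)
  apart n (inj₂ refl) (inj₂ refl) _ = n refl

  cover : FinGraph
  cover = record
    { Pt = Pt × Bits ; E = E × Bits ; _≟V_ = ×-≟ _≟V_ (vec-≟ _≟B_) ; _≟_ = ×-≟ _≟_ (vec-≟ _≟B_)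
    ; vs = cartesianProduct vs (vecs _) ; vs-unique = Uniqueₚ.cartesianProduct⁺ vs-unique (vecs-unique _)
    ; vs-all = λ (v , x) → ∈-cartesianProduct⁺ (vs-all v) (vecs-all x)
    ; es = cartesianProduct es (vecs _) ; es-unique = Uniqueₚ.cartesianProduct⁺ es-unique (vecs-unique _)
    ; es-all = λ (e , x) → ∈-cartesianProduct⁺ (es-all e) (vecs-all x)
    ; src = src′ ; tgt = tgt′ ; noloop = λ (e , _) p → noloop e (cong proj₁ p)
    ; simple = λ {e} {f} n a b c d → lift-unique a c (simple (apart n a b) (down a) (down b) (down c) (down d)) }

  private module C = FinGraph cover

  degree-cover : ∀ v → C.degree v ≤ degree (proj₁ v)
  degree-cover v = subst₂ _≤_ (trans (length-map proj₁ (filter (λ e → C.inc? e v) C.es)) (length-filter≡# (λ e → C.inc? e v) C.es)) (length-filter≡# (λ e → inc? e (proj₁ v)) es)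
    (unique-⊆-length {xs = map proj₁ (filter (λ e → C.inc? e v) C.es)} (unique-map (λ p q → lift-unique (inc p) (inc q)) (unique-filter _ C.es-unique))
      λ p → case ∈-map⁻ proj₁ p of λ { (e , e∈ , refl) → ∈-filter⁺ (λ e → inc? e (proj₁ v)) (es-all (proj₁ e)) (down (inc e∈)) })
    where inc : ∀ {e} → e ∈ filter (λ e → C.inc? e v) C.es → Inc′ e v
          inc p = proj₂ (filter-∈ (λ e → C.inc? e v) C.es p)

  module _ {g} (girth : Girth> g) where
    private
      open DecList _≟_ using (_∈?_)
      module D = DecList C._≟_

      proj : List (E × Bits) → List E
      proj Y = deduplicate _≟_ (map proj₁ Y)

      proj⁻ : ∀ {Y e} → e ∈ proj Y → ∃ λ x → (e , x) ∈ Y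
      proj⁻ {Y} p with ∈-map⁻ proj₁ (∈-deduplicate⁻ _≟_ (map proj₁ Y) p)
      ... | (_ , x) , q , refl = x , q

      proj⁺ : ∀ {Y e} → e ∈ Y → proj₁ e ∈ proj Y
      proj⁺ p = ∈-deduplicate⁺ _≟_ (∈-map⁺ proj₁ p)

      proj-large : ∀ {Y} → 1 ≤ length Y → C.Leafless Y → g < length (proj Y)
      proj-large {Y} ne lf = girth (UniqueD.deduplicate-! _≟_ (map proj₁ Y))
        (let (e , e∈) = nonempty {xs = Y} ne in unique-⊆-length {xs = proj₁ e ∷ []} ([] ∷ []) λ { (here refl) → proj⁺ e∈ })
        λ {e} e∈ i → let (x , ex∈) = proj⁻ {Y} e∈ ; (y , i′) = up {e} x i ; (f , f∈ , f≢ , fi) = lf ex∈ i′ in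
          proj₁ f , proj⁺ f∈ , (λ q → f≢ (lift-unique fi i′ q)) , down fi

      proj-length : ∀ Y → length (proj Y) ≤ length Y
      proj-length Y = ≤-trans (unique-⊆-length (UniqueD.deduplicate-! _≟_ (map proj₁ Y)) (∈-deduplicate⁻ _≟_ (map proj₁ Y))) (≤-reflexive (length-map proj₁ Y))

      large : ∀ {Y} → 1 ≤ length Y → C.Leafless Y → g < length Y
      large {Y} ne lf = ≤-trans (proj-large {Y} ne lf) (proj-length Y)

    -- A leafless set of at most `g + 1` edges has a projection of more than `g` edges, so it
    -- projects injectively and each of its edges is alone over its image. Trimming one side of such
    -- a bridge leaves a leafless set of at most `g` edges, which is too small.
    girth-cover : C.Girth> (suc g)
    girth-cover {Y} u ne lf = ≰⇒> contra
      where
      contra : ¬ (length Y ≤ suc g)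
      contra le with nonempty {xs = Y} ne
      ... | e₀@(i , x) , e∈ = <⇒≱ (large (proj₁ (proj₂ (proj₂ small))) (proj₂ (proj₂ (proj₂ (proj₂ small))))) small≤
        where
        unique-lift : ∀ {f} → f ∈ Y → f ≢ e₀ → i ≢ proj₁ f
        unique-lift {f} f∈ f≢ p = <⇒≱ (proj-large {Y} ne lf) (≤-pred (≤-trans (s≤s (≤-trans
            (unique-⊆-length {ys = map proj₁ (Y D.⊖ e₀)} (UniqueD.deduplicate-! _≟_ (map proj₁ Y)) sub) (≤-reflexive (length-map proj₁ (Y D.⊖ e₀)))))
            (≤-trans (≤-reflexive (sym (D.length-⊖ u e∈))) le)))
          where
          sub : proj Y ⊆ map proj₁ (Y D.⊖ e₀)
          sub q with proj⁻ {Y} q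
          ... | y , q∈ with (_ , y) C.≟ e₀
          ...   | no n     = ∈-map⁺ proj₁ (D.∈-⊖⁺ q∈ n)
          ...   | yes refl = subst (_∈ map proj₁ (Y D.⊖ e₀)) (sym p) (∈-map⁺ proj₁ (D.∈-⊖⁺ f∈ f≢))
        side? : ∀ (f : E × Bits) → Dec (f ≢ e₀ × bit i (proj₂ f) ≡ bit i x)
        side? f = ¬? (f C.≟ e₀) ×-dec (bit i (proj₂ f) ≟B bit i x)
        Y₀ = filter side? Y
        same-side : ∀ {f v} → f ∈ Y → f ≢ e₀ → Inc′ f v → bit i (proj₂ v) ≡ bit i (proj₂ f)
        same-side f∈ f≢ (inj₁ refl) = refl
        same-side {f , y} f∈ f≢ (inj₂ refl) = bit-other y (unique-lift f∈ f≢)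
        w = src′ e₀
        next = lf e∈ (inj₁ refl)
        Y₀-w : proj₁ next ∈ Y₀
        Y₀-w = let (f , f∈ , f≢ , fi) = next in ∈-filter⁺ side? f∈ (f≢ , sym (same-side f∈ f≢ fi))
        step : ∀ {f v} → f ∈ Y₀ → Inc′ f v → v ≢ w → ∃ λ h → h ∈ Y₀ × h ≢ f × Inc′ h v
        step {f} {v} f∈ fi v≢w with filter-∈ side? Y f∈
        ... | f∈Y , f≢ , b with lf f∈Y fi
        ...   | h , h∈ , h≢f , hi = h , ∈-filter⁺ side? h∈ (h≢e , trans (sym (same-side h∈ h≢e hi)) vb) , h≢f , hi
          where
          vb : bit i (proj₂ v) ≡ bit i x
          vb = trans (same-side f∈Y f≢ fi) b
          h≢e : h ≢ e₀
          h≢e refl = [ (λ p → v≢w (sym p)) , (λ { refl → bit-flip i x vb }) ]′ hi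
        small = C.trim (length Y₀) Y₀ w ≤-refl (unique-filter side? u) (unique-⊆-length {xs = proj₁ next ∷ []} ([] ∷ []) λ { (here refl) → Y₀-w }) step
        small≤ : length (proj₁ small) ≤ g
        small≤ = ≤-pred (≤-trans (s≤s (unique-⊆-length {ys = Y D.⊖ e₀} (proj₁ (proj₂ small)) λ p →
            let (q , n , _) = filter-∈ side? Y (proj₁ (proj₂ (proj₂ (proj₂ small))) p) in D.∈-⊖⁺ q n))
          (≤-trans (≤-reflexive (sym (D.length-⊖ u e∈))) le))

complete : ℕ → FinGraph
complete N = record
  { Pt = Fin N ⊎ Fin N ; E = Fin N × Fin N ; _≟V_ = ⊎-≟ _≟F_ _≟F_ ; _≟_ = ×-≟ _≟F_ _≟F_
  ; vs = map inj₁ (allFin N) ++ map inj₂ (allFin N)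
  ; vs-unique = unique-++ (unique-map (λ _ _ → inj₁-injective) (Uniqueₚ.allFin⁺ N)) (unique-map (λ _ _ → inj₂-injective) (Uniqueₚ.allFin⁺ N))
      λ p q → case ∈-map⁻ inj₁ p of λ { (_ , _ , refl) → case ∈-map⁻ inj₂ q of λ { (_ , _ , ()) } }
  ; vs-all = λ { (inj₁ i) → ∈-++⁺ˡ (∈-map⁺ inj₁ (∈-allFin i)) ; (inj₂ i) → ∈-++⁺ʳ (map inj₁ (allFin N)) (∈-map⁺ inj₂ (∈-allFin i)) }
  ; es = cartesianProduct (allFin N) (allFin N) ; es-unique = Uniqueₚ.cartesianProduct⁺ (Uniqueₚ.allFin⁺ N) (Uniqueₚ.allFin⁺ N)
  ; es-all = λ (i , j) → ∈-cartesianProduct⁺ (∈-allFin i) (∈-allFin j)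
  ; src = λ (i , _) → inj₁ i ; tgt = λ (_ , j) → inj₂ j ; noloop = λ _ ()
  ; simple = λ { n (inj₁ refl) (inj₁ refl) _ _ → ⊥-elim (n refl) ; n (inj₂ refl) (inj₂ refl) _ _ → ⊥-elim (n refl)
               ; n (inj₁ refl) (inj₂ refl) (inj₁ refl) (inj₂ refl) → refl ; n (inj₂ refl) (inj₁ refl) (inj₂ refl) (inj₁ refl) → refl } }

record LargeGirth (N g : ℕ) : Set₁ where
  field
    graph : FinGraph
  open FinGraph graph public
  field
    girth  : Girth> g
    degree≤ : ∀ v → degree v ≤ N
    order  : N ≤ length vs
    dense  : N * length vs ≤ length es + length es

-- Covers multiply the numbers of vertices and edges by the same factor, the number of bit vectors,
-- so `dense` survives every step.
large-girth : ∀ N g → LargeGirth N g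
large-girth N zero = record
  { graph = complete N ; girth = λ _ ne _ → ne ; degree≤ = deg
  ; order = ≤-trans (m≤m+n N N) (≤-reflexive (sym lv))
  ; dense = ≤-reflexive (trans (cong (N *_) lv) (trans (*-distribˡ-+ N N N) (cong₂ _+_ (sym le) (sym le)))) }
  where
  open FinGraph (complete N)
  lf : length (allFin N) ≡ N
  lf = length-tabulate id
  lv : length vs ≡ N + N
  lv = trans (length-++ (map inj₁ (allFin N))) (cong₂ _+_ (trans (length-map inj₁ (allFin N)) lf) (trans (length-map inj₂ (allFin N)) lf))
  le : length es ≡ N * N
  le = trans (length-× (allFin N) (allFin N)) (cong₂ _*_ lf lf)
  deg : ∀ v → degree v ≤ N
  deg v = subst₂ _≤_ (length-filter≡# (λ e → inc? e v) es) (trans (length-map (edge v) (allFin N)) lf)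
      (unique-⊆-length {ys = map (edge v) (allFin N)} (unique-filter (λ e → inc? e v) es-unique) λ p → inc (proj₂ (filter-∈ (λ e → inc? e v) es p)))
    where
    edge : Pt → Fin N → E
    edge (inj₁ i) j = i , j
    edge (inj₂ j) i = i , j
    inc : ∀ {e v} → Inc e v → e ∈ map (edge v) (allFin N)
    inc {_ , j} (inj₁ refl) = ∈-map⁺ _ (∈-allFin j)
    inc {i , _} (inj₂ refl) = ∈-map⁺ _ (∈-allFin i)
large-girth N (suc g) = record
  { graph = cover ; girth = girth-cover L.girth ; degree≤ = λ v → ≤-trans (degree-cover v) (L.degree≤ (proj₁ v))
  ; order = ≤-trans L.order (≤-trans (m≤m*n (length L.vs) B {{>-nonZero B>0}}) (≤-reflexive (sym (length-× L.vs (vecs b)))))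
  ; dense = ≤-trans (≤-reflexive (trans (cong (N *_) (length-× L.vs (vecs b))) (sym (*-assoc N (length L.vs) B))))
      (≤-trans (*-monoˡ-≤ B L.dense) (≤-reflexive (trans (*-distribʳ-+ B (length L.es) (length L.es)) (cong₂ _+_ (sym (length-× L.es (vecs b))) (sym (length-× L.es (vecs b))))))) }
  where
  module L = LargeGirth (large-girth N g)
  open Cover L.graph
  b = length L.es
  B = length (vecs b)
  B>0 : 1 ≤ B
  B>0 = unique-⊆-length {xs = Vec.replicate b true ∷ []} ([] ∷ []) λ { (here refl) → vecs-all _ }

-- Symmetric matroids of bounded rank: a forest that is a dependent set of small size exhibits stars of small rank

module BoundedTheory {V : Set} (S : SymRank V) where
  open SymRankTheory S

  _≟P_ : DecidableEquality P
  _≟P_ = ×-≟ _≟_ _≟_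

  Spanning : ℕ → Set
  Spanning n = ∀ {T} → Unique T → n ≤ length T → ∀ e → Cl (K T) e

  -- By symmetry every clique of this order spans all pairs with one end inside it. A pair with both
  -- ends outside is reached by first replacing a vertex of the clique by one of the ends.
  clique-spanning : ∀ {X U u₀ v₀} → Unique U → X ⊆ K U → u₀ ∈ U → v₀ ∉ U → Cl X (u₀ , v₀) → Spanning (length U)
  clique-spanning {X} {U} {u₀} {v₀} uU X⊆ u₀∈ v₀∉ cl = span
    where
    moved : ∀ {W u v} → Unique W → length W ≡ length U → u ∈ W → v ∉ W → Cl (K W) (u , v)
    moved {W} {u} {v} uW lW u∈ v∉ = image (permute {v₀ ∷ u₀ ∷ U ⊖ u₀} {v ∷ u ∷ W ⊖ u} (uniq uU u₀∈ v₀∉) (uniq uW u∈ v∉)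
        (cong suc (trans (sym (length-⊖ uU u₀∈)) (trans (sym lW) (length-⊖ uW u∈)))))
      where
      uniq : ∀ {W u v} → Unique W → u ∈ W → v ∉ W → Unique (v ∷ u ∷ W ⊖ u)
      uniq {W} uW u∈ v∉ = unique-∷ (λ { (here refl) → v∉ u∈ ; (there p) → v∉ (proj₁ (∈-⊖⁻ W p)) })
        (unique-∷ (λ p → proj₂ (∈-⊖⁻ W p) refl) (unique-filter _ uW))
      image : (Σ (V → V) λ π → (∀ X → r (map (mapP π) X) ≡ r X) × (∀ {x y} → π x ≡ π y → x ≡ y) × map π (v₀ ∷ u₀ ∷ U ⊖ u₀) ≡ v ∷ u ∷ W ⊖ u) → Cl (K W) (u , v)
      image (π , inv , _ , eq) = cl-mono {map (mapP π) (K U)} sub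
          (subst (Cl (map (mapP π) (K U))) (cong₂ _,_ (cong (λ { (_ ∷ x ∷ _) → x ; _ → u }) eq) (cong (λ { (x ∷ _) → x ; _ → v }) eq))
            (subst₂ _≤_ (sym (inv ((u₀ , v₀) ∷ K U))) (sym (inv (K U))) (cl-mono {X} X⊆ cl)))
        where
        inW : ∀ {x} → x ∈ U → π x ∈ W
        inW {x} x∈ with subst (π x ∈_) (cong (λ { (_ ∷ xs) → xs ; _ → [] }) eq) (∈-map⁺ π {xs = u₀ ∷ U ⊖ u₀} (case x ≟ u₀ of λ { (yes p) → here p ; (no n) → there (∈-⊖⁺ x∈ n) }))
        ... | here p  = subst (_∈ W) (sym p) u∈
        ... | there p = proj₁ (∈-⊖⁻ W p)
        sub : map (mapP π) (K U) ⊆ K W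
        sub p with ∈-map⁻ (mapP π) p
        ... | (a , b) , q , refl = K⁺ (inW (proj₁ (K⁻ q))) (inW (proj₂ (K⁻ q)))
    exact : ∀ {W} → Unique W → length W ≡ length U → ∀ e → Cl (K W) e
    exact {W} uW lW (x , y) with x ≟ y
    ... | yes refl = r-loop x (K W)
    ... | no x≢y with x ∈? W | y ∈? W
    ...   | yes p | yes q = cl-∈ (K⁺ p q)
    ...   | yes p | no q  = moved uW lW p q
    ...   | no p  | yes q = cl-flip (moved uW lW q p)
    ...   | no p  | no q  = two (nonempty {xs = W} (≤-trans (nonempty⁻ u₀∈) (≤-reflexive (sym lW))))
      where
      nonempty⁻ : ∀ {x : V} {xs} → x ∈ xs → 1 ≤ length xs
      nonempty⁻ (here _)  = s≤s z≤n
      nonempty⁻ (there _) = s≤s z≤n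
      two : ∃ (_∈ W) → Cl (K W) (x , y)
      two (w , w∈) = cl-trans {K W} {K (x ∷ W ⊖ w)} inside (moved {x ∷ W ⊖ w} (unique-∷ (p ∘ proj₁ ∘ ∈-⊖⁻ W) (unique-filter _ uW))
          (trans (sym (length-⊖ uW w∈)) lW) (here refl) λ { (here t) → x≢y (sym t) ; (there t) → q (proj₁ (∈-⊖⁻ W t)) })
        where
        inside : ∀ {f} → f ∈ K (x ∷ W ⊖ w) → Cl (K W) f
        inside {a , b} t with K⁻ {U = x ∷ W ⊖ w} t
        ... | here refl , here refl = r-loop x (K W)
        ... | here refl , there t′  = cl-flip (moved uW lW (proj₁ (∈-⊖⁻ W t′)) p)
        ... | there t′ , here refl  = moved uW lW (proj₁ (∈-⊖⁻ W t′)) p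
        ... | there t′ , there t″   = cl-∈ (K⁺ (proj₁ (∈-⊖⁻ W t′)) (proj₁ (∈-⊖⁻ W t″)))
    span : Spanning (length U)
    span {T} uT le e = cl-mono {K (take (length U) T)} (K-mono (take-⊆ (length U) T)) (exact (unique-take (length U) uT) (length-take≤ (length U) le) e)

  -- Some edge of a dependent star is spanned by later ones, and symmetry moves its leaf to any
  -- other vertex.
  star-dep : ∀ {z} T → Unique T → z ∉ T → r (star z T) < length T → ∀ w → Cl (star z T) (z , w)
  star-dep {z} (t ∷ T) u z∉ lt w with Cl? (star z T) (z , t)
  ... | no ¬c = cl-mono {star z T} wider (star-dep T (unique-tail u) (z∉ ∘ there) (≤-pred (≤-trans (s≤s (≰⇒> ¬c)) (subst (λ Y → r Y < suc (length T)) star-∷ lt))) w)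
    where wider : star z T ⊆ star z (t ∷ T)
          wider p = subst (_ ∈_) (sym star-∷) (there p)
  ... | yes c = cl-mono {star z T} (λ p → subst (_ ∈_) (sym star-∷) (there p)) all
    where
    all : Cl (star z T) (z , w)
    all with z ≟ w | w ∈? T
    ... | yes refl | _     = r-loop z (star z T)
    ... | no _     | yes q = cl-∈ (star⁺ q)
    ... | no z≢w   | no q  = cl-move {t} {w} fix (λ { refl → z∉ (here refl) }) z≢w c
      where fix : ∀ {f} → f ∈ star z T → swP t w f ∈ star z T
            fix {a , b} f∈ with star⁻ f∈
            ... | refl , b∈ = subst (_∈ star z T) (cong₂ _,_ (sym (sw-other (λ { refl → z∉ (here refl) }) z≢w))
                  (sym (sw-other (λ { refl → unique-head u b∈ }) (λ { refl → q b∈ })))) (star⁺ b∈)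

  σ : V → ℕ
  σ z = r (star z pool)

  σ-≤ : ∀ z w → σ z ≤ σ w
  σ-≤ z w = ≤-trans (r-mono {star z pool} {map (swP z w) (star w pool)} sub) (r-swap z w (star w pool))
    where sub : star z pool ⊆ map (swP z w) (star w pool)
          sub {a , b} p = subst (_∈ map (swP z w) (star w pool)) (cong₂ _,_ (trans (sw-r z w) (sym (proj₁ (star⁻ p)))) (sw-invol z w b))
            (∈-map⁺ (swP z w) (star⁺ {v = w} (pool-all (sw z w b))))

  R : ℕ
  R = r (K pool)

  r≤R : ∀ X → r X ≤ R
  r≤R X = r-mono {X} {K pool} (λ { {a , b} _ → K⁺ (pool-all a) (pool-all b) })

  spans⇒R≤ : ∀ {X n T} → Spanning n → Unique T → n ≤ length T → (∀ {x y} → x ∈ T → y ∈ T → Cl X (x , y)) → R ≤ r X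
  spans⇒R≤ {X} {n} {T} sp u le h = span-≤ {X} λ {e} _ → cl-trans {X} {K T} (λ { {a , b} p → h (proj₁ (K⁻ p)) (proj₂ (K⁻ p)) }) (sp u le e)

  star-indep : ∀ {z} T → Unique T → z ∉ T → length T ≤ σ z → length T ≤ r (star z T)
  star-indep {z} T u z∉ le = ≮⇒≥ λ lt → <⇒≱ (≤-trans lt le) (span-≤ {star z T} λ { {a , b} p → case star⁻ p of λ { (refl , _) → star-dep T u z∉ lt b } })

  -- If the star spanned one pair off `z`, symmetry would move it to every pair off `z`, and the
  -- star would have rank `R`.
  star-coloop : ∀ {z a b} → σ z < R → a ≢ z → b ≢ z → a ≢ b → ¬ Cl (star z pool) (a , b)
  star-coloop {z} {a} {b} lt a≢ b≢ a≢b c = <⇒≱ lt (span-≤ {star z pool} λ {e} _ → all e)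
    where
    fix : ∀ {x y} → x ≢ z → y ≢ z → ∀ {f} → f ∈ star z pool → swP x y f ∈ star z pool
    fix {x} {y} n n′ {a , b} p with star⁻ p
    ... | refl , _ = subst (λ w → (w , sw x y b) ∈ star a pool) (sym (sw-other (n ∘ sym) (n′ ∘ sym))) (star⁺ (pool-all _))
    at : ∀ {x y} → x ≢ z → y ≢ z → Cl (star z pool) (x , y) → ∀ {y′} → x ≢ y → x ≢ y′ → y′ ≢ z → Cl (star z pool) (x , y′)
    at x≢ y≢ c n n′ y′≢ = cl-move (λ {f} → fix y≢ y′≢ {f}) n n′ c
    all : ∀ e → Cl (star z pool) e
    all (x , y) with x ≟ z | y ≟ z | x ≟ y
    ... | yes refl | _ | _ = cl-∈ (star⁺ (pool-all y))
    ... | no _ | yes refl | _ = cl-flip (cl-∈ (star⁺ (pool-all x)))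
    ... | no _ | no _ | yes refl = r-loop x (star z pool)
    ... | no x≢ | no y≢ | no x≢y with x ≟ b
    ...   | yes refl = at b≢ a≢ (cl-flip c) (a≢b ∘ sym) x≢y y≢
    ...   | no x≢b = at x≢ b≢ (cl-flip (at b≢ a≢ (cl-flip c) (a≢b ∘ sym) (x≢b ∘ sym) x≢)) x≢b x≢y y≢

  data Matching : List P → Set where
    []  : Matching []
    _∷_ : ∀ {a b M} → (a ≢ b × Off M a × Off M b) → Matching M → Matching ((a , b) ∷ M)

  verts : List P → List V
  verts []            = []
  verts ((a , b) ∷ X) = a ∷ b ∷ verts X

  verts⁺ : ∀ {X a b} → (a , b) ∈ X → a ∈ verts X × b ∈ verts X
  verts⁺ (here refl) = here refl , there (here refl)
  verts⁺ (there p)   = there (there (proj₁ (verts⁺ p))) , there (there (proj₂ (verts⁺ p)))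

  length-verts : ∀ X → length (verts X) ≡ length X + length X
  length-verts []      = refl
  length-verts (e ∷ X) = cong suc (trans (cong suc (length-verts X)) (sym (+-suc (length X) (length X))))

  off-verts : ∀ {X x} → x ∉ verts X → Off X x
  off-verts n p = (λ { refl → n (proj₁ (verts⁺ p)) }) , (λ { refl → n (proj₂ (verts⁺ p)) })

  -- An edge spanned by the rest of the matching could be moved to every pair that misses the rest.
  -- Enough fresh vertices form a spanning clique, so the rest would have rank `R`, although it has
  -- at most `σ z < R` edges.
  matching-indep : ∀ {n z M} → Spanning n → R + R + n ≤ length pool → σ z < R → Matching M → length M ≤ suc (σ z) → length M ≤ r M
  matching-indep sp room lt [] le = z≤n
  matching-indep {n} {z} {(a , b) ∷ M} sp room lt ((a≢b , oa , ob) ∷ mt) le = ≤-trans (s≤s (matching-indep {z = z} sp room lt mt (≤-trans (n≤1+n _) le)))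
      (≰⇒> λ c → <⇒≱ lt (≤-trans (big c) (≤-trans (r-≤-len M) (≤-pred le))))
    where
    M≤R : length M ≤ R
    M≤R = ≤-trans (≤-pred le) (<⇒≤ lt)
    fr = fresh n (verts M) (≤-trans (+-monoˡ-≤ n (≤-trans (≤-reflexive (length-verts M)) (+-mono-≤ M≤R M≤R))) room)
    big : Cl M (a , b) → R ≤ r M
    big c = let (T , uT , lT , T∉) = fr in spans⇒R≤ sp uT (≤-reflexive (sym lT)) λ p q → pair (off-verts (T∉ p)) (off-verts (T∉ q))
      where
      move : ∀ {x y y′} → Cl M (x , y) → Off M y → Off M y′ → x ≢ y → x ≢ y′ → Cl M (x , y′)
      move c oy oy′ n n′ = cl-move (off-fix oy oy′) n n′ c
      pair : ∀ {x y} → Off M x → Off M y → Cl M (x , y)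
      pair {x} {y} ox oy with x ≟ y | x ≟ b
      ... | yes refl | _ = r-loop x M
      ... | no n | yes refl = move (cl-flip c) oa oy (a≢b ∘ sym) n
      ... | no n | no x≢b = move (cl-flip (move (cl-flip c) oa ox (a≢b ∘ sym) (x≢b ∘ sym))) ob oy x≢b n

  Meets : List V → P → Set
  Meets Z (a , b) = a ∈ Z ⊎ b ∈ Z

  meets? : ∀ Z e → Dec (Meets Z e)
  meets? Z (a , b) = (a ∈? Z) ⊎-dec (b ∈? Z)

  module Forest (c : ℕ) (bip : ∀ {A B x y} → Unique (A ++ B) → c ≤ length A → c ≤ length B → x ∈ A → y ∈ A → Cl (Bi A B) (x , y))
    {n : ℕ} (sp : Spanning n) (room : R + R + (suc R + n + suc c) ≤ length pool)
    (F : List P) (uF : Unique F) (dep : r F < length F) (small : length F ≤ R) (Δ : ℕ) (deg : ∀ z → # (meets? (z ∷ [])) F ≤ Δ)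
    (leafy : ∀ {Y} → Unique Y → Y ⊆ F → 1 ≤ length Y → ∃ λ u → ∃ λ v → u ≢ v × Σ P λ e → e ∈ Y × (e ≡ (u , v) ⊎ e ≡ (v , u)) ×
             (∀ {f} → f ∈ Y → f ≢ e → ¬ Meets (v ∷ []) f)) where

    open DecList _≟P_ using () renaming (_⊖_ to _⊖P_; ∈-⊖⁺ to ∈-⊖P⁺; ∈-⊖⁻ to ∈-⊖P⁻; length-⊖ to length-⊖P)

    private
      fr = fresh (suc R + n + suc c) (verts F) (≤-trans (+-monoˡ-≤ _ (≤-trans (≤-reflexive (length-verts F)) (+-mono-≤ small small))) room)
      T = proj₁ fr
      uT = proj₁ (proj₂ fr)
      T∉ : ∀ {x} → x ∈ T → x ∉ verts F
      T∉ = proj₂ (proj₂ (proj₂ fr))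
      lT : length T ≡ suc R + n + suc c
      lT = proj₁ (proj₂ (proj₂ fr))
      R<T : R < length T
      R<T = ≤-trans (≤-trans (m≤m+n (suc R) n) (m≤m+n _ (suc c))) (≤-reflexive (sym lT))
      n≤T : n ≤ length T
      n≤T = ≤-trans (≤-trans (m≤n+m n (suc R)) (m≤m+n _ (suc c))) (≤-reflexive (sym lT))
      c≤T : c ≤ length T
      c≤T = ≤-trans (≤-trans (n≤1+n c) (m≤n+m (suc c) (suc R + n))) (≤-reflexive (sym lT))
      t₀∈′ = nonempty {xs = T} (≤-trans (s≤s z≤n) R<T)
      t₀ = proj₁ t₀∈′
      t₀∈ = proj₂ t₀∈′

    abstract
      -- The vertices of `F` whose whole stars are spanned by `F`. One fresh leaf `t₀` is a
      -- sufficient test: symmetry extends it to all of `T`, and more than `R` leaves make a star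
      -- dependent.
      Z : List V
      Z = filter (λ z → Cl? F (z , t₀)) (deduplicate _≟_ (verts F))

      Z⁻ : ∀ {z} → z ∈ Z → z ∈ verts F × Cl F (z , t₀)
      Z⁻ p = let (q , c) = filter-∈ (λ z → Cl? F (z , t₀)) (deduplicate _≟_ (verts F)) p in ∈-deduplicate⁻ _≟_ (verts F) q , c

      Z⁺ : ∀ {z} → z ∈ verts F → Cl F (z , t₀) → z ∈ Z
      Z⁺ p c = ∈-filter⁺ (λ z → Cl? F (z , t₀)) (∈-deduplicate⁺ _≟_ p) c

      Z-unique : Unique Z
      Z-unique = unique-filter (λ z → Cl? F (z , t₀)) (UniqueD.deduplicate-! _≟_ (verts F))

    apart : ∀ {z t} → z ∈ Z → t ∈ T → z ≢ t
    apart p q refl = T∉ q (proj₁ (Z⁻ p))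

    spanned-T : ∀ {z t} → z ∈ Z → t ∈ T → Cl F (z , t)
    spanned-T p q = cl-move (off-fix (off-verts (T∉ t₀∈)) (off-verts (T∉ q))) (apart p t₀∈) (apart p q) (proj₂ (Z⁻ p))

    ΣZ : List P
    ΣZ = Bi Z pool

    spanned : ∀ {e} → e ∈ ΣZ → Cl F e
    spanned {z , w} p = cl-trans {F} {star z T} (λ { {a , b} q → case star⁻ q of λ { (refl , b∈) → spanned-T z∈ b∈ } })
        (star-dep T uT (λ q → apart z∈ q refl) (≤-trans (s≤s (r≤R (star z T))) R<T) w)
      where z∈ = proj₁ (Bi⁻ {X = Z} {pool} p)

    rF<R : r F < R
    rF<R = ≤-trans dep small

    -- The stars at `c` such vertices contain a complete bipartite graph that spans the clique on
    -- `T`, and this clique spans everything.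
    few : length Z < c
    few = ≰⇒> λ le → <⇒≱ rF<R (spans⇒R≤ sp uT n≤T λ p q → cl-trans {F} {Bi T Z}
      (λ { {a , b} t → cl-flip (spanned-T (proj₂ (Bi⁻ {X = T} {Z} t)) (proj₁ (Bi⁻ {X = T} {Z} t))) })
      (bip {T} {Z} (unique-++ uT Z-unique (λ p q → apart q p refl)) c≤T le p q))

    off? : ∀ e → Dec (¬ Meets Z e)
    off? e = ¬? (meets? Z e)

    -- Leaf by leaf. If a leaf edge `uv` were spanned by the others and `ΣZ`, then exchanging the
    -- leaf `v` with `t₀`, which fixes both, would show that `F` spans `(u , t₀)` and put `u` into
    -- `Z`.
    off-indep : ∀ k {Y} → length Y ≤ k → Unique Y → Y ⊆ filter off? F → length Y + r ΣZ ≤ r (Y ++ ΣZ)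
    off-indep k {[]} _ _ _ = ≤-refl
    off-indep (suc k) {Y@(_ ∷ _)} le uY sub = step (leafy uY (λ p → proj₁ (filter-∈ off? F (sub p))) (s≤s z≤n))
      where
      step : (∃ λ u → ∃ λ v → u ≢ v × Σ P λ e → e ∈ Y × (e ≡ (u , v) ⊎ e ≡ (v , u)) × (∀ {f} → f ∈ Y → f ≢ e → ¬ Meets (v ∷ []) f)) → length Y + r ΣZ ≤ r (Y ++ ΣZ)
      step (u , v , u≢v , e , e∈ , dir , leaf) = ≤-trans (≤-reflexive (cong (_+ r ΣZ) (length-⊖P uY e∈)))
          (≤-trans (s≤s (off-indep k {Y ⊖P e} (≤-pred (≤-trans (≤-reflexive (sym (length-⊖P uY e∈))) le)) (unique-filter (λ y → ¬? (y ≟P e)) uY) (λ p → sub (proj₁ (∈-⊖P⁻ Y p)))))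
            (≤-trans (≰⇒> free) (r-mono {e ∷ X} {Y ++ ΣZ} λ { (here refl) → ∈-++⁺ˡ e∈ ; (there p) → [ (λ q → ∈-++⁺ˡ (proj₁ (∈-⊖P⁻ Y q))) , ∈-++⁺ʳ Y ]′ (∈-++⁻ (Y ⊖P e) p) })))
        where
        X = (Y ⊖P e) ++ ΣZ
        e∈F : e ∈ F
        e∈F = proj₁ (filter-∈ off? F (sub e∈))
        ends : u ∈ verts F × v ∈ verts F × ¬ (u ∈ Z) × ¬ (v ∈ Z)
        ends = [ (λ { refl → proj₁ (verts⁺ e∈F) , proj₂ (verts⁺ e∈F) , nz ∘ inj₁ , nz ∘ inj₂ }) , (λ { refl → proj₂ (verts⁺ e∈F) , proj₁ (verts⁺ e∈F) , nz ∘ inj₂ , nz ∘ inj₁ }) ]′ dir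
          where nz : ¬ Meets Z e
                nz = proj₂ (filter-∈ off? F (sub e∈))
        v∉Z = proj₂ (proj₂ (proj₂ ends))
        fix : ∀ {f} → f ∈ X → swP v t₀ f ∈ X
        fix {a , b} p with ∈-++⁻ (Y ⊖P e) p
        ... | inj₁ q = ∈-++⁺ˡ (off-fix offv (λ t → off-verts (T∉ t₀∈) (proj₁ (filter-∈ off? F (sub (proj₁ (∈-⊖P⁻ Y t)))))) q)
          where offv : Off (Y ⊖P e) v
                offv t = let (t∈ , t≢) = ∈-⊖P⁻ Y t ; h = leaf t∈ t≢ in (λ s → h (inj₁ (here s))) , (λ s → h (inj₂ (here s)))
        ... | inj₂ q = ∈-++⁺ʳ (Y ⊖P e) (subst (λ x → (x , sw v t₀ b) ∈ ΣZ) (sym (sw-other (λ { refl → v∉Z a∈ }) (apart a∈ t₀∈))) (Bi⁺ a∈ (pool-all _)))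
          where a∈ = proj₁ (Bi⁻ {X = Z} {pool} q)
        free : ¬ Cl X e
        free cl = proj₁ (proj₂ (proj₂ ends)) (Z⁺ (proj₁ ends)
            (cl-trans {F} {X} inF (cl-move {v} {t₀} (λ {f} → fix {f}) u≢v (λ { refl → T∉ t₀∈ (proj₁ ends) }) (turn dir cl))))
          where
          turn : e ≡ (u , v) ⊎ e ≡ (v , u) → Cl X e → Cl X (u , v)
          turn (inj₁ refl) cl = cl
          turn (inj₂ refl) cl = cl-flip cl
          inF : ∀ {f} → f ∈ X → Cl F f
          inF p = [ (λ q → cl-∈ (proj₁ (filter-∈ off? F (sub (proj₁ (∈-⊖P⁻ Y q)))))) , spanned ]′ (∈-++⁻ (Y ⊖P e) p)

    few-on : ∀ Z → # (meets? Z) F ≤ length Z * Δ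
    few-on [] = ≮⇒≥ λ lt → case #-pos (meets? []) F (≤-trans (s≤s z≤n) lt) of λ { (_ , _ , inj₁ ()) ; (_ , _ , inj₂ ()) }
    few-on (z ∷ Z) = ≤-trans (#-mono (meets? (z ∷ Z)) (λ e → meets? (z ∷ []) e ⊎-dec meets? Z e) F
        λ { _ _ (inj₁ (here p)) → inj₁ (inj₁ (here p)) ; _ _ (inj₁ (there p)) → inj₂ (inj₁ p) ; _ _ (inj₂ (here p)) → inj₁ (inj₂ (here p)) ; _ _ (inj₂ (there p)) → inj₂ (inj₂ p) })
      (≤-trans (#-⊎ (meets? (z ∷ [])) (meets? Z) F) (+-mono-≤ (deg z) (few-on Z)))

    -- `F` is dependent although its edges off `Z` are independent over `ΣZ`; so the rank of `ΣZ` is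
    -- less than the number of edges of `F` that meet `Z`.
    ΣZ-small : r ΣZ < length Z * Δ
    ΣZ-small = ≤-trans (+-cancelˡ-≤ (# off? F) _ _ (≤-trans (≤-reflexive (+-suc (# off? F) (r ΣZ))) (≤-trans (s≤s main) (≤-trans dep (≤-reflexive (trans (sym (#-¬ (meets? Z) F)) (+-comm (# (meets? Z) F) _))))))) (few-on Z)
      where
      main : # off? F + r ΣZ ≤ r F
      main = ≤-trans (≤-reflexive (cong (_+ r ΣZ) (sym (length-filter≡# off? F)))) (≤-trans (off-indep _ ≤-refl (unique-filter off? uF) id)
        (span-≤ {F} λ p → [ (λ q → cl-∈ (proj₁ (filter-∈ off? F q))) , spanned ]′ (∈-++⁻ (filter off? F) p)))

    small-star : ∃ λ z → σ z < c * Δ × σ z < R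
    small-star = z , ≤-trans (s≤s le) (≤-trans ΣZ-small (*-monoˡ-≤ Δ (<⇒≤ few))) , ≤-trans (s≤s (≤-trans le (span-≤ {F} spanned))) rF<R
      where
      heavy : ∃ (_∈ Z)
      heavy = nonempty {xs = Z} (≮⇒≥ λ lt → <⇒≱ ΣZ-small (≤-trans (≤-reflexive (cong (_* Δ) (n<1⇒n≡0 lt))) z≤n))
      z = proj₁ heavy
      z∈ = proj₂ heavy
      le : σ z ≤ r ΣZ
      le = r-mono {star z pool} {ΣZ} λ { {a , b} p → case star⁻ p of λ { (refl , b∈) → Bi⁺ z∈ b∈ } }

open import Defs

-- Edges

edge-≡ : ∀ {e f : Edge} → lo e ≡ lo f → hi e ≡ hi f → e ≡ f
edge-≡ {mkEdge a b p} {mkEdge _ _ p′} refl refl = cong (mkEdge a b) (<-irrelevant p p′)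

_≟E_ : DecidableEquality Edge
e ≟E f = map′ (λ (p , p′) → edge-≡ p p′) (λ { refl → refl , refl }) ((lo e ≟ℕ lo f) ×-dec (hi e ≟ℕ hi f))

joins-unique : ∀ {e f x y} → joins e x y → joins f x y → e ≡ f
joins-unique (inj₁ (a , b)) (inj₁ (c , d)) = edge-≡ (trans a (sym c)) (trans b (sym d))
joins-unique (inj₂ (a , b)) (inj₂ (c , d)) = edge-≡ (trans a (sym c)) (trans b (sym d))
joins-unique {e} {f} (inj₁ (refl , refl)) (inj₂ (c , d)) = ⊥-elim (<-asym (lo<hi e) (subst₂ _<_ c d (lo<hi f)))
joins-unique {e} {f} (inj₂ (refl , refl)) (inj₁ (c , d)) = ⊥-elim (<-asym (lo<hi e) (subst₂ _<_ c d (lo<hi f)))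

joins-sym : ∀ {e x y} → joins e x y → joins e y x
joins-sym (inj₁ p) = inj₂ p
joins-sym (inj₂ p) = inj₁ p

joins-≢ : ∀ {e x y} → joins e x y → x ≢ y
joins-≢ {e} (inj₁ (refl , refl)) p = <⇒≢ (lo<hi e) p
joins-≢ {e} (inj₂ (refl , refl)) p = <⇒≢ (lo<hi e) (sym p)

joins-map : ∀ {e x y} → (f : ℕ → ℕ) → ∀ {g} → joins g (f (lo e)) (f (hi e)) → joins e x y → joins g (f x) (f y)
joins-map f j (inj₁ (refl , refl)) = j
joins-map f {g} j (inj₂ (refl , refl)) = joins-sym {g} j

abstract
  mkE : ∀ (x y : ℕ) → x ≢ y → Edge
  mkE x y n with <-cmp x y
  ... | tri< p _ _ = mkEdge x y p
  ... | tri≈ _ p _ = ⊥-elim (n p)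
  ... | tri> _ _ p = mkEdge y x p

  mkE-joins : ∀ x y n → joins (mkE x y n) x y
  mkE-joins x y n with <-cmp x y
  ... | tri< p _ _ = inj₁ (refl , refl)
  ... | tri≈ _ p _ = ⊥-elim (n p)
  ... | tri> _ _ p = inj₂ (refl , refl)

open Transposition _≟ℕ_

ren : ℕ → ℕ → Edge → Edge
ren a b e = mkE (sw a b (lo e)) (sw a b (hi e)) (λ p → <⇒≢ (lo<hi e) (sw-inj a b p))

ren-joins : ∀ a b e → joins (ren a b e) (sw a b (lo e)) (sw a b (hi e))
ren-joins a b e = mkE-joins _ _ _

ren-joins′ : ∀ a b e {x y} → joins e x y → joins (ren a b e) (sw a b x) (sw a b y)
ren-joins′ a b e {x} {y} j = joins-map {e} {x} {y} (sw a b) {ren a b e} (ren-joins a b e) j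

ren-invol : ∀ a b e → ren a b (ren a b e) ≡ e
ren-invol a b e = joins-unique {ren a b (ren a b e)} {e} (subst₂ (joins (ren a b (ren a b e))) (sw-invol a b _) (sw-invol a b _)
  (ren-joins′ a b (ren a b e) (ren-joins a b e))) (inj₁ (refl , refl))

ren-inj : ∀ a b {e f} → ren a b e ≡ ren a b f → e ≡ f
ren-inj a b {e} {f} p = trans (sym (ren-invol a b e)) (trans (cong (ren a b) p) (ren-invol a b f))

record EdgeMatroid : Set₁ where
  field
    base      : ListMatroid Edge
  open ListMatroid base public
  field
    invariant : ∀ a b {X} → I X → I (map (ren a b) X)

sublists : ∀ {A : Set} → List A → List (List A)
sublists []       = [] ∷ []
sublists (x ∷ xs) = sublists xs ++ map (x ∷_) (sublists xs)

filter-sublist : ∀ {A : Set} {Q : A → Set} (Q? : ∀ x → Dec (Q x)) xs → filter Q? xs ∈ sublists xs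
filter-sublist Q? [] = here refl
filter-sublist Q? (x ∷ xs) with Q? x
... | yes _ = ∈-++⁺ʳ (sublists xs) (∈-map⁺ (x ∷_) (filter-sublist Q? xs))
... | no _  = ∈-++⁺ˡ (filter-sublist Q? xs)

module Pairs (n : ℕ) where

  abstract
    -- A loop gives the empty list, which is what makes `r-loop` hold.
    toE : Fin n × Fin n → List Edge
    toE (u , v) with <-cmp (toℕ u) (toℕ v)
    ... | tri< p _ _ = mkEdge (toℕ u) (toℕ v) p ∷ []
    ... | tri≈ _ _ _ = []
    ... | tri> _ _ p = mkEdge (toℕ v) (toℕ u) p ∷ []

    toE⁻ : ∀ {f u v} → f ∈ toE (u , v) → joins f (toℕ u) (toℕ v)
    toE⁻ {f} {u} {v} t with <-cmp (toℕ u) (toℕ v)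
    toE⁻ (here refl) | tri< p _ _ = inj₁ (refl , refl)
    toE⁻ (here refl) | tri> _ _ p = inj₂ (refl , refl)

    toE-len : ∀ e → length (toE e) ≤ 1
    toE-len (u , v) with <-cmp (toℕ u) (toℕ v)
    ... | tri< p _ _ = s≤s z≤n
    ... | tri≈ _ _ _ = z≤n
    ... | tri> _ _ p = s≤s z≤n

    toE⁺ : ∀ {f u v} → joins f (toℕ u) (toℕ v) → f ∈ toE (u , v)
    toE⁺ {f} {u} {v} j with <-cmp (toℕ u) (toℕ v)
    ... | tri< p _ _ = here (joins-unique {f} j (inj₁ (refl , refl)))
    ... | tri≈ _ p _ = ⊥-elim (joins-≢ {f} j p)
    ... | tri> _ _ p = here (joins-unique {f} j (inj₂ (refl , refl)))

  edges : List (Fin n × Fin n) → List Edge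
  edges []      = []
  edges (e ∷ X) = toE e ++ edges X

  edges⁺ : ∀ {f u v X} → (u , v) ∈ X → joins f (toℕ u) (toℕ v) → f ∈ edges X
  edges⁺ {f} {u} {v} (here refl) j = ∈-++⁺ˡ (toE⁺ {f} {u} {v} j)
  edges⁺ {f} {u} {v} {e ∷ X} (there p) j = ∈-++⁺ʳ (toE e) (edges⁺ p j)

  edges⁻ : ∀ {f} X → f ∈ edges X → ∃ λ u → ∃ λ v → (u , v) ∈ X × joins f (toℕ u) (toℕ v)
  edges⁻ {f} ((u , v) ∷ X) p with ∈-++⁻ (toE (u , v)) p
  ... | inj₁ t = u , v , here refl , toE⁻ {f} {u} {v} t
  ... | inj₂ t = let (a , b , q , j) = edges⁻ X t in a , b , there q , j

  InRange : Edge → Set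
  InRange e = ∃ λ u → ∃ λ v → joins e (toℕ {n} u) (toℕ {n} v)

  inRange? : ∀ e → Dec (InRange e)
  inRange? e = map′ (λ { ((i , p) , (j , p′)) → i , j , inj₁ (sym p , sym p′) }) f
      (anyF? (λ (i : Fin n) → toℕ i ≟ℕ lo e) ×-dec anyF? (λ (j : Fin n) → toℕ j ≟ℕ hi e))
    where f : InRange e → (∃ λ i → toℕ i ≡ lo e) × (∃ λ j → toℕ j ≡ hi e)
          f (i , j , inj₁ (p , p′)) = (i , sym p) , (j , sym p′)
          f (i , j , inj₂ (p , p′)) = (j , sym p) , (i , sym p′)

  sw-range : ∀ (a b x : Fin n) → ∃ λ y → toℕ {n} y ≡ sw (toℕ a) (toℕ b) (toℕ x)
  sw-range a b x with toℕ x ≟ℕ toℕ a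
  ... | yes _ = b , refl
  ... | no _ with toℕ x ≟ℕ toℕ b
  ...   | yes _ = a , refl
  ...   | no _  = x , refl

-- The restriction of an edge matroid to the complete graph on Fin n

module Ambient (M : EdgeMatroid) (n : ℕ) where
  open EdgeMatroid M
  open Pairs n public
  open DecList _≟E_ using () renaming (_∈?_ to _∈E?_)

  Iₙ : List Edge → Set
  Iₙ X = I X × (∀ {e} → e ∈ X → InRange e)

  matroidₙ : ListMatroid Edge
  matroidₙ = record
    { I = Iₙ ; I-[] = I-[] , (λ ()) ; I-unique = I-unique ∘ proj₁
    ; I-⊆ = λ u s (i , h) → I-⊆ u s i , (h ∘ s)
    ; I-aug = λ (i , h) (j , h′) lt → let (e , e∈ , k) = I-aug i j lt in e , e∈ , k , λ { (here refl) → h′ e∈ ; (there p) → h p } }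

  -- Only finitely many cases matter: every duplicate-free list in range has the same elements as
  -- some sublist of the list of all edges.
  decidable : ¬ ¬ (∀ X → Dec (Iₙ X))
  decidable = dne-→ (dns-All (λ X → lem (I X)) (sublists all)) λ ds k → k λ X → dec ds X
    where
    all = deduplicate _≟E_ (edges (cartesianProduct (allFin n) (allFin n)))
    dec : All (λ X → Dec (I X)) (sublists all) → ∀ X → Dec (Iₙ X)
    dec ds X with UniqueDec.unique? _≟E_ X
    ... | no ¬u = no λ (i , _) → ¬u (I-unique i)
    ... | yes u with allL? inRange? X
    ...   | no ¬h = no λ (_ , h) → ¬h (tabulateAll h)
    ...   | yes h = map′ (λ i → I-⊆ u (λ {e} p → ∈-filter⁺ (_∈E? X) (∈-deduplicate⁺ _≟E_ (let (i , j , jn) = lookupAll h p in edges⁺ (∈-cartesianProduct⁺ (∈-allFin i) (∈-allFin j)) jn)) p) i , lookupAll h)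
                         (λ (i , _) → I-⊆ (unique-filter (_∈E? X) (UniqueD.deduplicate-! _≟E_ (edges (cartesianProduct (allFin n) (allFin n))))) (λ p → proj₂ (filter-∈ (_∈E? X) all p)) i)
                         (lookupAll ds (filter-sublist (_∈E? X) all))

  module WithDec (dec : ∀ X → Dec (Iₙ X)) where
    open MatroidRank matroidₙ dec public

    rank-ren : ∀ (a b : Fin n) Z → rank (map (ren (toℕ a) (toℕ b)) Z) ≤ rank Z
    rank-ren a b Z = ≤-trans (≤-reflexive (sym (length-map ρ B))) (rank-max (iρ (basis-I (map ρ Z))) sub)
      where
      ρ = ren (toℕ a) (toℕ b)
      B = basis (map ρ Z)
      iρ : ∀ {X} → Iₙ X → Iₙ (map ρ X)
      iρ (i , h) = invariant (toℕ a) (toℕ b) i , λ p → case ∈-map⁻ ρ p of λ { (e , e∈ , refl) →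
        let (u , v , j) = h e∈ ; (u′ , p) = sw-range a b u ; (v′ , p′) = sw-range a b v in
        u′ , v′ , subst₂ (joins (ρ e)) (sym p) (sym p′) (ren-joins′ (toℕ a) (toℕ b) e j) }
      sub : map ρ B ⊆ Z
      sub p = let (e , e∈ , eq) = ∈-map⁻ ρ p ; (f , f∈ , eq′) = ∈-map⁻ ρ (basis-⊆ (map ρ Z) e∈) in
        subst (_∈ Z) (sym (trans eq (trans (cong ρ eq′) (ren-invol (toℕ a) (toℕ b) f)))) f∈

    symRank : SymRank (Fin n)
    symRank = record
      { _≟_ = _≟F_ ; pool = allFin n ; pool-unique = Uniqueₚ.allFin⁺ n ; pool-all = ∈-allFin
      ; r = rank ∘ edges ; r-[] = refl
      ; r-step = λ e X → grow1 (toE e) (toE-len e) (edges X)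
      ; r-mono = λ {X} {Y} s → rank-mono (mono {X} {Y} s)
      ; r-dim = λ {X} {Y} e s → dim (toE e) (toE-len e) (edges X) (edges Y) (mono {X} {Y} s)
      ; r-loop = λ u X → rank-mono {edges ((u , u) ∷ X)} {edges X} (λ {f} p → [ (λ t → ⊥-elim (joins-≢ {f} (toE⁻ {f} {u} {u} t) refl)) , id ]′ (∈-++⁻ (toE (u , u)) p))
      ; r-flip = λ {u} {v} {X} uv → rank-mono {edges ((v , u) ∷ X)} {edges X} (λ {f} p → [ (λ t → edges⁺ uv (joins-sym {f} (toE⁻ {f} {v} {u} t))) , id ]′ (∈-++⁻ (toE (v , u)) p))
      ; r-swap = λ a b X → ≤-trans (rank-mono (swapped a b X)) (rank-ren a b (edges X)) }
      where
      grow1 : ∀ A → length A ≤ 1 → ∀ Z → rank (A ++ Z) ≤ suc (rank Z)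
      grow1 []          _         Z = n≤1+n _
      grow1 (e ∷ [])    _         Z = rank-step e Z
      grow1 (_ ∷ _ ∷ _) (s≤s ()) Z
      dim : ∀ A → length A ≤ 1 → ∀ X Y → X ⊆ Y → rank (A ++ Y) + rank X ≤ rank (A ++ X) + rank Y
      dim []          _         X Y s = ≤-reflexive (+-comm (rank Y) (rank X))
      dim (e ∷ [])    _         X Y s = rank-dim e s
      dim (_ ∷ _ ∷ _) (s≤s ()) X Y s
      mono : ∀ {X Y} → X ⊆ Y → edges X ⊆ edges Y
      mono {X} s {f} p = let (u , v , q , j) = edges⁻ X p in edges⁺ {f} {u} {v} (s q) j
      swF : ∀ a b x → toℕ (Transposition.sw _≟F_ a b x) ≡ sw (toℕ a) (toℕ b) (toℕ x)
      swF a b x with x ≟F a | toℕ x ≟ℕ toℕ a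
      ... | yes p | yes _ = refl
      ... | yes p | no n  = ⊥-elim (n (cong toℕ p))
      ... | no n  | yes p = ⊥-elim (n (toℕ-injective p))
      ... | no _  | no _ with x ≟F b | toℕ x ≟ℕ toℕ b
      ...   | yes p | yes _ = refl
      ...   | yes p | no n  = ⊥-elim (n (cong toℕ p))
      ...   | no n  | yes p = ⊥-elim (n (toℕ-injective p))
      ...   | no _  | no _  = refl
      swapped : ∀ a b X → edges (map (mapP (Transposition.sw _≟F_ a b)) X) ⊆ map (ren (toℕ a) (toℕ b)) (edges X)
      swapped a b X {f} p with edges⁻ (map (mapP (Transposition.sw _≟F_ a b)) X) p
      ... | _ , _ , q , j with ∈-map⁻ (mapP (Transposition.sw _≟F_ a b)) q
      ...   | (u , v) , uv , refl = subst (_∈ map (ren A B) (edges X)) (ren-invol A B f) (∈-map⁺ (ren A B)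
              (edges⁺ {ren A B f} {u} {v} uv (subst₂ (joins (ren A B f)) (sw-invol A B (toℕ u)) (sw-invol A B (toℕ v))
                (ren-joins′ A B f (subst₂ (joins f) (swF a b u) (swF a b v) j)))))
        where A = toℕ a
              B = toℕ b

-- Families of graph matroids as matroids on the edges of the infinite complete graph

fromS : ∀ {n} → Subset n → List (Fin n)
fromS []            = []
fromS (S.inside ∷ p)  = fzero ∷ map fsuc (fromS p)
fromS (S.outside ∷ p) = map fsuc (fromS p)

fromS-length : ∀ {n} (p : Subset n) → length (fromS p) ≡ S.∣ p ∣
fromS-length []            = refl
fromS-length (S.inside ∷ p)  = cong suc (trans (length-map fsuc (fromS p)) (fromS-length p))
fromS-length (S.outside ∷ p) = trans (length-map fsuc (fromS p)) (fromS-length p)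

fromS⁺ : ∀ {n} {p : Subset n} {i} → i S.∈ p → i ∈ fromS p
fromS⁺ {p = S.inside ∷ p} {fzero} _ = here refl
fromS⁺ {p = S.outside ∷ p} {fzero} ()
fromS⁺ {p = S.inside ∷ p} {fsuc i} (there q) = there (∈-map⁺ fsuc (fromS⁺ q))
fromS⁺ {p = S.outside ∷ p} {fsuc i} (there q) = ∈-map⁺ fsuc (fromS⁺ q)

fromS⁻ : ∀ {n} {p : Subset n} {i} → i ∈ fromS p → i S.∈ p
fromS⁻ {p = S.inside ∷ p} (here refl) = here
fromS⁻ {p = S.inside ∷ p} (there q) with ∈-map⁻ fsuc q
... | j , j∈ , refl = there (fromS⁻ j∈)
fromS⁻ {p = S.outside ∷ p} q with ∈-map⁻ fsuc q
... | j , j∈ , refl = there (fromS⁻ j∈)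

fromS-unique : ∀ {n} (p : Subset n) → Unique (fromS p)
fromS-unique []            = []
fromS-unique (S.inside ∷ p)  = unique-∷ (λ q → case ∈-map⁻ fsuc q of λ { (_ , _ , ()) }) (unique-map (λ _ _ → fsuc-injective) (fromS-unique p))
fromS-unique (S.outside ∷ p) = unique-map (λ _ _ → fsuc-injective) (fromS-unique p)

module _ {n : ℕ} where
  open DecList {A = Fin n} _≟F_

  abstract
    toS : List (Fin n) → Subset n
    toS L = Vec.tabulate (λ i → does (i ∈? L))

    toS⁺ : ∀ {L i} → i ∈ L → i S.∈ toS L
    toS⁺ {L} {i} p = lookup⇒[]= i (toS L) (trans (lookup∘tabulate _ i) (eq (i ∈? L) p))
      where eq : ∀ {P : Set} (d : Dec P) → P → does d ≡ true
            eq (yes _) _ = refl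
            eq (no ¬p) p = ⊥-elim (¬p p)

    toS⁻ : ∀ {L i} → i S.∈ toS L → i ∈ L
    toS⁻ {L} {i} p = eq (i ∈? L) (trans (sym (lookup∘tabulate _ i)) ([]=⇒lookup p))
      where eq : ∀ {P : Set} (d : Dec P) → does d ≡ true → P
            eq (yes p) _ = p
            eq (no _) ()

  toS-card : ∀ {L} → Unique L → S.∣ toS L ∣ ≡ length L
  toS-card {L} u = trans (sym (fromS-length (toS L))) (≤-antisym
    (unique-⊆-length {ys = L} (fromS-unique (toS L)) (λ q → toS⁻ {L} (fromS⁻ q))) (unique-⊆-length u (λ q → fromS⁺ (toS⁺ q))))

graphOf : (X : List Edge) → Unique X → Graph
graphOf X u = record { m = length X ; edge = lookup X ; edge-inj = unique-lookup u }

end : ∀ e {x y} → joins e x y → x ≡ lo e ⊎ x ≡ hi e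
end e (inj₁ (p , _)) = inj₁ (sym p)
end e (inj₂ (_ , p)) = inj₂ (sym p)

end⁻ : ∀ e {x y z} → joins e x y → z ≡ lo e ⊎ z ≡ hi e → z ≡ x ⊎ z ≡ y
end⁻ e (inj₁ (p , p′)) (inj₁ t) = inj₁ (trans t p)
end⁻ e (inj₁ (p , p′)) (inj₂ t) = inj₂ (trans t p′)
end⁻ e (inj₂ (p , p′)) (inj₁ t) = inj₂ (trans t p)
end⁻ e (inj₂ (p , p′)) (inj₂ t) = inj₁ (trans t p′)

V-≡ : ∀ {G} {u v : V G} → proj₁ u ≡ proj₁ v → u ≡ v
V-≡ {u = a , p} {_ , p′} refl = cong (a ,_) (T-irr p p′)
  where T-irr : ∀ {b} (p p′ : Data.Bool.Base.T b) → p ≡ p′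
        T-irr {true} tt tt = refl

module _ (F : GraphMatroidFamily) where

  -- Independence is read off from the graph that has exactly these edges; `restrict` makes this
  -- agree with every larger graph, so a family becomes one matroid on all edges.
  IF : List Edge → Set
  IF X = Σ (Unique X) λ u → Ind F (graphOf X u) S.⊤

  bridge : ∀ G {L} → Unique L → ∀ {Y} → (∀ {j} → j S.∈ Y → j ∈ L) → (∀ {j} → j ∈ L → j S.∈ Y) →
           Ind F G Y ⇔ IF (map (edge G) L)
  bridge G {L} u {Y} h h′ = mk⇔ (λ y → u′ , from E y) (λ { (v , x) → to (E′ v) x })
    where
    u′ : Unique (map (edge G) L)
    u′ = unique-map (λ _ _ → edge-inj G) u
    ι : Fin (length (map (edge G) L)) → Fin (m G)
    ι i = lookup L (cast (length-map (edge G) L) i)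
    emb : ∀ L i → edge G (lookup L (cast (length-map (edge G) L) i)) ≡ lookup (map (edge G) L) i
    emb (x ∷ L) fzero    = refl
    emb (x ∷ L) (fsuc i) = emb L i
    onto : ∀ L {j} → j ∈ L → ∃ λ i → lookup L (cast (length-map (edge G) L) i) ≡ j
    onto (x ∷ L) (here refl) = fzero , refl
    onto (x ∷ L) (there p)   = let (i , e) = onto L p in fsuc i , e
    E′ : ∀ v → Ind F (graphOf (map (edge G) L) v) S.⊤ ⇔ Ind F G Y
    E′ v = restrict F (graphOf (map (edge G) L) v) G ι (emb L) S.⊤ Y (λ j → mk⇔
      (λ p → let (i , e) = onto L (h p) in i , ∈⊤ , e)
      (λ { (i , _ , refl) → h′ (∈-lookup (cast (length-map (edge G) L) i)) }))
    E = E′ u′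

  bridge-toS : ∀ G {L} → Unique L → Ind F G (toS L) ⇔ IF (map (edge G) L)
  bridge-toS G u = bridge G u toS⁻ toS⁺

  indices : ∀ (X : List Edge) {Z} → X ⊆ Z → List (Fin (length Z))
  indices []      s = []
  indices (e ∷ X) s = Any.index (s (here refl)) ∷ indices X (s ∘ there)

  map-indices : ∀ X {Z} (s : X ⊆ Z) → map (lookup Z) (indices X s) ≡ X
  map-indices []      s = refl
  map-indices (e ∷ X) s = cong₂ _∷_ (sym (lookup-index (s (here refl)))) (map-indices X (s ∘ there))

  unique-indices : ∀ {X Z} (s : X ⊆ Z) → Unique X → Unique (indices X s)
  unique-indices {X} s u = Uniqueₚ.map⁻ (subst Unique (sym (map-indices X s)) u)

  inside-graph : ∀ {X Z} (s : X ⊆ Z) (uX : Unique X) (uZ : Unique Z) → Ind F (graphOf Z uZ) (toS (indices X s)) ⇔ IF X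
  inside-graph {X} {Z} s uX uZ = subst (λ Y → Ind F (graphOf Z uZ) (toS (indices X s)) ⇔ IF Y) (map-indices X s)
    (bridge-toS (graphOf Z uZ) (unique-indices s uX))

  listMatroid : ListMatroid Edge
  listMatroid = record
    { I = IF
    ; I-[] = [] , IsMatroid.indep-∅ (matroid F (graphOf [] []))
    ; I-unique = proj₁
    ; I-⊆ = λ {X} {Y} u s (v , i) → to (inside-graph s u v) (IsMatroid.indep-⊆ (matroid F (graphOf Y v)) _ S.⊤ ⊆⊤ i)
    ; I-aug = aug }
    where
    aug : ∀ {X Y} → IF X → IF Y → length X < length Y → ∃ λ e → e ∈ Y × IF (e ∷ X)
    aug {X} {Y} iX iY lt = result
      where
      Z = deduplicate _≟E_ (X ++ Y)
      uZ : Unique Z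
      uZ = UniqueD.deduplicate-! _≟E_ (X ++ Y)
      sX : X ⊆ Z
      sX p = ∈-deduplicate⁺ _≟E_ (∈-++⁺ˡ p)
      sY : Y ⊆ Z
      sY p = ∈-deduplicate⁺ _≟E_ (∈-++⁺ʳ X p)
      G = graphOf Z uZ
      uLX = unique-indices sX (proj₁ iX)
      uLY = unique-indices sY (proj₁ iY)
      len : ∀ X {Z} (s : X ⊆ Z) → length (indices X s) ≡ length X
      len []      s = refl
      len (e ∷ X) s = cong suc (len X (s ∘ there))
      res = IsMatroid.indep-aug (matroid F G) (toS (indices X sX)) (toS (indices Y sY)) (from (inside-graph sX (proj₁ iX) uZ) iX) (from (inside-graph sY (proj₁ iY) uZ) iY)
        (subst₂ _<_ (sym (trans (toS-card uLX) (len X sX))) (sym (trans (toS-card uLY) (len Y sY))) lt)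
      i = proj₁ res
      result : ∃ λ e → e ∈ Y × IF (e ∷ X)
      result = lookup Z i , subst (lookup Z i ∈_) (map-indices Y sY) (∈-map⁺ (lookup Z) (toS⁻ (proj₁ (proj₂ res)))) ,
        subst (λ W → IF (lookup Z i ∷ W)) (map-indices X sX) (to (bridge G {i ∷ indices X sX} (unique-∷ (λ p → proj₁ (proj₂ (proj₂ res)) (toS⁺ p)) uLX)
          (λ p → [ (λ q → there (toS⁻ q)) , (λ q → here (x∈⁅y⁆⇒x≡y _ q)) ]′ (x∈p∪q⁻ (toS (indices X sX)) S.⁅ i ⁆ p))
          (λ { (here refl) → x∈p∪q⁺ (inj₂ (x∈⁅x⁆ i)) ; (there p) → x∈p∪q⁺ (inj₁ (toS⁺ p)) })) (proj₂ (proj₂ (proj₂ res))))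

  open ListMatroid listMatroid

  renamed : ∀ a b {X} → IF X → IF (map (ren a b) X)
  renamed a b {X} (u , i) = subst IF (trans (map-∘ (allFin (length X))) (cong (map (ren a b)) (trans (map-tabulate id (lookup X)) (tabulate-lookup X))))
      (to (bridge H (Uniqueₚ.allFin⁺ (length X)) {S.⊤} (λ _ → ∈-allFin _) (λ _ → ∈⊤)) iH)
    where
    G H : Graph
    G = graphOf X u
    H = record { m = length X ; edge = ren a b ∘ lookup X ; edge-inj = unique-lookup u ∘ ren-inj a b }
    vert : ∀ {v} → IsVertex G v → IsVertex H (sw a b v)
    vert p with toWitness p
    ... | i , inj₁ refl = fromWitness (i , end (ren a b (lookup X i)) (ren-joins a b (lookup X i)))
    ... | i , inj₂ refl = fromWitness (i , end (ren a b (lookup X i)) (joins-sym {ren a b (lookup X i)} (ren-joins a b (lookup X i))))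
    back : ∀ i {w} → w ≡ lo (ren a b (lookup X i)) ⊎ w ≡ hi (ren a b (lookup X i)) → sw a b w ≡ lo (lookup X i) ⊎ sw a b w ≡ hi (lookup X i)
    back i e with end⁻ (ren a b (lookup X i)) (ren-joins a b (lookup X i)) e
    ... | inj₁ refl = inj₁ (sw-invol a b _)
    ... | inj₂ refl = inj₂ (sw-invol a b _)
    vert⁻ : ∀ {w} → IsVertex H w → IsVertex G (sw a b w)
    vert⁻ p = let (i , e) = toWitness p in fromWitness (i , back i e)
    f : V G → V H
    f (v , p) = sw a b v , vert p
    φ : GraphIso G H
    φ = mk⤖ {to = f} ((λ {x} {y} e → V-≡ {G} {x} {y} (sw-inj a b (cong proj₁ e))) ,
             λ { (w , p) → (sw a b w , vert⁻ p) , λ { refl → V-≡ {H} (sw-invol a b w) } }) ,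
        λ { (x , _) (y , _) → mk⇔ (λ (i , j) → i , ren-joins′ a b (lookup X i) j)
             (λ (i , j) → i , subst (λ e → joins e x y) (ren-invol a b (lookup X i)) (subst₂ (joins (ren a b (ren a b (lookup X i)))) (sw-invol a b x) (sw-invol a b y)
               (ren-joins′ a b (ren a b (lookup X i)) j))) }
    iH : Ind F H S.⊤
    iH = from (iso-inv F G H φ id (λ i → ren-joins a b (lookup X i)) S.⊤) (IsMatroid.indep-⊆ (matroid F G) _ S.⊤ ⊆⊤ i)

  edgeMatroid : EdgeMatroid
  edgeMatroid = record { base = listMatroid ; invariant = renamed }

-- Two graphs with the same number of edges, identified by position

sameGraph : ∀ {k} (e : Fin k → Edge) → (∀ {i j} → e i ≡ e j → i ≡ j) → Graph
sameGraph {k} e inj = record { m = k ; edge = e ; edge-inj = inj }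

module Positions {k} (e f : Fin k → Edge) (ie : ∀ {i j} → e i ≡ e j → i ≡ j) (jf : ∀ {i j} → f i ≡ f j → i ≡ j) where

  G H : Graph
  G = sameGraph e ie
  H = sameGraph f jf

  module _ (F : GraphMatroidFamily) {c} (wh : ∀ G → IsConnected c G → Reconstructible (Ind F) G) (conn : IsConnected c G)
    (ef : ∀ {L} → Unique L → IF F (map e L) → IF F (map f L)) (fe : ∀ {L} → Unique L → IF F (map f L) → IF F (map e L)) where

    iso : IsMatroidIso (Ind F G) (Ind F H) id
    iso Y = mk⇔ (λ y → from eG (fe u (to eH y))) (λ x → from eH (ef u (to eG x)))
      where
      u = fromS-unique Y
      eH : Ind F H Y ⇔ IF F (map f (fromS Y))
      eH = bridge F H u fromS⁺ fromS⁻
      eG : Ind F G (preimage id Y) ⇔ IF F (map e (fromS Y))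
      eG = bridge F G u (λ {j} p → fromS⁺ (lookup⇒[]= j Y (trans (sym (lookup∘tabulate (Vec.lookup Y) j)) ([]=⇒lookup p))))
                        (λ {j} p → lookup⇒[]= j (preimage id Y) (trans (lookup∘tabulate (Vec.lookup Y) j) ([]=⇒lookup (fromS⁻ {p = Y} p))))

    rec : Σ (GraphIso G H) λ φ → Induced G H φ id
    rec = wh G conn H (⤖-id (Fin k)) iso

    Moves : (V G → ℕ) → Set
    Moves φ = ∀ i (x y : V G) → joins (e i) (proj₁ x) (proj₁ y) → joins (f i) (φ x) (φ y)

    reconstruction : Σ (V G → ℕ) Moves
    reconstruction = φ , φ-joins
      where
      φ : V G → ℕ
      φ x = proj₁ (Bijection.to (proj₁ (proj₁ rec)) x)
      φ-joins : Moves φ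
      φ-joins i x y (inj₁ (p , p′)) = subst₂ (λ x y → joins (f i) (φ x) (φ y)) (V-≡ {G} {loV G i} {x} p) (V-≡ {G} {hiV G i} {y} p′) (proj₂ rec i)
      φ-joins i x y (inj₂ (p , p′)) = joins-sym {f i} (subst₂ (λ x y → joins (f i) (φ x) (φ y)) (V-≡ {G} {loV G i} {y} p) (V-≡ {G} {hiV G i} {x} p′) (proj₂ rec i))

-- The common end of two different edges is determined by the edges alone.
fixed-vertex : ∀ g h {x y z x′ y′ z′} → joins g x y → joins h x z → joins g x′ y′ → joins h x′ z′ → y ≢ z → x′ ≡ x
fixed-vertex g h {x} {y} {z} {x′} p p′ q q′ n = pick (end⁻ g p (end g q)) (end⁻ h p′ (end h q′))
  where
  pick : x′ ≡ x ⊎ x′ ≡ y → x′ ≡ x ⊎ x′ ≡ z → x′ ≡ x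
  pick (inj₁ t) _ = t
  pick (inj₂ t) (inj₁ t′) = t′
  pick (inj₂ t) (inj₂ t′) = ⊥-elim (n (trans (sym t) t′))

-- The Whitney property and complete bipartite graphs.

module WhitneyBip (F : GraphMatroidFamily) (c : ℕ) (3≤c : 3 ≤ c) (wh : ∀ G → IsConnected c G → Reconstructible (Ind F) G) (n : ℕ)
  (dec : ∀ X → Dec (Ambient.Iₙ (edgeMatroid F) n X)) where
  open Ambient (edgeMatroid F) n
  open WithDec dec
  open SymRankTheory symRank hiding (sw; sw-l; sw-r; sw-other; sw-invol; sw-inj)
  open ListMatroid (listMatroid F)

  module _ {A B : List (Fin n)} (u : Unique (A ++ B)) (cA : c ≤ length A) (cB : c ≤ length B) where
    abstract
      X₀ : List Edge
      X₀ = deduplicate _≟E_ (edges (Bi A B))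

      uX₀ : Unique X₀
      uX₀ = UniqueD.deduplicate-! _≟E_ (edges (Bi A B))

      X₀⊆ : X₀ ⊆ edges (Bi A B)
      X₀⊆ = ∈-deduplicate⁻ _≟E_ (edges (Bi A B))

      X₀⁺ : ∀ {g a b} → a ∈ A → b ∈ B → joins g (toℕ a) (toℕ b) → g ∈ X₀
      X₀⁺ p q j = ∈-deduplicate⁺ _≟E_ (edges⁺ (Bi⁺ p q) j)

    X₀⁻ : ∀ {g} → g ∈ X₀ → ∃ λ a → ∃ λ b → a ∈ A × b ∈ B × joins g (toℕ a) (toℕ b)
    X₀⁻ {g} p with edges⁻ (Bi A B) (X₀⊆ p)
    ... | a , b , q , j = a , b , proj₁ (Bi⁻ q) , proj₂ (Bi⁻ q) , j

    disj : ∀ {x} → x ∈ A → x ∉ B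
    disj = proj₂ (proj₂ (unique-++⁻ A u))
    uA : Unique A
    uA = proj₁ (unique-++⁻ A u)
    uB : Unique B
    uB = proj₁ (proj₂ (unique-++⁻ A u))

    module New {x y} (x∈ : x ∈ A) (y∈ : y ∈ A) (x≢y : x ≢ y) where
      new : Edge
      new = mkE (toℕ x) (toℕ y) (x≢y ∘ toℕ-injective)

      new-joins : joins new (toℕ x) (toℕ y)
      new-joins = mkE-joins _ _ _

      new∉ : new ∉ X₀
      new∉ p with X₀⁻ p
      ... | a , b , a∈ , b∈ , j with end⁻ new new-joins (end new (joins-sym {new} j))
      ...   | inj₁ t = disj x∈ (subst (_∈ B) (toℕ-injective t) b∈)
      ...   | inj₂ t = disj y∈ (subst (_∈ B) (toℕ-injective t) b∈)

      all : List Edge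
      all = new ∷ X₀

      uall : Unique all
      uall = unique-∷ new∉ uX₀

      G : Graph
      G = sameGraph (lookup all) (unique-lookup uall)

      adj : ∀ {a b} → a ∈ A → b ∈ B → Adj G (toℕ a) (toℕ b)
      adj {a} {b} p q = fsuc (Any.index e∈) , subst (λ g → joins g (toℕ a) (toℕ b)) (lookup-index e∈) (mkE-joins (toℕ a) (toℕ b) ab)
        where ab : toℕ a ≢ toℕ b
              ab t = disj p (subst (_∈ B) (sym (toℕ-injective t)) q)
              e∈ : mkE (toℕ a) (toℕ b) ab ∈ X₀
              e∈ = X₀⁺ p q (mkE-joins (toℕ a) (toℕ b) ab)

      adj-sym : ∀ {x y} → Adj G x y → Adj G y x
      adj-sym (i , j) = i , joins-sym {edge G i} j

      vertex : ∀ {z w} → Adj G z w → IsVertex G z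
      vertex (i , j) = fromWitness (i , end (edge G i) j)

      some-out : ∀ {W : List (Fin n)} (X : List ℕ) → Unique W → length X < length W → ∃ λ a → a ∈ W × toℕ a ∉ X
      some-out {W} X uW lt with anyL? (λ a → ¬? (DecList._∈?_ _≟ℕ_ (toℕ a) X)) W
      ... | yes t = find t
      ... | no none = ⊥-elim (<⇒≱ lt (subst (_≤ length X) (length-map toℕ W) (unique-⊆-length (unique-map (λ _ _ → toℕ-injective) uW)
            (λ p → case ∈-map⁻ toℕ p of λ { (a , a∈ , refl) → decidable-stable (DecList._∈?_ _≟ℕ_ (toℕ a) X) (λ m → none (lose a∈ m)) }))))

      aV : ∀ {a} → a ∈ A → IsVertex G (toℕ a)
      aV p = let (b , b∈) = nonempty {xs = B} (≤-trans (≤-trans (s≤s z≤n) 3≤c) cB) in vertex (adj p b∈)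

      bV : ∀ {b} → b ∈ B → IsVertex G (toℕ b)
      bV p = let (a , a∈) = nonempty {xs = A} (≤-trans (≤-trans (s≤s z≤n) 3≤c) cA) in vertex (adj-sym (adj a∈ p))

      side : ∀ {z} → IsVertex G z → ∃ λ a → toℕ a ≡ z × (a ∈ A ⊎ a ∈ B)
      side {z} p with toWitness p
      ... | fzero , t with end⁻ new new-joins t
      ...   | inj₁ e = x , sym e , inj₁ x∈
      ...   | inj₂ e = y , sym e , inj₁ y∈
      side {z} p | fsuc i , t with X₀⁻ (∈-lookup {xs = X₀} i)
      ... | a , b , a∈ , b∈ , j with end⁻ (lookup X₀ i) j t
      ...   | inj₁ e = a , sym e , inj₁ a∈
      ...   | inj₂ e = b , sym e , inj₂ b∈

      connected′ : IsConnected c G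
      connected′ = (take (suc c) (map toℕ (A ++ B)) , unique-take (suc c) (unique-map (λ _ _ → toℕ-injective) u) ,
          length-take≤ (suc c) {map toℕ (A ++ B)} (≤-trans (≤-trans (≤-trans (≤-reflexive (+-comm 1 c)) (+-mono-≤ cA (≤-trans (≤-trans (s≤s z≤n) 3≤c) cB))) (≤-reflexive (sym (length-++ A)))) (≤-reflexive (sym (length-map toℕ (A ++ B))))) ,
          tabulateAll (λ p → case ∈-map⁻ toℕ (take-⊆ (suc c) (map toℕ (A ++ B)) p) of λ { (a , a∈ , refl) → [ aV , bV ]′ (∈-++⁻ A a∈) }))
        , λ X lt u′ v′ pu pv u∉ v∉ → conn X lt (side pu) (side pv) v∉
        where
        conn : ∀ X → length X < c → ∀ {u′ v′} → (∃ λ a → toℕ a ≡ u′ × (a ∈ A ⊎ a ∈ B)) → (∃ λ a → toℕ a ≡ v′ × (a ∈ A ⊎ a ∈ B)) → v′ ∉ X → Reach G X u′ v′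
        conn X lt (s , refl , sAB) (t , refl , tAB) v∉ = finish tAB
          where
          oa = some-out X uA (≤-trans lt cA)
          ob = some-out X uB (≤-trans lt cB)
          a = proj₁ oa
          b = proj₁ ob
          a∈ = proj₁ (proj₂ oa)
          b∈ = proj₁ (proj₂ ob)
          toB′ : s ∈ A ⊎ s ∈ B → Reach G X (toℕ s) (toℕ b)
          toB′ (inj₁ p) = step here (adj p b∈) (proj₂ (proj₂ ob))
          toB′ (inj₂ p) = step (step here (adj-sym (adj a∈ p)) (proj₂ (proj₂ oa))) (adj a∈ b∈) (proj₂ (proj₂ ob))
          toB = toB′ sAB
          finish : t ∈ A ⊎ t ∈ B → Reach G X (toℕ s) (toℕ t)
          finish (inj₁ p) = step toB (adj-sym (adj p b∈)) v∉
          finish (inj₂ p) = step (step toB (adj-sym (adj a∈ b∈)) (proj₂ (proj₂ oa))) (adj a∈ p) v∉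

      abstract
        connected : IsConnected c G
        connected = connected′

    two : ∃ λ b → ∃ λ b′ → b ∈ B × b′ ∈ B × b ≢ b′
    two = pick B uB (≤-trans (≤-trans (s≤s (s≤s z≤n)) 3≤c) cB)
      where pick : ∀ B → Unique B → 2 ≤ length B → ∃ λ b → ∃ λ b′ → b ∈ B × b′ ∈ B × b ≢ b′
            pick (b ∷ b′ ∷ _) u _ = b , b′ , here refl , there (here refl) , λ e → unique-head u (here e)
            pick (b ∷ []) u (s≤s ())

    inX₀? : ∀ g → Dec (g ∈ X₀)
    inX₀? g = DecList._∈?_ _≟E_ g X₀

    -- The edge `g` is not spanned by the bipartite graph, so it can be added to whatever an
    -- independent set has inside that graph.
    replace : ∀ {e g} → (ue : Unique (e ∷ X₀)) (ug : Unique (g ∷ X₀)) → ¬ (rank (g ∷ edges (Bi A B)) ≤ rank (edges (Bi A B))) → ∀ {L} → Unique L →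
      IF F (map (lookup (e ∷ X₀)) L) → IF F (map (lookup (g ∷ X₀)) L)
    replace {e} {g} ue ug big {L} uL i = I-⊆ (unique-map (λ _ _ → unique-lookup ug) uL) sub (proj₁ (coloop g big
        (I-⊆ (unique-filter inX₀? (I-unique i)) (λ p → proj₁ (filter-∈ inX₀? (map (lookup (e ∷ X₀)) L) p)) i , range)
        (λ p → X₀⊆ (proj₂ (filter-∈ inX₀? (map (lookup (e ∷ X₀)) L) p)))))
      where
      rest = filter inX₀? (map (lookup (e ∷ X₀)) L)
      range : ∀ {h} → h ∈ rest → InRange h
      range p with X₀⁻ (proj₂ (filter-∈ inX₀? (map (lookup (e ∷ X₀)) L) p))
      ... | a , b , _ , _ , j = a , b , j
      sub : map (lookup (g ∷ X₀)) L ⊆ g ∷ rest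
      sub {h} p with ∈-map⁻ (lookup (g ∷ X₀)) p
      ... | fzero , _ , eq = here eq
      ... | fsuc i , i∈ , eq = there (subst (_∈ rest) (sym eq) (∈-filter⁺ inX₀? (∈-map⁺ (lookup (e ∷ X₀)) i∈) (∈-lookup {xs = X₀} i)))

    -- Exchanging the coloops xy and xz is an automorphism of the matroid, but fixes every vertex.
    exchange : ∀ {x y z} → x ∈ A → y ∈ A → z ∈ A → x ≢ y → x ≢ z → y ≢ z → ¬ Cl (Bi A B) (x , y) → ¬ Cl (Bi A B) (x , z) → ⊥
    exchange {x} {y} {z} x∈ y∈ z∈ x≢y x≢z y≢z cy cz = contra
      (Positions.reconstruction (lookup (gy ∷ X₀)) (lookup (gz ∷ X₀)) (unique-lookup uy) (unique-lookup uz) F wh (New.connected x∈ y∈ x≢y)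
        (replace uy uz (big jz cz)) (replace uz uy (big jy cy)))
      where
      gy gz : Edge
      gy = New.new x∈ y∈ x≢y
      gz = New.new x∈ z∈ x≢z
      uy = New.uall x∈ y∈ x≢y
      uz = New.uall x∈ z∈ x≢z
      jy : joins gy (toℕ x) (toℕ y)
      jy = New.new-joins x∈ y∈ x≢y
      jz : joins gz (toℕ x) (toℕ z)
      jz = New.new-joins x∈ z∈ x≢z
      big : ∀ {g t} → joins g (toℕ x) (toℕ t) → ¬ Cl (Bi A B) (x , t) → ¬ (rank (g ∷ edges (Bi A B)) ≤ rank (edges (Bi A B)))
      big {g} {t} j c le = c (≤-trans (rank-mono {edges ((x , t) ∷ Bi A B)} λ {h} p → [ (λ k → here (joins-unique {h} (toE⁻ {h} {x} {t} k) j)) , there ]′ (∈-++⁻ (toE (x , t)) p)) le)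
      Gy = New.G x∈ y∈ x≢y
      vA : ∀ {a} → a ∈ A → V Gy
      vA {a} p = toℕ a , New.aV x∈ y∈ x≢y p
      vB : ∀ {b} → b ∈ B → V Gy
      vB {b} p = toℕ b , New.bV x∈ y∈ x≢y p
      contra : Σ (V Gy → ℕ) (λ φ → ∀ i (s t : V Gy) → joins (lookup (gy ∷ X₀) i) (proj₁ s) (proj₁ t) → joins (lookup (gz ∷ X₀) i) (φ s) (φ t)) → ⊥
      contra (φ , mv) = [ (λ t → x≢y (sym (toℕ-injective t))) , (λ t → y≢z (toℕ-injective t)) ]′ (end⁻ gz jz (end gz (joins-sym {gz} joined)))
        where
        edgeAt : ∀ {a b} → a ∈ A → b ∈ B → ∃ λ i → joins (lookup X₀ i) (toℕ a) (toℕ b)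
        edgeAt {a} {b} p q = Any.index e∈ , subst (λ g → joins g (toℕ a) (toℕ b)) (lookup-index e∈) (mkE-joins (toℕ a) (toℕ b) ab)
          where ab : toℕ a ≢ toℕ b
                ab t = disj p (subst (_∈ B) (sym (toℕ-injective t)) q)
                e∈ : mkE (toℕ a) (toℕ b) ab ∈ X₀
                e∈ = X₀⁺ p q (mkE-joins (toℕ a) (toℕ b) ab)
        fixed : ∀ {a} (p : a ∈ A) → φ (vA p) ≡ toℕ a
        fixed p with two
        ... | b , b′ , b∈ , b′∈ , b≢ with edgeAt p b∈ | edgeAt p b′∈
        ...   | i , j | i′ , j′ = fixed-vertex (lookup X₀ i) (lookup X₀ i′) j j′ (mv (fsuc i) (vA p) (vB b∈) j) (mv (fsuc i′) (vA p) (vB b′∈) j′) (b≢ ∘ toℕ-injective)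
        joined : joins gz (toℕ x) (toℕ y)
        joined = subst₂ (joins gz) (fixed x∈) (fixed y∈) (mv fzero (vA x∈) (vA y∈) jy)

    third : ∀ {x y} → x ∈ A → y ∈ A → ∃ λ z → z ∈ A × x ≢ z × y ≢ z
    third {x} {y} x∈ y∈ with anyL? (λ z → ¬? (x ≟F z) ×-dec ¬? (y ≟F z)) A
    ... | yes a = find a
    ... | no none = ⊥-elim (1+n≰n (≤-trans (≤-trans 3≤c cA) (unique-⊆-length {ys = x ∷ y ∷ []} uA λ {z} p → case x ≟F z of λ
          { (yes e) → here (sym e) ; (no n₁) → case y ≟F z of λ { (yes e) → there (here (sym e)) ; (no n₂) → ⊥-elim (none (lose p (n₁ , n₂))) } })))

    -- If `xy` is not spanned, then by the symmetry of `A` neither is `xz` for a third vertex `z`,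
    -- and the two can be exchanged.
    whitney-bip : ∀ {x y} → x ∈ A → y ∈ A → Cl (Bi A B) (x , y)
    whitney-bip {x} {y} x∈ y∈ with x ≟F y
    ... | yes refl = SymRank.r-loop symRank x (Bi A B)
    ... | no x≢y = decidable-stable (Cl? (Bi A B) (x , y)) λ c′ →
          let (z , z∈ , x≢z , y≢z) = third x∈ y∈ in
          exchange x∈ y∈ z∈ x≢y x≢z y≢z c′ (λ cz → c′ (cl-move {z} {y} (λ {f} → fix z∈ {f}) x≢z x≢y cz))
      where
      module T = Transposition _≟F_
      fix : ∀ {z} → z ∈ A → ∀ {f} → f ∈ Bi A B → swP z y f ∈ Bi A B
      fix {z} z∈ {a , b} p = Bi⁺ inA (subst (_∈ B) (sym (T.sw-other (λ { refl → disj z∈ b∈ }) (λ { refl → disj y∈ b∈ }))) b∈)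
        where
        b∈ = proj₂ (Bi⁻ {X = A} {B} p)
        inA : T.sw z y a ∈ A
        inA with a ≟F z
        ... | yes _ = y∈
        ... | no _ with a ≟F y
        ...   | yes _ = z∈
        ...   | no _  = proj₁ (Bi⁻ {X = A} {B} p)

-- A bijection of edges that maps stars to stars comes from a graph isomorphism

_∈E_ : ℕ → Edge → Set
v ∈E e = v ≡ lo e ⊎ v ≡ hi e

_∈E?_ : ∀ v e → Dec (v ∈E e)
v ∈E? e = (v ≟ℕ lo e) ⊎-dec (v ≟ℕ hi e)

two-ends : ∀ e {x y} → x ∈E e → y ∈E e → x ≢ y → joins e x y
two-ends e (inj₁ p) (inj₁ p′) n = ⊥-elim (n (trans p (sym p′)))
two-ends e (inj₁ p) (inj₂ p′) n = inj₁ (sym p , sym p′)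
two-ends e (inj₂ p) (inj₁ p′) n = inj₂ (sym p′ , sym p)
two-ends e (inj₂ p) (inj₂ p′) n = ⊥-elim (n (trans p (sym p′)))

joins-other : ∀ e {x y z} → joins e x y → joins e x z → y ≡ z
joins-other e (inj₁ (_ , p)) (inj₁ (_ , p′)) = trans (sym p) p′
joins-other e (inj₂ (p , _)) (inj₂ (p′ , _)) = trans (sym p) p′
joins-other e (inj₁ (p , _)) (inj₂ (_ , p′)) = ⊥-elim (<⇒≢ (lo<hi e) (trans p (sym p′)))
joins-other e (inj₂ (_ , p)) (inj₁ (p′ , _)) = ⊥-elim (<⇒≢ (lo<hi e) (trans p′ (sym p)))

far : ℕ → Edge → ℕ
far v e with v ≟ℕ lo e
... | yes _ = hi e
... | no _  = lo e

far-joins : ∀ {v} e → v ∈E e → joins e v (far v e)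
far-joins {v} e p with v ≟ℕ lo e
... | yes q = inj₁ (sym q , refl)
... | no n  = inj₂ (refl , [ ⊥-elim ∘ n , sym ]′ p)

incident? : ∀ G v (i : Fin (m G)) → Dec (v ∈E edge G i)
incident? G v i = v ∈E? edge G i

-- The neighbours of a vertex separate it from any other vertex.
degree-≥ : ∀ {C} G → IsConnected C G → ∀ {v} → IsVertex G v → C ≤ # (incident? G v) (allFin (m G))
degree-≥ {C} G ((L , uL , lL , vL) , conn) {v} pv = ≮⇒≥ contra
  where
  open DecList _≟ℕ_
  I = filter (incident? G v) (allFin (m G))
  X = map (far v ∘ edge G) I
  contra : ¬ (# (incident? G v) (allFin (m G)) < C)
  contra lt = proj₁ (proj₂ (proj₂ away)) (stuck (conn X ltX v (proj₁ away) pv (lookupAll vL (proj₁ (proj₂ away))) v∉X (proj₂ (proj₂ (proj₂ away)))))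
    where
    ltX : length X < C
    ltX = subst (_< C) (sym (trans (length-map (far v ∘ edge G) I) (length-filter≡# (incident? G v) (allFin (m G))))) lt
    away : ∃ λ u → u ∈ L × (u ≢ v × u ∉ X)
    away with anyL? (λ u → ¬? (u ≟ℕ v) ×-dec ¬? (u ∈? X)) L
    ... | yes a = find a
    ... | no none = ⊥-elim (1+n≰n (≤-trans (≤-trans (≤-reflexive (sym lL)) (unique-⊆-length {ys = v ∷ X} uL
          (λ {u} p → case u ≟ℕ v of λ { (yes t) → here t ; (no t) → there (decidable-stable (u ∈? X) (λ t′ → none (lose p (t , t′)))) }))) ltX))
    v∉X : v ∉ X
    v∉X p with ∈-map⁻ (far v ∘ edge G) p
    ... | i , i∈ , eq = joins-≢ {edge G i} (far-joins (edge G i) (proj₂ (filter-∈ (incident? G v) (allFin (m G)) i∈))) eq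
    stuck : ∀ {w} → Reach G X v w → w ≡ v
    stuck here = refl
    stuck {w} (step {w′} r (i , j) w∉) = ⊥-elim (w∉ (subst (_∈ X) (sym (joins-other (edge G i) jv (far-joins (edge G i) iv))) (∈-map⁺ (far v ∘ edge G) (∈-filter⁺ (incident? G v) (∈-allFin i) iv))))
      where
      jv : joins (edge G i) v w
      jv = subst (λ z → joins (edge G i) z w) (stuck r) j
      iv : v ∈E edge G i
      iv = end (edge G i) jv

module StarMap (G H : Graph) (ψ : Fin (m G) ⤖ Fin (m H)) where
  ψ₀ : Fin (m G) → Fin (m H)
  ψ₀ = Bijection.to ψ

  Star : ℕ → ℕ → Set
  Star v w = ∀ i → (v ∈E edge G i → w ∈E edge H (ψ₀ i)) × (w ∈E edge H (ψ₀ i) → v ∈E edge G i)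

  Star? : ∀ v w → Dec (Star v w)
  Star? v w = all? λ i → ((v ∈E? edge G i) →-dec (w ∈E? edge H (ψ₀ i))) ×-dec ((w ∈E? edge H (ψ₀ i)) →-dec (v ∈E? edge G i))

  -- For `v` on the edge `i`, its image can only be an end of the edge `ψ₀ i`; searching there makes
  -- `StarsToStars` decidable.
  Good : Fin (m G) → ℕ → Set
  Good i v = Star v (lo (edge H (ψ₀ i))) ⊎ Star v (hi (edge H (ψ₀ i)))

  StarsToStars : Set
  StarsToStars = ∀ i → Good i (lo (edge G i)) × Good i (hi (edge G i))

  starsToStars? : Dec StarsToStars
  starsToStars? = all? λ i → good? i (lo (edge G i)) ×-dec good? i (hi (edge G i))
    where good? : ∀ i v → Dec (Good i v)
          good? i v = Star? v (lo (edge H (ψ₀ i))) ⊎-dec Star? v (hi (edge H (ψ₀ i)))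

  from-vertices : (∀ v → IsVertex G v → ∃ (Star v)) → StarsToStars
  from-vertices h i = good (lo (edge G i)) (inj₁ refl) , good (hi (edge G i)) (inj₂ refl)
    where
    good : ∀ v → v ∈E edge G i → Good i v
    good v p with h v (fromWitness (i , p))
    ... | w , s with proj₁ (s i) p
    ...   | inj₁ e = inj₁ (subst (Star v) e s)
    ...   | inj₂ e = inj₂ (subst (Star v) e s)

  module _ (Q : StarsToStars) (two : ∀ {v} → IsVertex G v → ∃ λ i → ∃ λ j → v ∈E edge G i × v ∈E edge G j × i ≢ j) where

    image : ∀ v → IsVertex G v → ∃ (Star v)
    image v p with toWitness p
    ... | i , inj₁ refl = [ (λ s → _ , s) , (λ s → _ , s) ]′ (proj₁ (Q i))
    ... | i , inj₂ refl = [ (λ s → _ , s) , (λ s → _ , s) ]′ (proj₂ (Q i))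

    φ : ∀ v → IsVertex G v → ℕ
    φ v p = proj₁ (image v p)

    φ-star : ∀ v p → Star v (φ v p)
    φ-star v p = proj₂ (image v p)

    φ-vert : ∀ v p → IsVertex H (φ v p)
    φ-vert v p = let (i , e) = toWitness p in fromWitness (ψ₀ i , proj₁ (φ-star v p i) e)

    -- Vertices with the same image have the same star, but two distinct edges at `u` cannot both
    -- end in `v`.
    φ-inj : ∀ {u v} p p′ → φ u p ≡ φ v p′ → u ≡ v
    φ-inj {u} {v} p p′ eq with u ≟ℕ v
    ... | yes e = e
    ... | no n with two {u} p
    ...   | i , j , ui , uj , i≢j = ⊥-elim (i≢j (edge-inj G (joins-unique {edge G i} {edge G j} (two-ends (edge G i) ui (other i ui) n) (two-ends (edge G j) uj (other j uj) n))))
      where other : ∀ i → u ∈E edge G i → v ∈E edge G i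
            other i ui = proj₂ (φ-star v p′ i) (subst (_∈E edge H (ψ₀ i)) eq (proj₁ (φ-star u p i) ui))

    joined : ∀ i {u v} p p′ → joins (edge G i) u v → joins (edge H (ψ₀ i)) (φ u p) (φ v p′)
    joined i {u} {v} p p′ j = two-ends (edge H (ψ₀ i)) (proj₁ (φ-star u p i) (end (edge G i) j)) (proj₁ (φ-star v p′ i) (end (edge G i) (joins-sym {edge G i} j)))
      (λ e → joins-≢ {edge G i} j (φ-inj p p′ e))

    f : V G → V H
    f (v , p) = φ v p , φ-vert v p

    preimageE : ∀ j → ∃ λ i → ψ₀ i ≡ j
    preimageE j = let (i , h) = Bijection.surjective ψ j in i , h refl

    f-onto : ∀ w → IsVertex H w → ∃ λ v → Σ (IsVertex G v) λ p → φ v p ≡ w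
    f-onto w p with toWitness p
    ... | j , e with preimageE j
    ...   | i , refl = [ (λ t → _ , proj₂ (loV G i) , sym t) , (λ t → _ , proj₂ (hiV G i) , sym t) ]′
              (end⁻ (edge H (ψ₀ i)) (joined i (proj₂ (loV G i)) (proj₂ (hiV G i)) (inj₁ (refl , refl))) e)

    graphIso : GraphIso G H
    graphIso = mk⤖ {to = f} ((λ {x} {y} e → V-≡ {G} {x} {y} (φ-inj (proj₂ x) (proj₂ y) (cong proj₁ e))) ,
        (λ { (w , p) → let (v , p′ , e) = f-onto w p in (v , p′) , λ { refl → V-≡ {H} e } })) ,
      λ { (u , p) (v , p′) → mk⇔ (λ (i , j) → ψ₀ i , joined i p p′ j) (λ (j , t) → back p p′ j t) }
      where
      back : ∀ {u v} p p′ j → joins (edge H j) (φ u p) (φ v p′) → Adj G u v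
      back {u} {v} p p′ j t with preimageE j
      ... | i , refl = i , two-ends (edge G i) (proj₂ (φ-star u p i) (end (edge H (ψ₀ i)) t)) (proj₂ (φ-star v p′ i) (end (edge H (ψ₀ i)) (joins-sym {edge H (ψ₀ i)} t)))
            (λ { refl → joins-≢ {edge H (ψ₀ i)} t (cong proj₁ (cong f (V-≡ {G} {u , p} {v , p′} refl))) })

    induced : Induced G H graphIso ψ₀
    induced i = joined i (proj₂ (loV G i)) (proj₂ (hiV G i)) (inj₁ (refl , refl))

-- Cliques of the closure, when complete bipartite graphs span

module CliqueGrowth {V : Set} (S : SymRank V) (c : ℕ)
  (bip : ∀ {A B x y} → Unique (A ++ B) → c ≤ length A → c ≤ length B → x ∈ A → y ∈ A → SymRankTheory.Cl S (Bi A B) (x , y)) where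
  open SymRankTheory S

  Clique : List P → List V → Set
  Clique X Q = ∀ {x y} → x ∈ Q → y ∈ Q → Cl X (x , y)

  bip-clique : ∀ {X A B} → Unique (A ++ B) → c ≤ length A → c ≤ length B → (∀ {a b} → a ∈ A → b ∈ B → Cl X (a , b)) → Clique X A
  bip-clique u cA cB h p q = cl-trans (λ { {a , b} t → h (proj₁ (Bi⁻ t)) (proj₂ (Bi⁻ t)) }) (bip u cA cB p q)

  -- Put `c` vertices of `T` on one side and the rest of `Q` together with `v` on the other: the
  -- closure contains this complete bipartite graph, so it joins `v` to the rest.
  attach : ∀ {X Q v T} → Clique X Q → Unique Q → c + c ≤ length Q → v ∉ Q → Unique T → T ⊆ Q → c ≤ length T →
           (∀ {t} → t ∈ T → Cl X (v , t)) → Clique X (v ∷ Q)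
  attach {X} {Q} {v} {T} cq uQ big v∉ uT T⊆ cT h = cl
    where
    T₀ = take c T
    uT₀ = unique-take c uT
    lT₀ : length T₀ ≡ c
    lT₀ = length-take≤ c {T} cT
    R = filter (λ x → ¬? (x ∈? T₀)) Q
    R⁻ : ∀ {x} → x ∈ R → x ∈ Q × x ∉ T₀
    R⁻ p = filter-∈ (λ x → ¬? (x ∈? T₀)) Q p
    lR : c ≤ length R
    lR = +-cancelˡ-≤ c _ _ (≤-trans big (≤-trans (unique-⊆-length {ys = T₀ ++ R} uQ (λ {x} p → case x ∈? T₀ of λ
      { (yes t) → ∈-++⁺ˡ t ; (no t) → ∈-++⁺ʳ T₀ (∈-filter⁺ (λ x → ¬? (x ∈? T₀)) p t) })) (≤-reflexive (trans (length-++ T₀) (cong (_+ length R) lT₀)))))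
    T₀⊆ : T₀ ⊆ Q
    T₀⊆ p = T⊆ (take-⊆ c T p)
    uAB : Unique ((v ∷ R) ++ T₀)
    uAB = unique-++ (unique-∷ (λ p → v∉ (proj₁ (R⁻ p))) (unique-filter (λ x → ¬? (x ∈? T₀)) uQ)) uT₀
      (λ { (here refl) p → v∉ (T₀⊆ p) ; (there q) p → proj₂ (R⁻ q) p })
    wide : Clique X (v ∷ R)
    wide = bip-clique uAB (≤-trans lR (n≤1+n _)) (≤-reflexive (sym lT₀))
      (λ { (here refl) q → h (take-⊆ c T q) ; (there p) q → cq (proj₁ (R⁻ p)) (T₀⊆ q) })
    new : ∀ {y} → y ∈ Q → Cl X (v , y)
    new {y} p with y ∈? T₀
    ... | yes t = h (take-⊆ c T t)
    ... | no t = wide (here refl) (there (∈-filter⁺ (λ x → ¬? (x ∈? T₀)) p t))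
    cl : Clique X (v ∷ Q)
    cl (here refl) (here refl) = r-loop v X
    cl (here refl) (there q) = new q
    cl (there p) (here refl) = cl-flip (new p)
    cl (there p) (there q) = cq p q

-- All elements outside the chosen blocks of `c` get the last label, so the labelling is total.
labels : ∀ {A : Set} (_≟_ : DecidableEquality A) c N {W : List A} → Unique W → suc N * c ≤ length W →
  Σ (A → Fin (suc N)) λ g → ∀ i → ∃ λ T → Unique T × T ⊆ W × c ≤ length T × (∀ {x} → x ∈ T → g x ≡ i)
labels _≟_ c zero {W} u le = (λ _ → fzero) , λ { fzero → W , u , id , ≤-trans (≤-reflexive (sym (+-identityʳ c))) le , λ _ → refl }
labels {A} _≟_ c (suc N) {W} u le = g , cls
  where
  open DecList _≟_
  split = unique-++⁻ (take c W) (subst Unique (sym (take++drop≡id c W)) u)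
  drop⊆ : drop c W ⊆ W
  drop⊆ p = subst (_ ∈_) (take++drop≡id c W) (∈-++⁺ʳ (take c W) p)
  rec = labels _≟_ c N {drop c W} (proj₁ (proj₂ split)) (+-cancelˡ-≤ c _ _ (≤-trans le (≤-trans (≤-reflexive (sym (m+[n∸m]≡n (≤-trans (m≤m+n c _) le)))) (≤-reflexive (cong (c +_) (sym (length-drop c W)))))))
  g : A → Fin (suc (suc N))
  g x with x ∈? take c W
  ... | yes _ = fzero
  ... | no _  = fsuc (proj₁ rec x)
  g-in : ∀ {x} → x ∈ take c W → g x ≡ fzero
  g-in {x} p with x ∈? take c W
  ... | yes _ = refl
  ... | no n  = ⊥-elim (n p)
  g-out : ∀ {x} → x ∉ take c W → g x ≡ fsuc (proj₁ rec x)
  g-out {x} n with x ∈? take c W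
  ... | yes p = ⊥-elim (n p)
  ... | no _  = refl
  cls : ∀ i → ∃ λ T → Unique T × T ⊆ W × c ≤ length T × (∀ {x} → x ∈ T → g x ≡ i)
  cls fzero = take c W , unique-take c u , take-⊆ c W , ≤-reflexive (sym (length-take≤ c {W} (≤-trans (m≤m+n c _) le))) , g-in
  cls (fsuc i) = let (T , uT , T⊆ , lT , h) = proj₂ rec i in T , uT , (drop⊆ ∘ T⊆) , lT ,
    λ p → trans (g-out (λ q → proj₂ (proj₂ split) q (T⊆ p))) (cong fsuc (h p))

-- Doubly negated because families need not be decidable.
Unbounded : GraphMatroidFamily → Set
Unbounded F = ∀ {X e u v} → IF F X → joins e u v → (∀ {f} → f ∈ X → v ≢ lo f × v ≢ hi f) → ¬ ¬ IF F (e ∷ X)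

-- Unions of families

module UnionFamily {k : ℕ} (𝓜 : Fin (suc k) → GraphMatroidFamily) where
  open Union _≟E_ (λ j → listMatroid (𝓜 j)) public

  unionMatroid : EdgeMatroid
  unionMatroid = record
    { base = ∪-matroid
    ; invariant = λ a b (u , B , i , h) → unique-map (λ _ _ → ren-inj a b) u , (λ j → map (ren a b) (B j)) , (λ j → renamed (𝓜 j) a b (i j)) ,
        λ p → let (e , e∈ , eq) = ∈-map⁻ (ren a b) p ; (j , q) = h e∈ in j , subst (_∈ map (ren a b) (B j)) (sym eq) (∈-map⁺ (ren a b) q) }

  union-ext : ∀ G {X Y} → (∀ {e} → e S.∈ X → e S.∈ Y) → (∀ {e} → e S.∈ Y → e S.∈ X) → UnionInd 𝓜 G X → UnionInd 𝓜 G Y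
  union-ext G h h′ (B , i , c) = B , i , λ e → mk⇔ (λ p → to (c e) (h′ p)) (λ q → h (from (c e) q))

  bridge-∪ : ∀ G {L} → Unique L → UnionInd 𝓜 G (toS L) ⇔ I∪ (map (edge G) L)
  bridge-∪ G {L} u = mk⇔ forth back
    where
    forth : UnionInd 𝓜 G (toS L) → I∪ (map (edge G) L)
    forth (B , i , c) = unique-map (λ _ _ → edge-inj G) u , (λ j → map (edge G) (fromS (B j))) ,
      (λ j → to (bridge (𝓜 j) G (fromS-unique (B j)) fromS⁺ (fromS⁻ {p = B j})) (i j)) ,
      λ p → let (x , x∈ , eq) = ∈-map⁻ (edge G) p ; (j , q) = to (c x) (toS⁺ x∈) in j , subst (_∈ map (edge G) (fromS (B j))) (sym eq) (∈-map⁺ (edge G) (fromS⁺ q))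
    back : I∪ (map (edge G) L) → UnionInd 𝓜 G (toS L)
    back (_ , B , i , h) = (λ j → toS (Lj j)) ,
        (λ j → from (bridge-toS (𝓜 j) G (unique-filter (in? j) u)) (ListMatroid.I-⊆ (listMatroid (𝓜 j)) (unique-map (λ _ _ → edge-inj G) (unique-filter (in? j) u))
          (λ p → let (x , x∈ , eq) = ∈-map⁻ (edge G) p in subst (_∈ B j) (sym eq) (proj₂ (filter-∈ (in? j) L x∈))) (i j))) ,
        λ e → mk⇔ (λ p → let (j , q) = h (∈-map⁺ (edge G) (toS⁻ p)) in j , toS⁺ (∈-filter⁺ (in? j) (toS⁻ p) q))
                  (λ (j , q) → toS⁺ (proj₁ (filter-∈ (in? j) L (toS⁻ q))))
      where
      in? : ∀ j x → Dec (edge G x ∈ B j)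
      in? j x = DecList._∈?_ _≟E_ (edge G x) (B j)
      Lj : Fin (suc k) → List (Fin (m G))
      Lj j = filter (in? j) L

  module _ (n : ℕ) (decJ : ∀ j X → Dec (Ambient.Iₙ (edgeMatroid (𝓜 j)) n X)) (decU : ∀ X → Dec (Ambient.Iₙ unionMatroid n X)) where
    open Pairs n
    module J (j : Fin (suc k)) = MatroidRank (Ambient.matroidₙ (edgeMatroid (𝓜 j)) n) (decJ j)
    module U = MatroidRank (Ambient.matroidₙ unionMatroid n) decU

    S∪ : SymRank (Fin n)
    S∪ = Ambient.WithDec.symRank unionMatroid n decU

    SJ : Fin (suc k) → SymRank (Fin n)
    SJ j = Ambient.WithDec.symRank (edgeMatroid (𝓜 j)) n (decJ j)

    Js : List (Fin (suc k))
    Js = allFin (suc k)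

    rank-∪≤ : ∀ Z → U.rank Z ≤ ∑ Js (λ j → J.rank j Z)
    rank-∪≤ Z = ≤-trans (≤-reflexive (sym (∑-class f B))) (∑-mono Js (λ j _ → J.rank-max j
        (ic j , (λ p → range (proj₁ (filter-∈ (λ e → f e ≟F j) B p)))) (λ p → U.basis-⊆ Z (proj₁ (filter-∈ (λ e → f e ≟F j) B p)))))
      where
      B = U.basis Z
      range = proj₂ (U.basis-I Z)
      f = proj₁ (colour (proj₁ (U.basis-I Z)))
      ic = proj₂ (colour (proj₁ (U.basis-I Z)))

    rank-∪≥ : ∀ (Zs : Fin (suc k) → List Edge) Z → (∀ {i j e} → e ∈ Zs i → e ∈ Zs j → i ≡ j) → (∀ j → Zs j ⊆ Z) →
              ∑ Js (λ j → J.rank j (Zs j)) ≤ U.rank Z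
    rank-∪≥ Zs Z disj sub = ≤-trans (≤-reflexive (sym (len Js))) (U.rank-max {Z} {cc Js}
        ((uniq Js (Uniqueₚ.allFin⁺ (suc k)) , (λ j → J.basis j (Zs j)) , (λ j → proj₁ (J.basis-I j (Zs j))) , λ p → let (j , _ , q) = cc⁻ Js p in j , q) ,
         λ p → let (j , _ , q) = cc⁻ Js p in proj₂ (J.basis-I j (Zs j)) q)
        (λ p → let (j , _ , q) = cc⁻ Js p in sub j (J.basis-⊆ j (Zs j) q)))
      where
      cc : List (Fin (suc k)) → List Edge
      cc []       = []
      cc (j ∷ js) = J.basis j (Zs j) ++ cc js
      cc⁻ : ∀ js {e} → e ∈ cc js → ∃ λ j → j ∈ js × e ∈ J.basis j (Zs j)
      cc⁻ (j ∷ js) p with ∈-++⁻ (J.basis j (Zs j)) p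
      ... | inj₁ q = j , here refl , q
      ... | inj₂ q = let (i , i∈ , t) = cc⁻ js q in i , there i∈ , t
      uniq : ∀ js → Unique js → Unique (cc js)
      uniq []       _ = []
      uniq (j ∷ js) u = unique-++ (ListMatroid.I-unique (listMatroid (𝓜 j)) (proj₁ (J.basis-I j (Zs j)))) (uniq js (unique-tail u))
        (λ p q → let (i , i∈ , t) = cc⁻ js q in unique-head u (subst (_∈ js) (disj (J.basis-⊆ i (Zs i) t) (J.basis-⊆ j (Zs j) p)) i∈))
      len : ∀ js → length (cc js) ≡ ∑ js (λ j → J.rank j (Zs j))
      len []       = refl
      len (j ∷ js) = trans (length-++ (J.basis j (Zs j))) (cong (J.rank j (Zs j) +_) (len js))

    module _ (c : ℕ) (3≤c : 3 ≤ c) (wh : ∀ j G → IsConnected c G → Reconstructible (Ind (𝓜 j)) G) where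

      bipJ : ∀ j {A B x y} → Unique (A ++ B) → c ≤ length A → c ≤ length B → x ∈ A → y ∈ A → SymRankTheory.Cl (SJ j) (Bi A B) (x , y)
      bipJ j u cA cB = WhitneyBip.whitney-bip (𝓜 j) c 3≤c (wh j) n (decJ j) u cA cB

      -- Room for one class of `c` vertices for each part and each bit.
      q∪ : ℕ
      q∪ = (suc k + suc k) * c

      -- Vertices get a class i and a bit b; the edge between (i , b) and (l , b′) goes to the i-th part if b = b′ and to the l-th otherwise.
      module _ {A B : List (Fin n)} (uAB : Unique (A ++ B)) (qA : q∪ ≤ length A) (qB : q∪ ≤ length B) where
        uA = proj₁ (unique-++⁻ A uAB)
        uB = proj₁ (proj₂ (unique-++⁻ A uAB))
        A∩B = proj₂ (proj₂ (unique-++⁻ A uAB))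
        labA = labels _≟F_ c (k + suc k) uA qA
        labB = labels _≟F_ c (k + suc k) uB qB

        mix : Fin (suc k) ⊎ Fin (suc k) → Fin (suc k) ⊎ Fin (suc k) → Fin (suc k)
        mix (inj₁ i) (inj₁ l) = i
        mix (inj₂ i) (inj₂ l) = i
        mix (inj₁ i) (inj₂ l) = l
        mix (inj₂ i) (inj₁ l) = l

        gA gB : Fin n → Fin (suc k) ⊎ Fin (suc k)
        gA x = splitAt (suc k) (proj₁ labA x)
        gB x = splitAt (suc k) (proj₁ labB x)

        clsA : ∀ s → ∃ λ T → Unique T × T ⊆ A × c ≤ length T × (∀ {x} → x ∈ T → gA x ≡ s)
        clsA (inj₁ i) = let (T , a , b , l , h) = proj₂ labA (i ↑ˡ suc k) in T , a , b , l , λ p → trans (cong (splitAt (suc k)) (h p)) (splitAt-↑ˡ (suc k) i (suc k))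
        clsA (inj₂ i) = let (T , a , b , l , h) = proj₂ labA (suc k ↑ʳ i) in T , a , b , l , λ p → trans (cong (splitAt (suc k)) (h p)) (splitAt-↑ʳ (suc k) (suc k) i)

        clsB : ∀ s → ∃ λ T → Unique T × T ⊆ B × c ≤ length T × (∀ {x} → x ∈ T → gB x ≡ s)
        clsB (inj₁ i) = let (T , a , b , l , h) = proj₂ labB (i ↑ˡ suc k) in T , a , b , l , λ p → trans (cong (splitAt (suc k)) (h p)) (splitAt-↑ˡ (suc k) i (suc k))
        clsB (inj₂ i) = let (T , a , b , l , h) = proj₂ labB (suc k ↑ʳ i) in T , a , b , l , λ p → trans (cong (splitAt (suc k)) (h p)) (splitAt-↑ʳ (suc k) (suc k) i)

        part? : ∀ j (e : Fin n × Fin n) → Dec (mix (gA (proj₁ e)) (gB (proj₂ e)) ≡ j)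
        part? j e = mix (gA (proj₁ e)) (gB (proj₂ e)) ≟F j

        Part : Fin (suc k) → List (Fin n × Fin n)
        Part j = filter (part? j) (Bi A B)

        part⁺ : ∀ {j a b} → a ∈ A → b ∈ B → mix (gA a) (gB b) ≡ j → (a , b) ∈ Part j
        part⁺ {j} p q e = ∈-filter⁺ (part? j) (Bi⁺ p q) e

        module _ (j : Fin (suc k)) where
          open SymRankTheory (SJ j)
          open CliqueGrowth (SJ j) c (bipJ j)

          A₁ A₂ B₁ B₂ A₀ B₀ Q : List (Fin n)
          A₁ = proj₁ (clsA (inj₁ j))
          A₂ = proj₁ (clsA (inj₂ j))
          B₁ = proj₁ (clsB (inj₁ j))
          B₂ = proj₁ (clsB (inj₂ j))
          A₀ = A₁ ++ A₂
          B₀ = B₁ ++ B₂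
          Q  = A₀ ++ B₀

          12-≢ : ∀ {i i′ : Fin (suc k)} → _≡_ {A = Fin (suc k) ⊎ Fin (suc k)} (inj₁ i) (inj₂ i′) → ⊥
          12-≢ ()

          uA₀ : Unique A₀
          uA₀ = unique-++ (proj₁ (proj₂ (clsA (inj₁ j)))) (proj₁ (proj₂ (clsA (inj₂ j))))
            (λ p q → 12-≢ (trans (sym (proj₂ (proj₂ (proj₂ (proj₂ (clsA (inj₁ j))))) p)) (proj₂ (proj₂ (proj₂ (proj₂ (clsA (inj₂ j))))) q)))
          uB₀ : Unique B₀
          uB₀ = unique-++ (proj₁ (proj₂ (clsB (inj₁ j)))) (proj₁ (proj₂ (clsB (inj₂ j))))
            (λ p q → 12-≢ (trans (sym (proj₂ (proj₂ (proj₂ (proj₂ (clsB (inj₁ j))))) p)) (proj₂ (proj₂ (proj₂ (proj₂ (clsB (inj₂ j))))) q)))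

          A₀⊆ : A₀ ⊆ A
          A₀⊆ p = [ proj₁ (proj₂ (proj₂ (clsA (inj₁ j)))) , proj₁ (proj₂ (proj₂ (clsA (inj₂ j)))) ]′ (∈-++⁻ A₁ p)
          B₀⊆ : B₀ ⊆ B
          B₀⊆ p = [ proj₁ (proj₂ (proj₂ (clsB (inj₁ j)))) , proj₁ (proj₂ (proj₂ (clsB (inj₂ j)))) ]′ (∈-++⁻ B₁ p)

          gA₀ : ∀ {x} → x ∈ A₀ → gA x ≡ inj₁ j ⊎ gA x ≡ inj₂ j
          gA₀ p = [ (λ t → inj₁ (proj₂ (proj₂ (proj₂ (proj₂ (clsA (inj₁ j))))) t)) , (λ t → inj₂ (proj₂ (proj₂ (proj₂ (proj₂ (clsA (inj₂ j))))) t)) ]′ (∈-++⁻ A₁ p)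
          gB₀ : ∀ {x} → x ∈ B₀ → gB x ≡ inj₁ j ⊎ gB x ≡ inj₂ j
          gB₀ p = [ (λ t → inj₁ (proj₂ (proj₂ (proj₂ (proj₂ (clsB (inj₁ j))))) t)) , (λ t → inj₂ (proj₂ (proj₂ (proj₂ (proj₂ (clsB (inj₂ j))))) t)) ]′ (∈-++⁻ B₁ p)

          mix-same : ∀ {s t} → s ≡ inj₁ j ⊎ s ≡ inj₂ j → t ≡ inj₁ j ⊎ t ≡ inj₂ j → mix s t ≡ j
          mix-same (inj₁ refl) (inj₁ refl) = refl
          mix-same (inj₁ refl) (inj₂ refl) = refl
          mix-same (inj₂ refl) (inj₁ refl) = refl
          mix-same (inj₂ refl) (inj₂ refl) = refl

          uQ : Unique Q
          uQ = unique-++ uA₀ uB₀ (λ p q → A∩B (A₀⊆ p) (B₀⊆ q))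

          cA₀ : c ≤ length A₀
          cA₀ = ≤-trans (proj₁ (proj₂ (proj₂ (proj₂ (clsA (inj₁ j)))))) (≤-trans (m≤m+n _ _) (≤-reflexive (sym (length-++ A₁))))
          cB₀ : c ≤ length B₀
          cB₀ = ≤-trans (proj₁ (proj₂ (proj₂ (proj₂ (clsB (inj₁ j)))))) (≤-trans (m≤m+n _ _) (≤-reflexive (sym (length-++ B₁))))

          X = Part j

          inCl : ∀ {e} → e ∈ X → Cl X e
          inCl = cl-∈ {X}

          flipCl : ∀ {x y} → Cl X (x , y) → Cl X (y , x)
          flipCl {x} {y} = cl-flip {X} {x} {y}

          cross : ∀ {a b} → a ∈ A₀ → b ∈ B₀ → Cl X (a , b)
          cross p q = inCl (part⁺ (A₀⊆ p) (B₀⊆ q) (mix-same (gA₀ p) (gB₀ q)))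

          cliqueQ : Clique X Q
          cliqueQ p q with ∈-++⁻ A₀ p | ∈-++⁻ A₀ q
          ... | inj₁ a | inj₁ a′ = bip-clique {X} uQ cA₀ cB₀ cross a a′
          ... | inj₁ a | inj₂ b = cross a b
          ... | inj₂ b | inj₁ a = flipCl (cross a b)
          ... | inj₂ b | inj₂ b′ = bip-clique {X} (unique-++ uB₀ uA₀ (λ p q → A∩B (A₀⊆ q) (B₀⊆ p))) cB₀ cA₀ (λ p q → flipCl (cross q p)) b b′

          bigQ : c + c ≤ length Q
          bigQ = ≤-trans (+-mono-≤ cA₀ cB₀) (≤-reflexive (sym (length-++ A₀)))

          -- The purpose of the bits: whatever the class and bit of `x`, the edges to the vertices
          -- of class `j` with the opposite bit on the other side belong to the part `j`.
          anchor : ∀ {x} → x ∈ A ++ B → ∃ λ T → Unique T × T ⊆ Q × c ≤ length T × (∀ {t} → t ∈ T → Cl X (x , t))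
          anchor {x} p with ∈-++⁻ A p
          ... | inj₁ a with gA x in eq
          ...   | inj₁ i = let (T , uT , T⊆ , lT , h) = clsB (inj₂ j) in T , uT , (λ t → ∈-++⁺ʳ A₀ (∈-++⁺ʳ B₁ t)) , lT , λ t → inCl (part⁺ a (T⊆ t) (cong₂ mix eq (h t)))
          ...   | inj₂ i = let (T , uT , T⊆ , lT , h) = clsB (inj₁ j) in T , uT , (λ t → ∈-++⁺ʳ A₀ (∈-++⁺ˡ t)) , lT , λ t → inCl (part⁺ a (T⊆ t) (cong₂ mix eq (h t)))
          anchor {x} p | inj₂ b with gB x in eq
          ...   | inj₁ i = let (T , uT , T⊆ , lT , h) = clsA (inj₁ j) in T , uT , (λ t → ∈-++⁺ˡ (∈-++⁺ˡ t)) , lT , λ t → flipCl (inCl (part⁺ (T⊆ t) b (cong₂ mix (h t) eq)))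
          ...   | inj₂ i = let (T , uT , T⊆ , lT , h) = clsA (inj₂ j) in T , uT , (λ t → ∈-++⁺ˡ (∈-++⁺ʳ A₁ t)) , lT , λ t → flipCl (inCl (part⁺ (T⊆ t) b (cong₂ mix (h t) eq)))

          grow : ∀ {Q′ x} → Clique X Q′ → Unique Q′ → Q ⊆ Q′ → x ∈ A ++ B → ∃ λ Q″ → Clique X Q″ × Unique Q″ × Q′ ⊆ Q″ × x ∈ Q″
          grow {Q′} {x} cq u s p with x ∈? Q′
          ... | yes t = Q′ , cq , u , id , t
          ... | no t = let (T , uT , T⊆ , lT , h) = anchor p in x ∷ Q′ , attach {X} cq u (≤-trans bigQ (unique-⊆-length uQ s)) t uT (s ∘ T⊆) lT h , unique-∷ t u , there , here refl

          part-spans : ∀ {e} → e ∈ K (A ++ B) → Cl X e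
          part-spans {x , y} p with grow cliqueQ uQ id (proj₁ (K⁻ p))
          ... | Q₁ , cq₁ , u₁ , s₁ , x∈ with grow cq₁ u₁ s₁ (proj₂ (K⁻ p))
          ...   | Q₂ , cq₂ , _ , s₂ , y∈ = cq₂ (s₂ x∈) y∈

          part-rank : J.rank j (edges (K (A ++ B))) ≤ J.rank j (edges X)
          part-rank = span-≤ {X} part-spans

        edges-mono : ∀ {X Y} → X ⊆ Y → edges X ⊆ edges Y
        edges-mono {X} {Y} s {f} p = let (u , v , q , t) = edges⁻ X p in edges⁺ {f} {u} {v} {Y} (s q) t

        parts-disjoint : ∀ {i j e} → e ∈ edges (Part i) → e ∈ edges (Part j) → i ≡ j
        parts-disjoint {i} {j} {e} p q with edges⁻ (Part i) p | edges⁻ (Part j) q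
        ... | a , b , ab , t | a′ , b′ , ab′ , t′ with filter-∈ (part? i) (Bi A B) ab | filter-∈ (part? j) (Bi A B) ab′
        ...   | w , ei | w′ , ej = trans (sym ei) (trans (cong₂ (λ a b → mix (gA a) (gB b)) a≡ b≡) ej)
          where
          a≡ : a ≡ a′
          a≡ = [ toℕ-injective , (λ h → ⊥-elim (A∩B (proj₁ (Bi⁻ w)) (subst (_∈ B) (sym (toℕ-injective h)) (proj₂ (Bi⁻ w′))))) ]′ (end⁻ e t′ (end e t))
          b≡ : b ≡ b′
          b≡ = [ (λ h → ⊥-elim (A∩B (proj₁ (Bi⁻ w′)) (subst (_∈ B) (toℕ-injective h) (proj₂ (Bi⁻ w))))) , toℕ-injective ]′ (end⁻ e t′ (end e (joins-sym {e} t)))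

        -- Each part has full rank in its own matroid. As the parts are disjoint, these ranks add up
        -- inside the bipartite graph to the upper bound for the rank of the whole clique.
        bip-∪ : ∀ {x y} → x ∈ A → y ∈ A → SymRankTheory.Cl S∪ (Bi A B) (x , y)
        bip-∪ {x} {y} p q = ≤-trans (U.rank-mono {edges ((x , y) ∷ Bi A B)} {edges (K (A ++ B))} (edges-mono {(x , y) ∷ Bi A B} {K (A ++ B)}
              λ { (here refl) → K⁺ (∈-++⁺ˡ p) (∈-++⁺ˡ q) ; {a , b} (there t) → K⁺ (∈-++⁺ˡ (proj₁ (Bi⁻ t))) (∈-++⁺ʳ A (proj₂ (Bi⁻ {X = A} t))) }))
          (≤-trans (rank-∪≤ (edges (K (A ++ B)))) (≤-trans (∑-mono Js (λ j _ → part-rank j))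
            (rank-∪≥ (λ j → edges (Part j)) (edges (Bi A B)) (λ {i} {j} {e} → parts-disjoint {i} {j} {e}) (λ j → edges-mono {Part j} {Bi A B} (λ t → proj₁ (filter-∈ (part? j) (Bi A B) t))))))

      -- Colour a basis by the matroids; the pendant edge can join the class of colour `j₀`.
      leaf-∪ : ∀ j → Unbounded (𝓜 j) → ∀ {W X u v} → X ⊆ K W → v ∉ W → u ∈ W → SymRank.r S∪ X < SymRank.r S∪ ((v , u) ∷ X)
      leaf-∪ j₀ unb {W} {X} {u} {v} X⊆ v∉ u∈ = U.rank-max {edges ((v , u) ∷ X)} {e ∷ B} ((unique-∷ e∉ (proj₁ iB) , B′ , iB′ , cov) , range)
          (λ { (here refl) → edges⁺ {e} {v} {u} {(v , u) ∷ X} (here refl) je ; (there p) → edges-there (U.basis-⊆ (edges X) p) })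
        where
        B = U.basis (edges X)
        iB = proj₁ (U.basis-I (edges X))
        v≢u : v ≢ u
        v≢u refl = v∉ u∈
        e = mkE (toℕ v) (toℕ u) (v≢u ∘ toℕ-injective)
        je : joins e (toℕ v) (toℕ u)
        je = mkE-joins _ _ _
        edges-there : ∀ {f} → f ∈ edges X → f ∈ edges ((v , u) ∷ X)
        edges-there {f} p = let (a , b , t , h) = edges⁻ X p in edges⁺ {f} {a} {b} {(v , u) ∷ X} (there t) h
        off : ∀ {f} → f ∈ B → toℕ v ≢ lo f × toℕ v ≢ hi f
        off {f} p = (λ h → bad (inj₁ h)) , (λ h → bad (inj₂ h))
          where
          bad : toℕ v ≡ lo f ⊎ toℕ v ≡ hi f → ⊥
          bad h with edges⁻ X (U.basis-⊆ (edges X) p)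
          ... | a , b , t , jf with end⁻ f jf h
          ...   | inj₁ r = v∉ (subst (_∈ W) (sym (toℕ-injective r)) (proj₁ (K⁻ (X⊆ t))))
          ...   | inj₂ r = v∉ (subst (_∈ W) (sym (toℕ-injective r)) (proj₂ (K⁻ (X⊆ t))))
        e∉ : e ∉ B
        e∉ p = [ proj₁ (off {e} p) , proj₂ (off {e} p) ]′ (end e je)
        col = colour iB
        f₀ = proj₁ col
        B′ : Fin (suc k) → List Edge
        B′ j with j ≟F j₀
        ... | yes _ = e ∷ class f₀ B j₀
        ... | no _  = class f₀ B j
        range : ∀ {f} → f ∈ e ∷ B → InRange f
        range (here refl) = v , u , je
        range (there p) = proj₂ (U.basis-I (edges X)) p
        iB′ : ∀ j → IF (𝓜 j) (B′ j)
        iB′ j with j ≟F j₀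
        ... | yes refl = proj₁ (decidable-stable (decJ j₀ (e ∷ class f₀ B j₀)) λ n →
              unb (proj₂ col j₀) (joins-sym {e} je) (λ {f} p → off (proj₁ (filter-∈ (λ e → f₀ e ≟F j₀) B p))) λ i →
              n (i , λ { (here p) → range (here p) ; (there p) → range (there (proj₁ (filter-∈ (λ e → f₀ e ≟F j₀) B p))) }))
        ... | no _ = proj₂ col j
        ∈B′ : ∀ {x} j → x ∈ class f₀ B j → x ∈ B′ j
        ∈B′ j p with j ≟F j₀
        ... | yes refl = there p
        ... | no _ = p
        e∈B′ : e ∈ B′ j₀
        e∈B′ with j₀ ≟F j₀
        ... | yes _ = here refl
        ... | no h = ⊥-elim (h refl)
        cov : ∀ {x} → x ∈ e ∷ B → ∃ λ j → x ∈ B′ j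
        cov (here refl) = j₀ , e∈B′
        cov {x} (there p) = f₀ x , ∈B′ (f₀ x) (∈-filter⁺ (λ y → f₀ y ≟F f₀ x) p refl)

      growing-∪ : ∀ j → Unbounded (𝓜 j) → Growing S∪
      growing-∪ j unb = record
        { q = q∪
        ; 2≤q = ≤-trans (≤-trans (s≤s (s≤s z≤n)) 3≤c) (m≤m+n c _)
        ; bip = λ u a b → bip-∪ u a b
        ; leaf = leaf-∪ j unb }

-- Realizing graphs as pairs of a finite vertex set.

bound : Graph → ℕ
bound G = suc (∑ (allFin (m G)) (hi ∘ edge G))

hi<bound : ∀ G i → hi (edge G i) < bound G
hi<bound G i = s≤s (∑-∈ (hi ∘ edge G) (∈-allFin i))

lo<bound : ∀ G i → lo (edge G i) < bound G
lo<bound G i = <-trans (lo<hi (edge G i)) (hi<bound G i)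

-- `σ` re-indexes the edges: the identity is used for `G` and `ψ₀` for `H`, so that both graphs are
-- indexed by the edges of `G`.
module Realize (G : Graph) {k : ℕ} (σ : Fin k → Fin (m G)) (σ-inj : ∀ {i j} → σ i ≡ σ j → i ≡ j) {n : ℕ} (b≤n : bound G ≤ n) where

  abstract
    e : Fin k → Fin n × Fin n
    e i = fromℕ< (≤-trans (lo<bound G (σ i)) b≤n) , fromℕ< (≤-trans (hi<bound G (σ i)) b≤n)

    e-lo : ∀ i → toℕ (proj₁ (e i)) ≡ lo (edge G (σ i))
    e-lo i = toℕ-fromℕ< _

    e-hi : ∀ i → toℕ (proj₂ (e i)) ≡ hi (edge G (σ i))
    e-hi i = toℕ-fromℕ< _

  e-joins : ∀ i → joins (edge G (σ i)) (toℕ (proj₁ (e i))) (toℕ (proj₂ (e i)))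
  e-joins i = inj₁ (sym (e-lo i) , sym (e-hi i))

  noloop : ∀ i → proj₁ (e i) ≢ proj₂ (e i)
  noloop i p = <⇒≢ (lo<hi (edge G (σ i))) (trans (sym (e-lo i)) (trans (cong toℕ p) (e-hi i)))

  simple : ∀ {i j} → e i ≡ e j ⊎ e i ≡ (proj₂ (e j) , proj₁ (e j)) → i ≡ j
  simple {i} {j} h = σ-inj (Graph.edge-inj G (joins-unique {edge G (σ i)} {edge G (σ j)} (e-joins i) (other h)))
    where
    other : e i ≡ e j ⊎ e i ≡ (proj₂ (e j) , proj₁ (e j)) → joins (edge G (σ j)) (toℕ (proj₁ (e i))) (toℕ (proj₂ (e i)))
    other (inj₁ p) = subst₂ (λ x y → joins (edge G (σ j)) (toℕ x) (toℕ y)) (sym (cong proj₁ p)) (sym (cong proj₂ p)) (e-joins j)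
    other (inj₂ p) = subst₂ (λ x y → joins (edge G (σ j)) (toℕ x) (toℕ y)) (sym (cong proj₁ p)) (sym (cong proj₂ p)) (joins-sym {edge G (σ j)} (e-joins j))

  inc→ : ∀ {i v} → proj₁ (e i) ≡ v ⊎ proj₂ (e i) ≡ v → toℕ v ∈E edge G (σ i)
  inc→ {i} (inj₁ refl) = inj₁ (e-lo i)
  inc→ {i} (inj₂ refl) = inj₂ (e-hi i)

  inc← : ∀ {i v} → toℕ v ∈E edge G (σ i) → proj₁ (e i) ≡ v ⊎ proj₂ (e i) ≡ v
  inc← {i} (inj₁ p) = inj₁ (toℕ-injective (trans (e-lo i) (sym p)))
  inc← {i} (inj₂ p) = inj₂ (toℕ-injective (trans (e-hi i) (sym p)))

  abstract
    verts : List (Fin n)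
    verts = deduplicate _≟F_ (map (proj₁ ∘ e) (allFin k) ++ map (proj₂ ∘ e) (allFin k))

    verts-unique : Unique verts
    verts-unique = UniqueD.deduplicate-! _≟F_ _

    verts-in : ∀ i → proj₁ (e i) ∈ verts × proj₂ (e i) ∈ verts
    verts-in i = ∈-deduplicate⁺ _≟F_ (∈-++⁺ˡ (∈-map⁺ (proj₁ ∘ e) (∈-allFin i))) , ∈-deduplicate⁺ _≟F_ (∈-++⁺ʳ (map (proj₁ ∘ e) (allFin k)) (∈-map⁺ (proj₂ ∘ e) (∈-allFin i)))

    verts-inc : ∀ {v} → v ∈ verts → ∃ λ i → proj₁ (e i) ≡ v ⊎ proj₂ (e i) ≡ v
    verts-inc p with ∈-++⁻ (map (proj₁ ∘ e) (allFin k)) (∈-deduplicate⁻ _≟F_ (map (proj₁ ∘ e) (allFin k) ++ map (proj₂ ∘ e) (allFin k)) p)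
    ... | inj₁ t = let (i , _ , eq) = ∈-map⁻ (proj₁ ∘ e) t in i , inj₁ (sym eq)
    ... | inj₂ t = let (i , _ , eq) = ∈-map⁻ (proj₂ ∘ e) t in i , inj₂ (sym eq)

  verts-length : length verts ≤ bound G
  verts-length = ≤-trans (≤-reflexive (sym (length-map toℕ verts))) (≤-trans (unique-⊆-length {ys = upTo (bound G)} (unique-map (λ _ _ → toℕ-injective) verts-unique) sub)
      (≤-reflexive (length-upTo (bound G))))
    where
    sub : map toℕ verts ⊆ upTo (bound G)
    sub p with ∈-map⁻ toℕ p
    ... | v , v∈ , refl with verts-inc v∈
    ...   | i , inj₁ refl = ∈-upTo⁺ (≤-trans (s≤s (≤-reflexive (e-lo i))) (lo<bound G (σ i)))
    ...   | i , inj₂ refl = ∈-upTo⁺ (≤-trans (s≤s (≤-reflexive (e-hi i))) (hi<bound G (σ i)))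

-- High connectivity

module Connectivity {n : ℕ} (S : SymRank (Fin n)) (Gr : Growing S) (G : Graph) (b≤n : bound G ≤ n) {C : ℕ} (conn : IsConnected C G) where
  open Realize G {m G} id id b≤n
  open Covers.HighlyConnected S Gr e noloop simple

  isVertex : ∀ {v} → v ∈ verts → IsVertex G (toℕ v)
  isVertex p = let (i , t) = verts-inc p in fromWitness (i , inc→ {i} t)

  isVert⁻ : ∀ {v} → IsVertex G v → ∃ λ x → toℕ x ≡ v × x ∈ verts
  isVert⁻ p with toWitness p
  ... | i , inj₁ t = proj₁ (e i) , trans (e-lo i) (sym t) , proj₁ (verts-in i)
  ... | i , inj₂ t = proj₂ (e i) , trans (e-hi i) (sym t) , proj₂ (verts-in i)

  e-other : ∀ {v i} → proj₁ (e i) ≡ v ⊎ proj₂ (e i) ≡ v → joins (edge G i) (toℕ v) (toℕ (other v i))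
  e-other {v} {i} h with other-spec {v} {i} h
  ... | inj₁ p = subst₂ (λ x y → joins (edge G i) (toℕ x) (toℕ y)) (cong proj₁ p) (cong proj₂ p) (e-joins i)
  ... | inj₂ p = joins-sym {edge G i} (subst₂ (λ x y → joins (edge G i) (toℕ x) (toℕ y)) (cong proj₁ p) (cong proj₂ p) (e-joins i))

  degree-C : ∀ {v} → v ∈ verts → C ≤ # (inc? v) (allFin (m G))
  degree-C {v} v∈ = ≤-trans (degree-≥ G conn (isVertex v∈)) (#-mono (incident? G (toℕ v)) (inc? v) (allFin (m G)) (λ i _ → inc← {i}))

  separ-C : ∀ W {v₀ u₀} → v₀ ∈ verts → v₀ ∈ W → ¬ Boundary (allFin (m G)) W v₀ → u₀ ∈ verts → u₀ ∉ W → C ≤ # (boundary? (allFin (m G)) W) verts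
  separ-C W {v₀} {u₀} v₀∈ v₀W nb u₀∈ u₀∉ = ≮⇒≥ contra
    where
    bd? = boundary? (allFin (m G)) W
    contra : ¬ (# bd? verts < C)
    contra lt = u₀∉ (let (x , eq , xW , _) = inside (proj₂ conn X ltX (toℕ v₀) (toℕ u₀) (isVertex v₀∈) (isVertex u₀∈) (v₀∉X) u₀∉X) in subst (_∈ W) (toℕ-injective eq) xW)
      where
      X = map toℕ (filter bd? verts)
      ltX : length X < C
      ltX = subst (_< C) (sym (trans (length-map toℕ (filter bd? verts)) (length-filter≡# bd? verts))) lt
      X⁻ : ∀ {x} → toℕ x ∈ X → Boundary (allFin (m G)) W x
      X⁻ {x} p with ∈-map⁻ toℕ p
      ... | y , y∈ , eq = subst (Boundary (allFin (m G)) W) (sym (toℕ-injective eq)) (proj₂ (filter-∈ bd? verts y∈))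
      v₀∉X : toℕ v₀ ∉ X
      v₀∉X p = nb (X⁻ p)
      u₀∉X : toℕ u₀ ∉ X
      u₀∉X p = u₀∉ (proj₁ (X⁻ p))
      -- A walk that avoids `X` cannot leave the interior of `W`: an edge at a non-boundary vertex
      -- stays inside `W`, and its other end is not in `X`, hence not on the boundary.
      inside : ∀ {w} → Reach G X (toℕ v₀) w → ∃ λ x → toℕ x ≡ w × x ∈ W × ¬ Boundary (allFin (m G)) W x
      inside here = v₀ , refl , v₀W , nb
      inside {w} (step r (i , j) w∉) with inside r
      ... | x , refl , xW , nbx = y , ey , yW , (λ b → w∉ (subst (_∈ X) ey (∈-map⁺ toℕ (∈-filter⁺ bd? y∈ b))))
        where
        ix : proj₁ (e i) ≡ x ⊎ proj₂ (e i) ≡ x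
        ix = inc← {i} (end (edge G i) j)
        y = other x i
        ey : toℕ y ≡ w
        ey = sym (joins-other (edge G i) j (e-other {x} {i} ix))
        inW : In (e i) W
        inW = decidable-stable (in? W i) (λ n → nbx (xW , lose (∈-allFin i) (ix , n)))
        yW : y ∈ W
        yW with other-spec {x} {i} ix
        ... | inj₁ p = subst (_∈ W) (cong proj₂ p) (proj₂ inW)
        ... | inj₂ p = subst (_∈ W) (cong proj₁ p) (proj₁ inW)
        y∈ : y ∈ verts
        y∈ with other-spec {x} {i} ix
        ... | inj₁ p = subst (_∈ verts) (cong proj₂ p) (proj₂ (verts-in i))
        ... | inj₂ p = subst (_∈ verts) (cong proj₁ p) (proj₁ (verts-in i))

  highlyConnected : HC C (allFin (m G)) verts
  highlyConnected = record
    { uL = Uniqueₚ.allFin⁺ (m G) ; uV = verts-unique ; inV = λ {i} _ → verts-in i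
    ; degree = degree-C ; separ = separ-C }

module Recognize {n : ℕ} (S : SymRank (Fin n)) (Gr : Growing S) (G H : Graph) (ψ : Fin (m G) ⤖ Fin (m H))
  (bG : bound G ≤ n) (bH : bound H ≤ n) where
  open StarMap G H ψ
  private
    module RG = Realize G {m G} id id bG
    module RH = Realize H {m G} ψ₀ (Bijection.injective ψ) bH
    q = Growing.q Gr

  module _ (same : ∀ L → SymRank.r S (map RG.e L) ≡ SymRank.r S (map RH.e L))
    (conn : IsConnected (suc (Constants.C₀ q)) G) (big : bound G + bound H + suc q ≤ length (SymRank.pool S)) where
    private
      module CG = Connectivity S Gr G bG conn
      module Rec = Recognition S Gr RG.e RH.e RG.noloop RH.noloop RG.simple RH.simple same

      capG : length RG.verts + suc q ≤ length (SymRank.pool S)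
      capG = ≤-trans (+-monoˡ-≤ (suc q) (≤-trans RG.verts-length (m≤m+n (bound G) (bound H)))) big

      capH : length RH.verts + suc q ≤ length (SymRank.pool S)
      capH = ≤-trans (+-monoˡ-≤ (suc q) (≤-trans RH.verts-length (m≤n+m (bound H) (bound G)))) big

      2≤N : 2 ≤ length RG.verts
      2≤N = two (proj₁ conn)
        where
        two : (∃ λ (L : List ℕ) → Unique L × length L ≡ suc (suc (Constants.C₀ q)) × All (IsVertex G) L) → 2 ≤ length RG.verts
        two (x ∷ y ∷ _ , u , _ , px ∷ py ∷ _) with CG.isVert⁻ px | CG.isVert⁻ py
        ... | a , refl , a∈ | b , refl , b∈ = unique-⊆-length {xs = a ∷ b ∷ []} (unique-∷ (λ { (here t) → unique-head u (here (cong toℕ t)) }) ([] ∷ [])) λ { (here refl) → a∈ ; (there (here refl)) → b∈ }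
        two (_ ∷ [] , _ , () , _)
        two ([] , _ , () , _)

    recognize : StarsToStars
    recognize = from-vertices star′
      where
      IncG IncH : Fin (m G) → Fin n → Set
      IncG i x = proj₁ (RG.e i) ≡ x ⊎ proj₂ (RG.e i) ≡ x
      IncH i x = proj₁ (RH.e i) ≡ x ⊎ proj₂ (RH.e i) ≡ x
      found : ∀ {x} → x ∈ RG.verts → ∃ λ w → ∀ {i} → i ∈ allFin (m G) → (IncG i x → IncH i w) × (IncH i w → IncG i x)
      found = Rec.stars-to-stars CG.highlyConnected capG capH RH.verts-unique (λ {i} _ → RH.verts-in i)
                (λ w∈ → let (i , t) = RH.verts-inc w∈ in i , ∈-allFin i , t) 2≤N
      convert : ∀ {x} → (∃ λ w → ∀ {i} → i ∈ allFin (m G) → (IncG i x → IncH i w) × (IncH i w → IncG i x)) → ∃ (Star (toℕ x))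
      convert (w , h) = toℕ w , λ i → (λ t → RH.inc→ {i} (proj₁ (h (∈-allFin i)) (RG.inc← {i} t))) ,
                                      (λ t → RG.inc→ {i} (proj₂ (h (∈-allFin i)) (RH.inc← {i} t)))
      located : ∀ {v} → (∃ λ x → toℕ x ≡ v × x ∈ RG.verts) → ∃ (Star v)
      located (x , refl , x∈) = convert (found x∈)
      star′ : ∀ v → IsVertex G v → ∃ (Star v)
      star′ v p = located (CG.isVert⁻ p)

-- The case that some family is unbounded

module UnboundedCase {k : ℕ} (𝓜 : Fin (suc k) → GraphMatroidFamily) (c : ℕ) (3≤c : 3 ≤ c)
  (wh : ∀ j G → IsConnected c G → Reconstructible (Ind (𝓜 j)) G) where
  open UnionFamily 𝓜

  Q∪ : ℕ
  Q∪ = (suc k + suc k) * c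

  C∪ : ℕ
  C∪ = suc (Constants.C₀ Q∪)

  module _ (G H : Graph) (ψ : Fin (m G) ⤖ Fin (m H)) (iso : IsMatroidIso (UnionInd 𝓜 G) (UnionInd 𝓜 H) (Bijection.to ψ))
    (conn : IsConnected C∪ G) where
    open StarMap G H ψ

    n : ℕ
    n = bound G + bound H + suc Q∪

    bG : bound G ≤ n
    bG = ≤-trans (m≤m+n _ _) (m≤m+n _ _)
    bH : bound H ≤ n
    bH = ≤-trans (m≤n+m _ (bound G)) (m≤m+n _ _)

    module RG = Realize G {m G} id id bG
    module RH = Realize H {m G} ψ₀ (Bijection.injective ψ) bH
    open Pairs n

    iso-list : ∀ {L} → Unique L → I∪ (map (edge G) L) ⇔ I∪ (map (edge H ∘ ψ₀) L)
    iso-list {L} u = mk⇔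
        (λ x → subst I∪ (sym (map-∘ L)) (to (bridge-∪ H uψ) (from (iso (toS (map ψ₀ L))) (union-ext G {toS L} {pre} in⁺ in⁻ (from (bridge-∪ G u) x)))))
        (λ y → to (bridge-∪ G u) (union-ext G {pre} {toS L} in⁻ in⁺ (to (iso (toS (map ψ₀ L))) (from (bridge-∪ H uψ) (subst I∪ (map-∘ L) y)))))
      where
      uψ : Unique (map ψ₀ L)
      uψ = unique-map (λ _ _ → Bijection.injective ψ) u
      pre = preimage ψ₀ (toS (map ψ₀ L))
      in⁺ : ∀ {i} → i S.∈ toS L → i S.∈ pre
      in⁺ {i} p = lookup⇒[]= i pre (trans (lookup∘tabulate _ i) ([]=⇒lookup (toS⁺ (∈-map⁺ ψ₀ (toS⁻ p)))))
      in⁻ : ∀ {i} → i S.∈ pre → i S.∈ toS L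
      in⁻ {i} p with ∈-map⁻ ψ₀ (toS⁻ {L = map ψ₀ L} (lookup⇒[]= (ψ₀ i) (toS (map ψ₀ L)) (trans (sym (lookup∘tabulate _ i)) ([]=⇒lookup p))))
      ... | j , j∈ , eq = toS⁺ (subst (_∈ L) (sym (Bijection.injective ψ eq)) j∈)

    module _ (decJ : ∀ j X → Dec (Ambient.Iₙ (edgeMatroid (𝓜 j)) n X)) (decU : ∀ X → Dec (Ambient.Iₙ unionMatroid n X))
      (j₀ : Fin (suc k)) (unb : Unbounded (𝓜 j₀)) where
      open MatroidRank (Ambient.matroidₙ unionMatroid n) decU

      S₀ : SymRank (Fin n)
      S₀ = S∪ n decJ decU

      Gr : Growing S₀
      Gr = growing-∪ n decJ decU c 3≤c wh j₀ unb

      open DecList _≟E_ using () renaming (_∈?_ to _∈Ed?_)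

      -- A basis on one side is carried, edge by edge, to an independent set of the same length on
      -- the other.
      transfer : ∀ {f g : Fin (m G) → Edge} {eg : Fin (m G) → Fin n × Fin n} {ef : Fin (m G) → Fin n × Fin n} →
        (∀ i → joins (f i) (toℕ (proj₁ (ef i))) (toℕ (proj₂ (ef i)))) → (∀ i → joins (g i) (toℕ (proj₁ (eg i))) (toℕ (proj₂ (eg i)))) →
        (∀ {i j} → f i ≡ f j → i ≡ j) → (∀ {L} → Unique L → I∪ (map f L) → I∪ (map g L)) → ∀ L → rank (edges (map ef L)) ≤ rank (edges (map eg L))
      transfer {f} {g} {eg} {ef} jf jg f-inj h L = ≤-trans count (≤-trans (≤-reflexive (sym (length-map g L′))) (rank-max {edges (map eg L)} {map g L′} (h uL′ iL′ , range) sub))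
        where
        B = basis (edges (map ef L))
        Ld = deduplicate _≟F_ L
        in? : ∀ i → Dec (f i ∈ B)
        in? i = f i ∈Ed? B
        L′ = filter in? Ld
        uL′ : Unique L′
        uL′ = unique-filter in? (UniqueD.deduplicate-! _≟F_ L)
        mem : ∀ {i} → i ∈ L′ → i ∈ L × f i ∈ B
        mem p = let (a , b) = filter-∈ in? Ld p in ∈-deduplicate⁻ _≟F_ L a , b
        iL′ : I∪ (map f L′)
        iL′ = ListMatroid.I-⊆ ∪-matroid (unique-map (λ _ _ → f-inj) uL′) (λ p → let (i , i∈ , eq) = ∈-map⁻ f p in subst (_∈ B) (sym eq) (proj₂ (mem i∈))) (proj₁ (basis-I (edges (map ef L))))
        count : length B ≤ length L′
        count = ≤-trans (unique-⊆-length {ys = map f L′} (ListMatroid.I-unique ∪-matroid (proj₁ (basis-I (edges (map ef L))))) B⊆) (≤-reflexive (length-map f L′))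
          where
          B⊆ : B ⊆ map f L′
          B⊆ {x} p with edges⁻ (map ef L) (basis-⊆ (edges (map ef L)) p)
          ... | u , v , uv , t with ∈-map⁻ ef uv
          ...   | i , i∈ , refl = subst (_∈ map f L′) eq (∈-map⁺ f (∈-filter⁺ in? (∈-deduplicate⁺ _≟F_ i∈) (subst (_∈ B) (sym eq) p)))
            where eq : f i ≡ x
                  eq = joins-unique {f i} {x} (jf i) t
        range : ∀ {x} → x ∈ map g L′ → InRange x
        range p = let (i , _ , eq) = ∈-map⁻ g p in proj₁ (eg i) , proj₂ (eg i) , subst (λ x → joins x (toℕ (proj₁ (eg i))) (toℕ (proj₂ (eg i)))) (sym eq) (jg i)
        sub : map g L′ ⊆ edges (map eg L)
        sub p = let (i , i∈ , eq) = ∈-map⁻ g p in subst (_∈ edges (map eg L)) (sym eq) (edges⁺ {g i} {X = map eg L} (∈-map⁺ eg (proj₁ (mem i∈))) (jg i))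

      same : ∀ L → rank (edges (map RG.e L)) ≡ rank (edges (map RH.e L))
      same L = ≤-antisym (transfer {edge G} {edge H ∘ ψ₀} {RH.e} {RG.e} RG.e-joins RH.e-joins (edge-inj G) (λ u → to (iso-list u)) L)
                         (transfer {edge H ∘ ψ₀} {edge G} {RG.e} {RH.e} RH.e-joins RG.e-joins (λ p → Bijection.injective ψ (edge-inj H p)) (λ u → from (iso-list u)) L)

      pool-n : bound G + bound H + suc Q∪ ≤ length (SymRank.pool S₀)
      pool-n = ≤-reflexive (sym (length-tabulate id))

      conclusion : StarsToStars
      conclusion = Recognize.recognize S₀ Gr G H ψ bG bH same conn pool-n

    unbounded-case : ∀ j₀ → Unbounded (𝓜 j₀) → ¬ ¬ StarsToStars
    unbounded-case j₀ unb = dne-→ (dns-Fin (λ j → Ambient.decidable (edgeMatroid (𝓜 j)) n)) λ decJ →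
      dne-→ (Ambient.decidable unionMatroid n) λ decU k → k (conclusion decJ decU j₀ unb)

open DecList using (_∈?_)

-- Highly connected graphs of bounded degree and large girth

record Sparse (c Δ g : ℕ) : Set where
  field
    lines     : List Edge
    unique    : Unique lines
    connected : IsConnected c (graphOf lines unique)
    bounded   : ∀ v → # (v ∈E?_) lines ≤ Δ
    leafy     : ∀ {Y} → Unique Y → Y ⊆ lines → 1 ≤ length Y → length Y ≤ g →
                ∃ λ e → ∃ λ v → e ∈ Y × v ∈E e × (∀ {f} → f ∈ Y → f ≢ e → ¬ v ∈E f)

adj-vertex : ∀ G {x y} → Adj G x y → IsVertex G x
adj-vertex G (i , j) = fromWitness (i , end (edge G i) j)

module Encoding (Γ : FinGraph) where
  open FinGraph Γ

  enc : Pt → ℕ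
  enc v = toℕ (Any.index (vs-all v))

  enc-inj : ∀ {u v} → enc u ≡ enc v → u ≡ v
  enc-inj {u} {v} p = trans (lookup-index (vs-all u)) (trans (cong (lookup vs) (toℕ-injective p)) (sym (lookup-index (vs-all v))))

  abstract
    line : E → Edge
    line e = mkE (enc (src e)) (enc (tgt e)) (noloop e ∘ enc-inj)

    line-joins : ∀ e → joins (line e) (enc (src e)) (enc (tgt e))
    line-joins e = mkE-joins _ _ _

  line-inc : ∀ {e v} → Inc e v → enc v ∈E line e
  line-inc {e} (inj₁ refl) = end (line e) (line-joins e)
  line-inc {e} (inj₂ refl) = end (line e) (joins-sym {line e} (line-joins e))

  line-inc⁻ : ∀ e {w} → w ∈E line e → ∃ λ v → w ≡ enc v × Inc e v
  line-inc⁻ e p with end⁻ (line e) (line-joins e) p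
  ... | inj₁ q = src e , q , inj₁ refl
  ... | inj₂ q = tgt e , q , inj₂ refl

  line-inc′ : ∀ e {v} → enc v ∈E line e → Inc e v
  line-inc′ e p = let (u , q , i) = line-inc⁻ e p in subst (Inc e) (sym (enc-inj q)) i

  line-inj : ∀ {e f} → line e ≡ line f → e ≡ f
  line-inj {e} {f} p = simple (noloop e) (inj₁ refl) (inj₂ refl)
    (line-inc′ f (subst (enc (src e) ∈E_) p (line-inc {e} (inj₁ refl)))) (line-inc′ f (subst (enc (tgt e) ∈E_) p (line-inc {e} (inj₂ refl))))

  line-bounded : ∀ {N Es} → (∀ v → degree v ≤ N) → Unique Es → ∀ w → # (w ∈E?_) (map line Es) ≤ N
  line-bounded {N} {Es} deg u w with anyL? (w ∈E?_) (map line Es)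
  ... | no none = ≮⇒≥ λ lt → let (e , e∈ , p) = #-pos (w ∈E?_) (map line Es) (≤-trans (s≤s z≤n) lt) in none (lose e∈ p)
  ... | yes a with find a
  ...   | _ , l∈ , p with ∈-map⁻ line l∈
  ...     | e , _ , refl with line-inc⁻ e p
  ...       | v , refl , _ = ≤-trans (subst₂ _≤_ (length-filter≡# (enc v ∈E?_) (map line Es))
              (trans (length-map line (filter (λ e → inc? e v) es)) (length-filter≡# (λ e → inc? e v) es))
              (unique-⊆-length {ys = map line (filter (λ e → inc? e v) es)} (unique-filter (enc v ∈E?_) (unique-map (λ _ _ → line-inj) u)) sub)) (deg v)
    where
    sub : filter (enc v ∈E?_) (map line Es) ⊆ map line (filter (λ e → inc? e v) es)
    sub q with filter-∈ (enc v ∈E?_) (map line Es) q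
    ... | q∈ , t with ∈-map⁻ line q∈
    ...   | f , _ , refl = ∈-map⁺ line (∈-filter⁺ (λ e → inc? e v) (es-all f) (line-inc′ f t))

  line-leafy : ∀ {g Es Y} → Girth> g → Unique Y → Y ⊆ map line Es → 1 ≤ length Y → length Y ≤ g →
    ∃ λ e → ∃ λ v → e ∈ Y × v ∈E e × (∀ {f} → f ∈ Y → f ≢ e → ¬ v ∈E f)
  line-leafy {g} {Es} {Y} girth u sub ne le = line (proj₁ leaf) , enc (proj₁ (proj₂ leaf)) , Y₀⁻ (proj₁ (proj₂ (proj₂ leaf))) ,
      line-inc {proj₁ leaf} (proj₁ (proj₂ (proj₂ (proj₂ leaf)))) , only
    where
    in? : ∀ e → Dec (line e ∈ Y)
    in? e = _∈?_ _≟E_ (line e) Y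
    Y₀ = filter in? es
    Y₀⁻ : ∀ {e} → e ∈ Y₀ → line e ∈ Y
    Y₀⁻ p = proj₂ (filter-∈ in? es p)
    uY₀ : Unique Y₀
    uY₀ = unique-filter in? es-unique
    short : length Y₀ ≤ length Y
    short = ≤-trans (≤-reflexive (sym (length-map line Y₀))) (unique-⊆-length (unique-map (λ _ _ → line-inj) uY₀)
      λ p → let (e , e∈ , q) = ∈-map⁻ line p in subst (_∈ Y) (sym q) (Y₀⁻ e∈))
    pull : ∀ {l} → l ∈ Y → ∃ λ e → e ∈ Y₀ × l ≡ line e
    pull p = let (e , _ , q) = ∈-map⁻ line (sub p) in e , ∈-filter⁺ in? (es-all e) (subst (_∈ Y) q p) , q
    ne₀ : 1 ≤ length Y₀
    ne₀ = let (l , l∈) = nonempty {xs = Y} ne ; (e , e∈ , _) = pull l∈ in unique-⊆-length {xs = e ∷ []} ([] ∷ []) λ { (here refl) → e∈ }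
    leaf = has-leaf {Y₀} (λ lf → <⇒≱ (girth uY₀ ne₀ lf) (≤-trans short le))
    only : ∀ {f} → f ∈ Y → f ≢ line (proj₁ leaf) → ¬ enc (proj₁ (proj₂ leaf)) ∈E f
    only f∈ f≢ i = let (e , e∈ , q) = pull f∈ in
      proj₂ (proj₂ (proj₂ (proj₂ leaf))) e∈ (λ p → f≢ (trans q (cong line p))) (line-inc′ e (subst (enc (proj₁ (proj₂ leaf)) ∈E_) q i))

-- Mader's theorem: a minimal set U of at least 2c vertices spanning more than 2c(|U| - c) edges spans a c-connected graph.

module Mader (Γ : FinGraph) (c : ℕ) (1≤c : 1 ≤ c) where
  open FinGraph Γ
  open Encoding Γ
  open DecList _≟V_ using (_⊖_; ∈-⊖⁺; ∈-⊖⁻; length-⊖) renaming (_∈?_ to _∈V?_)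

  b : ℕ
  b = c + c

  Spans : List Pt → E → Set
  Spans U e = src e ∈ U × tgt e ∈ U

  in? : ∀ U e → Dec (Spans U e)
  in? U e = (src e ∈V? U) ×-dec (tgt e ∈V? U)

  in-inc : ∀ {U e v} → Spans U e → Inc e v → v ∈ U
  in-inc (p , _) (inj₁ refl) = p
  in-inc (_ , p) (inj₂ refl) = p

  induced# : List Pt → ℕ
  induced# U = # (in? U) es

  Good : List Pt → Set
  Good U = b ≤ length U × b * length U < induced# U + b * c

  Minimal : List Pt → Set
  Minimal U = ∀ {U′} → Unique U′ → length U′ < length U → ¬ Good U′

  minimal : ∀ n {U} → length U ≤ n → Unique U → Good U → ¬ ¬ (∃ λ U → Unique U × Good U × Minimal U)
  minimal n {U} le u g k = lem (∃ λ U′ → Unique U′ × length U′ < length U × Good U′) λ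
    { (no none)                 → k (U , u , g , λ u′ lt g′ → none (_ , u′ , lt , g′))
    ; (yes (U′ , u′ , lt , g′)) → rec n le u′ lt g′ k }
    where
    rec : ∀ n {U′} → length U ≤ n → Unique U′ → length U′ < length U → Good U′ → ¬ ¬ (∃ λ U → Unique U × Good U × Minimal U)
    rec zero    le _  lt _  = ⊥-elim (<⇒≱ (≤-trans (s≤s z≤n) lt) le)
    rec (suc n) le u′ lt g′ = minimal n (≤-pred (≤-trans lt le)) u′ g′

  other : E → Pt → Pt
  other e u with src e ≟V u
  ... | yes _ = tgt e
  ... | no _  = src e

  other-inc : ∀ e u → Inc e (other e u)
  other-inc e u with src e ≟V u
  ... | yes _ = inj₂ refl
  ... | no _  = inj₁ refl

  other-≢ : ∀ e u → other e u ≢ u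
  other-≢ e u with src e ≟V u
  ... | yes p = λ q → noloop e (trans p (sym q))
  ... | no n  = n

  degIn : List Pt → Pt → ℕ
  degIn A u = # (λ e → in? A e ×-dec inc? e u) es

  degIn≤ : ∀ A u → degIn A u ≤ length A
  degIn≤ A u = subst (_≤ length A) (trans (length-map (λ e → other e u) F) (length-filter≡# p? es))
      (unique-⊆-length (unique-map inj (unique-filter p? es-unique)) λ q → let (e , e∈ , eq) = ∈-map⁻ (λ e → other e u) q in
        subst (_∈ A) (sym eq) (in-inc {A} (proj₁ (F⁻ e∈)) (other-inc e u)))
    where
    p? : ∀ e → Dec (Spans A e × Inc e u)
    p? e = in? A e ×-dec inc? e u
    F = filter p? es
    F⁻ : ∀ {e} → e ∈ F → Spans A e × Inc e u
    F⁻ q = proj₂ (filter-∈ p? es q)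
    inj : ∀ {e f} → e ∈ F → f ∈ F → other e u ≡ other f u → e ≡ f
    inj {e} {f} p q eq = simple (other-≢ e u) (other-inc e u) (proj₂ (F⁻ p)) (subst (Inc f) (sym eq) (other-inc f u)) (proj₂ (F⁻ q))

  size≤ : ∀ {U} → induced# U + induced# U ≤ length U * length U
  size≤ {U} = subst₂ _≤_ (trans (length-++ (map st F)) (cong₂ _+_ (trans (length-map st F) lF) (trans (length-map ts F) lF))) (length-× U U)
      (unique-⊆-length {xs = map st F ++ map ts F} (unique-++ (unique-map (λ _ _ → st-inj) uF) (unique-map (λ _ _ → ts-inj) uF) disj) sub)
    where
    st ts : E → Pt × Pt
    st e = src e , tgt e
    ts e = tgt e , src e
    F = filter (in? U) es
    uF = unique-filter (in? U) es-unique
    lF = length-filter≡# (in? U) es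
    st-inj : ∀ {e f} → st e ≡ st f → e ≡ f
    st-inj {e} {f} p = simple (noloop e) (inj₁ refl) (inj₂ refl) (inj₁ (sym (cong proj₁ p))) (inj₂ (sym (cong proj₂ p)))
    ts-inj : ∀ {e f} → ts e ≡ ts f → e ≡ f
    ts-inj p = st-inj (cong₂ _,_ (cong proj₂ p) (cong proj₁ p))
    disj : ∀ {x} → x ∈ map st F → x ∉ map ts F
    disj p q with ∈-map⁻ st p | ∈-map⁻ ts q
    ... | e , _ , refl | f , _ , eq = noloop e (trans (cong proj₁ eq) (cong tgt (sym e≡f)))
      where e≡f : e ≡ f
            e≡f = simple (noloop e) (inj₁ refl) (inj₂ refl) (inj₂ (sym (cong proj₁ eq))) (inj₁ (sym (cong proj₂ eq)))
    sub : map st F ++ map ts F ⊆ cartesianProduct U U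
    sub q with ∈-++⁻ (map st F) q
    ... | inj₁ t = let (e , e∈ , eq) = ∈-map⁻ st t ; (_ , s , t) = filter-∈ (in? U) es e∈ in subst (_∈ cartesianProduct U U) (sym eq) (∈-cartesianProduct⁺ s t)
    ... | inj₂ t = let (e , e∈ , eq) = ∈-map⁻ ts t ; (_ , s , t) = filter-∈ (in? U) es e∈ in subst (_∈ cartesianProduct U U) (sym eq) (∈-cartesianProduct⁺ t s)

  module _ {U : List Pt} (u : Unique U) (good : Good U) (min : Minimal U) where

    -- On exactly `2 * c` vertices there are at most `2 * c * c` edges, which is not enough for a
    -- good set.
    large : b < length U
    large = ≤∧≢⇒< (proj₁ good) λ eq → <⇒≱ (proj₂ good) (half (subst (λ l → induced# U + induced# U + (b * c + b * c) ≤ l * l + (b * c + b * c)) (sym eq) (+-monoˡ-≤ _ (size≤ {U}))) eq)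
      where
      half : induced# U + induced# U + (b * c + b * c) ≤ b * b + (b * c + b * c) → b ≡ length U → induced# U + b * c ≤ b * length U
      half h eq = subst (λ l → induced# U + b * c ≤ b * l) eq (≮⇒≥ λ lt → <⇒≱ (+-mono-< lt lt) (lin 0 h (id′ (induced# U) c)))
        where id′ : ∀ s c → s + (c + c) * c + (s + (c + c) * c) + ((c + c) * (c + c) + ((c + c) * c + (c + c) * c)) + 0
                          ≡ (c + c) * (c + c) + (c + c) * (c + c) + (s + s + ((c + c) * c + (c + c) * c))
              id′ = solve-∀

    -- Otherwise deleting `v` loses at most `b` edges and leaves a smaller good set.
    min-degree : ∀ {v} → v ∈ U → b < degIn U v
    min-degree {v} v∈ = ≰⇒> λ le → min (unique-filter _ u) (≤-reflexive (sym lU))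
        (≤-pred (subst (b <_) lU large) , lin 0 (+-mono-≤ (+-mono-≤ (proj₂ good) split) le) (id′ (length (U ⊖ v)) lU))
      where
      lU : length U ≡ suc (length (U ⊖ v))
      lU = length-⊖ u v∈
      split : induced# U ≤ induced# (U ⊖ v) + degIn U v
      split = ≤-trans (#-mono (in? U) (λ e → in? (U ⊖ v) e ⊎-dec (in? U e ×-dec inc? e v)) es λ e _ (p , q) → case inc? e v of λ
                { (yes i) → inj₂ ((p , q) , i) ; (no n) → inj₁ (∈-⊖⁺ p (n ∘ inj₁) , ∈-⊖⁺ q (n ∘ inj₂)) })
              (#-⊎ (in? (U ⊖ v)) (λ e → in? U e ×-dec inc? e v) es)
      id′ : ∀ l → length U ≡ suc l → suc (b * l) + (induced# U + b * c + (induced# (U ⊖ v) + degIn U v) + b) + 0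
                ≡ induced# (U ⊖ v) + b * c + (suc (b * length U) + induced# U + degIn U v)
      id′ l eq = trans (ar b l (induced# U) (b * c) (induced# (U ⊖ v)) (degIn U v)) (cong (λ x → induced# (U ⊖ v) + b * c + (suc (b * x) + induced# U + degIn U v)) (sym eq))
        where ar : ∀ b l s x t d → suc (b * l) + (s + x + (t + d) + b) + 0 ≡ t + x + (suc (b * suc l) + s + d)
              ar = solve-∀

    Es : List E
    Es = filter (in? U) es

    Es⁻ : ∀ {e} → e ∈ Es → Spans U e
    Es⁻ p = proj₂ (filter-∈ (in? U) es p)

    lines : List Edge
    lines = map line Es

    lines-unique : Unique lines
    lines-unique = unique-map (λ _ _ → line-inj) (unique-filter (in? U) es-unique)

    G : Graph
    G = graphOf lines lines-unique

    adj : ∀ {e x y} → Spans U e → Inc e x → Inc e y → x ≢ y → Adj G (enc x) (enc y)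
    adj {e} {x} {y} p i j n = Any.index l∈ , subst (λ l → joins l (enc x) (enc y)) (lookup-index l∈) (two-ends (line e) (line-inc {e} i) (line-inc {e} j) (n ∘ enc-inj))
      where l∈ : line e ∈ lines
            l∈ = ∈-map⁺ line (∈-filter⁺ (in? U) (es-all e) p)

    some-edge : ∀ {v} → v ∈ U → ∃ λ e → e ∈ es × (Spans U e × Inc e v)
    some-edge v∈ = #-pos (λ e → in? U e ×-dec inc? e _) es (≤-trans (s≤s z≤n) (min-degree v∈))

    vertex : ∀ {v} → v ∈ U → IsVertex G (enc v)
    vertex {v} v∈ = adj-vertex G (adj {proj₁ e} {v} {other (proj₁ e) v} (proj₁ (proj₂ (proj₂ e))) (proj₂ (proj₂ (proj₂ e))) (other-inc (proj₁ e) v) (other-≢ (proj₁ e) v ∘ sym))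
      where e = some-edge v∈

    vertex⁻ : ∀ {w} → IsVertex G w → ∃ λ v → v ∈ U × enc v ≡ w
    vertex⁻ p with toWitness p
    ... | k , t with ∈-map⁻ line (∈-lookup {xs = lines} k)
    ...   | e , e∈ , eq with line-inc⁻ e (subst (_ ∈E_) eq t)
    ...     | v , q , i = v , in-inc {U} (Es⁻ e∈) i , sym q

    module _ (X : List ℕ) (X<c : length X < c) {s t : Pt} (s∈ : s ∈ U) (t∈ : t ∈ U) (s∉ : enc s ∉ X) (t∉ : enc t ∉ X) where
      inX? : ∀ v → Dec (enc v ∈ X)
      inX? v = _∈?_ _≟ℕ_ (enc v) X

      Closed : List Pt → Set
      Closed W = ∀ {e x y} → Spans U e → Inc e x → Inc e y → x ∈ W → enc y ∉ X → y ∈ W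

      Reached : List Pt → Set
      Reached W = ∀ {w} → w ∈ W → Reach G X (enc s) (enc w)

      Exit : List Pt → E → Set
      Exit W e = Spans U e × ((src e ∈ W × tgt e ∉ W × enc (tgt e) ∉ X) ⊎ (tgt e ∈ W × src e ∉ W × enc (src e) ∉ X))

      exit? : ∀ W e → Dec (Exit W e)
      exit? W e = in? U e ×-dec (((src e ∈V? W) ×-dec (¬? (tgt e ∈V? W) ×-dec ¬? (inX? (tgt e)))) ⊎-dec ((tgt e ∈V? W) ×-dec (¬? (src e ∈V? W) ×-dec ¬? (inX? (src e)))))

      -- The vertices reached from `s`, collected edge by edge; the fuel bounds those of `U` that
      -- are still missing.
      grow : ∀ n W → length U ≤ n + length W → Unique W → W ⊆ U → Reached W → ∃ λ W′ → W ⊆ W′ × W′ ⊆ U × Reached W′ × Closed W′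
      grow n W le uW W⊆ r with anyL? (exit? W) es
      ... | no none = W , id , W⊆ , r , closed
        where
        closed : Closed W
        closed {e} {x} {y} p i j x∈ y∉ with y ∈V? W
        ... | yes q = q
        ... | no y∉W = ⊥-elim (none (lose (es-all e) (p , ex i j)))
          where
          ex : Inc e x → Inc e y → (src e ∈ W × tgt e ∉ W × enc (tgt e) ∉ X) ⊎ (tgt e ∈ W × src e ∉ W × enc (src e) ∉ X)
          ex (inj₁ refl) (inj₁ refl) = ⊥-elim (y∉W x∈)
          ex (inj₁ refl) (inj₂ refl) = inj₁ (x∈ , y∉W , y∉)
          ex (inj₂ refl) (inj₁ refl) = inj₂ (x∈ , y∉W , y∉)
          ex (inj₂ refl) (inj₂ refl) = ⊥-elim (y∉W x∈)
      ... | yes a = [ (λ (x∈ , y∉ , yX) → add n le (inj₁ refl) (inj₂ refl) x∈ y∉ yX) , (λ (x∈ , y∉ , yX) → add n le (inj₂ refl) (inj₁ refl) x∈ y∉ yX) ]′ (proj₂ (proj₂ (proj₂ (find a))))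
        where
        e = proj₁ (find a)
        p = proj₁ (proj₂ (proj₂ (find a)))
        add : ∀ n {x y} → length U ≤ n + length W → Inc e x → Inc e y → x ∈ W → y ∉ W → enc y ∉ X → ∃ λ W′ → W ⊆ W′ × W′ ⊆ U × Reached W′ × Closed W′
        add zero {x} {y} le i j x∈ y∉ yX = ⊥-elim (y∉ (unique-⊆-equal uW W⊆ le _≟V_ (in-inc {U} p j)))
        add (suc n) {x} {y} le i j x∈ y∉ yX =
          let (W′ , s′ , rest) = grow n (y ∷ W) (≤-trans le (≤-reflexive (sym (+-suc n (length W))))) (unique-∷ y∉ uW)
                (λ { (here refl) → in-inc {U} p j ; (there q) → W⊆ q })
                (λ { (here refl) → step (r x∈) (adj {e} p i j (λ { refl → y∉ x∈ })) yX ; (there q) → r q })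
          in W′ , (s′ ∘ there) , rest

      -- `U₁` and `U₂` contain every edge between them and overlap only in `X`. Each is smaller than
      -- `U` and has at least `b` vertices, namely the neighbours of `s` or of `t`, so minimality
      -- bounds its edges. As `length X < c`, the sum of both bounds contradicts that `U` is good.
      separated : ∀ {W} → s ∈ W → Closed W → t ∉ W → ⊥
      separated {W} s∈W closed t∉W = <⇒≱ (proj₂ good) (lin (b * (c ∸ length X)) (+-mono-≤ (+-mono-≤ cut (+-mono-≤ (bad u₁ lt₁ big₁) (bad u₂ lt₂ big₂))) (*-monoʳ-≤ b common)) ident)
        where
        p₁? : ∀ v → Dec (v ∈ W ⊎ enc v ∈ X)
        p₁? v = (v ∈V? W) ⊎-dec inX? v
        p₂? : ∀ v → Dec (v ∉ W)
        p₂? v = ¬? (v ∈V? W)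
        U₁ = filter p₁? U
        U₂ = filter p₂? U
        u₁ = unique-filter p₁? u
        u₂ = unique-filter p₂? u
        bad : ∀ {U′} → Unique U′ → length U′ < length U → b ≤ length U′ → induced# U′ + b * c ≤ b * length U′
        bad u′ lt big = ≮⇒≥ λ g → min u′ lt (big , g)
        shorter : ∀ {P : Pt → Set} (P? : ∀ v → Dec (P v)) {v} → v ∈ U → ¬ P v → length (filter P? U) < length U
        shorter P? {v} v∈ n = subst (length (filter P? U) <_) (sym (length-⊖ u v∈)) (s≤s (unique-⊆-length (unique-filter P? u)
          λ {x} q → let (x∈ , px) = filter-∈ P? U q in ∈-⊖⁺ x∈ (λ { refl → n px })))
        lt₁ : length U₁ < length U
        lt₁ = shorter p₁? t∈ [ t∉W , t∉ ]′
        lt₂ : length U₂ < length U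
        lt₂ = shorter p₂? s∈ (λ n → n s∈W)
        wide : ∀ {U′ v} → v ∈ U → (∀ {e} → Spans U e → Inc e v → Spans U′ e) → b ≤ length U′
        wide {U′} {v} v∈ h = ≤-trans (<⇒≤ (min-degree v∈)) (≤-trans (#-mono (λ e → in? U e ×-dec inc? e v) (λ e → in? U′ e ×-dec inc? e v) es (λ e _ (p , i) → h p i , i)) (degIn≤ U′ v))
        cases₁ : ∀ {e x y} → Spans U e → Inc e x → Inc e y → x ∈ W → y ∈ U₁
        cases₁ {e} {x} {y} p i j x∈ = ∈-filter⁺ p₁? (in-inc {U} p j) (case inX? y of λ { (yes q) → inj₂ q ; (no q) → inj₁ (closed p i j x∈ q) })
        cases₂ : ∀ {e x y} → Spans U e → Inc e x → Inc e y → x ∉ W → enc x ∉ X → y ∈ U₂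
        cases₂ {e} {x} {y} p i j x∉ xX = ∈-filter⁺ p₂? (in-inc {U} p j) (λ y∈ → x∉ (closed p j i y∈ xX))
        big₁ : b ≤ length U₁
        big₁ = wide s∈ λ p i → cases₁ p i (inj₁ refl) s∈W , cases₁ p i (inj₂ refl) s∈W
        big₂ : b ≤ length U₂
        big₂ = wide t∈ λ p i → cases₂ p i (inj₁ refl) t∉W t∉ , cases₂ p i (inj₂ refl) t∉W t∉
        cut : induced# U ≤ induced# U₁ + induced# U₂
        cut = ≤-trans (#-mono (in? U) (λ e → in? U₁ e ⊎-dec in? U₂ e) es (λ e _ → part e)) (#-⊎ (in? U₁) (in? U₂) es)
          where
          part : ∀ e → Spans U e → Spans U₁ e ⊎ Spans U₂ e
          part e p with src e ∈V? W | tgt e ∈V? W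
          ... | yes q | _     = inj₁ (cases₁ p (inj₁ refl) (inj₁ refl) q , cases₁ p (inj₁ refl) (inj₂ refl) q)
          ... | no _  | yes q = inj₁ (cases₁ p (inj₂ refl) (inj₁ refl) q , cases₁ p (inj₂ refl) (inj₂ refl) q)
          ... | no q  | no q′ = inj₂ (∈-filter⁺ p₂? (proj₁ p) q , ∈-filter⁺ p₂? (proj₂ p) q′)
        common : length U₁ + length U₂ ≤ length U + length X
        common = subst₂ _≤_ (cong₂ _+_ (sym (length-filter≡# p₁? U)) (sym (length-filter≡# p₂? U))) refl
          (≤-trans (+-monoˡ-≤ (# p₂? U) (#-⊎ (_∈V? W) inX? U)) (≤-trans (≤-reflexive (ar (# (_∈V? W) U) (# inX? U) (# p₂? U)))
            (+-mono-≤ (≤-reflexive (#-¬ (_∈V? W) U)) xs)))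
          where
          ar : ∀ a b c → a + b + c ≡ a + c + b
          ar = solve-∀
          xs : # inX? U ≤ length X
          xs = subst (_≤ length X) (trans (length-map enc (filter inX? U)) (length-filter≡# inX? U)) (unique-⊆-length {xs = map enc (filter inX? U)} (unique-map (λ _ _ → enc-inj) (unique-filter inX? u))
            λ q → let (v , v∈ , eq) = ∈-map⁻ enc q in subst (_∈ X) (sym eq) (proj₂ (filter-∈ inX? U v∈)))
        ident : induced# U + b * c + (induced# U₁ + induced# U₂ + (b * length U₁ + b * length U₂) + b * (length U + length X)) + b * (c ∸ length X)
              ≡ b * length U + (induced# U + (induced# U₁ + b * c + (induced# U₂ + b * c)) + b * (length U₁ + length U₂))
        ident = trans (ar b (length X) (c ∸ length X) (induced# U) (induced# U₁) (induced# U₂) (b * c) (length U) (length U₁) (length U₂))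
            (cong (λ z → b * length U + (induced# U + (induced# U₁ + b * c + (induced# U₂ + z)) + b * (length U₁ + length U₂))) (cong (b *_) (m+[n∸m]≡n (<⇒≤ X<c))))
          where ar : ∀ b x d s s₁ s₂ bc l l₁ l₂ → s + bc + (s₁ + s₂ + (b * l₁ + b * l₂) + b * (l + x)) + b * d ≡ b * l + (s + (s₁ + bc + (s₂ + b * (x + d))) + b * (l₁ + l₂))
                ar = solve-∀

      reach : Reach G X (enc s) (enc t)
      reach = let (W , s∈W , _ , r , closed) = grow (length U) (s ∷ []) (m≤m+n _ _) ([] ∷ []) (λ { (here refl) → s∈ }) (λ { (here refl) → Reach.here }) in
        r (decidable-stable (t ∈V? W) (separated (s∈W (here refl)) closed))

    connected′ : IsConnected c G
    connected′ = (take (suc c) (map enc U) , unique-take (suc c) (unique-map (λ _ _ → enc-inj) u) ,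
        length-take≤ (suc c) {map enc U} (≤-trans (s≤s (m≤m+n c c)) (≤-trans large (≤-reflexive (sym (length-map enc U))))) ,
        tabulateAll λ q → let (v , v∈ , eq) = ∈-map⁻ enc (take-⊆ (suc c) (map enc U) q) in subst (IsVertex G) (sym eq) (vertex v∈)) ,
      λ X lt x y px py x∉ y∉ → conn X lt (vertex⁻ px) (vertex⁻ py) x∉ y∉
      where
      conn : ∀ X → length X < c → ∀ {x y} → (∃ λ v → v ∈ U × enc v ≡ x) → (∃ λ v → v ∈ U × enc v ≡ y) → x ∉ X → y ∉ X → Reach G X x y
      conn X lt (s , s∈ , refl) (t , t∈ , refl) s∉ t∉ = reach X lt s∈ t∈ s∉ t∉

-- A density parameter of `4 * c` means at least `2 * c` edges per vertex, as the condition `Good`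
-- on all vertices asks for.
sparse : ∀ c g → 1 ≤ c → ¬ ¬ Sparse c (c + c + (c + c)) g
sparse c g 1≤c = dne-→ (minimal (length vs) ≤-refl vs-unique good) λ (U , u , gd , mn) k → k (record
    { lines = lines u gd mn ; unique = lines-unique u gd mn ; connected = connected′ u gd mn
    ; bounded = line-bounded {Es = Es u gd mn} degree≤ (unique-filter (in? U) es-unique)
    ; leafy = line-leafy {Es = Es u gd mn} girth })
  where
  open LargeGirth (large-girth (c + c + (c + c)) g)
  open Mader graph c 1≤c
  open Encoding graph
  good : Good vs
  good = ≤-trans (m≤m+n b b) order , ≤-trans (s≤s (≮⇒≥ λ lt → <⇒≱ (+-mono-< lt lt) (≤-trans (≤-reflexive (sym (*-distribʳ-+ (length vs) b b))) dense)))
      (≤-trans (≤-reflexive (+-comm 1 (length es))) (+-mono-≤ all (*-mono-≤ (≤-trans 1≤c (m≤m+n c c)) 1≤c)))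
    where all : length es ≤ induced# vs
          all = ≤-trans (unique-⊆-length es-unique (λ {e} p → ∈-filter⁺ (in? vs) p (vs-all (src e) , vs-all (tgt e)))) (≤-reflexive (length-filter≡# (in? vs) es))

-- Matroids in which the stars are small uniform flats

Within : ℕ → List Edge → Set
Within N X = ∀ {e} → e ∈ X → hi e < N

At : ℕ → List Edge → Set
At v X = ∀ {e} → e ∈ X → v ∈E e

Disjoint : Edge → Edge → Set
Disjoint e f = ∀ {v} → v ∈E e → ¬ v ∈E f

Scattered : List Edge → Set
Scattered X = ∀ {e f} → e ∈ X → f ∈ X → e ≢ f → Disjoint e f

-- On vertices below `N`, stars are uniform of rank `ρ`, by `star-rank` and `star-free`, and closed,
-- by `star-flat`; matchings are free one step beyond that rank. The last two tell stars from other
-- large sets of rank `ρ`.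
record StarBounded (I : List Edge → Set) (N ρ : ℕ) : Set where
  field
    star-rank   : ∀ {X v} → v < N → Within N X → At v X → I X → length X ≤ ρ
    star-free   : ∀ {X v} → v < N → Within N X → At v X → Unique X → length X ≤ ρ → I X
    star-flat   : ∀ {X v e} → v < N → Within N X → At v X → Unique X → length X ≤ ρ → hi e < N → ¬ v ∈E e → I (e ∷ X)
    matching-free : ∀ {X} → Within N X → Unique X → Scattered X → length X ≤ suc ρ → I X

∈E-≤ : ∀ {v} e → v ∈E e → v ≤ hi e
∈E-≤ e (inj₁ p) = ≤-trans (≤-reflexive p) (<⇒≤ (lo<hi e))
∈E-≤ e (inj₂ p) = ≤-reflexive p

far∈ : ∀ {v} e → v ∈E e → far v e ∈E e
far∈ e p = end e (joins-sym {e} (far-joins e p))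

-- From symmetric rank functions to lists of edges.

module StarFacts {n′ : ℕ} (S : SymRank (Fin (suc n′))) (I : List Edge → Set)
  (from-rank : ∀ {X} P → Pairs.edges (suc n′) P ⊆ X → length X ≤ SymRank.r S P → I X)
  (to-rank : ∀ {X} P → Within (suc n′) X → X ⊆ Pairs.edges (suc n′) P → I X → length X ≤ SymRank.r S P) where
  n : ℕ
  n = suc n′
  open Pairs n using (edges; edges⁺; edges⁻)
  open SymRankTheory S hiding (sw; sw-l; sw-r; sw-other; sw-invol; sw-inj)
  open BoundedTheory S

  abstract
    fin : ℕ → Fin n
    fin x with x <? n
    ... | yes p = fromℕ< p
    ... | no _  = fzero

    fin-toℕ : ∀ {x} → x < n → toℕ (fin x) ≡ x
    fin-toℕ {x} p with x <? n
    ... | yes q = toℕ-fromℕ< q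
    ... | no h  = ⊥-elim (h p)

  fin-inj : ∀ {x y} → x < n → y < n → fin x ≡ fin y → x ≡ y
  fin-inj p q e = trans (sym (fin-toℕ p)) (trans (cong toℕ e) (fin-toℕ q))

  pr : Edge → P
  pr e = fin (lo e) , fin (hi e)

  lo<n : ∀ {e} → hi e < n → lo e < n
  lo<n {e} h = <-trans (lo<hi e) h

  fin-joins : ∀ {f x y} → x < n → y < n → joins f (toℕ (fin x)) (toℕ (fin y)) → joins f x y
  fin-joins {f} p q = subst₂ (joins f) (fin-toℕ p) (fin-toℕ q)

  joins-fin : ∀ {f x y} → x < n → y < n → joins f x y → joins f (toℕ (fin x)) (toℕ (fin y))
  joins-fin {f} p q = subst₂ (joins f) (sym (fin-toℕ p)) (sym (fin-toℕ q))

  edges-pr : ∀ {X} → Within n X → edges (map pr X) ⊆ X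
  edges-pr {X} w {f} p with edges⁻ (map pr X) p
  ... | a , b , q , j with ∈-map⁻ pr q
  ...   | e , e∈ , refl = subst (_∈ X) (joins-unique {e} {f} (inj₁ (refl , refl)) (fin-joins {f} (lo<n {e} (w e∈)) (w e∈) j)) e∈

  pr-inj : ∀ {e f} → hi e < n → hi f < n → pr e ≡ pr f → e ≡ f
  pr-inj {e} {f} h h′ p = edge-≡ (fin-inj (lo<n {e} h) (lo<n {f} h′) (cong proj₁ p)) (fin-inj h h′ (cong proj₂ p))

  module _ {v X} (v<n : v < n) (w : Within n X) (at : At v X) where
    leaves : List (Fin n)
    leaves = map (fin ∘ far v) X

    far<n : ∀ {e} → e ∈ X → far v e < n
    far<n {e} e∈ = ≤-trans (s≤s (∈E-≤ e (far∈ e (at e∈)))) (w e∈)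

    leaves-unique : Unique X → Unique leaves
    leaves-unique = unique-map λ {e} {f} p q eq → joins-unique {e} {f} (far-joins e (at p))
      (subst (joins f v) (sym (fin-inj (far<n p) (far<n q) eq)) (far-joins f (at q)))

    centre∉ : fin v ∉ leaves
    centre∉ p with ∈-map⁻ (fin ∘ far v) p
    ... | e , e∈ , eq = joins-≢ {e} (far-joins e (at e∈)) (fin-inj v<n (far<n e∈) eq)

    star-edges : edges (star (fin v) leaves) ⊆ X
    star-edges {f} p with edges⁻ (star (fin v) leaves) p
    ... | a , b , q , j with star⁻ q
    ...   | refl , b∈ with ∈-map⁻ (fin ∘ far v) b∈
    ...     | e , e∈ , refl = subst (_∈ X) (joins-unique {e} {f} (far-joins e (at e∈)) (fin-joins {f} v<n (far<n e∈) j)) e∈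

    in-star : X ⊆ edges (star (fin v) pool)
    in-star {e} e∈ = edges⁺ {e} {fin v} {fin (far v e)} (star⁺ (pool-all _)) (joins-fin {e} v<n (far<n e∈) (far-joins e (at e∈)))

  starBounded : ∀ {N n₁ z₀} → N ≤ n → Spanning n₁ → R + R + n₁ ≤ length pool → σ z₀ < R → StarBounded I N (σ z₀)
  starBounded {N} {n₁} {z₀} N≤n sp room lt = record
    { star-rank = λ {X} {v} v<N w at i → ≤-trans (to-rank (star (fin v) pool) (up w) (in-star (≤-trans v<N N≤n) (up w) at) i) (σ-≤ (fin v) z₀)
    ; star-free = λ {X} {v} v<N w at u le → from-rank (star (fin v) (leaves (≤-trans v<N N≤n) (up w) at)) (star-edges (≤-trans v<N N≤n) (up w) at)
        (free (≤-trans v<N N≤n) (up w) at u le)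
    ; star-flat = λ {X} {v} {e} v<N w at u le e<N e∌ → flat (≤-trans v<N N≤n) (up w) at u le (≤-trans e<N N≤n) e∌
    ; matching-free = λ {X} w u sc le → from-rank (map pr X) (edges-pr (up w))
        (≤-trans (≤-reflexive (sym (length-map pr X))) (matching-indep {z = z₀} sp room lt (matching (up w) u sc) (≤-trans (≤-reflexive (length-map pr X)) le))) }
    where
    up : ∀ {X} → Within N X → Within n X
    up w p = ≤-trans (w p) N≤n
    free : ∀ {X v} (v<n : v < n) (w : Within n X) (at : At v X) → Unique X → length X ≤ σ z₀ → length X ≤ r (star (fin v) (leaves v<n w at))
    free {X} {v} v<n w at u le = subst (_≤ r (star (fin v) (leaves v<n w at))) lX
        (star-indep (leaves v<n w at) (leaves-unique v<n w at u) (centre∉ v<n w at) (≤-trans (≤-reflexive lX) (≤-trans le (σ-≤ z₀ (fin v)))))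
      where lX : length (leaves v<n w at) ≡ length X
            lX = length-map (fin ∘ far v) X
    flat : ∀ {X v e} (v<n : v < n) (w : Within n X) (at : At v X) → Unique X → length X ≤ σ z₀ → hi e < n → ¬ v ∈E e → I (e ∷ X)
    flat {X} {v} {e} v<n w at u le e<n e∌ = from-rank (pr e ∷ star (fin v) T) sub
        (≤-trans (s≤s (free v<n w at u le)) (≰⇒> λ c → star-coloop (≤-trans (s≤s (σ-≤ (fin v) z₀)) lt)
          (λ p → e∌ (inj₁ (sym (fin-inj (lo<n {e} e<n) v<n p)))) (λ p → e∌ (inj₂ (sym (fin-inj e<n v<n p)))) (λ p → <⇒≢ (lo<hi e) (fin-inj (lo<n {e} e<n) e<n p))
          (cl-mono {star (fin v) T} {star (fin v) pool} (λ { {a , b} p → case star⁻ p of λ { (refl , _) → star⁺ (pool-all b) } }) c)))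
      where
      T = leaves v<n w at
      sub : edges (pr e ∷ star (fin v) T) ⊆ e ∷ X
      sub {f} p with edges⁻ (pr e ∷ star (fin v) T) p
      ... | _ , _ , here refl , j = here (joins-unique {f} {e} (fin-joins {f} (lo<n {e} e<n) e<n j) (inj₁ (refl , refl)))
      ... | a , b , there q , j   = there (star-edges v<n w at (edges⁺ {f} {a} {b} q j))
    matching : ∀ {X} → Within n X → Unique X → Scattered X → Matching (map pr X)
    matching {[]} w u sc = []
    matching {e ∷ X} w u sc = ((λ p → <⇒≢ (lo<hi e) (fin-inj (lo<n {e} e<n) e<n p)) , off (inj₁ refl) , off (inj₂ refl)) ∷ matching (w ∘ there) (unique-tail u) (λ p q → sc (there p) (there q))
      where
      e<n = w (here refl)
      off : ∀ {x} → x ∈E e → Off (map pr X) (fin x)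
      off {x} x∈ p with ∈-map⁻ pr p
      ... | f , f∈ , refl = (λ q → apart x∈ (inj₁ (sym (fin-inj (lo<n {f} f<n) x<n q)))) , (λ q → apart x∈ (inj₂ (sym (fin-inj f<n x<n q))))
        where apart : Disjoint e f
              apart = sc (here refl) (there f∈) (λ { refl → unique-head u f∈ })
              f<n = w (there f∈)
              x<n = ≤-trans (s≤s (∈E-≤ e x∈)) e<n

  -- A counterexample to `Unbounded` is an edge to `v` that is spanned by edges on the vertices
  -- below `b` other than `v`, which is what `clique-spanning` asks for.
  witness-spanning : ∀ {X e u v b} → Within b (e ∷ X) → b ≤ n → (∀ {Y} → I Y → Unique Y) → I X → joins e u v →
    (∀ {f} → f ∈ X → v ≢ lo f × v ≢ hi f) → ¬ I (e ∷ X) → Spanning b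
  witness-spanning {X} {e} {u} {v} {b} w b≤n uniq i j off ni {T} uT le =
      clique-spanning {map pr X} {U} {fin u} {fin v} uU inU (U⁺ u<b (joins-≢ {e} j)) (λ p → proj₂ (U⁻ p) (fin-toℕ (≤-trans v<b b≤n))) cl uT (≤-trans lU le)
    where
    wn : Within n (e ∷ X)
    wn p = ≤-trans (w p) b≤n
    u<b : u < b
    u<b = ≤-trans (s≤s (∈E-≤ e (end e j))) (w (here refl))
    v<b : v < b
    v<b = ≤-trans (s≤s (∈E-≤ e (end e (joins-sym {e} j)))) (w (here refl))
    in? : ∀ x → Dec (toℕ x < b × toℕ x ≢ v)
    in? x = (toℕ x <? b) ×-dec ¬? (toℕ x ≟ℕ v)
    abstract
      U : List (Fin n)
      U = filter in? pool
      uU : Unique U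
      uU = unique-filter in? pool-unique
      U⁻ : ∀ {x} → x ∈ U → toℕ x < b × toℕ x ≢ v
      U⁻ p = proj₂ (filter-∈ in? pool p)
      U⁺ : ∀ {x} → x < b → x ≢ v → fin x ∈ U
      U⁺ {x} x<b x≢v = ∈-filter⁺ in? (pool-all (fin x)) (subst (_< b) (sym eq) x<b , λ p → x≢v (trans (sym eq) p))
        where eq : toℕ (fin x) ≡ x
              eq = fin-toℕ (≤-trans x<b b≤n)
    lU : length U ≤ b
    lU = ≤-trans (≤-reflexive (sym (length-map toℕ U))) (≤-trans (unique-⊆-length {ys = upTo b} (unique-map (λ _ _ → toℕ-injective) uU)
        λ p → let (x , x∈ , eq) = ∈-map⁻ toℕ p in subst (_∈ upTo b) (sym eq) (∈-upTo⁺ (proj₁ (U⁻ x∈)))) (≤-reflexive (length-upTo b)))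
    inU : map pr X ⊆ K U
    inU p with ∈-map⁻ pr p
    ... | f , f∈ , refl = K⁺ (U⁺ (<-trans (lo<hi f) (w (there f∈))) (proj₁ (off f∈) ∘ sym)) (U⁺ (w (there f∈)) (proj₂ (off f∈) ∘ sym))
    cl : Cl (map pr X) (fin u , fin v)
    cl = ≮⇒≥ λ lt → ni (from-rank ((fin u , fin v) ∷ map pr X) sub (≤-trans (s≤s (to-rank (map pr X) (wn ∘ there) inX i)) lt))
      where
      inX : X ⊆ edges (map pr X)
      inX {f} f∈ = edges⁺ {f} {fin (lo f)} {fin (hi f)} (∈-map⁺ pr f∈) (joins-fin {f} (lo<n {f} (wn (there f∈))) (wn (there f∈)) (inj₁ (refl , refl)))
      sub : edges ((fin u , fin v) ∷ map pr X) ⊆ e ∷ X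
      sub {f} p with edges⁻ ((fin u , fin v) ∷ map pr X) p
      ... | _ , _ , here refl , jf = here (joins-unique {f} {e} (fin-joins {f} (≤-trans u<b b≤n) (≤-trans v<b b≤n) jf) j)
      ... | x , y , there q , jf   = there (edges-pr (wn ∘ there) (edges⁺ {f} {x} {y} q jf))

  -- A clique on `b` vertices already has rank `R` and consists of `b * b` ordered pairs.
  R≤ : ∀ {b} → Spanning b → b ≤ length pool → R ≤ b * b
  R≤ {b} sp le = ≤-trans (span-≤ {K T} λ {e} _ → sp (unique-take b pool-unique) (≤-reflexive (sym lT)) e)
      (≤-trans (r-mono {K T} {cartesianProduct T T} λ { {x , y} p → ∈-cartesianProduct⁺ (proj₁ (K⁻ p)) (proj₂ (K⁻ p)) })
        (≤-trans (r-≤-len (cartesianProduct T T)) (≤-reflexive (trans (length-× T T) (cong₂ _*_ lT lT)))))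
    where T = take b pool
          lT = length-take≤ b {pool} le

  indep≤R : ∀ {X} → Within n X → I X → length X ≤ R
  indep≤R w i = ≤-trans (to-rank (K pool) w (λ {e} p → edges⁺ {e} {fin (lo e)} {fin (hi e)} (K⁺ (pool-all _) (pool-all _)) (joins-fin {e} (lo<n {e} (w p)) (w p) (inj₁ (refl , refl)))) i) ≤-refl

  forest-star : ∀ {c Δ b F} → (∀ {A B x y} → Unique (A ++ B) → c ≤ length A → c ≤ length B → x ∈ A → y ∈ A → Cl (Bi A B) (x , y)) →
    Spanning b → R + R + (suc R + b + suc c) ≤ length pool → Unique F → Within n F → ¬ I F → length F ≤ R → (∀ v → # (v ∈E?_) F ≤ Δ) →
    (∀ {Y} → Unique Y → Y ⊆ F → 1 ≤ length Y → ∃ λ e → ∃ λ v → e ∈ Y × v ∈E e × (∀ {f} → f ∈ Y → f ≢ e → ¬ v ∈E f)) →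
    ∃ λ z → σ z < c * Δ × σ z < R
  forest-star {c} {Δ} {b} {F} bip sp room uF w ni le deg leafy = Forest.small-star c bip sp room (map pr F) (unique-map (λ p q → pr-inj (w p) (w q)) uF)
      (≰⇒> λ h → ni (from-rank (map pr F) (edges-pr w) (≤-trans (≤-reflexive (sym (length-map pr F))) h)))
      (≤-trans (≤-reflexive (length-map pr F)) le) Δ deg′ leafy′
    where
    end-of : ∀ {x f} → f ∈ F → Meets (x ∷ []) (pr f) → toℕ x ∈E f
    end-of {x} {f} f∈ (inj₁ (here p)) = inj₁ (trans (cong toℕ (sym p)) (fin-toℕ (lo<n {f} (w f∈))))
    end-of {x} {f} f∈ (inj₂ (here p)) = inj₂ (trans (cong toℕ (sym p)) (fin-toℕ (w f∈)))
    deg′ : ∀ z → # (meets? (z ∷ [])) (map pr F) ≤ Δ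
    deg′ z = ≤-trans (count F id) (deg (toℕ z))
      where
      count : ∀ Y → Y ⊆ F → # (meets? (z ∷ [])) (map pr Y) ≤ # (toℕ z ∈E?_) Y
      count []      s = z≤n
      count (f ∷ Y) s = +-mono-≤ (ind-mono (meets? (z ∷ []) (pr f)) (toℕ z ∈E? f) (end-of (s (here refl)))) (count Y (s ∘ there))
    leafy′ : ∀ {Y} → Unique Y → Y ⊆ map pr F → 1 ≤ length Y → ∃ λ u → ∃ λ v → u ≢ v × Σ P λ e → e ∈ Y × (e ≡ (u , v) ⊎ e ≡ (v , u)) ×
             (∀ {f} → f ∈ Y → f ≢ e → ¬ Meets (v ∷ []) f)
    leafy′ {Y} uY s ne = convert (leafy (unique-filter in? uF) (λ p → proj₁ (filter-∈ in? F p)) ne′)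
      where
      in? : ∀ e → Dec (pr e ∈ Y)
      in? e = DecList._∈?_ _≟P_ (pr e) Y
      Y₀ = filter in? F
      pull : ∀ {p} → p ∈ Y → ∃ λ e → e ∈ Y₀ × p ≡ pr e
      pull q = let (e , e∈ , eq) = ∈-map⁻ pr (s q) in e , ∈-filter⁺ in? e∈ (subst (_∈ Y) eq q) , eq
      ne′ : 1 ≤ length Y₀
      ne′ = let (p , p∈) = nonempty {xs = Y} ne ; (e , e∈ , _) = pull p∈ in unique-⊆-length {xs = e ∷ []} ([] ∷ []) λ { (here refl) → e∈ }
      convert : (∃ λ e → ∃ λ v → e ∈ Y₀ × v ∈E e × (∀ {f} → f ∈ Y₀ → f ≢ e → ¬ v ∈E f)) →
        ∃ λ u → ∃ λ v → u ≢ v × Σ P λ e → e ∈ Y × (e ≡ (u , v) ⊎ e ≡ (v , u)) × (∀ {f} → f ∈ Y → f ≢ e → ¬ Meets (v ∷ []) f)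
      convert (e , v , e∈ , v∈ , only) = fin (far v e) , fin v , (λ p → joins-≢ {e} jn (sym (fin-inj f<n v<n p))) , pr e , proj₂ (filter-∈ in? F e∈) , dir jn , only′
        where
        e<n = w (proj₁ (filter-∈ in? F e∈))
        jn : joins e v (far v e)
        jn = far-joins e v∈
        v<n : v < n
        v<n = ≤-trans (s≤s (∈E-≤ e v∈)) e<n
        f<n : far v e < n
        f<n = ≤-trans (s≤s (∈E-≤ e (far∈ e v∈))) e<n
        dir : ∀ {x y} → joins e x y → pr e ≡ (fin y , fin x) ⊎ pr e ≡ (fin x , fin y)
        dir (inj₁ (refl , refl)) = inj₂ refl
        dir (inj₂ (refl , refl)) = inj₁ refl
        only′ : ∀ {f} → f ∈ Y → f ≢ pr e → ¬ Meets (fin v ∷ []) f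
        only′ f∈ f≢ mt = let (f₀ , f₀∈ , eq) = pull f∈ in only f₀∈ (λ p → f≢ (trans eq (cong pr p)))
          (subst (_∈E f₀) (fin-toℕ v<n) (end-of (proj₁ (filter-∈ in? F f₀∈)) (subst (Meets (fin v ∷ [])) eq mt)))

two-of : ∀ {A : Set} (xs : List A) → Unique xs → 2 ≤ length xs → ∃ λ a → ∃ λ b → a ∈ xs × b ∈ xs × a ≢ b
two-of (a ∷ [])    u (s≤s ())
two-of (a ∷ b ∷ _) u _ = a , b , here refl , there (here refl) , λ e → unique-head u (here e)

-- Small stars from the Whitney property.

module Uniform (F : GraphMatroidFamily) {c} (3≤c : 3 ≤ c) (wh : ∀ G → IsConnected c G → Reconstructible (Ind F) G)
  {L : List Edge} (u : Unique L) (conn : IsConnected c (graphOf L u)) (R : ℕ)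
  (free : ∀ {Y} → Unique Y → Y ⊆ L → length Y ≤ R → IF F Y) (rank : ∀ {Y} → Y ⊆ L → IF F Y → length Y ≤ R) where
  private
    G : Graph
    G = graphOf L u
    k = length L
    module T = Transposition (_≟F_ {k})
    open DecList (_≟F_ {k}) using (_⊖_; ∈-⊖⁻; length-⊖)

    at : ℕ → List (Fin k)
    at v = filter (incident? G v) (allFin k)

    at⁻ : ∀ {v i} → i ∈ at v → v ∈E lookup L i
    at⁻ {v} p = proj₂ (filter-∈ (incident? G v) (allFin k) p)

    at-unique : ∀ v → Unique (at v)
    at-unique v = unique-filter (incident? G v) (Uniqueₚ.allFin⁺ k)

    at-large : ∀ {v} → IsVertex G v → 3 ≤ length (at v)
    at-large {v} p = ≤-trans 3≤c (≤-trans (degree-≥ G conn p) (≤-reflexive (sym (length-filter≡# (incident? G v) (allFin k)))))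

    vertexAt : ∀ {v} i → v ∈E lookup L i → IsVertex G v
    vertexAt {v} i p = adj-vertex G {v} {far v (lookup L i)} (i , far-joins (lookup L i) p)

    same-edge : ∀ {i j x y} → joins (lookup L i) x y → joins (lookup L j) x y → i ≡ j
    same-edge {i} {j} p q = unique-lookup u (joins-unique {lookup L i} {lookup L j} p q)

    start : ∃ (IsVertex G)
    start = head (proj₁ conn)
      where head : (∃ λ (L : List ℕ) → Unique L × length L ≡ suc c × All (IsVertex G) L) → ∃ (IsVertex G)
            head ([] , _ , () , _)
            head (x ∷ _ , _ , _ , p ∷ _) = x , p

  -- If M(Γ) were uniform, exchanging two edges at a vertex x would be an automorphism; but it moves the edge xy while fixing y.
  not-uniform : ⊥
  not-uniform = swap (two-of (at x) (at-unique x) (≤-trans (s≤s (s≤s z≤n)) (at-large (proj₂ start))))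
    where
    x = proj₁ start
    swap : (∃ λ i → ∃ λ j → i ∈ at x × j ∈ at x × i ≢ j) → ⊥
    swap (i₀ , i₁ , i₀∈ , i₁∈ , i₀≢i₁) = others (two-of (at y ⊖ i₀) (unique-filter (λ i → ¬? (i ≟F i₀)) (at-unique y))
        (≤-pred (≤-trans (at-large py) (≤-reflexive (length-⊖ (at-unique y) (∈-filter⁺ (incident? G y) (∈-allFin i₀) y∈))))))
      where
      e = lookup L
      y = far x (e i₀)
      xy : joins (e i₀) x y
      xy = far-joins (e i₀) (at⁻ i₀∈)
      y∈ : y ∈E e i₀
      y∈ = end (e i₀) (joins-sym {e i₀} xy)
      py : IsVertex G y
      py = vertexAt i₀ y∈
      y∉i₁ : ¬ y ∈E e i₁
      y∉i₁ p = i₀≢i₁ (same-edge xy (two-ends (e i₁) (at⁻ i₁∈) p (joins-≢ {e i₀} xy)))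
      f : Fin k → Edge
      f i = e (T.sw i₀ i₁ i)
      f-inj : ∀ {i j} → f i ≡ f j → i ≡ j
      f-inj p = T.sw-inj i₀ i₁ (unique-lookup u p)
      -- By uniformity only the number of edges decides about independence.
      keep : ∀ {g h : Fin k → Edge} → (∀ {i j} → h i ≡ h j → i ≡ j) → (∀ i → g i ∈ L) → (∀ i → h i ∈ L) → ∀ {M} → Unique M → IF F (map g M) → IF F (map h M)
      keep {g} {h} hi g∈ h∈ {M} uM i = free (unique-map (λ _ _ → hi) uM) (inside h h∈)
          (≤-trans (≤-reflexive (trans (length-map h M) (sym (length-map g M)))) (rank (inside g g∈) i))
        where inside : ∀ (g : Fin k → Edge) → (∀ i → g i ∈ L) → map g M ⊆ L
              inside g g∈ p = let (j , _ , eq) = ∈-map⁻ g p in subst (_∈ L) (sym eq) (g∈ j)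
      moved : Σ (V G → ℕ) λ φ → ∀ i (s t : V G) → joins (e i) (proj₁ s) (proj₁ t) → joins (f i) (φ s) (φ t)
      moved = Positions.reconstruction e f (unique-lookup u) f-inj F wh conn
        (keep {e} {f} f-inj (λ i → ∈-lookup i) (λ i → ∈-lookup (T.sw i₀ i₁ i))) (keep {f} {e} (unique-lookup u) (λ i → ∈-lookup (T.sw i₀ i₁ i)) (λ i → ∈-lookup i))
      φ = proj₁ moved
      vy : V G
      vy = y , py
      other : ∀ {j} → j ∈ at y ⊖ i₀ → Σ (V G) λ t → joins (e j) y (proj₁ t) × joins (e j) (φ vy) (φ t)
      other {j} p = t , yt , subst (λ i → joins (e i) (φ vy) (φ t)) (T.sw-other (proj₂ (∈-⊖⁻ (at y) p)) (λ { refl → y∉i₁ yj })) (proj₂ moved j vy t yt)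
        where
        yj : y ∈E e j
        yj = at⁻ (proj₁ (∈-⊖⁻ (at y) p))
        yt : joins (e j) y (far y (e j))
        yt = far-joins (e j) yj
        t : V G
        t = far y (e j) , vertexAt j (end (e j) (joins-sym {e j} yt))
      others : (∃ λ i → ∃ λ j → i ∈ at y ⊖ i₀ × j ∈ at y ⊖ i₀ × i ≢ j) → ⊥
      others (j₁ , j₂ , p₁ , p₂ , j₁≢j₂) = y∉i₁ (subst (_∈E e i₁) fixed (end (e i₁) hit))
        where
        fixed : φ vy ≡ y
        fixed = let (_ , a , b) = other p₁ ; (_ , a′ , b′) = other p₂ in
          fixed-vertex (e j₁) (e j₂) a a′ b b′ (λ q → j₁≢j₂ (same-edge a (subst (joins (e j₂) y) (sym q) a′)))
        hit : joins (e i₁) (φ vy) (φ (x , proj₂ start))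
        hit = subst (λ i → joins (e i) (φ vy) (φ (x , proj₂ start))) (T.sw-l i₀ i₁) (proj₂ moved i₀ vy (x , proj₂ start) (joins-sym {e i₀} xy))

module BoundedFamily (F : GraphMatroidFamily) {c} (3≤c : 3 ≤ c) (wh : ∀ G → IsConnected c G → Reconstructible (Ind F) G) where
  open ListMatroid (listMatroid F) using (I-unique)

  private
    Δ = c + c + (c + c)

    hi≤ : ∀ {X} → Within (suc (∑ X hi)) X
    hi≤ p = s≤s (∑-∈ hi p)

    module Fixed (N : ℕ) {X e u v} (i : IF F X) (j : joins e u v) (off : ∀ {f} → f ∈ X → v ≢ lo f × v ≢ hi f) (ni : ¬ IF F (e ∷ X))
      (Γ : Sparse c Δ (suc (∑ (e ∷ X) hi) * suc (∑ (e ∷ X) hi))) where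
      open Sparse Γ

      -- All vertices of the witness against `Unbounded` are below `b`, so the rank `R` is at most
      -- `g = b * b`. Sets of up to `g` edges of `Γ` are forests, which therefore covers all sets of
      -- up to `R` edges. `n′` leaves room for the vertices below `N`, for `Γ` and for the fresh
      -- vertices of the forest argument.
      b g n′ : ℕ
      b = suc (∑ (e ∷ X) hi)
      g = b * b
      n′ = N + ∑ lines hi + b + (g + g + (suc g + b + suc c))

      module _ (dec : ∀ X → Dec (Ambient.Iₙ (edgeMatroid F) (suc n′) X)) where
        open Ambient (edgeMatroid F) (suc n′)
        open WithDec dec

        in-range : ∀ {e} → hi e < suc n′ → InRange e
        in-range {e} h = fromℕ< (<-trans (lo<hi e) h) , fromℕ< h , inj₁ (sym (toℕ-fromℕ< (<-trans (lo<hi e) h)) , sym (toℕ-fromℕ< h))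

        from-rank : ∀ {X} P → edges P ⊆ X → length X ≤ rank (edges P) → IF F X
        from-rank {X} P s le = proj₁ (rank-full X (≤-trans le (rank-mono s)))

        to-rank : ∀ {X} P → Within (suc n′) X → X ⊆ edges P → IF F X → length X ≤ rank (edges P)
        to-rank P w s i = rank-max (i , λ {x} p → in-range {x} (w p)) s

        open StarFacts symRank (IF F) from-rank to-rank using (starBounded; witness-spanning; R≤; indep≤R; forest-star)
        open BoundedTheory symRank using (Spanning; R; σ)

        pool-size : length (SymRank.pool symRank) ≡ suc n′
        pool-size = length-tabulate id

        b≤n : b ≤ suc n′
        b≤n = ≤-trans (≤-trans (m≤n+m b (N + ∑ lines hi)) (m≤m+n _ _)) (n≤1+n n′)

        N≤n : N ≤ suc n′
        N≤n = ≤-trans (≤-trans (m≤m+n N _) (≤-trans (m≤m+n _ b) (m≤m+n _ _))) (n≤1+n n′)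

        lines-within : Within (suc n′) lines
        lines-within p = s≤s (≤-trans (∑-∈ hi p) (≤-trans (m≤n+m _ N) (≤-trans (m≤m+n _ b) (m≤m+n _ _))))

        abstract
          spanning : Spanning b
          spanning = witness-spanning {X} {e} hi≤ b≤n I-unique i j off ni

          R≤g : R ≤ g
          R≤g = R≤ spanning (≤-trans b≤n (≤-reflexive (sym pool-size)))

          room : R + R + (suc R + b + suc c) ≤ length (SymRank.pool symRank)
          room = ≤-trans (≤-trans (+-mono-≤ (+-mono-≤ R≤g R≤g) (+-monoˡ-≤ (suc c) (+-monoˡ-≤ b (s≤s R≤g)))) (≤-trans (m≤n+m _ (N + ∑ lines hi + b)) (n≤1+n n′)))
            (≤-reflexive (sym pool-size))

          room′ : R + R + b ≤ length (SymRank.pool symRank)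
          room′ = ≤-trans (+-monoʳ-≤ (R + R) (≤-trans (m≤n+m b (suc R)) (m≤m+n _ (suc c)))) room

        Result : Set
        Result = ∃ λ ρ → ρ ≤ c * Δ × StarBounded (IF F) N ρ

        Bad : Set
        Bad = ∃ λ Y → Unique Y × Y ⊆ lines × length Y ≤ R × ¬ IF F Y

        from-bad : Bad → Result
        from-bad (Y , uY , Y⊆ , le , bad) = finish (forest-star (λ {A} {B} {x} {y} uAB cA cB → WhitneyBip.whitney-bip F c 3≤c wh (suc n′) dec {A} {B} uAB cA cB {x} {y}) spanning room uY (λ p → lines-within (Y⊆ p)) bad le
            (λ v → ≤-trans (#-⊆ (v ∈E?_) (v ∈E?_) uY (λ p t → Y⊆ p , t)) (bounded v)) (λ u s ne → leafy u (Y⊆ ∘ s) ne (≤-trans (unique-⊆-length u s) (≤-trans le R≤g))))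
          where
          finish : (∃ λ z → σ z < c * Δ × σ z < R) → Result
          finish (z , lt , lt′) = σ z , <⇒≤ lt , starBounded {N} {b} {z} N≤n spanning room′ lt′

        -- If every set of at most `R` edges of `Γ` is independent, its matroid is uniform.
        no-bad : ¬ Bad → ⊥
        no-bad none = Uniform.not-uniform F 3≤c wh unique connected R
          (λ {Y} uY s le → proj₁ (decidable-stable (dec Y) λ n → none (Y , uY , s , le , λ i → n (i , λ {x} p → in-range {x} (lines-within (s p))))))
          (λ s i → indep≤R (λ p → lines-within (s p)) i)

        result : ¬ ¬ Result
        result k = lem Bad λ { (yes bad) → k (from-bad bad) ; (no none) → no-bad none }

  -- `N` will depend on the two graphs that are compared, and so may `ρ`; but its bound does not
  -- involve `N` and can enter the connectivity constant.
  bounded-family : ¬ Unbounded F → ∀ N → ¬ ¬ (∃ λ ρ → ρ ≤ c * Δ × StarBounded (IF F) N ρ)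
  bounded-family nb N k = nb λ {X} {e} {u} {v} i j off ni →
    sparse c (suc (∑ (e ∷ X) hi) * suc (∑ (e ∷ X) hi)) (≤-trans (s≤s z≤n) 3≤c) λ Γ →
    Ambient.decidable (edgeMatroid F) (suc (Fixed.n′ N {X} {e} {u} {v} i j off ni Γ)) λ dec →
    Fixed.result N {X} {e} {u} {v} i j off ni Γ dec k

-- Unions of matroids with small stars

∑F : ∀ {k} → (Fin k → ℕ) → ℕ
∑F {zero}  f = 0
∑F {suc k} f = f fzero + ∑F (f ∘ fsuc)

∑F-mono : ∀ {k} {f g : Fin k → ℕ} → (∀ j → f j ≤ g j) → ∑F f ≤ ∑F g
∑F-mono {zero}  h = z≤n
∑F-mono {suc k} h = +-mono-≤ (h fzero) (∑F-mono (h ∘ fsuc))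

∑F-const : ∀ k n → ∑F {k} (λ _ → n) ≡ k * n
∑F-const zero    n = refl
∑F-const (suc k) n = cong (n +_) (∑F-const k n)

∑F-∈ : ∀ {k} (f : Fin k → ℕ) j → f j ≤ ∑F f
∑F-∈ f fzero    = m≤m+n _ _
∑F-∈ f (fsuc j) = ≤-trans (∑F-∈ (f ∘ fsuc) j) (m≤n+m _ _)

cover-length : ∀ {A : Set} {k} {X : List A} (B : Fin k → List A) → Unique X → (∀ {x} → x ∈ X → ∃ λ j → x ∈ B j) → length X ≤ ∑F (length ∘ B)
cover-length B u h = ≤-trans (unique-⊆-length u λ p → let (j , q) = h p in inside B j q) (≤-reflexive (len B))
  where
  joined : ∀ {A : Set} {k} → (Fin k → List A) → List A
  joined {k = zero}  B = []
  joined {k = suc k} B = B fzero ++ joined (B ∘ fsuc)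
  inside : ∀ {A : Set} {k} (B : Fin k → List A) j {x} → x ∈ B j → x ∈ joined B
  inside B fzero    p = ∈-++⁺ˡ p
  inside B (fsuc j) p = ∈-++⁺ʳ (B fzero) (inside (B ∘ fsuc) j p)
  len : ∀ {A : Set} {k} (B : Fin k → List A) → length (joined B) ≡ ∑F (length ∘ B)
  len {k = zero}  B = refl
  len {k = suc k} B = trans (length-++ (B fzero)) (cong (length (B fzero) +_) (len (B ∘ fsuc)))

distribute : ∀ {A : Set} {k} (ρ : Fin k → ℕ) {X : List A} → Unique X → length X ≤ ∑F ρ → Σ (Fin k → List A) λ B →
  (∀ j → Unique (B j) × B j ⊆ X × length (B j) ≤ ρ j) × (∀ {x} → x ∈ X → ∃ λ j → x ∈ B j)
distribute {k = zero}  ρ {[]} u le = (λ ()) , (λ ()) , λ ()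
distribute {A} {k = suc k} ρ {X} u le = B , parts , covers
  where
  r₀ = ρ fzero
  split = unique-++⁻ (take r₀ X) (subst Unique (sym (take++drop≡id r₀ X)) u)
  rest : Σ (Fin k → List A) λ B → (∀ j → Unique (B j) × B j ⊆ drop r₀ X × length (B j) ≤ ρ (fsuc j)) × (∀ {x} → x ∈ drop r₀ X → ∃ λ j → x ∈ B j)
  rest = distribute (ρ ∘ fsuc) {drop r₀ X} (proj₁ (proj₂ split)) (≤-trans (≤-reflexive (length-drop r₀ X)) (≤-trans (∸-monoˡ-≤ r₀ le) (≤-reflexive (m+n∸m≡n r₀ _))))
  B : Fin (suc k) → List A
  B fzero    = take r₀ X
  B (fsuc j) = proj₁ rest j
  parts : ∀ j → Unique (B j) × B j ⊆ X × length (B j) ≤ ρ j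
  parts fzero    = unique-take r₀ u , take-⊆ r₀ X , ≤-trans (≤-reflexive (length-take r₀ X)) (m⊓n≤m r₀ _)
  parts (fsuc j) = let (a , b , c) = proj₁ (proj₂ rest) j in a , (λ p → subst (_ ∈_) (take++drop≡id r₀ X) (∈-++⁺ʳ (take r₀ X) (b p))) , c
  covers : ∀ {x} → x ∈ X → ∃ λ j → x ∈ B j
  covers p with ∈-++⁻ (take r₀ X) (subst (_ ∈_) (sym (take++drop≡id r₀ X)) p)
  ... | inj₁ q = fzero , q
  ... | inj₂ q = let (j , t) = proj₂ (proj₂ rest) q in fsuc j , t

module _ {k : ℕ} (𝓜 : Fin (suc k) → GraphMatroidFamily) {N : ℕ} (ρ : Fin (suc k) → ℕ) (sb : ∀ j → StarBounded (IF (𝓜 j)) N (ρ j)) where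
  open UnionFamily 𝓜
  private module SB (j : Fin (suc k)) = StarBounded (sb j)

  -- A star splits into pieces of at most `ρ j` edges. For a closed star or a matching, the one
  -- additional edge goes to the first matroid, whose own property allows it.
  star-bounded-∪ : StarBounded I∪ N (∑F ρ)
  star-bounded-∪ = record { star-rank = rank ; star-free = free ; star-flat = flat ; matching-free = matching }
    where
    rank : ∀ {X v} → v < N → Within N X → At v X → I∪ X → length X ≤ ∑F ρ
    rank {X} v<N w at i = ≤-trans (cover-length (class f X) (proj₁ i) (λ {e} p → f e , ∈-filter⁺ (λ x → f x ≟F f e) p refl))
        (∑F-mono λ j → SB.star-rank j v<N (λ p → w (sub j p)) (λ p → at (sub j p)) (proj₂ (colour i) j))
      where
      f = proj₁ (colour i)
      sub : ∀ j → class f X j ⊆ X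
      sub j p = proj₁ (filter-∈ (λ x → f x ≟F j) X p)
    free : ∀ {X v} → v < N → Within N X → At v X → Unique X → length X ≤ ∑F ρ → I∪ X
    free {X} v<N w at u le = let (B , parts , covers) = distribute ρ u le in
      u , B , (λ j → let (uB , s , l) = parts j in SB.star-free j v<N (w ∘ s) (at ∘ s) uB l) , covers
    flat : ∀ {X v e} → v < N → Within N X → At v X → Unique X → length X ≤ ∑F ρ → hi e < N → ¬ v ∈E e → I∪ (e ∷ X)
    flat {X} {v} {e} v<N w at u le e<N n = unique-∷ (n ∘ at) u , B′ , indep , covers′
      where
      dist = distribute ρ u le
      B = proj₁ dist
      parts = proj₁ (proj₂ dist)
      B′ : Fin (suc k) → List Edge
      B′ fzero    = e ∷ B fzero
      B′ (fsuc j) = B (fsuc j)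
      indep : ∀ j → IF (𝓜 j) (B′ j)
      indep fzero    = let (uB , s , l) = parts fzero in SB.star-flat fzero v<N (w ∘ s) (at ∘ s) uB l e<N n
      indep (fsuc j) = let (uB , s , l) = parts (fsuc j) in SB.star-free (fsuc j) v<N (w ∘ s) (at ∘ s) uB l
      widen : ∀ {x} j → x ∈ B j → x ∈ B′ j
      widen fzero    p = there p
      widen (fsuc j) p = p
      covers′ : ∀ {x} → x ∈ e ∷ X → ∃ λ j → x ∈ B′ j
      covers′ (here refl) = fzero , here refl
      covers′ (there p)   = let (j , q) = proj₂ (proj₂ dist) p in j , widen j q
    matching : ∀ {X} → Within N X → Unique X → Scattered X → length X ≤ suc (∑F ρ) → I∪ X
    matching {X} w u sc le = u , proj₁ dist , indep , proj₂ (proj₂ dist)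
      where
      ρ′ : Fin (suc k) → ℕ
      ρ′ fzero    = suc (ρ fzero)
      ρ′ (fsuc j) = ρ (fsuc j)
      ρ′≤ : ∀ j → ρ′ j ≤ suc (ρ j)
      ρ′≤ fzero    = ≤-refl
      ρ′≤ (fsuc j) = n≤1+n _
      dist = distribute ρ′ u le
      indep : ∀ j → IF (𝓜 j) (proj₁ dist j)
      indep j = let (uB , s , l) = proj₁ (proj₂ dist) j in SB.matching-free j (w ∘ s) uB (λ p q → sc (s p) (s q)) (≤-trans l (ρ′≤ j))

abstract
  threshold : ℕ → ℕ
  threshold ρ = suc (ρ + ρ) * suc ρ

  threshold-≥ : ∀ ρ → suc (ρ + ρ) * suc ρ ≤ threshold ρ
  threshold-≥ ρ = ≤-refl

  threshold-mono : ∀ {a b} → a ≤ b → threshold a ≤ threshold b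
  threshold-mono h = *-mono-≤ (s≤s (+-mono-≤ h h)) (s≤s h)

-- A large set of edges without independent subsets of size ρ + 1 contains no matching of that size, hence has ρ + 1 edges at some
-- vertex, and then all its edges are there.

module StarRecognition (G H : Graph) (ψ : Fin (m G) ⤖ Fin (m H)) (I : List Edge → Set) {N ρ : ℕ} (sb : StarBounded I N ρ)
  (bG : bound G ≤ N) (bH : bound H ≤ N) (iso : ∀ {L} → Unique L → I (map (edge G) L) ⇔ I (map (edge H ∘ Bijection.to ψ) L))
  (deg : ∀ {v} → IsVertex G v → threshold ρ ≤ # (incident? G v) (allFin (m G))) where
  open StarMap G H ψ
  open StarBounded sb

  eG eH : Fin (m G) → Edge
  eG = edge G
  eH = edge H ∘ ψ₀

  eH-inj : ∀ {i j} → eH i ≡ eH j → i ≡ j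
  eH-inj p = Bijection.injective ψ (edge-inj H p)

  within-G : ∀ L → Within N (map eG L)
  within-G L p = let (i , _ , eq) = ∈-map⁻ eG p in subst (λ e → hi e < N) (sym eq) (≤-trans (hi<bound G i) bG)

  within-H : ∀ L → Within N (map eH L)
  within-H L p = let (i , _ , eq) = ∈-map⁻ eH p in subst (λ e → hi e < N) (sym eq) (≤-trans (hi<bound H (ψ₀ i)) bH)

  at-map : ∀ {v L} {e : Fin (m G) → Edge} → (∀ {i} → i ∈ L → v ∈E e i) → At v (map e L)
  at-map {v} {L} {e} h p = let (i , i∈ , eq) = ∈-map⁻ e p in subst (v ∈E_) (sym eq) (h i∈)

  too-big : ∀ {L} → length L ≡ suc ρ → ∀ {e : Fin (m G) → Edge} → ¬ (length (map e L) ≤ ρ)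
  too-big {L} l {e} le = 1+n≰n (≤-trans (≤-reflexive (sym (trans (length-map e L) l))) le)

  module _ {v : ℕ} (pv : IsVertex G v) where
    L : List (Fin (m G))
    L = filter (incident? G v) (allFin (m G))

    L⁻ : ∀ {i} → i ∈ L → v ∈E eG i
    L⁻ p = proj₂ (filter-∈ (incident? G v) (allFin (m G)) p)

    uL : Unique L
    uL = unique-filter (incident? G v) (Uniqueₚ.allFin⁺ (m G))

    large : suc (ρ + ρ) * suc ρ ≤ length L
    large = ≤-trans (≤-trans (threshold-≥ ρ) (deg pv)) (≤-reflexive (sym (length-filter≡# (incident? G v) (allFin (m G)))))

    v<N : v < N
    v<N = let (i , p) = toWitness pv in ≤-trans (s≤s (∈E-≤ (eG i) p)) (≤-trans (hi<bound G i) bG)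

    dependent : ∀ {M} → Unique M → M ⊆ L → length M ≡ suc ρ → ¬ I (map eH M)
    dependent {M} u s l i = too-big {M} l (star-rank v<N (within-G M) (at-map {L = M} (L⁻ ∘ s)) (from (iso u) i))

    at? : ∀ w i → Dec (w ∈E eH i)
    at? w i = w ∈E? eH i

    -- Greedy: a chosen edge excludes at most `ρ` edges at each of its two ends.
    matching : ∀ k {M} → Unique M → (∀ w → # (at? w) M ≤ ρ) → suc (ρ + ρ) * k ≤ length M →
      ∃ λ M′ → Unique M′ × M′ ⊆ M × length M′ ≡ k × (∀ {i j} → i ∈ M′ → j ∈ M′ → i ≢ j → Disjoint (eH i) (eH j))
    matching zero _ _ _ = [] , [] , (λ ()) , refl , λ ()
    matching (suc k) {M} u thin le = i ∷ M′ , unique-∷ (λ p → proj₁ (clear p) (inj₁ refl)) (proj₁ (proj₂ rest)) ,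
        (λ { (here refl) → i∈ ; (there p) → M₀⊆ (proj₁ (proj₂ (proj₂ rest)) p) }) , cong suc (proj₁ (proj₂ (proj₂ (proj₂ rest)))) , scattered
      where
      some = nonempty {xs = M} (≤-trans (s≤s z≤n) (≤-trans (≤-reflexive (sym (*-suc (suc (ρ + ρ)) k))) le))
      i = proj₁ some
      i∈ = proj₂ some
      a = lo (eH i)
      b = hi (eH i)
      touch? : ∀ j → Dec (a ∈E eH j ⊎ b ∈E eH j)
      touch? j = at? a j ⊎-dec at? b j
      off? : ∀ j → Dec (¬ (a ∈E eH j ⊎ b ∈E eH j))
      off? j = ¬? (touch? j)
      M₀ = filter off? M
      M₀⊆ : M₀ ⊆ M
      M₀⊆ p = proj₁ (filter-∈ off? M p)
      touching : # touch? M ≤ ρ + ρ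
      touching = ≤-trans (#-⊎ (at? a) (at? b) M) (+-mono-≤ (thin a) (thin b))
      enough : suc (ρ + ρ) * k ≤ length M₀
      enough = subst (suc (ρ + ρ) * k ≤_) (sym (length-filter≡# off? M)) (+-cancelˡ-≤ (suc (ρ + ρ)) _ _
        (≤-trans (≤-reflexive (sym (*-suc (suc (ρ + ρ)) k))) (≤-trans le (≤-trans (≤-reflexive (sym (#-¬ touch? M))) (+-monoˡ-≤ (# off? M) (≤-trans touching (n≤1+n _)))))))
      thin′ : ∀ w → # (at? w) M₀ ≤ ρ
      thin′ w = ≤-trans (#-⊆ (at? w) (at? w) (unique-filter off? u) (λ p t → M₀⊆ p , t)) (thin w)
      rest = matching k {M₀} (unique-filter off? u) thin′ enough
      M′ = proj₁ rest
      clear : ∀ {j} → j ∈ M′ → ¬ a ∈E eH j × ¬ b ∈E eH j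
      clear p = let n = proj₂ (filter-∈ off? M (proj₁ (proj₂ (proj₂ rest)) p)) in n ∘ inj₁ , n ∘ inj₂
      scattered : ∀ {j l} → j ∈ i ∷ M′ → l ∈ i ∷ M′ → j ≢ l → Disjoint (eH j) (eH l)
      scattered (here refl) (here refl) n = ⊥-elim (n refl)
      scattered (here refl) (there q) n = [ (λ { refl → proj₁ (clear q) }) , (λ { refl → proj₂ (clear q) }) ]′
      scattered (there p) (here refl) n x∈ = [ (λ { refl → proj₁ (clear p) x∈ }) , (λ { refl → proj₂ (clear p) x∈ }) ]′
      scattered (there p) (there q) n = proj₂ (proj₂ (proj₂ (proj₂ rest))) p q n

    not-thin : ¬ (∀ w → # (at? w) L ≤ ρ)
    not-thin thin = contra (matching (suc ρ) uL thin large)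
      where
      contra : (∃ λ M → Unique M × M ⊆ L × length M ≡ suc ρ × (∀ {i j} → i ∈ M → j ∈ M → i ≢ j → Disjoint (eH i) (eH j))) → ⊥
      contra (M , uM , s , l , sc) = dependent uM s l (matching-free (within-H M) (unique-map (λ _ _ → eH-inj) uM) scattered (≤-reflexive (trans (length-map eH M) l)))
        where
        scattered : Scattered (map eH M)
        scattered p q n x∈ y∈ = let (i , i∈ , eq) = ∈-map⁻ eH p ; (j , j∈ , eq′) = ∈-map⁻ eH q in
          sc i∈ j∈ (λ t → n (trans eq (trans (cong eH t) (sym eq′)))) (subst (_ ∈E_) eq x∈) (subst (_ ∈E_) eq′ y∈)

    centre : ∃ λ w → ρ < # (at? w) L
    centre = search (anyL? (λ i → (ρ <? # (at? (lo (eH i))) L) ⊎-dec (ρ <? # (at? (hi (eH i))) L)) L)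
      where
      search : Dec (Any (λ i → ρ < # (at? (lo (eH i))) L ⊎ ρ < # (at? (hi (eH i))) L) L) → ∃ λ w → ρ < # (at? w) L
      search (yes a) = [ (λ p → _ , p) , (λ p → _ , p) ]′ (proj₂ (proj₂ (find a)))
      search (no none) = ⊥-elim (not-thin λ w → ≮⇒≥ λ lt → let (i , i∈ , p) = #-pos (at? w) L (≤-trans (s≤s z≤n) lt) in none (lose i∈ (ends p lt)))
        where
            ends : ∀ {w i} → w ∈E eH i → ρ < # (at? w) L → ρ < # (at? (lo (eH i))) L ⊎ ρ < # (at? (hi (eH i))) L
            ends (inj₁ refl) lt = inj₁ lt
            ends (inj₂ refl) lt = inj₂ lt

    module _ {w} (w-large : ρ < # (at? w) L) where
      Lw : List (Fin (m G))
      Lw = filter (at? w) L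

      Lw⁻ : ∀ {i} → i ∈ Lw → i ∈ L × w ∈E eH i
      Lw⁻ = filter-∈ (at? w) L

      ρ≤Lw : ρ < length Lw
      ρ≤Lw = ≤-trans w-large (≤-reflexive (sym (length-filter≡# (at? w) L)))

      w<N : w < N
      w<N = let (i , i∈) = nonempty {xs = Lw} (≤-trans (s≤s z≤n) ρ≤Lw) in ≤-trans (s≤s (∈E-≤ (eH i) (proj₂ (Lw⁻ i∈)))) (within-H (i ∷ []) (here refl))

      -- In `H`, an edge off `w` is independent together with `ρ` edges at `w`. In `G` all these
      -- edges lie at `v`, where only `ρ` can be independent.
      forth : ∀ {i} → i ∈ L → w ∈E eH i
      forth {i} i∈ = decidable-stable (at? w i) λ n → dependent {i ∷ X} (unique-∷ (λ p → n (proj₂ (Lw⁻ (X⊆ p)))) uX)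
          (λ { (here refl) → i∈ ; (there p) → proj₁ (Lw⁻ (X⊆ p)) }) (cong suc lX)
          (star-flat w<N (within-H X) (at-map {L = X} (λ p → proj₂ (Lw⁻ (X⊆ p)))) (unique-map (λ _ _ → eH-inj) uX) (≤-reflexive (trans (length-map eH X) lX)) (within-H (i ∷ []) (here refl)) n)
        where
        X = take ρ Lw
        X⊆ = take-⊆ ρ Lw
        uX : Unique X
        uX = unique-take ρ (unique-filter (at? w) uL)
        lX : length X ≡ ρ
        lX = length-take≤ ρ {Lw} (<⇒≤ ρ≤Lw)

      -- The same with the graphs exchanged: the edges of `L` are at `w` by `forth`, so an edge at
      -- `w` but off `v` would make `ρ + 1` independent edges at `w`.
      back : ∀ {i} → w ∈E eH i → v ∈E eG i
      back {i} p = decidable-stable (v ∈E? eG i) λ n → too-big {i ∷ X} (cong suc lX) (star-rank w<N (within-H (i ∷ X)) (at-map {L = i ∷ X} λ { (here refl) → p ; (there q) → forth (X⊆ q) })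
          (to (iso {i ∷ X} (unique-∷ (λ q → n (L⁻ (X⊆ q))) uX))
            (star-flat v<N (within-G X) (at-map {L = X} (λ q → L⁻ (X⊆ q))) (unique-map (λ _ _ → edge-inj G) uX) (≤-reflexive (trans (length-map eG X) lX)) (within-G (i ∷ []) (here refl)) n)))
        where
        X = take ρ L
        X⊆ = take-⊆ ρ L
        uX : Unique X
        uX = unique-take ρ uL
        lX : length X ≡ ρ
        lX = length-take≤ ρ {L} (≤-trans (<⇒≤ ρ≤Lw) (unique-⊆-length (unique-filter (at? w) uL) (λ q → proj₁ (Lw⁻ q))))

      star-at : Star v w
      star-at i = (λ p → forth (∈-filter⁺ (incident? G v) (∈-allFin i) p)) , back

  recognized : StarsToStars
  recognized = from-vertices λ v pv → proj₁ (centre pv) , star-at pv (proj₂ (centre pv))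

IsConnected-mono : ∀ {c d G} → c ≤ d → IsConnected d G → IsConnected c G
IsConnected-mono {c} le ((L , u , l , p) , conn) = (take (suc c) L , unique-take (suc c) u , length-take≤ (suc c) {L} (≤-trans (s≤s le) (≤-reflexive (sym l))) ,
    tabulateAll (λ q → lookupAll p (take-⊆ (suc c) L q))) , λ X lt → conn X (≤-trans lt le)

-- The two cases combined.

module Assembly {k : ℕ} (𝓜 : Fin (suc k) → GraphMatroidFamily) (c : ℕ) (3≤c : 3 ≤ c)
  (wh : ∀ j G → IsConnected c G → Reconstructible (Ind (𝓜 j)) G) where
  open UnboundedCase 𝓜 c 3≤c wh
  ρ̂ : ℕ
  ρ̂ = suc k * (c * (c + c + (c + c)))
  C₁ : ℕ
  C₁ = threshold ρ̂
  module _ (G H : Graph) (ψ : Fin (m G) ⤖ Fin (m H)) (iso : IsMatroidIso (UnionInd 𝓜 G) (UnionInd 𝓜 H) (Bijection.to ψ)) (conn : IsConnected (2 + (C∪ + C₁)) G) where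
    open StarMap G H ψ
    conn∪ : IsConnected C∪ G
    conn∪ = IsConnected-mono {G = G} (≤-trans (m≤m+n C∪ C₁) (m≤n+m _ 2)) conn
    N : ℕ
    N = bound G + bound H
    bounded-case : (∀ j → ∃ λ ρ → ρ ≤ c * (c + c + (c + c)) × StarBounded (IF (𝓜 j)) N ρ) → StarsToStars
    bounded-case sb = StarRecognition.recognized G H ψ (UnionFamily.I∪ 𝓜) (star-bounded-∪ 𝓜 ρ (λ j → proj₂ (proj₂ (sb j)))) (m≤m+n _ _) (m≤n+m _ (bound G)) (iso-list G H ψ iso conn∪)
        (λ pv → ≤-trans (threshold-mono (≤-trans (∑F-mono (λ j → proj₁ (proj₂ (sb j)))) (≤-reflexive (∑F-const (suc k) _)))) (≤-trans (≤-trans (m≤n+m C₁ C∪) (m≤n+m _ 2)) (degree-≥ G conn pv)))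
      where ρ = λ j → proj₁ (sb j)
    cases : (∀ j → Dec (Unbounded (𝓜 j))) → ¬ ¬ StarsToStars
    cases unb? with anyF? unb?
    ... | yes (j , unb) = unbounded-case G H ψ iso conn∪ j unb
    ... | no none = dne-→ (dns-Fin (λ j → BoundedFamily.bounded-family (𝓜 j) 3≤c (wh j) (λ unb → none (j , unb)) N)) λ sb n → n (bounded-case sb)
    -- Both cases, and the distinction between them, are only available under double negation;
    -- decidability of `StarsToStars` removes it.
    stars : StarsToStars
    stars = decidable-stable starsToStars? (dne-→ (dns-Fin (λ j → lem (Unbounded (𝓜 j)))) cases)
    two : ∀ {v} → IsVertex G v → ∃ λ i → ∃ λ j → v ∈E edge G i × v ∈E edge G j × i ≢ j
    two {v} pv = let (i , j , p , q , n) = two-of (filter (incident? G v) (allFin (m G))) (unique-filter (incident? G v) (Uniqueₚ.allFin⁺ (m G)))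
                       (≤-trans (m≤m+n 2 _) (≤-trans (degree-≥ G conn pv) (≤-reflexive (sym (length-filter≡# (incident? G v) (allFin (m G)))))))
                 in i , j , proj₂ (filter-∈ (incident? G v) (allFin (m G)) p) , proj₂ (filter-∈ (incident? G v) (allFin (m G)) q) , n
    reconstruct : Σ (GraphIso G H) λ φ → Induced G H φ (Bijection.to ψ)
    reconstruct = graphIso stars two , induced stars two

  union-whitney : WhitneyProperty (UnionInd 𝓜)
  -- The 2 provides two edges at every vertex for `graphIso`, and the summands serve the two cases.
  union-whitney = 2 + (C∪ + C₁) , λ G conn H ψ iso → reconstruct G H ψ iso conn

theorem1p2 : (k : ℕ) (𝓜 : Fin (suc k) → GraphMatroidFamily) →
  (∀ j → WhitneyProperty (Ind (𝓜 j))) → WhitneyProperty (UnionInd 𝓜)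
-- The sum is a common constant for all families. The 3 provides a third vertex in `whitney-bip`
-- and, in `not-uniform`, two further edges at the end of an exchanged edge.
theorem1p2 k 𝓜 whitney = Assembly.union-whitney 𝓜 (3 + ∑F (proj₁ ∘ whitney)) (m≤m+n 3 _)
  λ j G conn → proj₂ (whitney j) G (IsConnected-mono {G = G} (≤-trans (∑F-∈ (proj₁ ∘ whitney) j) (m≤n+m _ 3)) conn)
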